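{- Let $k$ be a constant. Let $G=(B\uplus W,E)$ be a twin-free bipartite graph on $n$ vertices of bimodularwidth at most $k$, and let $T_G$ be its canonical bimodular decomposition tree. Given $G$ and $T_G$, a vertex-maximum biclique of $G$, an edge-maximum biclique of $G$, and a maximum balanced biclique of $G$ can be computed in $O(n^2)$ time.
   Context: $G=(B\uplus W,E)$ is a finite bipartite graph whose partition of the vertex set $V=B\cup W$ into black vertices $B$ and white vertices $W$ is given (induced subgraphs inherit the coloring); $n=|V|$. Running times are in the usual unit-cost RAM model. $G$ is twin-free if no two distinct vertices have the same neighborhood. Bicliques. A biclique of $G$ is a set $C\subseteq V$ such that every black vertex of $C$ is adjacent to every white vertex of $C$ (one of the two colors may be absent). A vertex-maximum biclique maximizes $|C\cap B|+|C\cap W|$; an edge-maximum biclique maximizes $|C\cap B|\cdot|C\cap W|$; a maximum balanced biclique is one of maximum cardinality among bicliques with $|C\cap B|=|C\cap W|$. Adjacency of sets. For disjoint $X,Y\subset V$: $X$ is nonadjacent to $Y$ if there is no edge between them; $X$ is fully adjacent to $Y$ if every black (resp. white) vertex of $X$ is adjacent to every white (resp. black) vertex of $Y$; $X$ is left adjacent to $Y$ if every black vertex of $X$ is adjacent to every white vertex of $Y$ and no white vertex of $X$ has a black neighbor in $Y$. Decompositions. Let $V$ be partitioned into nonempty $V_1,\dots,V_p$, $p\ge2$, and $G_i=G[V_i]$. If $V_i$ is nonadjacent (resp. fully adjacent) to $V_j$ for all $i\ne j$, with $p$ maximum for this property, then $G$ admits a Parallel (resp. Series) decomposition into $G_1,\dots,G_p$.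 If $V_i$ is left adjacent to $V_j$ for all $i<j$, with $p$ maximum for this property, then $G$ admits a K+S decomposition into $G_1,\dots,G_p$. If $G$ would admit both a K+S decomposition and a Parallel or Series one, then by convention it admits only the K+S decomposition. Prime decomposition. A bimodule of $G$ is a set $M\subseteq V$ such that each vertex $v$ of $V\setminus M$ is such that $\{v\}$ is nonadjacent or fully adjacent to $M$. It is trivial if it has at most one black and at most one white vertex; $V$ itself is also not counted among the nontrivial bimodules. If $G$ has at least two vertices and no Parallel, Series or K+S decomposition, it is known that two distinct inclusion-maximal nontrivial bimodules are either disjoint or share exactly one vertex, called an augmenting vertex. Removing the augmenting vertices (at most 2) from each maximal nontrivial bimodule gives pairwise disjoint sets; those that are nontrivial are the maximal canonical bimodules. The Prime decomposition of $G$ is the partition of $V$ into the maximal canonical bimodules and singletons (one for each remaining vertex). Canonical decomposition tree. Every twin-free bipartite graph with at least two vertices admits exactly one of the Parallel, Series, K+S or Prime decompositions (known theorem). The canonical bimodular decomposition tree $T_G$ has a root labeled by the decomposition that applies, whose children are the roots of the canonical trees of the subgraphs induced by the parts; one-vertex graphs are leaves. The bimodularwidth of $G$ is the largest number of children (counting leaves) of a Prime node of $T_G$, or $2$ if $T_G$ has no Prime node. -}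

module Defs where

open import Data.Bool.Base using (if_then_else_)
open import Data.Fin.Base using (Fin; toℕ)
open import Data.Fin.Subset
  using (Subset; Nonempty; Empty; ⁅_⁆; ∁; ⋃; ⊤; ∣_∣; _∈_; _∉_; _⊆_; _∩_)
open import Data.List.Base
  using (List; []; _∷_; _++_; _∷ʳ_; length; map; concatMap; allFin; foldr; head; drop)
open import Data.List.Membership.Propositional using () renaming (_∈_ to _∈ₗ_)
open import Data.List.Relation.Binary.Pointwise using (Pointwise)
open import Data.List.Relation.Unary.All using (All)
open import Data.List.Relation.Unary.AllPairs using (AllPairs)
open import Data.Maybe.Base using (Maybe; just; nothing)
open import Data.Nat.Base using (ℕ; zero; suc; _+_; _*_; _∸_; _^_; _≤_; _⊔_; _≡ᵇ_)
open import Data.Product.Base using (∃; ∃₂; _×_)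
open import Data.Sum.Base using (_⊎_)
open import Data.Vec.Base using (toList)
open import Function.Bundles using (_⇔_)
open import Function.Definitions using (Injective)
open import Relation.Binary.PropositionalEquality using (_≡_; _≢_)
open import Relation.Nullary.Negation.Core using (¬_)

------------------------------------------------------------------------
-- Bipartite graphs and bicliques

record BipartiteGraph (n : ℕ) : Set where
  field
    B : Subset n
    N : Fin n → Subset n

  W : Subset n
  W = ∁ B

  Adj : Fin n → Fin n → Set
  Adj u v = v ∈ N u

  field
    symmetric : ∀ {u v} → Adj u v → Adj v u
    bipartite : ∀ {u v} → Adj u v → (u ∈ B × v ∈ W) ⊎ (u ∈ W × v ∈ B)

module _ {n : ℕ} (G : BipartiteGraph n) where
  open BipartiteGraph G

  TwinFree : Set
  TwinFree = Injective _≡_ _≡_ N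

  Biclique : Subset n → Set
  Biclique C = ∀ {u v} → u ∈ C ∩ B → v ∈ C ∩ W → Adj u v

  IsVertexMaximumBiclique : Subset n → Set
  IsVertexMaximumBiclique C = Biclique C ×
    (∀ D → Biclique D → ∣ D ∩ B ∣ + ∣ D ∩ W ∣ ≤ ∣ C ∩ B ∣ + ∣ C ∩ W ∣)

  IsEdgeMaximumBiclique : Subset n → Set
  IsEdgeMaximumBiclique C = Biclique C ×
    (∀ D → Biclique D → ∣ D ∩ B ∣ * ∣ D ∩ W ∣ ≤ ∣ C ∩ B ∣ * ∣ C ∩ W ∣)

  BalancedBiclique : Subset n → Set
  BalancedBiclique C = Biclique C × ∣ C ∩ B ∣ ≡ ∣ C ∩ W ∣

  IsMaximumBalancedBiclique : Subset n → Set
  IsMaximumBalancedBiclique C = BalancedBiclique C ×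
    (∀ D → BalancedBiclique D → ∣ D ∣ ≤ ∣ C ∣)

------------------------------------------------------------------------
-- Decompositions
--
-- An induced subgraph G[S] is represented by its vertex set S, so every
-- notion below is relative to some S.

  Nonadjacent : Subset n → Subset n → Set
  Nonadjacent X Y = ∀ {u v} → u ∈ X → v ∈ Y → ¬ Adj u v

  FullyAdjacent : Subset n → Subset n → Set
  FullyAdjacent X Y = ∀ {u v} → u ∈ X → v ∈ Y →
    (u ∈ B → v ∈ W → Adj u v) × (u ∈ W → v ∈ B → Adj u v)

  LeftAdjacent : Subset n → Subset n → Set
  LeftAdjacent X Y = ∀ {u v} → u ∈ X → v ∈ Y →
    (u ∈ B → v ∈ W → Adj u v) × (u ∈ W → v ∈ B → ¬ Adj u v)

  record IsPartition (S : Subset n) (Vs : List (Subset n)) : Set where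
    field
      nonempty : All Nonempty Vs
      disjoint : AllPairs (λ X Y → Empty (X ∩ Y)) Vs
      covers   : ⋃ Vs ≡ S

  -- AllPairs relates Vᵢ to Vⱼ for i < j.  Nonadjacent and FullyAdjacent
  -- are symmetric, so for them this amounts to all i ≠ j.
  record Splits (R : Subset n → Subset n → Set)
                (S : Subset n) (Vs : List (Subset n)) : Set where
    field
      partition : IsPartition S Vs
      p≥2       : 2 ≤ length Vs
      related   : AllPairs R Vs

  Decomposition : (R : Subset n → Subset n → Set) →
                  Subset n → List (Subset n) → Set
  Decomposition R S Vs = Splits R S Vs ×
    (∀ Us → Splits R S Us → length Us ≤ length Vs)

  Admits : (R : Subset n → Subset n → Set) → Subset n → Set
  Admits R S = ∃ λ Vs → Decomposition R S Vs

------------------------------------------------------------------------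
-- Bimodules and the Prime decomposition

  record Bimodule (S M : Subset n) : Set where
    field
      subset      : M ⊆ S
      homogeneous : ∀ v → v ∈ S → v ∉ M →
                    Nonadjacent ⁅ v ⁆ M ⊎ FullyAdjacent ⁅ v ⁆ M

  Trivial : Subset n → Set
  Trivial M = ∣ M ∩ B ∣ ≤ 1 × ∣ M ∩ W ∣ ≤ 1

  NontrivialBimodule : Subset n → Subset n → Set
  NontrivialBimodule S M = Bimodule S M × ¬ Trivial M × M ≢ S

  MaximalNontrivialBimodule : Subset n → Subset n → Set
  MaximalNontrivialBimodule S M = NontrivialBimodule S M ×
    (∀ M′ → NontrivialBimodule S M′ → M ⊆ M′ → M′ ≡ M)

  Augmenting : Subset n → Fin n → Set
  Augmenting S v = ∃₂ λ M M′ →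
    MaximalNontrivialBimodule S M × MaximalNontrivialBimodule S M′ ×
    M ≢ M′ × v ∈ M × v ∈ M′

  MaximalCanonicalBimodule : Subset n → Subset n → Set
  MaximalCanonicalBimodule S P = ∃ λ M →
    MaximalNontrivialBimodule S M ×
    (∀ v → v ∈ P ⇔ (v ∈ M × ¬ Augmenting S v)) ×
    ¬ Trivial P

  RemainingSingleton : Subset n → Subset n → Set
  RemainingSingleton S P = ∃ λ v →
    v ∈ S × (∀ Q → MaximalCanonicalBimodule S Q → v ∉ Q) × P ≡ ⁅ v ⁆

  record PrimeDecomposition (S : Subset n) (Vs : List (Subset n)) : Set where
    field
      size≥2     : 2 ≤ ∣ S ∣
      ¬parallel  : ¬ Admits Nonadjacent S
      ¬series    : ¬ Admits FullyAdjacent S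
      ¬k+s       : ¬ Admits LeftAdjacent S
      partition  : IsPartition S Vs
      parts      : ∀ P → P ∈ₗ Vs ⇔
                   (MaximalCanonicalBimodule S P ⊎ RemainingSingleton S P)

------------------------------------------------------------------------
-- Canonical decomposition trees

data Label : Set where
  Parallel Series K+S Prime : Label

data Tree (n : ℕ) : Set where
  leaf : Fin n → Tree n
  node : Label → List (Tree n) → Tree n

module _ {n : ℕ} (G : BipartiteGraph n) where

  DecomposesInto : Label → Subset n → List (Subset n) → Set
  DecomposesInto Parallel S Vs =
    Decomposition G (Nonadjacent G) S Vs × ¬ Admits G (LeftAdjacent G) S
  DecomposesInto Series S Vs =
    Decomposition G (FullyAdjacent G) S Vs × ¬ Admits G (LeftAdjacent G) S
  DecomposesInto K+S S Vs = Decomposition G (LeftAdjacent G) S Vs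
  DecomposesInto Prime S Vs = PrimeDecomposition G S Vs

  data CanonicalTreeOf : Subset n → Tree n → Set where
    leaf : ∀ v → CanonicalTreeOf ⁅ v ⁆ (leaf v)
    node : ∀ {S ℓ Vs ts} → DecomposesInto ℓ S Vs →
           Pointwise CanonicalTreeOf Vs ts → CanonicalTreeOf S (node ℓ ts)

  CanonicalTree : Tree n → Set
  CanonicalTree = CanonicalTreeOf ⊤

module _ {n : ℕ} where

  mutual
    primeArities : Tree n → List ℕ
    primeArities (leaf _)        = []
    primeArities (node Prime ts) = length ts ∷ primeAritiesAll ts
    primeArities (node _     ts) = primeAritiesAll ts

    primeAritiesAll : List (Tree n) → List ℕ
    primeAritiesAll []       = []
    primeAritiesAll (t ∷ ts) = primeArities t ++ primeAritiesAll ts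

  bimodularwidth : Tree n → ℕ
  bimodularwidth t with primeArities t
  ... | []     = 2
  ... | a ∷ as = foldr _⊔_ a as

------------------------------------------------------------------------
-- Unit-cost random access machines
--
-- The instruction set is that of Cook and Reckhow, over ℕ with truncated
-- subtraction.  Multiplication is omitted on purpose: at unit cost on
-- unbounded numbers it would make the machine unreasonably strong.

data Instruction : Set where
  const : (i c : ℕ) → Instruction      -- Xᵢ ← c
  add   : (i j k : ℕ) → Instruction    -- Xᵢ ← Xⱼ + Xₖ
  sub   : (i j k : ℕ) → Instruction    -- Xᵢ ← Xⱼ ∸ Xₖ
  load  : (i j : ℕ) → Instruction      -- Xᵢ ← X at address Xⱼ
  store : (i j : ℕ) → Instruction      -- X at address Xᵢ ← Xⱼ
  jump  : (j m : ℕ) → Instruction      -- go to instruction m if Xⱼ > 0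
  read  : (i : ℕ) → Instruction        -- Xᵢ ← next input number
  print : (i : ℕ) → Instruction        -- append Xᵢ to the output

Program : Set
Program = List Instruction

record Config : Set where
  constructor config
  field
    pc     : ℕ
    memory : ℕ → ℕ
    input  : List ℕ
    output : List ℕ

_[_≔_] : (ℕ → ℕ) → ℕ → ℕ → (ℕ → ℕ)
(X [ a ≔ x ]) b = if a ≡ᵇ b then x else X b

execute : Instruction → Config → Config
execute (const i c) (config pc X is os) = config (suc pc) (X [ i ≔ c ]) is os
execute (add i j k) (config pc X is os) = config (suc pc) (X [ i ≔ X j + X k ]) is os
execute (sub i j k) (config pc X is os) = config (suc pc) (X [ i ≔ X j ∸ X k ]) is os
execute (load i j)  (config pc X is os) = config (suc pc) (X [ i ≔ X (X j) ]) is os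
execute (store i j) (config pc X is os) = config (suc pc) (X [ X i ≔ X j ]) is os
execute (jump j m)  (config pc X is os) with X j
... | zero  = config (suc pc) X is os
... | suc _ = config m X is os
execute (read i)    (config pc X [] os)       = config (suc pc) (X [ i ≔ 0 ]) [] os
execute (read i)    (config pc X (x ∷ is) os) = config (suc pc) (X [ i ≔ x ]) is os
execute (print i)   (config pc X is os) = config (suc pc) X is (os ∷ʳ X i)

fetch : Program → ℕ → Maybe Instruction
fetch P pc = head (drop pc P)

-- HaltsIn P s t os: started in s, P executes exactly t instructions, then
-- leaves the program text and stops with output os.
data HaltsIn (P : Program) : Config → ℕ → List ℕ → Set where
  stop : ∀ {s} → fetch P (Config.pc s) ≡ nothing →
         HaltsIn P s 0 (Config.output s)
  step : ∀ {s i t os} → fetch P (Config.pc s) ≡ just i →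
         HaltsIn P (execute i s) t os → HaltsIn P s (suc t) os

initial : List ℕ → Config
initial is = config 0 (λ _ → 0) is []

Computes_from_to_within_ : Program → List ℕ → List ℕ → ℕ → Set
Computes P from is to os within b = ∃ λ t → t ≤ b × HaltsIn P (initial is) t os

------------------------------------------------------------------------
-- Input and output formats

-- A set of vertices is written as its characteristic 0/1-sequence.
encodeSet : ∀ {n} → Subset n → List ℕ
encodeSet S = map (λ b → if b then 1 else 0) (toList S)

-- n, the colours (1 for black), and the rows of the adjacency matrix.
encodeGraph : ∀ {n} → BipartiteGraph n → List ℕ
encodeGraph {n} G = n ∷ encodeSet B ++ concatMap (λ v → encodeSet (N v)) (allFin n)
  where open BipartiteGraph G

encodeLabel : Label → ℕ
encodeLabel Parallel = 1
encodeLabel Series   = 2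
encodeLabel K+S      = 3
encodeLabel Prime    = 4

-- Preorder: 0 and the vertex for a leaf; the label, the number of children
-- and then the children for an inner node.
mutual
  encodeTree : ∀ {n} → Tree n → List ℕ
  encodeTree (leaf v)    = 0 ∷ toℕ v ∷ []
  encodeTree (node ℓ ts) = encodeLabel ℓ ∷ length ts ∷ encodeTrees ts

  encodeTrees : ∀ {n} → List (Tree n) → List ℕ
  encodeTrees []       = []
  encodeTrees (t ∷ ts) = encodeTree t ++ encodeTrees ts

------------------------------------------------------------------------
-- One program and one constant serve all n, G and T; only k is fixed
-- beforehand.  A canonical tree only exists for n ≥ 1, so no threshold on n
-- is needed in the O(n²) bound.

ComputableInQuadraticTime :
  ℕ → (∀ {n} → BipartiteGraph n → Subset n → Set) → Set
ComputableInQuadraticTime k Goal =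
  ∃₂ λ (P : Program) (c : ℕ) →
    ∀ {n} (G : BipartiteGraph n) (T : Tree n) →
    TwinFree G → CanonicalTree G T → bimodularwidth T ≤ k →
    ∃ λ C → Goal G C ×
      (Computes P from encodeGraph G ++ encodeTree T to encodeSet C within (c * n ^ 2))

{-# OPTIONS --safe #-}
module Submission where

-- Let the white vertex v weigh 2ⁿ + 2ᵛ and black vertices 0, so that the weight
-- of a set counts its white vertices in the high digits and lists them in the
-- low ones.  For every node S of the tree the program computes a table F: its
-- entry F b is the weight of some biclique of G[S] with at least b black
-- vertices, and at least the weight of every biclique with exactly b of them.
--
-- Let S be composed of parts that are pairwise all-or-nothing adjacent.  Once the
-- parts that may contain black vertices are chosen, the parts that may contain
-- white ones are determined, and F is the maximum, over all choices, of
-- (max,+)-convolutions of the tables of the parts.  The children of a Prime node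
-- are combined at once, in 2^O(k) choices; those of other nodes two at a time.
-- Convolving tables of parts of x and y vertices takes O(xy) steps, and since
-- x² + y² + 2xy = (x + y)² these costs add up to O(n²) over the whole tree.
--
-- No traceback is needed: the optimal weight contains the white vertices, and the
-- black ones are their common neighbours.
--
-- The program is written in a small language of bounded loops; its Hoare triples
-- speak directly about the compiled code and count loop iterations only.

open import Defs
open import Data.Bool.Base using (Bool; true; false; if_then_else_) renaming (T to IsTrue)
open import Data.Bool.Properties using () renaming (_≟_ to _≟ᵇ_)
open import Data.Empty using (⊥)
open import Data.Fin using (#_)
open import Data.Fin.Base using (Fin; zero; suc; toℕ; fromℕ<)
open import Data.Fin.Properties as Fin using (toℕ<n; toℕ-fromℕ<)
open import Data.Fin.Subset renaming (⊥ to ∅; ⊤ to ⊤ˢ)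
open import Data.Fin.Subset.Properties
open import Data.List.Base using (List; []; _∷_; length; map; drop; head; _∷ʳ_; foldr; concatMap; allFin)
  renaming (_++_ to _++ₗ_; tabulate to tabulateₗ)
open import Data.List.Membership.Propositional using () renaming (_∈_ to _∈ₗ_)
open import Data.List.Properties using (length-++; length-map; length-tabulate; map-∘)
  renaming (++-assoc to ++ₗ-assoc; ++-identityʳ to ++ₗ-identityʳ)
open import Data.List.Relation.Binary.Pointwise using (Pointwise; []; _∷_; Pointwise-length)
open import Data.List.Relation.Unary.All as All using (All; []; _∷_)
import Data.List.Relation.Unary.All.Properties as All
open import Data.List.Relation.Unary.AllPairs as AllPairs using (AllPairs; []; _∷_)
import Data.List.Relation.Unary.AllPairs.Properties as AllPairs
open import Data.List.Relation.Unary.Any using (here; there)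
open import Data.Maybe.Base using (just; nothing)
open import Data.Nat.Base
open import Data.Nat.Properties
open import Data.Nat.Tactic.RingSolver using (solve-∀)
open import Data.Product.Base using (∃; ∃₂; _×_; _,_; proj₁; proj₂)
open import Data.Sum.Base using (_⊎_; inj₁; inj₂; [_,_]′)
open import Data.Unit.Base using (⊤; tt)
open import Data.Vec.Base using (Vec; []; _∷_; _++_; lookup; toList; tabulate; here; there)
open import Data.Vec.Properties using (≡-dec; lookup∘tabulate; lookup⇒[]=; []=⇒lookup)
open import Function.Base using (_∘_; id)
open import Function.Bundles using (Equivalence)
open import Relation.Binary.Definitions using (tri<; tri≈; tri>)
open import Relation.Binary.PropositionalEquality hiding ([_])
open import Relation.Nullary using (¬_; Dec; yes; no; contradiction; decidable-stable)

-- A choice of parts can be tested on one black and one white vertex per part only if parts are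
-- homogeneous: no vertex outside a part tells apart two vertices of one colour in it. `Homogeneous`
-- speaks of all vertices of the graph, so that it is inherited from a set to its parts. The
-- obstacle is the Prime node. There a maximal bimodule loses its augmenting vertices, and a removed
-- vertex may distinguish what is left. Twin-freeness limits the damage: a canonical bimodule that
-- fails to be homogeneous is a pair of one colour. Every part of two vertices is therefore replaced
-- by its two vertices, which at most doubles the number of parts and explains the 2k in the
-- constants. Splitting requires that the two representatives of a two-vertex set are its two
-- vertices, whatever their colours; this is why representatives receive default values even when a
-- colour is missing. The machine cannot multiply, divide or shift. Powers of two are tabulated by
-- doubling, sets are decoded by comparing with these powers, and the number of white vertices in a
-- weight is found by repeated subtraction.

private variable
  Γ l m n : ℕ

-- A language of bounded loops and its compiler

Heap : Set
Heap = ℕ → ℕ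

record World : Set where
  constructor world
  field
    heap : Heap
    inp out : List ℕ
open World public

infixl 6 _⊕_ _⊖_
infix 7 !_

data Expr (Γ : ℕ) : Set where
  var     : Fin Γ → Expr Γ
  lit     : ℕ → Expr Γ
  _⊕_ _⊖_ : Expr Γ → Expr Γ → Expr Γ
  !_      : Expr Γ → Expr Γ

⟦_⟧ : Expr Γ → Vec ℕ Γ → Heap → ℕ
⟦ var x ⟧ ρ h = lookup ρ x
⟦ lit c ⟧ ρ h = c
⟦ e ⊕ f ⟧ ρ h = ⟦ e ⟧ ρ h + ⟦ f ⟧ ρ h
⟦ e ⊖ f ⟧ ρ h = ⟦ e ⟧ ρ h ∸ ⟦ f ⟧ ρ h
⟦ ! e ⟧ ρ h   = h (⟦ e ⟧ ρ h)

⟦_⟧* : Vec (Expr Γ) m → Vec ℕ Γ → Heap → Vec ℕ m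
⟦ [] ⟧* ρ h     = []
⟦ e ∷ es ⟧* ρ h = ⟦ e ⟧ ρ h ∷ ⟦ es ⟧* ρ h

-- A command of type Cmd Γ m works in an environment of Γ immutable variables
-- (de Bruijn indices) and returns m numbers.  The body of a loop sees its m
-- accumulators and, next to them, the number of iterations still to come.
data Cmd : ℕ → ℕ → Set where
  return : Vec (Expr Γ) m → Cmd Γ m
  bind   : Cmd Γ l → Cmd (l + Γ) m → Cmd Γ m
  poke   : Expr Γ → Expr Γ → Cmd Γ m → Cmd Γ m
  input  : Cmd (suc Γ) m → Cmd Γ m
  output : Expr Γ → Cmd Γ m → Cmd Γ m
  ifz    : Expr Γ → Cmd Γ m → Cmd Γ m → Cmd Γ m
  loop   : Expr Γ → Vec (Expr Γ) m → Cmd (m + suc Γ) m → Cmd Γ m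

-- Variables and temporaries live at even addresses, the heap at odd ones.
reg cell : ℕ → ℕ
reg i  = i + i
cell a = suc (a + a)

-- Registers are assigned by counting from the outer end of the environment, so a variable keeps its
-- register when further variables are bound.
level : Fin Γ → ℕ
level {suc Γ} zero    = Γ
level {suc Γ} (suc x) = level x

-- Registers from d on serve as a stack of temporaries, and the result is left in `reg d`. No
-- instruction copies a register, so a copy is an addition to 0. A heap address a becomes `cell a`
-- by doubling it and adding 1.
exprCode : ℕ → Expr Γ → List Instruction
exprCode d (var x) = const (reg d) 0 ∷ add (reg d) (reg d) (reg (level x)) ∷ []
exprCode d (lit c) = const (reg d) c ∷ []
exprCode d (e ⊕ f) = exprCode d e ++ₗ exprCode (suc d) f ++ₗ add (reg d) (reg d) (reg (suc d)) ∷ []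
exprCode d (e ⊖ f) = exprCode d e ++ₗ exprCode (suc d) f ++ₗ sub (reg d) (reg d) (reg (suc d)) ∷ []
exprCode d (! e)   = exprCode d e ++ₗ add (reg d) (reg d) (reg d) ∷ const (reg (suc d)) 1 ∷
                     add (reg d) (reg d) (reg (suc d)) ∷ load (reg d) (reg d) ∷ []

-- Starting with the last component leaves the first one in the highest register, which is how an
-- environment is laid out.
vecCode : ℕ → Vec (Expr Γ) m → List Instruction
vecCode d []                   = []
vecCode {m = suc m} d (e ∷ es) = vecCode d es ++ₗ exprCode (m + d) e

-- Slides m results down over the l variables that go out of scope. Copying the lowest register
-- first ensures that no source is overwritten before it has been read.
moveCode : (Γ l m : ℕ) → List Instruction
moveCode Γ zero    m       = []
moveCode Γ (suc l) zero    = []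
moveCode Γ (suc l) (suc m) = moveCode Γ (suc l) m ++ₗ
  const (reg (m + Γ)) 0 ∷ add (reg (m + Γ)) (reg (m + Γ)) (reg (m + (suc l + Γ))) ∷ []

pokeCode : Expr Γ → Expr Γ → List Instruction
pokeCode {Γ} e f = exprCode Γ e ++ₗ exprCode (suc Γ) f ++ₗ
  add (reg Γ) (reg Γ) (reg Γ) ∷ const (reg (suc (suc Γ))) 1 ∷
  add (reg Γ) (reg Γ) (reg (suc (suc Γ))) ∷ store (reg Γ) (reg (suc Γ)) ∷ []

-- Recursion on the code, instead of adding its length, advances in step with the indices of `At`.
end : ℕ → List Instruction → ℕ
end o []       = o
end o (_ ∷ cs) = end (suc o) cs

code : ℕ → Cmd Γ m → List Instruction
loopCode : ℕ → Cmd (m + suc Γ) m → List Instruction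

code {Γ} o (return es) = vecCode Γ es
code {Γ} {m} o (bind {l = l} c d) =
  code o c ++ₗ code (end o (code o c)) d ++ₗ moveCode Γ l m
code o (poke e f c) = pokeCode e f ++ₗ code (end o (pokeCode e f)) c
code {Γ} {m} o (input c) = read (reg Γ) ∷ code (suc o) c ++ₗ moveCode Γ 1 m
code {Γ} o (output e c) =
  exprCode Γ e ++ₗ print (reg Γ) ∷ code (suc (end o (exprCode Γ e))) c
code {Γ} {m} o (ifz e c d) = E ++ₗ jump (reg Γ) o₂ ∷ C ++ₗ
  const (reg (m + Γ)) 1 ∷ jump (reg (m + Γ)) (end o₂ D) ∷ D
  where
  E  = exprCode Γ e
  o₁ = suc (end o E)
  C  = code o₁ c
  -- Two places are reserved for setting a register to 1 and jumping on it, which together make an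
  -- unconditional jump over D.
  o₂ = suc (suc (end o₁ C))
  D  = code o₂ d
code {Γ} {m} o (loop e es c) = E ++ₗ V ++ₗ loopCode (end (end o E) V) c ++ₗ moveCode Γ 1 m
  where
  E = exprCode Γ e
  V = vecCode (suc Γ) es

loopCode {m} {Γ} o c =
  -- With truncated subtraction, 1 minus the counter is positive exactly when the counter is 0, and
  -- then the jump leaves the loop.
  const t 1 ∷ sub t t (reg Γ) ∷ jump t (2 + end (end (5 + o) C) M) ∷
  const t 1 ∷ sub (reg Γ) (reg Γ) t ∷
  C ++ₗ M ++ₗ const t 1 ∷ jump t o ∷ []
  where
  t = reg (m + suc Γ)
  C = code (5 + o) c
  M = moveCode (suc Γ) m m

iterationSize : Cmd (m + suc Γ) m → ℕ

-- A loop contributes its set-up and a single iteration. All other iterations are paid for by the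
-- factor `suc b` of `Runs`.
size : Cmd Γ m → ℕ
size {Γ} (return es)            = length (vecCode Γ es)
size {Γ} {m} (bind {l = l} c d) = size c + (size d + length (moveCode Γ l m))
size (poke e f c)               = length (pokeCode e f) + size c
size {Γ} {m} (input c)          = 1 + (size c + length (moveCode Γ 1 m))
size {Γ} (output e c)           = length (exprCode Γ e) + (1 + size c)
size {Γ} (ifz e c d)            = length (exprCode Γ e) + (1 + (size c + (2 + size d)))
size {Γ} {m} (loop e es c)      = length (exprCode Γ e) + (length (vecCode (suc Γ) es) +
  (3 + (length (moveCode Γ 1 m) + iterationSize c)))

iterationSize {m} {Γ} c = 5 + (size c + (length (moveCode (suc Γ) m m) + 2))

-- Memory updates, placement of code, sequences of machine steps

≡ᵇ-refl : ∀ a → (a ≡ᵇ a) ≡ true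
≡ᵇ-refl zero    = refl
≡ᵇ-refl (suc a) = ≡ᵇ-refl a

≢⇒≡ᵇ-false : ∀ {a b} → a ≢ b → (a ≡ᵇ b) ≡ false
≢⇒≡ᵇ-false {a} {b} a≢b with a ≡ᵇ b in eq
... | false = refl
... | true  = contradiction (≡ᵇ⇒≡ a b (subst IsTrue (sym eq) tt)) a≢b

update-same : ∀ X a x → (X [ a ≔ x ]) a ≡ x
update-same X a x rewrite ≡ᵇ-refl a = refl

update-other : ∀ X {a b} x → a ≢ b → (X [ a ≔ x ]) b ≡ X b
update-other X x a≢b rewrite ≢⇒≡ᵇ-false a≢b = refl

i+i-injective : ∀ {i j} → i + i ≡ j + j → i ≡ j
i+i-injective {zero}  {zero}  _  = refl
i+i-injective {suc i} {suc j} eq rewrite +-suc i i | +-suc j j =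
  cong suc (i+i-injective (suc-injective (suc-injective eq)))

reg≢cell : ∀ i a → reg i ≢ cell a
reg≢cell (suc i) zero    eq rewrite +-suc i i = contradiction eq λ ()
reg≢cell (suc i) (suc a) eq rewrite +-suc i i | +-suc a a =
  reg≢cell i a (suc-injective (suc-injective eq))

<⇒reg≢ : ∀ {i j} → i < j → reg j ≢ reg i
<⇒reg≢ i<j eq = <⇒≢ i<j (sym (i+i-injective eq))

data At (P : Program) : ℕ → List Instruction → Set where
  []  : ∀ {o} → At P o []
  _∷_ : ∀ {o i is} → fetch P o ≡ just i → At P (suc o) is → At P o (i ∷ is)

at-++ˡ : ∀ {P o} cs {ds} → At P o (cs ++ₗ ds) → At P o cs
at-++ˡ []       _        = []
at-++ˡ (c ∷ cs) (f ∷ at) = f ∷ at-++ˡ cs at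

at-++ʳ : ∀ {P o} cs {ds} → At P o (cs ++ₗ ds) → At P (end o cs) ds
at-++ʳ []       at       = at
at-++ʳ (c ∷ cs) (f ∷ at) = at-++ʳ cs at

end-++ : ∀ o cs ds → end o (cs ++ₗ ds) ≡ end (end o cs) ds
end-++ o []       ds = refl
end-++ o (c ∷ cs) ds = end-++ (suc o) cs ds

at-self : ∀ P → At P 0 P
at-self P = go 0 P refl
  where
  drop-suc : ∀ o (xs : Program) {y ys} → drop o xs ≡ y ∷ ys → drop (suc o) xs ≡ ys
  drop-suc zero    (x ∷ xs) refl = refl
  drop-suc (suc o) (x ∷ xs) eq   = drop-suc o xs eq
  go : ∀ o cs → drop o P ≡ cs → At P o cs
  go o []       eq = []
  go o (c ∷ cs) eq = cong head eq ∷ go (suc o) cs (drop-suc o P eq)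

fetch-end : ∀ P → fetch P (end 0 P) ≡ nothing
fetch-end P = cong head (trans (cong (λ o → drop o P) (lem 0 P)) (drop-all P))
  where
  lem : ∀ o cs → end o cs ≡ o + length cs
  lem o []       = sym (+-identityʳ o)
  lem o (c ∷ cs) = trans (lem (suc o) cs) (sym (+-suc o (length cs)))
  drop-all : ∀ (cs : Program) → drop (length cs) cs ≡ []
  drop-all []       = refl
  drop-all (c ∷ cs) = drop-all cs

data Steps (P : Program) : ℕ → Config → Config → Set where
  done : ∀ {s} → Steps P 0 s s
  step : ∀ {s s′ i t} → fetch P (Config.pc s) ≡ just i →
         Steps P t (execute i s) s′ → Steps P (suc t) s s′

stepTo : ∀ {P s s₁ s′ i t} → fetch P (Config.pc s) ≡ just i → execute i s ≡ s₁ →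
         Steps P t s₁ s′ → Steps P (suc t) s s′
stepTo f refl σ = step f σ

steps-trans : ∀ {P a b s s′ s″} → Steps P a s s′ → Steps P b s′ s″ → Steps P (a + b) s s″
steps-trans done        q = q
steps-trans (step f p) q = step f (steps-trans p q)

steps-halt : ∀ {P t s s′} → Steps P t s s′ → fetch P (Config.pc s′) ≡ nothing →
             HaltsIn P s t (Config.output s′)
steps-halt done       f = stop f
steps-halt (step g p) f = step g (steps-halt p f)

record Reach (P : Program) (b : ℕ) (s s′ : Config) : Set where
  constructor reach
  field
    {time} : ℕ
    time≤  : time ≤ b
    steps  : Steps P time s s′

infixr 5 _⨾_
_⨾_ : ∀ {P a b s s′ s″} → Reach P a s s′ → Reach P b s′ s″ → Reach P (a + b) s s″
reach p σ ⨾ reach q τ = reach (+-mono-≤ p q) (steps-trans σ τ)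

weakenReach : ∀ {P a b s s′} → a ≤ b → Reach P a s s′ → Reach P b s s′
weakenReach a≤b (reach p σ) = reach (≤-trans p a≤b) σ

exactly : ∀ {P t s s′} → Steps P t s s′ → Reach P t s s′
exactly = reach ≤-refl

jump-taken : ∀ {j o X is os} → X j ≢ 0 → ∀ pc →
  execute (jump j o) (config pc X is os) ≡ config o X is os
jump-taken {j} {X = X} X≢0 pc with X j
... | zero  = contradiction refl X≢0
... | suc _ = refl

jump-passed : ∀ {j o X is os} → X j ≡ 0 → ∀ pc →
  execute (jump j o) (config pc X is os) ≡ config (suc pc) X is os
jump-passed {j} {X = X} X≡0 pc with X j
... | zero  = refl

-- Representation of environments and heaps; correctness of expressions and moves

RepEnv : Vec ℕ Γ → (ℕ → ℕ) → Set
RepEnv []              X = ⊤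
RepEnv {suc Γ} (x ∷ ρ) X = X (reg Γ) ≡ x × RepEnv ρ X

RepHeap : Heap → (ℕ → ℕ) → Set
RepHeap h X = ∀ a → X (cell a) ≡ h a

record Agree (d : ℕ) (X X′ : ℕ → ℕ) : Set where
  constructor agree
  field
    sameRegs  : ∀ {i} → i < d → X′ (reg i) ≡ X (reg i)
    sameCells : ∀ a → X′ (cell a) ≡ X (cell a)
open Agree

agree-refl : ∀ {d X} → Agree d X X
agree-refl = agree (λ _ → refl) (λ _ → refl)

agree-trans : ∀ {d X Y Z} → Agree d X Y → Agree d Y Z → Agree d X Z
agree-trans p q = agree (λ i<d → trans (sameRegs q i<d) (sameRegs p i<d))
                        (λ a → trans (sameCells q a) (sameCells p a))

agree-≤ : ∀ {d e X Y} → d ≤ e → Agree e X Y → Agree d X Y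
agree-≤ d≤e p = agree (λ i<d → sameRegs p (<-≤-trans i<d d≤e)) (sameCells p)

agree-set : ∀ {d e} X x → d ≤ e → Agree d X (X [ reg e ≔ x ])
agree-set {e = e} X x d≤e = agree (λ i<d → update-other X x (<⇒reg≢ (<-≤-trans i<d d≤e)))
                                  (λ a → update-other X x (reg≢cell e a))

agree-env : ∀ {d X Y} (ρ : Vec ℕ Γ) → Γ ≤ d → Agree d X Y → RepEnv ρ X → RepEnv ρ Y
agree-env []      _   _ _       = tt
agree-env (x ∷ ρ) Γ≤d p (q , r) = trans (sameRegs p Γ≤d) q , agree-env ρ (<⇒≤ Γ≤d) p r

agree-heap : ∀ {d X Y h} → Agree d X Y → RepHeap h X → RepHeap h Y
agree-heap p r a = trans (sameCells p a) (r a)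

level-< : (x : Fin Γ) → level x < Γ
level-< {suc Γ} zero    = ≤-refl
level-< {suc Γ} (suc x) = m<n⇒m<1+n (level-< x)

lookup-rep : ∀ (ρ : Vec ℕ Γ) {X} → RepEnv ρ X → ∀ x → X (reg (level x)) ≡ lookup ρ x
lookup-rep (x ∷ ρ) (p , r) zero    = p
lookup-rep (x ∷ ρ) (p , r) (suc y) = lookup-rep ρ r y

record ExprRun (P : Program) (cs : List Instruction) (o d x : ℕ) (X : ℕ → ℕ) (is os : List ℕ) : Set where
  constructor exprRun
  field
    {X′}   : ℕ → ℕ
    run    : Reach P (length cs) (config o X is os) (config (end o cs) X′ is os)
    result : X′ (reg d) ≡ x
    frame  : Agree d X X′

length-++-snoc : ∀ (as bs : List Instruction) → length (as ++ₗ bs) ≡ length as + length bs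
length-++-snoc []       bs = refl
length-++-snoc (a ∷ as) bs = cong suc (length-++-snoc as bs)

seq : ∀ {P o as bs X Y is os s} → Reach P (length as) (config o X is os) (config (end o as) Y is os) →
      Reach P (length bs) (config (end o as) Y is os) (config (end (end o as) bs) s is os) →
      Reach P (length (as ++ₗ bs)) (config o X is os) (config (end o (as ++ₗ bs)) s is os)
seq {o = o} {as} {bs} p q rewrite length-++-snoc as bs | end-++ o as bs = p ⨾ q

execExpr : ∀ {P o d X h is os} {ρ : Vec ℕ Γ} (e : Expr Γ) → At P o (exprCode d e) → Γ ≤ d →
           RepEnv ρ X → RepHeap h X → ExprRun P (exprCode d e) o d (⟦ e ⟧ ρ h) X is os
execExpr {d = d} {X} {ρ = ρ} (var x) (f ∷ g ∷ []) Γ≤d r k = exprRun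
  (exactly (step f (step g done)))
  (trans (update-same (X [ reg d ≔ 0 ]) (reg d) _)
    (cong₂ _+_ (update-same X (reg d) 0)
      (trans (update-other X 0 (<⇒reg≢ (<-≤-trans (level-< x) Γ≤d))) (lookup-rep ρ r x))))
  (agree-trans (agree-set X _ ≤-refl) (agree-set _ _ ≤-refl))
execExpr {d = d} {X} (lit c) (f ∷ []) Γ≤d r k = exprRun
  (exactly (step f done)) (update-same X (reg d) c) (agree-set X _ ≤-refl)
execExpr {d = d} {ρ = ρ} (e ⊕ e′) at Γ≤d r k
  with exprRun {X₁} run₁ res₁ fr₁ ← execExpr {d = d} {ρ = ρ} e (at-++ˡ (exprCode d e) at) Γ≤d r k
  with at′ ← at-++ʳ (exprCode d e) at
  with exprRun {X₂} run₂ res₂ fr₂ ← execExpr {d = suc d} {ρ = ρ} e′ (at-++ˡ (exprCode (suc d) e′) at′)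
         (m≤n⇒m≤1+n Γ≤d) (agree-env ρ Γ≤d fr₁ r) (agree-heap fr₁ k)
  with f ∷ [] ← at-++ʳ (exprCode (suc d) e′) at′
  = exprRun (seq {as = exprCode d e} run₁ (seq {as = exprCode (suc d) e′} run₂ (exactly (step f done))))
      (trans (update-same X₂ (reg d) _) (cong₂ _+_ (trans (sameRegs fr₂ ≤-refl) res₁) res₂))
      (agree-trans fr₁ (agree-trans (agree-≤ (n≤1+n d) fr₂) (agree-set X₂ _ ≤-refl)))
execExpr {d = d} {ρ = ρ} (e ⊖ e′) at Γ≤d r k
  with exprRun {X₁} run₁ res₁ fr₁ ← execExpr {d = d} {ρ = ρ} e (at-++ˡ (exprCode d e) at) Γ≤d r k
  with at′ ← at-++ʳ (exprCode d e) at
  with exprRun {X₂} run₂ res₂ fr₂ ← execExpr {d = suc d} {ρ = ρ} e′ (at-++ˡ (exprCode (suc d) e′) at′)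
         (m≤n⇒m≤1+n Γ≤d) (agree-env ρ Γ≤d fr₁ r) (agree-heap fr₁ k)
  with f ∷ [] ← at-++ʳ (exprCode (suc d) e′) at′
  = exprRun (seq {as = exprCode d e} run₁ (seq {as = exprCode (suc d) e′} run₂ (exactly (step f done))))
      (trans (update-same X₂ (reg d) _) (cong₂ _∸_ (trans (sameRegs fr₂ ≤-refl) res₁) res₂))
      (agree-trans fr₁ (agree-trans (agree-≤ (n≤1+n d) fr₂) (agree-set X₂ _ ≤-refl)))
execExpr {d = d} {h = h} {ρ = ρ} (! e) at Γ≤d r k
  with exprRun {X₁} run₁ res₁ fr₁ ← execExpr {d = d} {ρ = ρ} e (at-++ˡ (exprCode d e) at) Γ≤d r k
  with f₁ ∷ f₂ ∷ f₃ ∷ f₄ ∷ [] ← at-++ʳ (exprCode d e) at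
  = exprRun (seq {as = exprCode d e} run₁ (exactly (step f₁ (step f₂ (step f₃ (step f₄ done))))))
      (trans (update-same X₄ (reg d) _)
        (trans (cong X₄ (trans (update-same X₃ (reg d) _) addr))
          (trans (sameCells fr₄ a) (trans (sameCells fr₁ a) (k a)))))
      (agree-trans fr₁ (agree-trans fr₄ (agree-set X₄ _ ≤-refl)))
  where
  a = ⟦ e ⟧ ρ h
  X₂ = X₁ [ reg d ≔ X₁ (reg d) + X₁ (reg d) ]
  X₃ = X₂ [ reg (suc d) ≔ 1 ]
  X₄ = X₃ [ reg d ≔ X₃ (reg d) + X₃ (reg (suc d)) ]
  fr₄ : Agree d X₁ X₄
  fr₄ = agree-trans (agree-set X₁ _ ≤-refl)
          (agree-trans (agree-set X₂ _ (n≤1+n d)) (agree-set X₃ _ ≤-refl))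
  addr : X₃ (reg d) + X₃ (reg (suc d)) ≡ cell a
  addr = trans (cong₂ _+_
           (trans (update-other X₂ 1 (<⇒reg≢ (n<1+n d)))
             (trans (update-same X₁ (reg d) _) (cong₂ _+_ res₁ res₁)))
           (update-same X₂ (reg (suc d)) 1))
         (+-comm (a + a) 1)

RepAt : ℕ → Vec ℕ m → (ℕ → ℕ) → Set
RepAt d []                   X = ⊤
RepAt {m = suc m} d (x ∷ xs) X = X (reg (m + d)) ≡ x × RepAt d xs X

rep-++ : ∀ (xs : Vec ℕ m) {ρ : Vec ℕ Γ} {X} → RepAt Γ xs X → RepEnv ρ X → RepEnv (xs ++ ρ) X
rep-++ []       _       r = r
rep-++ (x ∷ xs) (p , q) r = p , rep-++ xs q r

agree-at : ∀ {d X Y} (xs : Vec ℕ m) → Agree (m + d) X Y → RepAt d xs X → RepAt d xs Y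
agree-at []                   _ _       = tt
agree-at {m = suc m} (x ∷ xs) p (q , r) = trans (sameRegs p ≤-refl) q , agree-at xs (agree-≤ (n≤1+n _) p) r

execVec : ∀ {P o d X h is os} {ρ : Vec ℕ Γ} (es : Vec (Expr Γ) m) → At P o (vecCode d es) → Γ ≤ d →
          RepEnv ρ X → RepHeap h X → ∃ λ X′ →
          Reach P (length (vecCode d es)) (config o X is os) (config (end o (vecCode d es)) X′ is os) ×
          RepAt d (⟦ es ⟧* ρ h) X′ × Agree d X X′
execVec {X = X} [] at Γ≤d r k = X , exactly done , tt , agree-refl
execVec {m = suc m} {d = d} {h = h} {ρ = ρ} (e ∷ es) at Γ≤d r k
  with X₁ , run₁ , res₁ , fr₁ ← execVec {ρ = ρ} es (at-++ˡ (vecCode d es) at) Γ≤d r k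
  with exprRun {X₂} run₂ res₂ fr₂ ← execExpr {d = m + d} {ρ = ρ} e (at-++ʳ (vecCode d es) at)
         (≤-trans Γ≤d (m≤n+m d m)) (agree-env ρ Γ≤d fr₁ r) (agree-heap fr₁ k)
  = X₂ , seq {as = vecCode d es} run₁ run₂ , (res₂ , agree-at (⟦ es ⟧* ρ h) fr₂ res₁) ,
    agree-trans fr₁ (agree-≤ (m≤n+m d m) fr₂)

record Moved (P : Program) (cs : List Instruction) (o k : ℕ) (ρ : Vec ℕ Γ) (X : ℕ → ℕ) (is os : List ℕ) : Set where
  constructor moved
  field
    {X′}  : ℕ → ℕ
    run   : Reach P (length cs) (config o X is os) (config (end o cs) X′ is os)
    env   : RepEnv ρ X′
    -- Registers from k on include the sources of the copies still to come, so they must be known to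
    -- be intact.
    high  : ∀ {i} → k ≤ i → X′ (reg i) ≡ X (reg i)
    sameCells : ∀ a → X′ (cell a) ≡ X (cell a)

rep-tail : ∀ (xs : Vec ℕ m) {ρ : Vec ℕ Γ} {X} → RepEnv (xs ++ ρ) X → RepEnv ρ X
rep-tail []       r       = r
rep-tail (x ∷ xs) (_ , r) = rep-tail xs r

execMove : ∀ {P o X is os} (ys : Vec ℕ m) (xs : Vec ℕ l) (ρ : Vec ℕ Γ) → At P o (moveCode Γ l m) →
           RepEnv (ys ++ (xs ++ ρ)) X → Moved P (moveCode Γ l m) o (m + Γ) (ys ++ ρ) X is os
execMove {l = zero}  ys [] ρ at r = moved (exactly done) r (λ _ → refl) (λ _ → refl)
execMove {l = suc l} [] xs ρ at r = moved (exactly done) (rep-tail xs r) (λ _ → refl) (λ _ → refl)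
execMove {m = suc m} {l = suc l} {Γ = Γ} {X = X} (y ∷ ys) xs ρ at (q , r)
  with moved {X₁} run₁ env₁ high₁ cells₁ ← execMove ys xs ρ (at-++ˡ (moveCode Γ (suc l) m) at) r
  with f ∷ g ∷ [] ← at-++ʳ (moveCode Γ (suc l) m) at
  = moved (seq {as = moveCode Γ (suc l) m} run₁ (exactly (step f (step g done))))
      ( trans (update-same X₂ (reg (m + Γ)) _)
          (cong₂ _+_ (update-same X₁ (reg (m + Γ)) 0)
            (trans (update-other X₁ 0 (<⇒reg≢′ lt)) (trans (high₁ (<⇒≤ lt)) q)))
      , agree-env (ys ++ ρ) ≤-refl fr env₁ )
      (λ k≤i → trans (update-other X₂ _ (<⇒reg≢′ k≤i))
                 (trans (update-other X₁ _ (<⇒reg≢′ k≤i)) (high₁ (<⇒≤ k≤i))))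
      (λ a → trans (sameCells fr a) (cells₁ a))
  where
  open Agree
  X₂ = X₁ [ reg (m + Γ) ≔ 0 ]
  fr = agree-trans (agree-set X₁ 0 ≤-refl) (agree-set X₂ (X₂ (reg (m + Γ)) + X₂ (reg (m + (suc l + Γ)))) ≤-refl)
  <⇒reg≢′ : ∀ {i j} → i < j → reg i ≢ reg j
  <⇒reg≢′ i<j eq = <⇒reg≢ i<j (sym eq)
  lt : m + Γ < m + (suc l + Γ)
  lt = +-monoʳ-< m (s≤s (m≤n+m Γ l))

heap-moved : ∀ X Y {h} → (∀ a → Y (cell a) ≡ X (cell a)) → RepHeap h X → RepHeap h Y
heap-moved X Y p r a = trans (p a) (r a)

-- Hoare triples

Post : ℕ → Set₁
Post m = Vec ℕ m → World → Set

-- The function `env` says how the results are embedded in the final environment: a finished loop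
-- still has its counter, now 0, between them and ρ.
record Outcome (P : Program) (b o e : ℕ) (X : ℕ → ℕ) (w : World) (k : ℕ) (ρ : Vec ℕ Γ)
               (env : Vec ℕ m → Vec ℕ k) (Q : Post m) : Set where
  constructor outcome
  field
    {X′}    : ℕ → ℕ
    {xs}    : Vec ℕ m
    {w′}    : World
    post    : Q xs w′
    run     : Reach P b (config o X (inp w) (out w)) (config e X′ (inp w′) (out w′))
    repEnv  : RepEnv (env xs) X′
    repHeap : RepHeap (heap w′) X′

-- Runs c ρ w b Q: started in ρ and w, the compiled c ends in a state
-- satisfying Q after at most size c * suc b instructions; b bounds the number
-- of loop iterations.
record Runs (c : Cmd Γ m) (ρ : Vec ℕ Γ) (w : World) (b : ℕ) (Q : Post m) : Set where
  constructor runs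
  field
    exec : ∀ {P o X} → At P o (code o c) → RepEnv ρ X → RepHeap (heap w) X →
           Outcome P (size c * suc b) o (end o (code o c)) X w (m + Γ) ρ (_++ ρ) Q
open Runs

-- Here b counts, for every remaining iteration, the iteration itself and those of the loops inside
-- it. The constant 3 pays for the final, failing test.
record LoopRuns (c : Cmd (m + suc Γ) m) (ρ : Vec ℕ Γ) (i : ℕ) (acc : Vec ℕ m) (w : World) (b : ℕ)
                (Q : Post m) : Set where
  constructor loopRuns
  field
    exec : ∀ {P o X} → At P o (loopCode o c) → RepEnv (acc ++ i ∷ ρ) X → RepHeap (heap w) X →
           Outcome P (3 + iterationSize c * b) o (end o (loopCode o c)) X w (m + suc Γ) ρ
                   (λ xs → xs ++ 0 ∷ ρ) Q

private
  ≤-suc* : ∀ s b → s ≤ s * suc b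
  ≤-suc* s b = m≤m*n s (suc b)

  bind-bound : ∀ s t v a b → s * suc a + (t * suc b + v) ≤ (s + (t + v)) * suc (a + b)
  bind-bound s t v a b rewrite *-distribʳ-+ (suc (a + b)) s (t + v) | *-distribʳ-+ (suc (a + b)) t v =
    +-mono-≤ (*-monoʳ-≤ s (s≤s (m≤m+n a b)))
      (+-mono-≤ (*-monoʳ-≤ t (s≤s (m≤n+m b a))) (≤-suc* v (a + b)))

  plus-bound : ∀ s t b → s + t * suc b ≤ (s + t) * suc b
  plus-bound s t b rewrite *-distribʳ-+ (suc b) s t = +-monoˡ-≤ _ (≤-suc* s b)

runs-weaken : ∀ {c : Cmd Γ m} {ρ w a b} {Q R : Post m} → a ≤ b → (∀ xs w′ → Q xs w′ → R xs w′) →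
              Runs c ρ w a Q → Runs c ρ w b R
runs-weaken {c = c} a≤b imp (runs ex) = runs λ at r k → let open Outcome (ex at r k) in
  outcome (imp _ _ post) (weakenReach (*-monoʳ-≤ (size c) (s≤s a≤b)) run) repEnv repHeap

runs-return : ∀ {ρ : Vec ℕ Γ} {w} {es : Vec (Expr Γ) m} {Q : Post m} →
              Q (⟦ es ⟧* ρ (heap w)) w → Runs (return es) ρ w 0 Q
runs-return {Γ} {ρ = ρ} {w} {es} q = runs λ at r k →
  let X′ , run , res , fr = execVec {ρ = ρ} es at ≤-refl r k in
  outcome q (weakenReach (≤-suc* _ 0) run)
    (rep-++ (⟦ es ⟧* ρ (heap w)) res (agree-env ρ ≤-refl fr r)) (agree-heap fr k)

runs-bind : ∀ {c : Cmd Γ l} {d : Cmd (l + Γ) m} {ρ w a b} {R : Post l} {Q : Post m} →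
            Runs c ρ w a R → (∀ xs w′ → R xs w′ → Runs d (xs ++ ρ) w′ b Q) →
            Runs (bind c d) ρ w (a + b) Q
runs-bind {Γ} {l} {m} {c} {d} {ρ} {w} {a} {b} p q = runs go
  where
  go : ∀ {P o X} → At P o (code o (bind c d)) → RepEnv ρ X → RepHeap (heap w) X →
       Outcome P (size (bind c d) * suc (a + b)) o (end o (code o (bind c d))) X w (m + Γ) ρ (_++ ρ) _
  go {o = o} at r k
    with outcome {xs = xs} post₁ run₁ r₁ k₁ ← exec p (at-++ˡ (code o c) at) r k
    with at′ ← at-++ʳ (code o c) at
    with outcome {X₂} {ys} post₂ run₂ r₂ k₂ ← exec (q _ _ post₁) (at-++ˡ (code (end o (code o c)) d) at′) r₁ k₁
    with moved {X₃} run₃ r₃ _ cells₃ ← execMove ys xs ρ (at-++ʳ (code (end o (code o c)) d) at′) r₂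
    rewrite end-++ o (code o c) (code (end o (code o c)) d ++ₗ moveCode Γ l m)
          | end-++ (end o (code o c)) (code (end o (code o c)) d) (moveCode Γ l m)
    = outcome post₂
        (weakenReach (bind-bound (size c) (size d) _ a b) (run₁ ⨾ run₂ ⨾ run₃)) r₃ (heap-moved X₂ X₃ cells₃ k₂)

runs-poke : ∀ {e f : Expr Γ} {c : Cmd Γ m} {ρ w b} {Q : Post m} →
            Runs c ρ (world (heap w [ ⟦ e ⟧ ρ (heap w) ≔ ⟦ f ⟧ ρ (heap w) ]) (inp w) (out w)) b Q →
            Runs (poke e f c) ρ w b Q
runs-poke {Γ} {m} {e} {f} {c} {ρ} {w} {b} {Q} p = runs go
  where
  h = heap w
  x = ⟦ e ⟧ ρ h
  y = ⟦ f ⟧ ρ h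
  go : ∀ {P o X} → At P o (code o (poke e f c)) → RepEnv ρ X → RepHeap h X →
       Outcome P (size (poke e f c) * suc b) o (end o (code o (poke e f c))) X w (m + Γ) ρ (_++ ρ) Q
  go {P} {o} {X} at r k
    with at₀ ← at-++ˡ (pokeCode e f) at
    with exprRun {X₁} run₁ res₁ fr₁ ← execExpr {ρ = ρ} e (at-++ˡ (exprCode Γ e) at₀) ≤-refl r k
    with at′ ← at-++ʳ (exprCode Γ e) at₀
    with exprRun {X₂} run₂ res₂ fr₂ ← execExpr {ρ = ρ} f (at-++ˡ (exprCode (suc Γ) f) at′) (n≤1+n Γ)
           (agree-env ρ ≤-refl fr₁ r) (agree-heap fr₁ k)
    with f₁ ∷ f₂ ∷ f₃ ∷ f₄ ∷ [] ← at-++ʳ (exprCode (suc Γ) f) at′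
    = result
    where
    X₃ = X₂ [ reg Γ ≔ X₂ (reg Γ) + X₂ (reg Γ) ]
    X₄ = X₃ [ reg (2 + Γ) ≔ 1 ]
    X₅ = X₄ [ reg Γ ≔ X₄ (reg Γ) + X₄ (reg (2 + Γ)) ]
    X₆ = X₅ [ X₅ (reg Γ) ≔ X₅ (reg (suc Γ)) ]
    fr₅ : Agree Γ X X₅
    fr₅ = agree-trans fr₁ (agree-trans (agree-≤ (n≤1+n Γ) fr₂)
            (agree-trans (agree-set X₂ _ ≤-refl)
              (agree-trans (agree-set X₃ _ (m≤n+m Γ 2)) (agree-set X₄ _ ≤-refl))))
    ≢reg : ∀ {i j} → i < j → reg i ≢ reg j
    ≢reg i<j eq = <⇒reg≢ i<j (sym eq)
    at-x : X₅ (reg Γ) ≡ cell x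
    at-x = trans (update-same X₄ (reg Γ) _) (trans (cong₂ _+_
             (trans (update-other X₃ 1 (<⇒reg≢ (m<n⇒m<1+n (n<1+n Γ))))
               (trans (update-same X₂ (reg Γ) _)
                 (cong₂ _+_ (trans (sameRegs fr₂ ≤-refl) res₁) (trans (sameRegs fr₂ ≤-refl) res₁))))
             (update-same X₃ (reg (2 + Γ)) 1)) (+-comm (x + x) 1))
    at-y : X₅ (reg (suc Γ)) ≡ y
    at-y = trans (update-other X₄ _ (≢reg (n<1+n Γ)))
             (trans (update-other X₃ 1 (<⇒reg≢ (n<1+n (suc Γ))))
               (trans (update-other X₂ _ (≢reg (n<1+n Γ))) res₂))
    X₆-reg : ∀ i → X₆ (reg i) ≡ X₅ (reg i)
    X₆-reg i = update-other X₅ _ (λ eq → reg≢cell i x (trans (sym eq) at-x))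
    cell-inj : ∀ i j → cell i ≡ cell j → i ≡ j
    cell-inj i j eq = i+i-injective (suc-injective eq)
    k₆ : RepHeap (h [ x ≔ y ]) X₆
    k₆ a with x ≟ a
    ... | yes refl = trans (cong (λ z → (X₅ [ z ≔ X₅ (reg (suc Γ)) ]) (cell x)) at-x)
                       (trans (update-same X₅ (cell x) _) (trans at-y (sym (update-same h x y))))
    ... | no x≢a = trans (update-other X₅ _ (λ eq → x≢a (cell-inj x a (trans (sym at-x) eq))))
                     (trans (Agree.sameCells fr₅ a) (trans (k a) (sym (update-other h y x≢a))))
    r₆ : RepEnv ρ X₆
    r₆ = agree-env′ ρ (λ i → X₆-reg i) (agree-env ρ ≤-refl fr₅ r)
      where
      agree-env′ : ∀ {Δ} (ρ : Vec ℕ Δ) {X Y} → (∀ i → Y (reg i) ≡ X (reg i)) → RepEnv ρ X → RepEnv ρ Y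
      agree-env′ []      q _       = tt
      agree-env′ {suc Δ} (x ∷ ρ) q (a , b) = trans (q Δ) a , agree-env′ ρ q b
    result : Outcome P (size (poke e f c) * suc b) o (end o (code o (poke e f c))) X w (m + Γ) ρ (_++ ρ) Q
    result with outcome post₂ run₃ r₃ k₃ ← exec p (at-++ʳ (pokeCode e f) at) r₆ k₆
      rewrite end-++ o (pokeCode e f) (code (end o (pokeCode e f)) c)
      = outcome post₂ (weakenReach (plus-bound (length (pokeCode e f)) (size c) b)
          (seq {as = exprCode Γ e} run₁ (seq {as = exprCode (suc Γ) f} run₂
            (exactly (step f₁ (step f₂ (step f₃ (step f₄ done)))))) ⨾ run₃)) r₃ k₃

runs-input : ∀ {c : Cmd (suc Γ) m} {ρ h x is os b} {Q : Post m} →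
             Runs c (x ∷ ρ) (world h is os) b Q → Runs (input c) ρ (world h (x ∷ is) os) b Q
runs-input {Γ} {m} {c} {ρ} {h} {x} {is} {os} {b} {Q} p = runs go
  where
  go : ∀ {P o X} → At P o (code o (input c)) → RepEnv ρ X → RepHeap h X →
       Outcome P (size (input c) * suc b) o (end o (code o (input c))) X (world h (x ∷ is) os)
         (m + Γ) ρ (_++ ρ) Q
  go {o = o} {X} (f ∷ at) r k
    with outcome {X₂} {ys} post₂ run₂ r₂ k₂ ← exec p (at-++ˡ (code (suc o) c) at)
           (update-same X (reg Γ) x , agree-env ρ ≤-refl (agree-set X x ≤-refl) r)
           (agree-heap {d = Γ} (agree-set X x ≤-refl) k)
    with moved {X₃} run₃ r₃ _ cells₃ ← execMove ys (x ∷ []) ρ (at-++ʳ (code (suc o) c) at) r₂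
    rewrite end-++ (suc o) (code (suc o) c) (moveCode Γ 1 m)
    = outcome post₂ (weakenReach (bind-bound 1 (size c) (length (moveCode Γ 1 m)) 0 b)
        (exactly (step f done) ⨾ run₂ ⨾ run₃)) r₃ (heap-moved X₂ X₃ cells₃ k₂)

runs-output : ∀ {e : Expr Γ} {c : Cmd Γ m} {ρ w b} {Q : Post m} →
              Runs c ρ (world (heap w) (inp w) (out w ∷ʳ ⟦ e ⟧ ρ (heap w))) b Q →
              Runs (output e c) ρ w b Q
runs-output {Γ} {m} {e} {c} {ρ} {w} {b} {Q} p = runs go
  where
  E = exprCode Γ e
  go : ∀ {P o X} → At P o (code o (output e c)) → RepEnv ρ X → RepHeap (heap w) X →
       Outcome P (size (output e c) * suc b) o (end o (code o (output e c))) X w (m + Γ) ρ (_++ ρ) Q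
  go {P} {o = o} at r k
    with exprRun {X₁} run₁ res₁ fr₁ ← execExpr {ρ = ρ} e (at-++ˡ E at) ≤-refl r k
    with f ∷ at′ ← at-++ʳ E at
    with outcome post₂ run₂ r₂ k₂ ← exec p at′ (agree-env ρ ≤-refl fr₁ r) (agree-heap fr₁ k)
    rewrite end-++ o E (print (reg Γ) ∷ code (suc (end o E)) c)
    = outcome post₂ (weakenReach
        (≤-trans (+-monoʳ-≤ (length E) (plus-bound 1 (size c) b)) (plus-bound (length E) (1 + size c) b))
        (run₁ ⨾ exactly (step f done)
          ⨾ subst (λ y → Reach P _ (config _ X₁ _ (out w ∷ʳ y)) _) (sym res₁) run₂)) r₂ k₂

runs-ifz : ∀ {e : Expr Γ} {c d : Cmd Γ m} {ρ w b} {Q : Post m} →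
           (⟦ e ⟧ ρ (heap w) ≡ 0 → Runs d ρ w b Q) → (⟦ e ⟧ ρ (heap w) ≢ 0 → Runs c ρ w b Q) →
           Runs (ifz e d c) ρ w b Q
runs-ifz {Γ} {m} {e} {c} {d} {ρ} {w} {b} {Q} p q = runs go
  where
  E = exprCode Γ e
  s = size c
  t = size d
  go : ∀ {P o X} → At P o (code o (ifz e d c)) → RepEnv ρ X → RepHeap (heap w) X →
       Outcome P (size (ifz e d c) * suc b) o (end o (code o (ifz e d c))) X w (m + Γ) ρ (_++ ρ) Q
  go {P} {o} {X} at r k
    with exprRun {X₁} run₁ res₁ fr₁ ← execExpr {ρ = ρ} e (at-++ˡ E at) ≤-refl r k
    with f ∷ at₁ ← at-++ʳ E at
    with g₁ ∷ g₂ ∷ at₂ ← at-++ʳ (code (suc (end o E)) d) at₁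
    = split (⟦ e ⟧ ρ (heap w) ≟ 0)
    where
    r₁ = agree-env ρ ≤-refl fr₁ r
    k₁ = agree-heap fr₁ k
    C = code (suc (end o E)) d
    o₂ = 2 + end (suc (end o E)) C
    D = code o₂ c
    u = reg (m + Γ)
    rest = const u 1 ∷ jump u (end o₂ D) ∷ D
    exit : end o (code o (ifz e d c)) ≡ end o₂ D
    exit = trans (end-++ o E _) (end-++ (suc (end o E)) C rest)
    split : _ → Outcome P (size (ifz e d c) * suc b) o (end o (code o (ifz e d c))) X w (m + Γ) ρ (_++ ρ) Q
    split (yes z)
      with outcome {X₂} {ys} post₂ run₂ r₂ k₂ ← exec (p z) (at-++ˡ C at₁) r₁ k₁
      rewrite exit
      = outcome {X′ = X₂ [ u ≔ 1 ]} post₂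
          (weakenReach (≤-trans (+-monoʳ-≤ (length E) (≤-trans (+-monoʳ-≤ 1
              (≤-trans (≤-trans (≤-reflexive (+-comm (t * suc b) 2))
                (plus-bound 2 t b)) (*-monoˡ-≤ (suc b) (≤-trans (≤-reflexive (+-comm 2 t)) (+-monoʳ-≤ t (m≤m+n 2 s))))))
              (plus-bound 1 (t + (2 + s)) b))) (plus-bound (length E) (1 + (t + (2 + s))) b))
            (run₁ ⨾ exactly (stepTo f (jump-passed (trans res₁ z) _) done)
             ⨾ run₂ ⨾ exactly (step g₁ (stepTo g₂
               (jump-taken {X = X₂ [ u ≔ 1 ]}
                  (λ eq → contradiction (trans (sym (update-same X₂ u 1)) eq) λ ()) _) done))))
          (agree-env (ys ++ ρ) ≤-refl (agree-set X₂ 1 ≤-refl) r₂)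
          (agree-heap {d = m + Γ} (agree-set X₂ 1 ≤-refl) k₂)
    split (no nz)
      with outcome {X₂} {ys} post₂ run₂ r₂ k₂ ← exec (q nz) at₂ r₁ k₁
      rewrite exit
      = outcome post₂
          (weakenReach (≤-trans (+-monoʳ-≤ (length E) (≤-trans (+-monoʳ-≤ 1
              (*-monoˡ-≤ (suc b) (≤-trans (m≤n+m s (t + 2)) (≤-reflexive (+-assoc t 2 s)))))
              (plus-bound 1 (t + (2 + s)) b))) (plus-bound (length E) (1 + (t + (2 + s))) b))
            (run₁ ⨾ exactly (stepTo f
               (jump-taken (λ eq → nz (trans (sym res₁) eq)) _) done) ⨾ run₂)) r₂ k₂

loopRuns-zero : ∀ {c : Cmd (m + suc Γ) m} {ρ : Vec ℕ Γ} {acc w} {Q : Post m} → Q acc w → LoopRuns c ρ 0 acc w 0 Q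
loopRuns-zero {m} {Γ} {c} {ρ} {acc} {w} {Q} q = loopRuns go
  where
  t = reg (m + suc Γ)
  go : ∀ {P o X} → At P o (loopCode o c) → RepEnv (acc ++ 0 ∷ ρ) X → RepHeap (heap w) X →
       Outcome P (3 + iterationSize c * 0) o (end o (loopCode o c)) X w (m + suc Γ) ρ (λ xs → xs ++ 0 ∷ ρ) Q
  go {P} {o} {X} (f₁ ∷ f₂ ∷ f₃ ∷ at) r k
    rewrite end-++ (5 + o) (code (5 + o) c) (moveCode (suc Γ) m m ++ₗ const t 1 ∷ jump t o ∷ [])
          | end-++ (end (5 + o) (code (5 + o) c)) (moveCode (suc Γ) m m) (const t 1 ∷ jump t o ∷ [])
    = outcome q (weakenReach (m≤m+n 3 _) (exactly (step f₁ (step f₂ (stepTo f₃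
        (jump-taken {X = X₂} (λ eq → contradiction (trans (sym nonzero) eq) λ ()) _) done)))))
        (agree-env (acc ++ 0 ∷ ρ) ≤-refl fr r) (agree-heap fr k)
    where
    X₁ = X [ t ≔ 1 ]
    X₂ = X₁ [ t ≔ X₁ t ∸ X₁ (reg Γ) ]
    fr : Agree (m + suc Γ) X X₂
    fr = agree-trans (agree-set X 1 ≤-refl) (agree-set X₁ _ ≤-refl)
    nonzero : X₂ t ≡ 1
    nonzero = trans (update-same X₁ t _) (cong₂ _∸_ (update-same X t 1)
      (trans (update-other X 1 (<⇒reg≢ (m≤n+m (suc Γ) m))) (proj₁ (rep-tail acc r))))

loopRuns-suc : ∀ {c : Cmd (m + suc Γ) m} {ρ : Vec ℕ Γ} {i acc w a b} {R Q : Post m} →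
               Runs c (acc ++ i ∷ ρ) w a R → (∀ xs w′ → R xs w′ → LoopRuns c ρ i xs w′ b Q) →
               LoopRuns c ρ (suc i) acc w (suc (a + b)) Q
loopRuns-suc {m} {Γ} {c} {ρ} {i} {acc} {w} {a} {b} {R} {Q} p q = loopRuns go
  where
  t = reg (m + suc Γ)
  M = moveCode (suc Γ) m m
  v = length M
  go : ∀ {P o X} → At P o (loopCode o c) → RepEnv (acc ++ suc i ∷ ρ) X → RepHeap (heap w) X →
       Outcome P (3 + iterationSize c * suc (a + b)) o (end o (loopCode o c)) X w (m + suc Γ) ρ (λ xs → xs ++ 0 ∷ ρ) Q
  go {P} {o} {X} at@(f₁ ∷ f₂ ∷ f₃ ∷ f₄ ∷ f₅ ∷ at₀) r k = result
    where
    C = code (5 + o) c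
    X₁ = X [ t ≔ 1 ]
    X₂ = X₁ [ t ≔ X₁ t ∸ X₁ (reg Γ) ]
    X₃ = X₂ [ t ≔ 1 ]
    X₄ = X₃ [ reg Γ ≔ X₃ (reg Γ) ∸ X₃ t ]
    Γ<t : Γ < m + suc Γ
    Γ<t = m≤n+m (suc Γ) m
    counter : X (reg Γ) ≡ suc i
    counter = proj₁ (rep-tail acc r)
    fr₃ : Agree (m + suc Γ) X X₃
    fr₃ = agree-trans (agree-set X 1 ≤-refl) (agree-trans (agree-set X₁ _ ≤-refl) (agree-set X₂ 1 ≤-refl))
    iszero : X₂ t ≡ 0
    iszero = trans (update-same X₁ t _) (trans (cong₂ _∸_ (update-same X t 1)
      (trans (update-other X 1 (<⇒reg≢ Γ<t)) counter)) (0∸n≡0 i))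
    x₄ : ℕ
    x₄ = X₃ (reg Γ) ∸ X₃ t
    r₄ : RepEnv (acc ++ i ∷ ρ) X₄
    r₄ = rep-++ acc (keep acc (rep-at acc r₃))
           ( trans (update-same X₃ (reg Γ) _) (cong₂ _∸_ (trans (sameRegs fr₃ Γ<t) counter) (update-same X₂ t 1))
           , agree-env ρ ≤-refl (agree-set X₃ x₄ ≤-refl) (proj₂ (rep-tail acc r₃)))
      where
      r₃ : RepEnv (acc ++ suc i ∷ ρ) X₃
      r₃ = agree-env (acc ++ suc i ∷ ρ) ≤-refl fr₃ r
      rep-at : ∀ {l Δ Y} (xs : Vec ℕ l) {σ : Vec ℕ Δ} → RepEnv (xs ++ σ) Y → RepAt Δ xs Y
      rep-at []       _       = tt
      rep-at (x ∷ xs) (a , b) = a , rep-at xs b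
      keep : ∀ {l} (xs : Vec ℕ l) → RepAt (suc Γ) xs X₃ → RepAt (suc Γ) xs X₄
      keep []       _       = tt
      keep {suc l} (x ∷ xs) (a , b) =
        trans (update-other X₃ x₄ (λ eq → <⇒reg≢ (m≤n+m (suc Γ) l) (sym eq))) a , keep xs b
    k₄ : RepHeap (heap w) X₄
    k₄ = agree-heap {d = Γ} (agree-set X₃ x₄ ≤-refl) (agree-heap fr₃ k)
    result : Outcome P (3 + iterationSize c * suc (a + b)) o (end o (loopCode o c)) X w (m + suc Γ) ρ
               (λ xs → xs ++ 0 ∷ ρ) Q
    result
      with outcome {X₅} {ys} post₅ run₅ r₅ k₅ ← exec p (at-++ˡ C at₀) r₄ k₄
      with at₁ ← at-++ʳ C at₀
      with moved {X₆} run₆ r₆ _ cells₆ ← execMove ys acc (i ∷ ρ) (at-++ˡ M at₁) r₅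
      with g₁ ∷ g₂ ∷ [] ← at-++ʳ M at₁
      with outcome post₇ run₇ r₇ k₇ ← LoopRuns.exec (q _ _ post₅) at
             (agree-env (ys ++ i ∷ ρ) ≤-refl (agree-set X₆ 1 ≤-refl) r₆)
             (agree-heap {d = m + suc Γ} (agree-set X₆ 1 ≤-refl) (heap-moved X₅ X₆ cells₆ k₅))
      = outcome post₇ (weakenReach bound
          (exactly (step f₁ (step f₂ (stepTo f₃
             (jump-passed {X = X₂} iszero _) (step f₄ (step f₅ done)))))
           ⨾ run₅ ⨾ run₆ ⨾ exactly (step g₁ (stepTo g₂
             (jump-taken {X = X₆ [ t ≔ 1 ]}
                (λ eq → contradiction (trans (sym (update-same X₆ t 1)) eq) λ ()) _) done)) ⨾ run₇))
          r₇ k₇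
      where
      open ≤-Reasoning
      K = iterationSize c
      bound : 5 + (size c * suc a + (v + (2 + (3 + K * b)))) ≤ 3 + K * suc (a + b)
      bound = begin
        5 + (size c * suc a + (v + (2 + (3 + K * b))))
          ≡⟨ rearrange (size c) a v (K * b) ⟩
        3 + ((5 + (size c * suc a + (v + 2))) + K * b)
          ≤⟨ +-monoʳ-≤ 3 (+-monoˡ-≤ (K * b) (≤-trans (+-monoʳ-≤ 5 (plus-bound′ (size c) (v + 2)))
               (plus-bound 5 (size c + (v + 2)) a))) ⟩
        3 + (K * suc a + K * b) ≡⟨ cong (3 +_) (*-distribˡ-+ K (suc a) b) ⟨
        3 + K * suc (a + b) ∎
        where
        rearrange : ∀ x y z w → 5 + (x * suc y + (z + (2 + (3 + w)))) ≡ 3 + ((5 + (x * suc y + (z + 2))) + w)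
        rearrange = solve-∀
        plus-bound′ : ∀ s t → s * suc a + t ≤ (s + t) * suc a
        plus-bound′ s t rewrite *-distribʳ-+ (suc a) s t = +-monoʳ-≤ _ (≤-suc* t a)

loopRuns-weaken : ∀ {c : Cmd (m + suc Γ) m} {ρ : Vec ℕ Γ} {i acc w a b} {Q R : Post m} →
                  a ≤ b → (∀ xs w′ → Q xs w′ → R xs w′) → LoopRuns c ρ i acc w a Q → LoopRuns c ρ i acc w b R
loopRuns-weaken {c = c} a≤b imp (loopRuns ex) = loopRuns λ at r k → let open Outcome (ex at r k) in
  outcome (imp _ _ post) (weakenReach (+-monoʳ-≤ 3 (*-monoʳ-≤ (iterationSize c) a≤b)) run) repEnv repHeap

runs-loop : ∀ {e : Expr Γ} {es : Vec (Expr Γ) m} {c : Cmd (m + suc Γ) m} {ρ w b} {Q : Post m} →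
            LoopRuns c ρ (⟦ e ⟧ ρ (heap w)) (⟦ es ⟧* ρ (heap w)) w b Q → Runs (loop e es c) ρ w b Q
runs-loop {Γ} {m} {e} {es} {c} {ρ} {w} {b} {Q} p = runs go
  where
  E = exprCode Γ e
  V = vecCode (suc Γ) es
  M = moveCode Γ 1 m
  K = iterationSize c
  open ≤-Reasoning
  bound : length E + (length V + (3 + K * b + length M)) ≤ size (loop e es c) * suc b
  bound = begin
    length E + (length V + (3 + K * b + length M))
      ≡⟨ cong (λ z → length E + (length V + z)) (+-assoc 3 (K * b) (length M)) ⟩
    length E + (length V + (3 + (K * b + length M)))
      ≤⟨ +-monoʳ-≤ (length E) (+-monoʳ-≤ (length V) (+-monoʳ-≤ 3
           (≤-trans (≤-reflexive (+-comm (K * b) (length M)))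
             (≤-trans (+-monoʳ-≤ (length M) (*-monoʳ-≤ K (n≤1+n b))) (plus-bound (length M) K b))))) ⟩
    length E + (length V + (3 + ((length M + K) * suc b)))
      ≤⟨ +-monoʳ-≤ (length E) (+-monoʳ-≤ (length V) (plus-bound 3 (length M + K) b)) ⟩
    length E + (length V + ((3 + (length M + K)) * suc b))
      ≤⟨ +-monoʳ-≤ (length E) (plus-bound (length V) (3 + (length M + K)) b) ⟩
    length E + (length V + (3 + (length M + K))) * suc b
      ≤⟨ plus-bound (length E) _ b ⟩
    size (loop e es c) * suc b ∎
  go : ∀ {P o X} → At P o (code o (loop e es c)) → RepEnv ρ X → RepHeap (heap w) X →
       Outcome P (size (loop e es c) * suc b) o (end o (code o (loop e es c))) X w (m + Γ) ρ (_++ ρ) Q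
  go {P} {o} {X} at r k
    with exprRun {X₁} run₁ res₁ fr₁ ← execExpr {ρ = ρ} e (at-++ˡ E at) ≤-refl r k
    with at₁ ← at-++ʳ E at
    with X₂ , run₂ , res₂ , fr₂ ← execVec {ρ = ρ} es (at-++ˡ V at₁) (n≤1+n Γ)
           (agree-env ρ ≤-refl fr₁ r) (agree-heap fr₁ k)
    with at₂ ← at-++ʳ V at₁
    with outcome {X₃} {ys} post₃ run₃ r₃ k₃ ← LoopRuns.exec p (at-++ˡ (loopCode _ c) at₂)
           (rep-++ (⟦ es ⟧* ρ (heap w)) res₂ (trans (sameRegs fr₂ ≤-refl) res₁ ,
              agree-env ρ (n≤1+n Γ) fr₂ (agree-env ρ ≤-refl fr₁ r)))
           (agree-heap fr₂ (agree-heap fr₁ k))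
    with moved {X₄} run₄ r₄ _ cells₄ ← execMove ys (0 ∷ []) ρ (at-++ʳ (loopCode (end (end o E) V) c) at₂) r₃
    rewrite end-++ o E (V ++ₗ loopCode (end (end o E) V) c ++ₗ M)
          | end-++ (end o E) V (loopCode (end (end o E) V) c ++ₗ M)
          | end-++ (end (end o E) V) (loopCode (end (end o E) V) c) M
    = outcome post₃ (weakenReach bound (run₁ ⨾ run₂ ⨾ run₃ ⨾ run₄)) r₄ (heap-moved X₃ X₄ cells₄ k₃)

-- The index of the invariant is the number of iterations still to come: all loops count downwards
-- and end with `Inv 0`.
loopRuns-inv : ∀ {c : Cmd (m + suc Γ) m} {ρ : Vec ℕ Γ} {b} (Inv : ℕ → Post m) →
               (∀ i acc w → Inv (suc i) acc w → Runs c (acc ++ i ∷ ρ) w b (Inv i)) →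
               ∀ i acc w → Inv i acc w → LoopRuns c ρ i acc w (i * suc b) (Inv 0)
loopRuns-inv Inv p zero    acc w q = loopRuns-zero q
loopRuns-inv Inv p (suc i) acc w q = loopRuns-suc (p i acc w q) (loopRuns-inv Inv p i)

runs-loop-inv : ∀ {e : Expr Γ} {es : Vec (Expr Γ) m} {c : Cmd (m + suc Γ) m} {ρ w b} (Inv : ℕ → Post m) →
                Inv (⟦ e ⟧ ρ (heap w)) (⟦ es ⟧* ρ (heap w)) w →
                (∀ i acc w → Inv (suc i) acc w → Runs c (acc ++ i ∷ ρ) w b (Inv i)) →
                Runs (loop e es c) ρ w (⟦ e ⟧ ρ (heap w) * suc b) (Inv 0)
runs-loop-inv Inv q p = runs-loop (loopRuns-inv Inv p _ _ _ q)

runs-computes : ∀ {c : Cmd 0 0} {is b} {Q : List ℕ → Set} →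
                Runs c [] (world (λ _ → 0) is []) b (λ _ w → Q (out w)) →
                ∃ λ os → Q os × Computes code 0 c from is to os within (size c * suc b)
runs-computes {c} {is} {b} p
  with outcome {w′ = w} post₁ (reach t≤ σ) _ _ ← exec p (at-self (code 0 c)) tt (λ _ → refl)
  = out w , post₁ , _ , t≤ , steps-halt σ (fetch-end (code 0 c))

-- The program that computes the tables

v0 : Expr (1 + Γ)
v0 = var (# 0)
v1 : Expr (2 + Γ)
v1 = var (# 1)
v2 : Expr (3 + Γ)
v2 = var (# 2)
v3 : Expr (4 + Γ)
v3 = var (# 3)
v4 : Expr (5 + Γ)
v4 = var (# 4)
v5 : Expr (6 + Γ)
v5 = var (# 5)
v6 : Expr (7 + Γ)
v6 = var (# 6)
v7 : Expr (8 + Γ)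
v7 = var (# 7)
v8 : Expr (9 + Γ)
v8 = var (# 8)
v9 : Expr (10 + Γ)
v9 = var (# 9)
v11 : Expr (12 + Γ)
v11 = var (# 11)

-- Record v starts at address 16 + 16 v and has the fields
--   0 size, 1 number of blacks, 2 black representative, 3 white representative,
--   4 address of the table, 5 and 6 the table of a single vertex,
--   7 the power 2^v, 8 the address of row v of the adjacency matrix.
-- The first five fields make it the item of the one-vertex set {v}.
record# : ℕ → ℕ
record# v = 16 + (v8x + v8x)
  where
  v2x = v + v
  v4x = v2x + v2x
  v8x = v4x + v4x

recordOf : Expr Γ → Expr Γ
recordOf v = lit 16 ⊕ (v8x ⊕ v8x)
  where
  v2x = v ⊕ v
  v4x = v2x ⊕ v2x
  v8x = v4x ⊕ v4x

field′ : ℕ → Expr Γ → Expr Γ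
field′ k p = ! (p ⊕ lit k)

powerOf : Expr Γ → Expr Γ
powerOf i = field′ 7 (recordOf i)

edge : Expr Γ → Expr Γ → Expr Γ
edge u v = ! (field′ 8 (recordOf u) ⊕ v)

max : Expr Γ → Expr Γ → Expr Γ
max e f = e ⊕ (f ⊖ e)

call : ∀ {k l} → Vec (Expr Γ) k → Cmd (k + Γ) l → Cmd Γ l
call es c = bind (return es) c

-- The comment above a command lists its environment, v0 first.

-- acc, its last index, table, its last index, conflicts, H
convolve : Cmd (6 + Γ) 0
convolve = loop (v1 ⊕ lit 1) [] (loop (v4 ⊕ lit 1) []
  -- A part with conflicts must give up its white vertices: it still contributes black ones, but no
  -- weight.
  (ifz v6 (poke target (max (! target) (! (v2 ⊕ v1) ⊕ ! (v4 ⊕ v0))) (return []))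
          (poke target (max (! target) (! (v2 ⊕ v1))) (return []))))
  where
  target : Expr (8 + Γ)
  target = v7 ⊕ (v1 ⊕ v0)

-- j parts flags q
forbidden : Cmd (4 + Γ) 1
forbidden = loop v3 (lit 0 ∷ []) (return
  ((v0 ⊕ ((! (v4 ⊕ v1) ⊖ (lit 1 ⊖ ((v1 ⊖ v2) ⊕ (v2 ⊖ v1)))) ⊖
     edge (field′ 2 (! (v3 ⊕ v1))) (field′ 3 (! (v3 ⊕ v2))))) ∷ []))

-- acc, its last index, H, j, parts, flags, q
evaluatePart : Cmd (7 + Γ) 3
evaluatePart =
  bind (call (v3 ∷ v4 ∷ v5 ∷ v6 ∷ []) forbidden) (
  bind (ifz (! (v6 ⊕ v4)) (return (lit 0 ∷ [])) (return (field′ 1 (! (v5 ⊕ v4)) ∷ []))) (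
  bind (call (v2 ∷ v3 ∷ field′ 4 (! (v6 ⊕ v5)) ∷ v0 ∷ v1 ∷ v4 ∷ []) convolve) (
  return (v4 ∷ (v3 ⊕ v0) ∷ (v4 ⊕ ((v3 ⊕ v0) ⊕ lit 1)) ∷ []))))

-- parts flags q H
evaluate : Cmd (4 + Γ) 3
evaluate = loop v2 (v3 ∷ lit 0 ∷ (v3 ⊕ lit 1) ∷ []) evaluatePart

-- mask q flags
bits : Cmd (3 + Γ) 1
bits = loop v1 (v0 ∷ []) (ifz (powerOf v1 ⊖ v0)
  (poke (v4 ⊕ v1) (lit 1) (return ((v0 ⊖ powerOf v1) ∷ [])))
  (poke (v4 ⊕ v1) (lit 0) (return (v0 ∷ []))))

-- best, b, acc, its last index, H
maximum : Cmd (5 + Γ) 0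
maximum = loop (v1 ⊕ lit 1) [] (ifz (v0 ⊖ v4)
  (poke (v5 ⊕ v0) (max (! (v1 ⊕ v0)) (! (v3 ⊕ v0))) (return []))
  (poke (v5 ⊕ v0) (! (v1 ⊕ v0)) (return [])))

-- mask best H b parts q
tryMask : Cmd (6 + Γ) 2
tryMask =
  bind (call (v0 ∷ v5 ∷ v2 ∷ []) bits) (
  bind (call (v5 ∷ v3 ∷ v6 ∷ (v3 ⊕ v6) ∷ []) evaluate) (
  bind (call (v5 ∷ v7 ∷ v0 ∷ v1 ∷ v2 ∷ []) maximum) (
  return (v2 ∷ (v2 ⊕ (v7 ⊕ lit 1)) ∷ []))))

-- q stack i a stack parts
expandTwo expandOne expandPart : Cmd (6 + Γ) 2
expandTwo =
  poke (v5 ⊕ v0) (recordOf (field′ 2 (! v1))) (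
  poke (v5 ⊕ (v0 ⊕ lit 1)) (recordOf (field′ 3 (! v1))) (
  return ((v0 ⊕ lit 2) ∷ field′ 1 v1 ∷ [])))
expandOne = poke (v5 ⊕ v0) (! v1) (return ((v0 ⊕ lit 1) ∷ field′ 1 v1 ∷ []))
expandPart = ifz ((! (! v1) ⊖ lit 2) ⊕ (lit 2 ⊖ ! (! v1))) expandTwo expandOne

-- a stack parts
expand : Cmd (3 + Γ) 2
expand = loop v0 (lit 0 ∷ v1 ∷ []) expandPart

-- size b repB repW j parts q
statisticsPart : Cmd (7 + Γ) 4
statisticsPart =
  bind (ifz (field′ 1 (! (v5 ⊕ v4))) (return (v2 ∷ [])) (return (field′ 2 (! (v5 ⊕ v4)) ∷ []))) (
  bind (ifz (! (field′ 4 (! (v6 ⊕ v5)))) (return (v4 ∷ [])) (return (field′ 3 (! (v6 ⊕ v5)) ∷ []))) (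
  return ((v2 ⊕ ! (! (v7 ⊕ v6))) ∷ (v3 ⊕ field′ 1 (! (v7 ⊕ v6))) ∷ v1 ∷ v0 ∷ [])))

-- parts q
statistics : Cmd (2 + Γ) 4
statistics = loop v1
  -- The representatives of the last part serve as defaults and are replaced only by parts that
  -- contain the colour in question.
  (lit 0 ∷ lit 0 ∷ field′ 2 (! (v0 ⊕ (v1 ⊖ lit 1))) ∷ field′ 3 (! (v0 ⊕ (v1 ⊖ lit 1))) ∷ [])
  statisticsPart

-- size b repB repW q stack a _ H
combineMasks : Cmd (9 + Γ) 2
combineMasks =
  -- The cells below this address hold the pointers to the parts, at most two per child. The initial
  -- best table is untouched memory and thus all zero.
  bind (loop (powerOf v4) ((v8 ⊕ (v6 ⊕ v6)) ∷ ((v8 ⊕ (v6 ⊕ v6)) ⊕ (v1 ⊕ lit 1)) ∷ [])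
          (call (v2 ∷ v0 ∷ v1 ∷ v4 ∷ v11 ∷ v7 ∷ []) tryMask)) (
  poke v1 v2 (
  poke (v1 ⊕ lit 1) v3 (
  poke (v1 ⊕ lit 2) v4 (
  poke (v1 ⊕ lit 3) v5 (
  poke (v1 ⊕ lit 4) v0 (
  poke (v1 ⊕ lit 5) v1 (
  poke (v1 ⊕ lit 6) v7 (
  return ((v1 ⊕ lit 5) ∷ (v1 ⊕ lit 7) ∷ [])))))))))

-- a stack H
combine : Cmd (3 + Γ) 2
combine =
  bind (call (v0 ∷ v1 ∷ v2 ∷ []) expand) (
  bind (call (v4 ∷ v0 ∷ []) statistics)
  combineMasks)

-- stack H
mergeTwo : Cmd (2 + Γ) 2
mergeTwo = call (lit 2 ∷ v0 ∷ v1 ∷ []) combine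

-- Tokens form a linked list, the last one first.
-- token stack H
processToken : Cmd (3 + Γ) 3
processToken =
  ifz (! v0)
    (poke v2 (recordOf (field′ 1 v0)) (
     poke (v2 ⊕ lit 1) v1 (
     return (field′ 2 v0 ∷ v2 ∷ (v2 ⊕ lit 2) ∷ []))))
    -- Labels 1, 2 and 3 are those of Parallel, Series and K+S nodes, 4 that of a Prime node.
    (ifz (! v0 ⊖ lit 3)
      (bind (loop (field′ 1 v0 ⊖ lit 1) (v1 ∷ v2 ∷ []) mergeTwo)
        (return (field′ 2 v2 ∷ v0 ∷ v1 ∷ [])))
      (bind (call (field′ 1 v0 ∷ v1 ∷ v2 ∷ []) combine)
        (return (field′ 2 v2 ∷ v0 ∷ v1 ∷ []))))

tokenStep : Cmd (3 + Γ) 3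
tokenStep = call (v0 ∷ v1 ∷ v2 ∷ []) processToken

-- Growth of the heap and facts that survive it

pokeWorld : World → ℕ → ℕ → World
pokeWorld w a x = world (heap w [ a ≔ x ]) (inp w) (out w)

Below : ℕ → Heap → Heap → Set
Below H h h′ = ∀ {a} → a < H → h′ a ≡ h a

-- Memory is 0 at the start and the bump pointer only moves up, so a new table needs no
-- initialisation.
Fresh : ℕ → World → Set
Fresh H w = ∀ {a} → H ≤ a → heap w a ≡ 0

-- Allocation is by a bump pointer H.  Grow H w H′ w′: w′ arises from w by
-- writing to addresses between H and H′ only.
record Grow (H : ℕ) (w : World) (H′ : ℕ) (w′ : World) : Set where
  constructor grow
  field
    inp≡  : inp w′ ≡ inp w
    out≡  : out w′ ≡ out w
    H≤    : H ≤ H′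
    below : Below H (heap w) (heap w′)
    fresh : Fresh H′ w′
open Grow public

-- P holds of h, and keeps holding as long as only addresses ≥ H are written.
record Kept (H : ℕ) (h : Heap) (P : Heap → Set) : Set where
  constructor kept
  field at : ∀ {h′} → Below H h h′ → P h′
open Kept public

now : ∀ {H h P} → Kept H h P → P h
now k = at k (λ _ → refl)

grow-refl : ∀ {H K w} → Fresh H w → H ≤ K → Grow H w K w
grow-refl f H≤K = grow refl refl H≤K (λ _ → refl) (λ K≤a → f (≤-trans H≤K K≤a))

grow-trans : ∀ {H H′ H″ w w′ w″} → Grow H w H′ w′ → Grow H′ w′ H″ w″ → Grow H w H″ w″
grow-trans g g′ = grow (trans (inp≡ g′) (inp≡ g)) (trans (out≡ g′) (out≡ g)) (≤-trans (H≤ g) (H≤ g′))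
  (λ a<H → trans (below g′ (<-≤-trans a<H (H≤ g))) (below g a<H)) (fresh g′)

grow-poke : ∀ {H w K w′ a x} → H ≤ a → a < K → Grow H w K w′ → Grow H w K (pokeWorld w′ a x)
grow-poke {w′ = w′} {a} {x} H≤a a<K (grow i o H≤K b f) = grow i o H≤K
  (λ c<H → trans (update-other (heap w′) x (≢-sym (<⇒≢ (<-≤-trans c<H H≤a)))) (b c<H))
  (λ K≤c → trans (update-other (heap w′) x (<⇒≢ (<-≤-trans a<K K≤c))) (f K≤c))

kept-grow : ∀ {H w H′ w′ P} → Grow H w H′ w′ → Kept H (heap w) P → Kept H′ (heap w′) P
kept-grow g k = kept λ b → at k (λ a<H → trans (b (<-≤-trans a<H (H≤ g))) (below g a<H))

kept-in : ∀ {H w H′ w′ P} → Grow H w H′ w′ → Kept H (heap w) P → P (heap w′)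
kept-in g k = at k (below g)

kept-map : ∀ {H h} {P Q : Heap → Set} → (∀ {h} → P h → Q h) → Kept H h P → Kept H h Q
kept-map f k = kept λ b → f (at k b)

runs-call : ∀ {k l} {es : Vec (Expr Γ) k} {c : Cmd (k + Γ) l} {ρ w b} {Q : Post l} →
            Runs c (⟦ es ⟧* ρ (heap w) ++ ρ) w b Q → Runs (call es c) ρ w b Q
runs-call {es = es} {ρ = ρ} {w = w} p =
  runs-bind {R = λ xs w′ → xs ≡ ⟦ es ⟧* ρ (heap w) × w′ ≡ w} (runs-return (refl , refl))
    λ { _ _ (refl , refl) → p }

x+[y∸x]-cases : ∀ x y → (x + (y ∸ x) ≡ x × y ≤ x) ⊎ (x + (y ∸ x) ≡ y × x ≤ y)
x+[y∸x]-cases x y with ≤-total x y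
... | inj₁ x≤y = inj₂ (m+[n∸m]≡n x≤y , x≤y)
... | inj₂ y≤x = inj₁ (trans (cong (x +_) (m≤n⇒m∸n≡0 y≤x)) (+-identityʳ x) , y≤x)

skip : ∀ h a i j {x y} → i ≢ j → h (a + j) ≡ y → (h [ a + i ≔ x ]) (a + j) ≡ y
skip h a i j ne eq = trans (update-other h _ (λ e → ne (+-cancelˡ-≡ a i j e))) eq

skip₀ : ∀ h a i {x y} → h a ≡ y → (h [ a + suc i ≔ x ]) a ≡ y
skip₀ h a i eq = trans (update-other h _ (λ e → <⇒≢ (≤-trans (m≤m+n (suc a) i) (≤-reflexive (sym (+-suc a i)))) (sym e))) eq

skip₁ : ∀ h a j {x y} → h (a + suc j) ≡ y → (h [ a ≔ x ]) (a + suc j) ≡ y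
skip₁ h a j eq = trans (update-other h _ (λ e → <⇒≢ (≤-trans (m≤m+n (suc a) j) (≤-reflexive (sym (+-suc a j)))) e)) eq

ifZero : ℕ → ℕ → ℕ → ℕ
ifZero zero    x y = x
ifZero (suc _) x y = y

ifZero-0 : ∀ {c x y} → c ≡ 0 → ifZero c x y ≡ x
ifZero-0 refl = refl

ifZero-≢0 : ∀ {c x y} → c ≢ 0 → ifZero c x y ≡ y
ifZero-≢0 {zero}  c≢0 = contradiction refl c≢0
ifZero-≢0 {suc c} _   = refl

-- Convolution of tables

Entries : (ℕ → ℕ) → ℕ → ℕ → Heap → Set
Entries a p n h = ∀ i → i ≤ n → h (p + i) ≡ a i

record Convolved (a g : ℕ → ℕ) (A M H : ℕ) (h : Heap) : Set where
  field
    sound    : ∀ t → t ≤ A + M → ∃₂ λ i j → i ≤ A × j ≤ M × i + j ≡ t × h (H + t) ≡ a i + g j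
    complete : ∀ i j → i ≤ A → j ≤ M → a i + g j ≤ h (H + (i + j))

module _ {a g : ℕ → ℕ} {A M H p src bad : ℕ} {w : World}
         (aFacts : Kept H (heap w) (Entries a p A))
         (gFacts : Kept H (heap w) (λ h → ∀ j → j ≤ M → ifZero bad (h (src + j)) 0 ≡ g j))
         (fresh₀ : Fresh H w) where

  private
    K = H + suc (A + M)

    record Partial (D : ℕ → ℕ → Set) (w′ : World) : Set where
      field
        growth   : Grow H w K w′
        -- A cell that no sum has exceeded still holds its initial 0.
        sound    : ∀ t → heap w′ (H + t) ≡ 0 ⊎
                   ∃₂ λ i j → i ≤ A × j ≤ M × i + j ≡ t × heap w′ (H + t) ≡ a i + g j
        complete : ∀ i j → i ≤ A → j ≤ M → D i j → a i + g j ≤ heap w′ (H + (i + j))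
    open Partial

    update : ∀ {D D′ w′ i j val} → Partial D w′ → i ≤ A → j ≤ M → val ≡ a i + g j →
             (∀ i′ j′ → i′ ≤ A → j′ ≤ M → D′ i′ j′ → D i′ j′ ⊎ (i′ ≡ i × j′ ≡ j)) →
             Partial D′ (pokeWorld w′ (H + (i + j)) (heap w′ (H + (i + j)) + (val ∸ heap w′ (H + (i + j)))))
    update {D} {D′} {w′} {i} {j} {val} q i≤A j≤M refl imp = record
      { growth   = grow-poke (m≤m+n H _) (+-monoʳ-< H (s≤s (+-mono-≤ i≤A j≤M))) (growth q)
      ; sound    = sound′
      ; complete = complete′ }
      where
      h = heap w′
      c = H + (i + j)
      new = h c + (val ∸ h c)
      h′ = h [ c ≔ new ]
      sound′ : ∀ t → h′ (H + t) ≡ 0 ⊎ ∃₂ λ i j → i ≤ A × j ≤ M × i + j ≡ t × h′ (H + t) ≡ a i + g j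
      sound′ t with c ≟ H + t
      ... | no c≢ rewrite update-other h new c≢ = sound q t
      ... | yes eq with refl ← +-cancelˡ-≡ H (i + j) t eq rewrite update-same h c new
                   with x+[y∸x]-cases (h c) val
      ... | inj₁ (eq′ , _) rewrite eq′ = sound q t
      ... | inj₂ (eq′ , _) = inj₂ (i , j , i≤A , j≤M , refl , eq′)
      increases : ∀ x → h x ≤ h′ x
      increases x with c ≟ x
      ... | no c≢ rewrite update-other h new c≢ = ≤-refl
      ... | yes refl rewrite update-same h c new = m≤m+n (h c) _
      complete′ : ∀ i j → i ≤ A → j ≤ M → D′ i j → a i + g j ≤ h′ (H + (i + j))
      complete′ i′ j′ i′≤ j′≤ d with imp i′ j′ i′≤ j′≤ d
      ... | inj₁ d′ = ≤-trans (complete q i′ j′ i′≤ j′≤ d′) (increases _)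
      ... | inj₂ (refl , refl) rewrite update-same h c new =
        ≤-trans (m≤n+m∸n val (h c)) ≤-refl

  runs-convolve : ∀ {ρ : Vec ℕ Γ} →
    Runs convolve (p ∷ A ∷ src ∷ M ∷ bad ∷ H ∷ ρ) w ((A + 1) * suc ((M + 1) * 1))
      (λ _ w′ → Grow H w (H + suc (A + M)) w′ × Convolved a g A M H (heap w′))
  runs-convolve = runs-weaken ≤-refl finished
    (runs-loop-inv Outer
      (record { growth = grow-refl fresh₀ (m≤m+n H _) ; sound = λ t → inj₁ (fresh₀ (m≤m+n H t))
              ; complete = λ i j i≤A _ d → contradiction (≤-trans (≤-reflexive (+-comm 1 A)) d) (<⇒≱ (s≤s i≤A)) }
       , ≤-reflexive (+-comm A 1))
      λ { i [] w₁ (q , i<) → runs-weaken ≤-refl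
            (λ { [] w₂ (q′ , _) → weaken (λ i′ j′ _ _ d → inj₂ (d , z≤n)) q′ , ≤-trans (n≤1+n i) i< })
            (runs-loop-inv (Inner i)
              (weaken (λ { i′ j′ _ j≤ (inj₁ d) → d
                         ; i′ j′ _ j≤ (inj₂ (_ , d)) → contradiction (≤-trans (≤-reflexive (+-comm 1 M)) d) (<⇒≱ (s≤s j≤)) }) q
               , ≤-reflexive (+-comm M 1))
              λ { j [] w₂ (q′ , j<) → runs-ifz
                    (λ { refl → runs-poke (runs-return (update q′ (s≤s⁻¹ i<) (s≤s⁻¹ j<)
                        (cong₂ _+_ (kept-in (growth q′) aFacts i (s≤s⁻¹ i<))
                                   (kept-in (growth q′) gFacts j (s≤s⁻¹ j<)))
                        (extend i j) , ≤-trans (n≤1+n j) j<)) })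
                    (λ bad≢0 → runs-poke (runs-return (update q′ (s≤s⁻¹ i<) (s≤s⁻¹ j<)
                        (trans (kept-in (growth q′) aFacts i (s≤s⁻¹ i<))
                          (trans (sym (+-identityʳ _)) (cong (a i +_)
                            (trans (sym (ifZero-≢0 bad≢0)) (kept-in (growth q′) gFacts j (s≤s⁻¹ j<))))))
                        (extend i j) , ≤-trans (n≤1+n j) j<))) }) })
    where
    Outer : ℕ → Post 0
    Outer i _ w′ = Partial (λ i′ _ → i ≤ i′) w′ × i ≤ suc A
    Inner : ℕ → ℕ → Post 0
    Inner i j _ w′ = Partial (λ i′ j′ → suc i ≤ i′ ⊎ (i ≤ i′ × j ≤ j′)) w′ × j ≤ suc M
    extend : ∀ i j i′ j′ → i′ ≤ A → j′ ≤ M → suc i ≤ i′ ⊎ (i ≤ i′ × j ≤ j′) →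
             (suc i ≤ i′ ⊎ (i ≤ i′ × suc j ≤ j′)) ⊎ (i′ ≡ i × j′ ≡ j)
    extend i j i′ j′ _ _ (inj₁ lt) = inj₁ (inj₁ lt)
    extend i j i′ j′ _ _ (inj₂ (i≤ , j≤)) with m≤n⇒m<n∨m≡n i≤ | m≤n⇒m<n∨m≡n j≤
    ... | inj₁ i< | _        = inj₁ (inj₁ i<)
    ... | inj₂ _  | inj₁ j<  = inj₁ (inj₂ (i≤ , j<))
    ... | inj₂ eq | inj₂ eq′ = inj₂ (sym eq , sym eq′)
    weaken : ∀ {D D′ w′} → (∀ i j → i ≤ A → j ≤ M → D′ i j → D i j) → Partial D w′ → Partial D′ w′
    weaken imp q = record { growth = growth q ; sound = sound q
                          ; complete = λ i j i≤ j≤ d → complete q i j i≤ j≤ (imp i j i≤ j≤ d) }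
    split≤ : ∀ t → t ≤ A + M → ∃₂ λ i j → i ≤ A × j ≤ M × i + j ≡ t
    split≤ t t≤ with ≤-total t A
    ... | inj₁ t≤A = t , 0 , t≤A , z≤n , +-identityʳ t
    ... | inj₂ A≤t = A , t ∸ A , ≤-refl , ≤-trans (∸-monoˡ-≤ A t≤) (≤-reflexive (m+n∸m≡n A M)) , m+[n∸m]≡n A≤t
    finished : ∀ xs w′ → Outer 0 xs w′ → Grow H w (H + suc (A + M)) w′ × Convolved a g A M H (heap w′)
    finished _ w′ (q , _) = growth q , record
      { sound    = λ t t≤ → case t t≤ (sound q t)
      ; complete = λ i j i≤ j≤ → complete q i j i≤ j≤ z≤n }
      where
      case : ∀ t → t ≤ A + M → _ → ∃₂ λ i j → i ≤ A × j ≤ M × i + j ≡ t × heap w′ (H + t) ≡ a i + g j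
      case t t≤ (inj₂ r) = r
      -- The 0 in the cell bounds every sum that belongs there. So any decomposition of t has the
      -- sum 0, and the entry is attained after all.
      case t t≤ (inj₁ z) with i , j , i≤ , j≤ , refl ← split≤ t t≤ =
        i , j , i≤ , j≤ , refl , trans z (sym (n≤0⇒n≡0 (≤-trans (complete q i j i≤ j≤ z≤n) (≤-reflexive z))))

-- The new table ends at A. Beyond that index the current choice offers nothing, and the old entry r
-- stays.
improve : (t A r a : ℕ) → ℕ
improve t A r a = ifZero (t ∸ A) (r + (a ∸ r)) r

improve-cases : ∀ t A r a → improve t A r a ≡ r ⊎ (t ≤ A × improve t A r a ≡ a)
improve-cases t A r a with t ∸ A in eq
... | suc _ = inj₁ refl
... | zero with x+[y∸x]-cases r a
...   | inj₁ (eq′ , _) = inj₁ eq′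
...   | inj₂ (eq′ , _) = inj₂ (m∸n≡0⇒m≤n eq , eq′)

improve-old : ∀ t A r a → r ≤ improve t A r a
improve-old t A r a with t ∸ A
... | suc _ = ≤-refl
... | zero  = m≤m+n r _

improve-new : ∀ {t A} r a → t ≤ A → a ≤ improve t A r a
improve-new {t} {A} r a t≤A rewrite m≤n⇒m∸n≡0 t≤A = m≤n+m∸n a r

-- Binary digits of a choice; maximum of two tables

value : ℕ → (ℕ → ℕ) → ℕ
value zero    φ = 0
value (suc i) φ = value i φ + φ i * 2 ^ i

Flags : (ℕ → ℕ) → Set
Flags φ = ∀ i → φ i ≤ 1

value-< : ∀ {φ} → Flags φ → ∀ i → value i φ < 2 ^ i
value-< fl zero    = s≤s z≤n
value-< {φ} fl (suc i) = +-mono-<-≤ (value-< fl i)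
  (≤-trans (*-monoˡ-≤ (2 ^ i) (fl i)) (≤-reflexive (trans (*-identityˡ _) (sym (+-identityʳ _)))))

-- The lower digits add up to less than 2 ^ i, so one comparison with 2 ^ i reveals digit i. Peeling
-- off digits from the top in this way replaces division.
value-digit : ∀ {φ} → Flags φ → ∀ i →
              (2 ^ i ≤ value (suc i) φ → φ i ≡ 1 × value (suc i) φ ∸ 2 ^ i ≡ value i φ) ×
              (¬ 2 ^ i ≤ value (suc i) φ → φ i ≡ 0 × value (suc i) φ ≡ value i φ)
value-digit {φ} fl i with φ i | fl i
... | zero  | _ = (λ le → contradiction (≤-trans le (≤-reflexive (+-identityʳ (value i φ)))) (<⇒≱ (value-< fl i)))
                , λ _ → refl , +-identityʳ (value i φ)
... | suc zero | _ = (λ _ → refl , trans (cong (λ z → value i φ + z ∸ 2 ^ i) (*-identityˡ (2 ^ i))) (m+n∸n≡m (value i φ) (2 ^ i)))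
                   , λ ≰ → contradiction (≤-trans (≤-reflexive (sym (*-identityˡ (2 ^ i)))) (m≤n+m _ (value i φ))) ≰
... | suc (suc _) | s≤s ()

Powers : ℕ → Heap → Set
Powers n h = ∀ i → i ≤ n → h (record# i + 7) ≡ 2 ^ i

-- Quantifying over φ avoids showing that each mask is the value of some flags. Only masks that
-- arise from a biclique matter for completeness, and soundness of the evaluation holds for
-- arbitrary flags.
Digits : ℕ → ℕ → ℕ → Heap → Set
Digits mask q H h = ∀ φ → Flags φ → value q φ ≡ mask → ∀ j → j < q → h (H + j) ≡ φ j

runs-bits : ∀ {n mask q H w} {ρ : Vec ℕ Γ} → Kept H (heap w) (Powers n) → q ≤ n → Fresh H w →
            Runs bits (mask ∷ q ∷ H ∷ ρ) w (q * 1)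
              (λ _ w′ → Grow H w (H + q) w′ × Digits mask q H (heap w′))
runs-bits {n = n} {mask} {q} {H} {w} powers q≤n fresh₀ = runs-weaken ≤-refl
  (λ { (_ ∷ []) w′ (g , _ , inv) → g , λ φ fl eq j j<q → proj₂ (inv φ fl eq) j z≤n j<q })
  (runs-loop-inv Inv
    (grow-refl fresh₀ (m≤m+n H q) , ≤-refl , λ φ fl eq → sym eq , λ j q≤j j<q → contradiction q≤j (<⇒≱ j<q))
    λ { i (r ∷ []) w₁ (g , i<q , inv) → let pow = kept-in g powers i (≤-trans (<⇒≤ i<q) q≤n) in runs-ifz
      (λ z → let g′ = grow-poke {x = 1} (m≤m+n H i) (+-monoʳ-< H i<q) g in
        runs-poke (runs-return (g′ , ≤-trans (n≤1+n i) i<q , λ φ fl eq →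
          let r≡ , old = inv φ fl eq
              φi , rest = proj₁ (value-digit fl i) (≤-trans (≤-reflexive (sym pow)) (≤-trans (m∸n≡0⇒m≤n z) (≤-reflexive r≡)))
          in trans (cong₂ _∸_ r≡ (kept-in g′ powers i (≤-trans (<⇒≤ i<q) q≤n))) rest
           , digit w₁ i φ 1 φi old)))
      (λ nz → let g′ = grow-poke {x = 0} (m≤m+n H i) (+-monoʳ-< H i<q) g in
        runs-poke (runs-return (g′ , ≤-trans (n≤1+n i) i<q , λ φ fl eq →
          let r≡ , old = inv φ fl eq
              φi , rest = proj₂ (value-digit fl i) (λ le → nz (m≤n⇒m∸n≡0 (≤-trans (≤-reflexive pow) (≤-trans le (≤-reflexive (sym r≡))))))
          in trans r≡ rest , digit w₁ i φ 0 φi old))) })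
  where
  Inv : ℕ → Post 1
  Inv i (r ∷ []) w′ = Grow H w (H + q) w′ × i ≤ q × (∀ φ → Flags φ → value q φ ≡ mask →
    r ≡ value i φ × (∀ j → i ≤ j → j < q → heap w′ (H + j) ≡ φ j))
  digit : ∀ w₁ i φ x → φ i ≡ x → (∀ j → suc i ≤ j → j < q → heap w₁ (H + j) ≡ φ j) →
          ∀ j → i ≤ j → j < q → (heap w₁ [ H + i ≔ x ]) (H + j) ≡ φ j
  digit w₁ i φ x φi old j i≤j j<q with m≤n⇒m<n∨m≡n i≤j
  ... | inj₁ i<j  = trans (update-other (heap w₁) x (λ eq → <⇒≢ i<j (+-cancelˡ-≡ H i j eq))) (old j i<j j<q)
  ... | inj₂ refl = trans (update-same (heap w₁) (H + i) x) (sym φi)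

runs-maximum : ∀ {r a : ℕ → ℕ} {R b p A H w} {ρ : Vec ℕ Γ} →
               Kept H (heap w) (Entries r R b) → Kept H (heap w) (Entries a p A) → Fresh H w →
               Runs maximum (R ∷ b ∷ p ∷ A ∷ H ∷ ρ) w ((b + 1) * 1)
                 (λ _ w′ → Grow H w (H + suc b) w′ ×
                   Entries (λ t → improve t A (r t) (a t)) H b (heap w′))
runs-maximum {r = r} {a} {R} {b} {p} {A} {H} {w} rFacts aFacts fresh₀ = runs-weaken ≤-refl
  (λ { [] w′ (g , _ , e) → g , λ t t≤ → e t z≤n t≤ })
  (runs-loop-inv Inv
    ( grow-refl fresh₀ (m≤m+n H (suc b)) , ≤-reflexive (+-comm b 1)
    , λ t b<t t≤b → contradiction (≤-trans (≤-reflexive (+-comm 1 b)) b<t) (<⇒≱ (s≤s t≤b)))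
    λ { i [] w₁ (g , i< , e) →
      let i≤b = s≤s⁻¹ i<
          ri = kept-in g rFacts i i≤b
          next : ∀ {x} → x ≡ f i → Inv i [] (pokeWorld w₁ (H + i) x)
          next = λ {x} eq → grow-poke {x = x} (m≤m+n H i) (+-monoʳ-< H i<) g , ≤-trans (n≤1+n i) i< , extend w₁ i x eq e in
      runs-ifz
        (λ z → runs-poke (runs-return (next (trans
                  (cong₂ (λ x y → x + (y ∸ x)) ri (kept-in g aFacts i (m∸n≡0⇒m≤n z))) (sym (ifZero-0 z))))))
        (λ nz → runs-poke (runs-return (next (trans ri (sym (ifZero-≢0 nz)))))) })
  where
  f : ℕ → ℕ
  f t = improve t A (r t) (a t)
  Inv : ℕ → Post 0
  Inv i _ w′ = Grow H w (H + suc b) w′ × i ≤ suc b × (∀ t → i ≤ t → t ≤ b → heap w′ (H + t) ≡ f t)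
  extend : ∀ w₁ i x → x ≡ f i → (∀ t → suc i ≤ t → t ≤ b → heap w₁ (H + t) ≡ f t) →
           ∀ t → i ≤ t → t ≤ b → (heap w₁ [ H + i ≔ x ]) (H + t) ≡ f t
  extend w₁ i x eq old t i≤t t≤b with m≤n⇒m<n∨m≡n i≤t
  ... | inj₁ i<t  = trans (update-other (heap w₁) x (λ eq → <⇒≢ i<t (+-cancelˡ-≡ H i t eq))) (old t i<t t≤b)
  ... | inj₂ refl = trans (update-same (heap w₁) (H + i) x) eq

-- Evaluating one choice φ of the parts that may contain black vertices

edgeValue : Heap → ℕ → ℕ → ℕ
edgeValue h u v = h (h (record# u + 8) + v)

record PartData : Set where
  field
    ptr blacks table repB repW : ℕ → ℕ
    entry edges : ℕ → ℕ → ℕ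

record PartFacts (D : PartData) (parts q : ℕ) (h : Heap) : Set where
  open PartData D
  field
    ptr≡    : ∀ j → j < q → h (parts + j) ≡ ptr j
    blacks≡ : ∀ j → j < q → h (ptr j + 1) ≡ blacks j
    repB≡   : ∀ j → j < q → h (ptr j + 2) ≡ repB j
    repW≡   : ∀ j → j < q → h (ptr j + 3) ≡ repW j
    table≡  : ∀ j → j < q → h (ptr j + 4) ≡ table j
    entry≡  : ∀ j → j < q → ∀ l → l ≤ blacks j → h (table j + l) ≡ entry j l
    edges≡  : ∀ i j → i < q → j < q → edgeValue h (repB i) (repW j) ≡ edges i j

-- The inner difference is 1 for i = j and 0 otherwise, so a part never conflicts with itself. For i
-- ≠ j and flags at most 1, the result is 1 exactly if part i may contain black vertices and its
-- black representative is not adjacent to the white one of part j.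
conflict : (φ : ℕ → ℕ) (E : ℕ → ℕ → ℕ) (j i : ℕ) → ℕ
conflict φ E j i = (φ i ∸ (1 ∸ ((i ∸ j) + (j ∸ i)))) ∸ E i j

conflicts : (φ : ℕ → ℕ) (E : ℕ → ℕ → ℕ) (j q : ℕ) → ℕ
conflicts φ E j zero    = 0
conflicts φ E j (suc i) = conflict φ E j i + conflicts φ E j i

EqualsFlags : (ℕ → ℕ) → ℕ → ℕ → Heap → Set
EqualsFlags φ flags q h = ∀ i → i < q → h (flags + i) ≡ φ i

runs-forbidden : ∀ {D φ j parts flags q w} {ρ : Vec ℕ Γ} → PartFacts D parts q (heap w) →
                 EqualsFlags φ flags q (heap w) → j < q →
                 Runs forbidden (j ∷ parts ∷ flags ∷ q ∷ ρ) w (q * 1)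
                   (λ xs w′ → w′ ≡ w × xs ≡ conflicts φ (PartData.edges D) j q ∷ [])
runs-forbidden {D = D} {φ} {j} {parts} {flags} {q} {w} facts φ≡ j<q = runs-weaken ≤-refl
  (λ { (x ∷ []) w′ (refl , _ , eq) → refl , cong (_∷ []) (trans (sym (+-identityʳ x)) eq) })
  (runs-loop-inv Inv (refl , ≤-refl , refl)
    λ { i (x ∷ []) w₁ (refl , i<q , eq) → runs-return
          ( refl , ≤-trans (n≤1+n i) i<q
          , trans (+-assoc x _ _) (trans (cong (λ z → x + (z + conflicts φ edges j i)) (term i i<q)) eq)) })
  where
  open PartData D
  open PartFacts facts
  Inv : ℕ → Post 1
  Inv i (x ∷ []) w′ = w′ ≡ w × i ≤ q × x + conflicts φ edges j i ≡ conflicts φ edges j q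
  h = heap w
  term : ∀ i → i < q → (h (flags + i) ∸ (1 ∸ ((i ∸ j) + (j ∸ i)))) ∸
           edgeValue h (h (h (parts + i) + 2)) (h (h (parts + j) + 3)) ≡ conflict φ edges j i
  term i i<q rewrite ptr≡ i i<q | ptr≡ j j<q | repB≡ i i<q | repW≡ j j<q | edges≡ i j i<q j<q | φ≡ i i<q = refl

module _ (D : PartData) (φ : ℕ → ℕ) (q : ℕ) where
  open PartData D

  blackLimit : ℕ → ℕ
  blackLimit j = ifZero (φ j) 0 (blacks j)

  gain : ℕ → ℕ → ℕ
  gain j l = ifZero (conflicts φ edges j q) (entry j l) 0

  -- The shadow of a biclique that the computed tables have to dominate: r j and y j stand for the
  -- number of black vertices and the weight of its share in the parts from j on.
  record Chain (r y : ℕ → ℕ) : Set where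
    field
      r-end : r q ≡ 0
      y-end : y q ≡ 0
      link  : ∀ j → j < q → ∃ λ l → l ≤ blackLimit j × r j ≡ r (suc j) + l × y j ≤ y (suc j) + gain j l

  blackLimit-≤ : ∀ j → blackLimit j ≤ blacks j
  blackLimit-≤ j with φ j
  ... | zero  = z≤n
  ... | suc _ = ≤-refl

  record Evaluated (S : ℕ → ℕ → ℕ → Set) (U : ℕ → ℕ) (i p A H : ℕ) (h : Heap) : Set where
    field
      best     : ℕ → ℕ
      entries  : Kept H h (Entries best p A)
      length≤  : A ≤ U i
      sound    : ∀ t → t ≤ A → S i t (best t)
      complete : ∀ r y → Chain r y → r i ≤ A × y i ≤ best (r i)

  -- Keeps the loop free of graphs. S j t x is what it means that x is an entry at t after the parts
  -- from j on have been treated, and U j bounds the last index of that table. Soundness needs S to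
  -- survive the addition of one part; completeness is stated for chains.
  runs-evaluate : ∀ {parts flags H w E} {ρ : Vec ℕ Γ} (S : ℕ → ℕ → ℕ → Set) (U : ℕ → ℕ) →
    Kept H (heap w) (PartFacts D parts q) → Kept H (heap w) (EqualsFlags φ flags q) → Fresh H w →
    S q 0 0 → (∀ j i l x → j < q → l ≤ blackLimit j → S (suc j) i x → S j (i + l) (x + gain j l)) →
    (∀ j → j < q → U (suc j) + blacks j ≤ U j × (U (suc j) + 1) * (blacks j + 1) ≤ E) →
    Runs evaluate (parts ∷ flags ∷ q ∷ H ∷ ρ) w (q * suc (q * 1 + (2 * E)))
      (λ { (p ∷ A ∷ H′ ∷ []) w′ → Grow H w H′ w′ × Evaluated S U 0 p A H′ (heap w′) })
  runs-evaluate {parts = parts} {flags} {H} {w} {E} S U facts flagged fresh₀ start next bound =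
    runs-weaken ≤-refl (λ { (p ∷ A ∷ H′ ∷ []) w′ (g , _ , ev) → g , ev })
    (runs-loop-inv Inv
      ( grow-refl fresh₀ (m≤m+n H 1) , ≤-refl , record
        { best     = λ _ → 0
        ; entries  = kept λ b i i≤0 → trans (b (+-monoʳ-< H (s≤s i≤0))) (fresh₀ (m≤m+n H i))
        ; length≤  = z≤n
        ; sound    = λ { zero _ → start }
        ; complete = λ r y c → ≤-reflexive (Chain.r-end c) , ≤-reflexive (Chain.y-end c) })
      λ { j (p ∷ A ∷ H₁ ∷ []) w₁ (g , j<q , ev) → iteration j p A H₁ w₁ g j<q ev })
    where
    Inv : ℕ → Post 3
    Inv i (p ∷ A ∷ H′ ∷ []) w′ = Grow H w H′ w′ × i ≤ q × Evaluated S U i p A H′ (heap w′)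
    iteration : ∀ {l} {σ : Vec ℕ l} j p A H₁ w₁ → Grow H w H₁ w₁ → j < q → Evaluated S U (suc j) p A H₁ (heap w₁) →
      Runs evaluatePart (p ∷ A ∷ H₁ ∷ j ∷ parts ∷ flags ∷ q ∷ σ) w₁ (q * 1 + (2 * E)) (Inv j)
    iteration j p A H₁ w₁ g j<q ev = runs-weaken
      (+-monoʳ-≤ (q * 1) convolveBound) (λ _ _ r → r)
      (runs-bind (runs-call (runs-forbidden pf ff j<q)) λ { _ _ (refl , refl) →
       runs-bind {a = 0} {R = λ xs w′ → w′ ≡ w₁ × xs ≡ M ∷ []}
         (runs-ifz (λ z → runs-return (refl , cong (_∷ []) (sym (ifZero-0 (trans (sym (ff j j<q)) z)))))
                   (λ nz → runs-return (refl , cong (_∷ []) (trans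
                      (trans (cong (λ z → heap w₁ (z + 1)) (ptr≡ j j<q)) (blacks≡ j j<q))
                      (sym (ifZero-≢0 (λ z → nz (trans (ff j j<q) z))))))))
         λ { _ _ (refl , refl) →
       runs-bind (runs-call (runs-convolve {bad = bad} entries gFacts (fresh g)))
         λ { [] w₂ (g₂ , cv) → runs-return (evaluated w₂ g₂ cv) }}})
      where
      open Evaluated ev
      pf = kept-in g facts
      ff = kept-in g flagged
      open PartFacts pf
      M = blackLimit j
      bad = conflicts φ edges j q
      src = heap w₁ (heap w₁ (parts + j) + 4)
      src≡ : src ≡ table j
      src≡ = trans (cong (λ z → heap w₁ (z + 4)) (ptr≡ j j<q)) (table≡ j j<q)
      gFacts : Kept H₁ (heap w₁) (λ h → ∀ l → l ≤ M → ifZero bad (h (src + l)) 0 ≡ gain j l)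
      gFacts = kept-map (λ {h} pf l l≤ → cong (λ z → ifZero bad z 0)
        (trans (cong (λ z → h (z + l)) src≡) (PartFacts.entry≡ pf j j<q l (≤-trans l≤ (blackLimit-≤ j)))))
        (kept-grow g facts)
      open ≤-Reasoning
      convolveBound : (A + 1) * suc ((M + 1) * 1) + 0 ≤ 2 * E
      convolveBound = begin
        (A + 1) * suc ((M + 1) * 1) + 0 ≡⟨ +-identityʳ _ ⟩
        (A + 1) * suc ((M + 1) * 1) ≡⟨ cong (λ z → (A + 1) * suc z) (*-identityʳ (M + 1)) ⟩
        (A + 1) * suc (M + 1) ≤⟨ *-monoʳ-≤ (A + 1) (+-monoˡ-≤ (M + 1) (m≤n+m 1 M)) ⟩
        (A + 1) * ((M + 1) + (M + 1)) ≡⟨ double (A + 1) (M + 1) ⟩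
        2 * ((A + 1) * (M + 1)) ≤⟨ *-monoʳ-≤ 2 (≤-trans (*-mono-≤ (+-monoˡ-≤ 1 length≤) (+-monoˡ-≤ 1 (blackLimit-≤ j)))
                                     (proj₂ (bound j j<q))) ⟩
        2 * E ∎
        where
        double : ∀ a b → a * (b + b) ≡ 2 * (a * b)
        double = solve-∀
      evaluated : ∀ w₂ → Grow H₁ w₁ (H₁ + suc (A + M)) w₂ → Convolved best (gain j) A M H₁ (heap w₂) →
               Inv j (H₁ ∷ A + M ∷ H₁ + (A + M + 1) ∷ []) w₂
      evaluated w₂ g₂ cv rewrite +-comm (A + M) 1 = grow-trans g g₂ , ≤-trans (n≤1+n j) j<q , record
        { best     = λ t → heap w₂ (H₁ + t)
        ; entries  = kept λ b i i≤ → b (+-monoʳ-< H₁ (s≤s i≤))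
        ; length≤  = ≤-trans (+-mono-≤ length≤ (blackLimit-≤ j)) (proj₁ (bound j j<q))
        ; sound    = λ t t≤ → let i , l , i≤ , l≤ , i+l≡t , eq = Convolved.sound cv t t≤ in
            subst₂ (S j) i+l≡t (sym eq) (next j i l (best i) j<q l≤ (sound i i≤))
        ; complete = λ r y c →
            let l , l≤ , r≡ , y≤ = Chain.link c j j<q
                r≤ , y≤′ = complete r y c
            in ≤-trans (≤-reflexive r≡) (+-mono-≤ r≤ l≤)
             , ≤-trans y≤ (≤-trans (+-monoˡ-≤ _ y≤′)
                 (≤-trans (Convolved.complete cv (r (suc j)) l r≤ l≤) (≤-reflexive (cong (λ z → heap w₂ (H₁ + z)) (sym r≡))))) }

-- Additive measures on subsets

μ : (Fin n → ℕ) → Subset n → ℕ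
μ f []          = 0
μ f (true ∷ C)  = f zero + μ (f ∘ suc) C
μ f (false ∷ C) = μ (f ∘ suc) C

record IsSum (C A D : Subset n) : Set where
  field
    split    : ∀ {v} → v ∈ C → v ∈ A ⊎ v ∈ D
    left     : A ⊆ C
    right    : D ⊆ C
    disjoint : ∀ {v} → v ∈ A → v ∉ D
open IsSum public

isSum-∩ : ∀ {C A D : Subset n} X → IsSum C A D → IsSum (C ∩ X) (A ∩ X) (D ∩ X)
isSum-∩ {C = C} {A} {D} X s = record
  { split = λ v∈ → let v∈C , v∈X = x∈p∩q⁻ C X v∈ in
      [ (λ v∈A → inj₁ (x∈p∩q⁺ (v∈A , v∈X))) , (λ v∈D → inj₂ (x∈p∩q⁺ (v∈D , v∈X))) ]′ (split s v∈C)
  ; left  = λ v∈ → let v∈A , v∈X = x∈p∩q⁻ A X v∈ in x∈p∩q⁺ (left s v∈A , v∈X)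
  ; right = λ v∈ → let v∈D , v∈X = x∈p∩q⁻ D X v∈ in x∈p∩q⁺ (right s v∈D , v∈X)
  ; disjoint = λ v∈A v∈D → disjoint s (proj₁ (x∈p∩q⁻ A X v∈A)) (proj₁ (x∈p∩q⁻ D X v∈D)) }

isSum-∩ˡ : ∀ {C A D : Subset n} X → IsSum C A D → IsSum (X ∩ C) (X ∩ A) (X ∩ D)
isSum-∩ˡ {C = C} {A} {D} X s rewrite ∩-comm X C | ∩-comm X A | ∩-comm X D = isSum-∩ X s

isSum-tail : ∀ {x y z} {C A D : Subset n} → IsSum (x ∷ C) (y ∷ A) (z ∷ D) → IsSum C A D
isSum-tail s = record
  { split = λ v∈ → [ inj₁ ∘ drop-there , inj₂ ∘ drop-there ]′ (split s (there v∈))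
  ; left = λ v∈ → drop-there (left s (there v∈))
  ; right = λ v∈ → drop-there (right s (there v∈))
  ; disjoint = λ v∈A v∈D → disjoint s (there v∈A) (there v∈D) }

μ-sum : ∀ (f : Fin n → ℕ) {C A D} → IsSum C A D → μ f C ≡ μ f A + μ f D
μ-sum f {[]} {[]} {[]} s = refl
μ-sum f {x ∷ C} {y ∷ A} {z ∷ D} s with μ-sum (f ∘ suc) (isSum-tail s)
μ-sum f {true ∷ C} {true ∷ A} {true ∷ D} s | eq = contradiction here (disjoint s here)
μ-sum f {true ∷ C} {true ∷ A} {false ∷ D} s | eq = trans (cong (f zero +_) eq) (sym (+-assoc (f zero) _ _))
μ-sum f {true ∷ C} {false ∷ A} {true ∷ D} s | eq = trans (cong (f zero +_) eq)
  (trans (sym (+-assoc (f zero) (μ (f ∘ suc) A) _)) (trans (cong (_+ μ (f ∘ suc) D) (+-comm (f zero) _)) (+-assoc (μ (f ∘ suc) A) _ _)))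
μ-sum f {true ∷ C} {false ∷ A} {false ∷ D} s | eq with split s here
... | inj₁ ()
... | inj₂ ()
μ-sum f {false ∷ C} {true ∷ A} {z ∷ D} s | eq with () ← left s here
μ-sum f {false ∷ C} {false ∷ A} {true ∷ D} s | eq with () ← right s here
μ-sum f {false ∷ C} {false ∷ A} {false ∷ D} s | eq = eq

μ-empty : ∀ (f : Fin n → ℕ) C → Empty C → μ f C ≡ 0
μ-empty f []          e = refl
μ-empty f (true ∷ C)  e = contradiction (zero , here) e
μ-empty f (false ∷ C) e = μ-empty (f ∘ suc) C (λ { (v , v∈) → e (suc v , there v∈) })

μ-one : (C : Subset n) → μ (λ _ → 1) C ≡ ∣ C ∣
μ-one []          = refl
μ-one (true ∷ C)  = cong suc (μ-one C)
μ-one (false ∷ C) = μ-one C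

∣∣-sum : ∀ {C A D : Subset n} → IsSum C A D → ∣ C ∣ ≡ ∣ A ∣ + ∣ D ∣
∣∣-sum {C = C} {A} {D} s rewrite sym (μ-one C) | sym (μ-one A) | sym (μ-one D) = μ-sum _ s

∣∣-empty : (C : Subset n) → Empty C → ∣ C ∣ ≡ 0
∣∣-empty C e = trans (sym (μ-one C)) (μ-empty _ C e)

∣∣≡0⇒empty : (C : Subset n) → ∣ C ∣ ≡ 0 → Empty C
∣∣≡0⇒empty C eq (v , v∈) = contradiction (≤-trans (≤-trans (≤-reflexive (sym (∣⁅x⁆∣≡1 v)))
  (p⊆q⇒∣p∣≤∣q∣ (λ x∈ → subst (_∈ C) (sym (x∈⁅y⁆⇒x≡y v x∈)) v∈))) (≤-reflexive eq)) λ ()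

∪-isSum : ∀ {A D : Subset n} → (∀ {v} → v ∈ A → v ∉ D) → IsSum (A ∪ D) A D
∪-isSum {A = A} {D} dis = record
  { split = x∈p∪q⁻ A D ; left = p⊆p∪q D ; right = q⊆p∪q A D ; disjoint = dis }

-- Weights, items and choices of parts

bit : Bool → ℕ
bit b = if b then 1 else 0

nth : ∀ {A : Set} → A → List A → ℕ → A
nth d []       i       = d
nth d (x ∷ xs) zero    = x
nth d (x ∷ xs) (suc i) = nth d xs i

drop-nth : ∀ {A : Set} (d : A) xs i → i < length xs → drop i xs ≡ nth d xs i ∷ drop (suc i) xs
drop-nth d (x ∷ xs) zero    _         = refl
drop-nth d (x ∷ xs) (suc i) (s≤s i<) = drop-nth d xs i i<

drop-length : ∀ {A : Set} (xs : List A) → drop (length xs) xs ≡ []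
drop-length []       = refl
drop-length (x ∷ xs) = drop-length xs

module Weighted {n : ℕ} (G : BipartiteGraph n) where
  open BipartiteGraph G

  -- The low n binary digits of the weight of a set encode its white vertices
  -- and the remaining ones count them, so that comparing weights means
  -- comparing numbers of white vertices first.
  weight : Fin n → ℕ
  weight v = 2 ^ n + 2 ^ toℕ v

  wt : Subset n → ℕ
  wt C = μ weight (C ∩ W)

  bl : Subset n → ℕ
  bl C = ∣ C ∩ B ∣

  adjacency : Fin n → Fin n → ℕ
  adjacency u v = bit (lookup (N u) v)

  adjacency⁺ : ∀ {u v} → Adj u v → adjacency u v ≡ 1
  adjacency⁺ a rewrite []=⇒lookup a = refl

  adjacency⁻ : ∀ {u v} → adjacency u v ≢ 0 → Adj u v
  adjacency⁻ {u} {v} ne with lookup (N u) v in eq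
  ... | true  = lookup⇒[]= v (N u) eq
  ... | false = contradiction refl ne

  wt-sum : ∀ {C A D} → IsSum C A D → wt C ≡ wt A + wt D
  wt-sum s = μ-sum weight (isSum-∩ W s)

  bl-sum : ∀ {C A D} → IsSum C A D → bl C ≡ bl A + bl D
  bl-sum s = ∣∣-sum (isSum-∩ B s)

  bl-mono : ∀ {C D} → C ⊆ D → bl C ≤ bl D
  bl-mono {C} C⊆D = p⊆q⇒∣p∣≤∣q∣ (λ v∈ → let v∈C , v∈B = x∈p∩q⁻ C B v∈ in x∈p∩q⁺ (C⊆D v∈C , v∈B))

  bl≡0 : ∀ {C} → bl C ≡ 0 → ∀ {v} → v ∈ C → v ∉ B
  bl≡0 {C} eq v∈C v∈B = ∣∣≡0⇒empty (C ∩ B) eq (_ , x∈p∩q⁺ (v∈C , v∈B))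

  noBlack : ∀ {C} → (∀ {v} → v ∈ C → v ∉ B) → bl C ≡ 0
  noBlack {C} none = ∣∣-empty (C ∩ B) λ { (v , v∈) → let v∈C , v∈B = x∈p∩q⁻ C B v∈ in none v∈C v∈B }

  noWhite : ∀ {C} → (∀ {v} → v ∈ C → v ∉ W) → wt C ≡ 0
  noWhite {C} none = μ-empty weight (C ∩ W) λ { (v , v∈) → let v∈C , v∈W = x∈p∩q⁻ C W v∈ in none v∈C v∈W }

  W⇒∉B : ∀ {v} → v ∈ W → v ∉ B
  W⇒∉B = x∈∁p⇒x∉p

  ∉B⇒W : ∀ {v} → v ∉ B → v ∈ W
  ∉B⇒W = x∉p⇒x∈∁p

  biclique-⊆ : ∀ {C D} → D ⊆ C → Biclique G C → Biclique G D
  biclique-⊆ {C} {D} D⊆C bc u∈ v∈ =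
    let u∈D , u∈B = x∈p∩q⁻ D B u∈ ; v∈D , v∈W = x∈p∩q⁻ D W v∈
    in bc (x∈p∩q⁺ (D⊆C u∈D , u∈B)) (x∈p∩q⁺ (D⊆C v∈D , v∈W))

  record ItemData : Set where
    field
      set       : Subset n
      ptr table : ℕ
      repB repW : Fin n
      entry     : ℕ → ℕ
  open ItemData public

  -- Only a lower bound on the black vertices is kept: a surplus does no harm, since all three
  -- objectives are monotone in their number.
  Attained : Subset n → ℕ → ℕ → Set
  Attained S b x = ∃ λ C → C ⊆ S × Biclique G C × b ≤ bl C × wt C ≡ x

  -- `black` and `white` serve the adjacency tests on representatives. `small` and `pair` make the
  -- representatives of a two-vertex set its two vertices, even if both have the same colour, so
  -- that the set can be split.
  record IsItem (X : ItemData) : Set where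
    field
      black    : ∀ {v} → v ∈ set X → v ∈ B → repB X ∈ set X × repB X ∈ B
      white    : ∀ {v} → v ∈ set X → v ∈ W → repW X ∈ set X × repW X ∈ W
      small    : ∣ set X ∣ ≤ 2 → repB X ∈ set X × repW X ∈ set X
      pair     : ∣ set X ∣ ≡ 2 → repB X ≢ repW X
      sound    : ∀ b → b ≤ bl (set X) → Attained (set X) b (entry X b)
      complete : ∀ C → C ⊆ set X → Biclique G C → wt C ≤ entry X (bl C)

  record ItemCells (X : ItemData) (h : Heap) : Set where
    field
      size≡  : h (ptr X) ≡ ∣ set X ∣
      black≡ : h (ptr X + 1) ≡ bl (set X)
      repB≡  : h (ptr X + 2) ≡ toℕ (repB X)
      repW≡  : h (ptr X + 3) ≡ toℕ (repW X)
      table≡ : h (ptr X + 4) ≡ table X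
      entry≡ : Entries (entry X) (table X) (bl (set X)) h

  record Stored (H : ℕ) (h : Heap) (X : ItemData) : Set where
    constructor stored
    field
      isItem : IsItem X
      cells  : Kept H h (ItemCells X)

  stored-grow : ∀ {H w H′ w′ X} → Grow H w H′ w′ → Stored H (heap w) X → Stored H′ (heap w′) X
  stored-grow g (stored i c) = stored i (kept-grow g c)

  EdgeCells : Heap → Set
  EdgeCells h = ∀ u v → edgeValue h (toℕ u) (toℕ v) ≡ adjacency u v

  -- The vertex v ranges over the whole graph and not over the set of the current node, so the
  -- property can be an invariant on the way down the tree.
  Homogeneous : Subset n → Set
  Homogeneous M = ∀ {v x y} → v ∉ M → x ∈ M → y ∈ M → (x ∈ B → y ∈ B) → (x ∈ W → y ∈ W) → Adj v x → Adj v y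

  module Choice (d : ItemData) (Xs : List ItemData)
                (isItem   : ∀ i → i < length Xs → IsItem (nth d Xs i))
                (disjoint : ∀ i j v → i < length Xs → j < length Xs →
                            v ∈ set (nth d Xs i) → v ∈ set (nth d Xs j) → i ≡ j)
                (homogeneous : ∀ i → i < length Xs → Homogeneous (set (nth d Xs i))) where

    q : ℕ
    q = length Xs

    X : ℕ → ItemData
    X = nth d Xs

    P : ℕ → Subset n
    P i = set (X i)

    U : ℕ → Subset n
    U j = ⋃ (map set (drop j Xs))

    D : PartData
    D = record
      { ptr = λ j → ptr (X j) ; blacks = λ j → bl (P j) ; table = λ j → table (X j)
      ; repB = λ j → toℕ (repB (X j)) ; repW = λ j → toℕ (repW (X j))
      ; entry = λ j → entry (X j) ; edges = λ i j → adjacency (repB (X i)) (repW (X j)) }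

    E : ℕ → ℕ → ℕ
    E = PartData.edges D

    U-step : ∀ j → j < q → U j ≡ P j ∪ U (suc j)
    U-step j j<q rewrite drop-nth d Xs j j<q = refl

    U-end : U q ≡ ∅
    U-end rewrite drop-length Xs = refl

    ∈U : ∀ k j → k + j ≡ q → ∀ {v} → v ∈ U j → ∃ λ i → j ≤ i × i < q × v ∈ P i
    ∈U zero    j refl v∈ rewrite U-end = contradiction v∈ ∉⊥
    ∈U (suc k) j eq {v} v∈ with x∈p∪q⁻ (P j) (U (suc j)) (subst (v ∈_) (U-step j j<q) v∈)
      where j<q = ≤-trans (m≤n+m (suc j) k) (≤-reflexive (trans (+-suc k j) eq))
    ... | inj₁ v∈P = j , ≤-refl , ≤-trans (m≤n+m (suc j) k) (≤-reflexive (trans (+-suc k j) eq)) , v∈P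
    ... | inj₂ v∈U = let i , j<i , i<q , v∈P = ∈U k (suc j) (trans (+-suc k j) eq) v∈U in i , <⇒≤ j<i , i<q , v∈P

    ∈U′ : ∀ {j} → j ≤ q → ∀ {v} → v ∈ U j → ∃ λ i → j ≤ i × i < q × v ∈ P i
    ∈U′ {j} j≤q = ∈U (q ∸ j) j (m∸n+n≡m j≤q)

    U-sum : ∀ j → j < q → IsSum (U j) (P j) (U (suc j))
    U-sum j j<q rewrite U-step j j<q = ∪-isSum λ v∈P v∈U →
      let i , j<i , i<q , v∈Pi = ∈U′ j<q v∈U in <⇒≢ j<i (disjoint j i _ j<q i<q v∈P v∈Pi)

    P⊆U : ∀ j → j < q → P j ⊆ U 0
    P⊆U j j<q = go j j<q
      where
      go : ∀ j → j < q → ∀ {i} → i ∈ P j → i ∈ U 0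
      go j j<q {v} v∈ = up j j<q (left (U-sum j j<q) v∈)
        where
        up : ∀ j → j < q → v ∈ U j → v ∈ U 0
        up zero    _   v∈ = v∈
        up (suc j) j<q v∈ = up j (<⇒≤ j<q) (right (U-sum j (<⇒≤ j<q)) v∈)

    -- One endpoint moves at a time: first w inside part j, as seen from b, then b inside part i, as
    -- seen from w′.
    bihomogeneous : ∀ {i j b b′ w w′} → i < q → j < q → i ≢ j → b ∈ P i → b′ ∈ P i → w ∈ P j → w′ ∈ P j →
                    b ∈ B → b′ ∈ B → w ∈ W → w′ ∈ W → Adj b w → Adj b′ w′
    bihomogeneous {i} {j} {b} {b′} {w} {w′} i<q j<q i≢j b∈ b′∈ w∈ w′∈ bB b′B wW w′W a =
      symmetric (homogeneous i i<q (λ w′∈i → i≢j (disjoint i j w′ i<q j<q w′∈i w′∈)) b∈ b′∈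
        (λ _ → b′B) (λ bW → contradiction bB (W⇒∉B bW))
        (symmetric (homogeneous j j<q (λ b∈j → i≢j (disjoint i j b i<q j<q b∈ b∈j)) w∈ w′∈
          (λ wB → contradiction wB (W⇒∉B wW)) (λ _ → w′W) a)))

    conflicts≡0⁻ : ∀ φ j k → conflicts φ E j k ≡ 0 → ∀ i → i < k → conflict φ E j i ≡ 0
    conflicts≡0⁻ φ j (suc k) eq i i< with m≤n⇒m<n∨m≡n (s≤s⁻¹ i<)
    ... | inj₁ i<k  = conflicts≡0⁻ φ j k (m+n≡0⇒n≡0 (conflict φ E j k) eq) i i<k
    ... | inj₂ refl = m+n≡0⇒m≡0 (conflict φ E j k) eq

    conflicts≡0⁺ : ∀ φ j k → (∀ i → i < k → conflict φ E j i ≡ 0) → conflicts φ E j k ≡ 0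
    conflicts≡0⁺ φ j zero    _ = refl
    conflicts≡0⁺ φ j (suc k) z rewrite z k ≤-refl = conflicts≡0⁺ φ j k (λ i i<k → z i (m<n⇒m<1+n i<k))

    distance : ∀ {i j} → i ≢ j → 1 ∸ ((i ∸ j) + (j ∸ i)) ≡ 0
    distance {i} {j} i≢j with <-cmp i j
    ... | tri< i<j _ _ = m≤n⇒m∸n≡0 (≤-trans (m<n⇒0<n∸m i<j) (m≤n+m (j ∸ i) (i ∸ j)))
    ... | tri≈ _ eq _ = contradiction eq i≢j
    ... | tri> _ _ j<i = m≤n⇒m∸n≡0 (≤-trans (m<n⇒0<n∸m j<i) (m≤m+n (i ∸ j) (j ∸ i)))

    conflict-same : ∀ φ i → φ i ≤ 1 → conflict φ E i i ≡ 0
    conflict-same φ i φ≤1 rewrite n∸n≡0 i | m≤n⇒m∸n≡0 φ≤1 = 0∸n≡0 (E i i)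

    module _ (φ : ℕ → ℕ) where

      Bad : ℕ → ℕ
      Bad j = conflicts φ E j q

      -- Besides the counts it records where each colour may occur. These restrictions are what
      -- makes the union with a share of the next part a biclique again.
      Reaches : ℕ → ℕ → ℕ → Set
      Reaches j t x = ∃ λ C → Biclique G C × t ≤ bl C × wt C ≡ x ×
        (∀ {v} → v ∈ C → ∃ λ i → j ≤ i × i < q × v ∈ P i × (v ∈ B → φ i ≢ 0) × (v ∈ W → Bad i ≡ 0))

      reaches-start : Reaches q 0 0
      reaches-start = ∅ , (λ u∈ _ → contradiction (proj₁ (x∈p∩q⁻ ∅ B u∈)) ∉⊥) , z≤n ,
        noWhite (λ v∈ → contradiction v∈ ∉⊥) , λ v∈ → contradiction v∈ ∉⊥

      -- If both colours are allowed, the table of the part supplies the share. If black is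
      -- forbidden, the white vertices of its biclique for index 0 remain; if white is forbidden,
      -- all black vertices of the part serve; otherwise the share is empty.
      within : ∀ j → j < q → ∀ l → l ≤ blackLimit D φ q j → ∃ λ C → C ⊆ P j × Biclique G C × l ≤ bl C ×
               wt C ≡ gain D φ q j l × (∀ {v} → v ∈ C → v ∈ B → φ j ≢ 0) × (∀ {v} → v ∈ C → v ∈ W → Bad j ≡ 0)
      within j j<q l l≤ with Bad j ≟ 0 | φ j ≟ 0
      ... | yes ok | no on =
        let C , C⊆ , bc , l≤C , eq = IsItem.sound (isItem j j<q) l (≤-trans l≤ (blackLimit-≤ D φ q j))
        in C , C⊆ , bc , l≤C , trans eq (sym (ifZero-0 ok)) , (λ _ _ → on) , (λ _ _ → ok)
      ... | yes ok | yes off rewrite off | n≤0⇒n≡0 l≤ =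
        let C , C⊆ , bc , _ , eq = IsItem.sound (isItem j j<q) 0 z≤n
            C∩W⊆ : C ∩ W ⊆ C
            C∩W⊆ = p∩q⊆p C W
        in C ∩ W , ⊆-trans C∩W⊆ C⊆ , biclique-⊆ C∩W⊆ bc , z≤n ,
           trans (cong (μ weight) (trans (∩-assoc C W W) (cong (C ∩_) (∩-idem W)))) (trans eq (sym (ifZero-0 ok))) ,
           (λ v∈ v∈B → contradiction v∈B (W⇒∉B (p∩q⊆q C W v∈))) , (λ _ _ → ok)
      ... | no bad | no on = P j ∩ B , p∩q⊆p (P j) B ,
           (λ {u} {v} u∈ v∈ → let v∈PB , v∈W = x∈p∩q⁻ (P j ∩ B) W v∈ in contradiction (p∩q⊆q (P j) B v∈PB) (W⇒∉B v∈W)) ,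
           ≤-trans (≤-trans l≤ (blackLimit-≤ D φ q j))
             (≤-reflexive (cong ∣_∣ (trans (cong (P j ∩_) (sym (∩-idem B))) (sym (∩-assoc (P j) B B))))) ,
           trans (noWhite (λ v∈ v∈W → W⇒∉B v∈W (p∩q⊆q (P j) B v∈))) (sym (ifZero-≢0 bad)) ,
           (λ _ _ → on) , (λ v∈ v∈W → contradiction (p∩q⊆q (P j) B v∈) (W⇒∉B v∈W))
      ... | no bad | yes off rewrite off | n≤0⇒n≡0 l≤ = ∅ , ⊥⊆ ,
           (λ u∈ _ → contradiction (proj₁ (x∈p∩q⁻ ∅ B u∈)) ∉⊥) , z≤n ,
           trans (noWhite (λ v∈ → contradiction v∈ ∉⊥)) (sym (ifZero-≢0 bad)) ,
           (λ v∈ → contradiction v∈ ∉⊥) , (λ v∈ → contradiction v∈ ∉⊥)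

      -- The tests with the representatives ensure that black vertices of one
      -- part are adjacent to white vertices of another one.
      across : ∀ {i j u v} → i < q → j < q → i ≢ j → u ∈ P i → v ∈ P j → u ∈ B → v ∈ W →
               φ i ≢ 0 → Bad j ≡ 0 → Adj u v
      across {i} {j} i<q j<q i≢j u∈ v∈ uB vW on ok =
        let b∈ , bB = IsItem.black (isItem i i<q) u∈ uB
            w∈ , wW = IsItem.white (isItem j j<q) v∈ vW
        in bihomogeneous i<q j<q i≢j b∈ u∈ w∈ v∈ bB uB wW vW (adjacency⁻ λ E≡0 →
             on (trans (sym (trans (cong₂ (λ x y → (φ i ∸ x) ∸ y) (distance i≢j) E≡0) refl))
               (conflicts≡0⁻ φ j q ok i i<q)))

      reaches-step : ∀ j i l x → j < q → l ≤ blackLimit D φ q j → Reaches (suc j) i x →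
                     Reaches j (i + l) (x + gain D φ q j l)
      reaches-step j i l x j<q l≤ (C , bc , i≤ , wt≡ , C∈) with within j j<q l l≤
      ... | A , A⊆ , bcA , l≤A , wtA , onB , onW =
        C ∪ A , biclique , ≤-trans (+-mono-≤ i≤ l≤A) (≤-reflexive (sym (bl-sum s))) ,
        trans (wt-sum s) (cong₂ _+_ wt≡ wtA) , λ v∈ → [ fromC , fromA ]′ (x∈p∪q⁻ C A v∈)
        where
        s : IsSum (C ∪ A) C A
        s = ∪-isSum λ v∈C v∈A → let k , j<k , k<q , v∈P , _ = C∈ v∈C in
              <⇒≢ j<k (disjoint j k _ j<q k<q (A⊆ v∈A) v∈P)
        fromC : ∀ {v} → v ∈ C → ∃ λ i → j ≤ i × i < q × v ∈ P i × (v ∈ B → φ i ≢ 0) × (v ∈ W → Bad i ≡ 0)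
        fromC v∈ = let k , j<k , r = C∈ v∈ in k , <⇒≤ j<k , r
        fromA : ∀ {v} → v ∈ A → ∃ λ i → j ≤ i × i < q × v ∈ P i × (v ∈ B → φ i ≢ 0) × (v ∈ W → Bad i ≡ 0)
        fromA v∈ = j , ≤-refl , j<q , A⊆ v∈ , onB v∈ , onW v∈
        biclique : Biclique G (C ∪ A)
        biclique u∈ v∈ with x∈p∩q⁻ (C ∪ A) B u∈ | x∈p∩q⁻ (C ∪ A) W v∈
        ... | u∈C∪A , uB | v∈C∪A , vW with x∈p∪q⁻ C A u∈C∪A | x∈p∪q⁻ C A v∈C∪A
        ... | inj₁ u∈C | inj₁ v∈C = bc (x∈p∩q⁺ (u∈C , uB)) (x∈p∩q⁺ (v∈C , vW))
        ... | inj₂ u∈A | inj₂ v∈A = bcA (x∈p∩q⁺ (u∈A , uB)) (x∈p∩q⁺ (v∈A , vW))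
        ... | inj₁ u∈C | inj₂ v∈A = let k , j<k , k<q , u∈P , on , _ = C∈ u∈C in
          across k<q j<q (≢-sym (<⇒≢ j<k)) u∈P (A⊆ v∈A) uB vW (on uB) (onW v∈A vW)
        ... | inj₂ u∈A | inj₁ v∈C = let k , j<k , k<q , v∈P , _ , ok = C∈ v∈C in
          across j<q k<q (<⇒≢ j<k) (A⊆ u∈A) v∈P uB vW (onB u∈A uB) (ok vW)

      reaches-attained : ∀ {t x} → Reaches 0 t x → Attained (U 0) t x
      reaches-attained (C , bc , t≤ , eq , C∈) =
        C , (λ v∈ → let i , _ , i<q , v∈P , _ = C∈ v∈ in P⊆U i i<q v∈P) , bc , t≤ , eq

    flagsOf : Subset n → ℕ → ℕ
    flagsOf C i = bl (C ∩ P i) ⊓ 1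

    flagsOf-flags : ∀ C → Flags (flagsOf C)
    flagsOf-flags C i = m⊓n≤n (bl (C ∩ P i)) 1

    flagsOf≡0 : ∀ C i → flagsOf C i ≡ 0 → bl (C ∩ P i) ≡ 0
    flagsOf≡0 C i eq with bl (C ∩ P i)
    ... | zero  = refl
    ... | suc _ with () ← eq

    module _ (C : Subset n) (C⊆ : C ⊆ U 0) (bc : Biclique G C) (φ : ℕ → ℕ)
             (φ≡ : ∀ i → i < q → φ i ≡ flagsOf C i) where

      -- A part i flagged for black contains a black vertex of C, which is adjacent to the white
      -- vertex v of C. Homogeneity carries this edge over to the representatives, so the test finds
      -- no conflict.
      allowed : ∀ j → j < q → ∀ {v} → v ∈ C → v ∈ P j → v ∈ W → Bad φ j ≡ 0
      allowed j j<q {v} v∈C v∈P vW = conflicts≡0⁺ φ j q no-conflict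
        where
        no-conflict : ∀ i → i < q → conflict φ E j i ≡ 0
        no-conflict i i<q with i ≟ j
        ... | yes refl = conflict-same φ i (≤-trans (≤-reflexive (φ≡ i i<q)) (flagsOf-flags C i))
        ... | no i≢j rewrite distance i≢j with nonempty? ((C ∩ P i) ∩ B)
        ...   | no empty rewrite φ≡ i i<q | ∣∣-empty _ empty = 0∸n≡0 (E i j)
        ...   | yes (u , u∈) = m≤n⇒m∸n≡0 (≤-trans (≤-trans (≤-reflexive (φ≡ i i<q)) (flagsOf-flags C i))
                  (≤-reflexive (sym (adjacency⁺ (bihomogeneous i<q j<q i≢j u∈P b∈ v∈P w∈ uB bB vW wW
                    (bc (x∈p∩q⁺ (u∈C , uB)) (x∈p∩q⁺ (v∈C , vW))))))))
          where
          uB  = p∩q⊆q (C ∩ P i) B u∈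
          u∈C = p∩q⊆p C (P i) (p∩q⊆p (C ∩ P i) B u∈)
          u∈P = p∩q⊆q C (P i) (p∩q⊆p (C ∩ P i) B u∈)
          b∈ = proj₁ (IsItem.black (isItem i i<q) u∈P uB)
          bB = proj₂ (IsItem.black (isItem i i<q) u∈P uB)
          w∈ = proj₁ (IsItem.white (isItem j j<q) v∈P vW)
          wW = proj₂ (IsItem.white (isItem j j<q) v∈P vW)

      chain : Chain D φ q (λ j → bl (C ∩ U j)) (λ j → wt (C ∩ U j))
      chain = record
        { r-end = noBlack (λ v∈ → contradiction (subst (_ ∈_) U-end (p∩q⊆q C (U q) v∈)) ∉⊥)
        ; y-end = noWhite (λ v∈ → contradiction (subst (_ ∈_) U-end (p∩q⊆q C (U q) v∈)) ∉⊥)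
        ; link  = λ j j<q → bl (C ∩ P j) , l≤ j j<q ,
            trans (bl-sum (isSum-∩ˡ C (U-sum j j<q))) (+-comm (bl (C ∩ P j)) _) ,
            ≤-trans (≤-reflexive (trans (wt-sum (isSum-∩ˡ C (U-sum j j<q))) (+-comm (wt (C ∩ P j)) _)))
              (+-monoʳ-≤ _ (gain≥ j j<q)) }
        where
        l≤ : ∀ j → j < q → bl (C ∩ P j) ≤ blackLimit D φ q j
        l≤ j j<q with φ j ≟ 0
        ... | yes off rewrite flagsOf≡0 C j (trans (sym (φ≡ j j<q)) off) = z≤n
        ... | no on rewrite ifZero-≢0 {x = 0} {bl (P j)} on = bl-mono (p∩q⊆q C (P j))
        gain≥ : ∀ j → j < q → wt (C ∩ P j) ≤ gain D φ q j (bl (C ∩ P j))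
        gain≥ j j<q with Bad φ j ≟ 0
        ... | yes ok rewrite ifZero-0 {x = entry (X j) (bl (C ∩ P j))} {0} ok =
          IsItem.complete (isItem j j<q) (C ∩ P j) (p∩q⊆q C (P j)) (biclique-⊆ (p∩q⊆p C (P j)) bc)
        ... | no bad rewrite noWhite {C ∩ P j} (λ v∈ v∈W →
                  bad (allowed j j<q (p∩q⊆p C (P j) v∈) (p∩q⊆q C (P j) v∈) v∈W)) = z≤n

      C∩U₀ : C ∩ U 0 ≡ C
      C∩U₀ = ⊆-antisym (p∩q⊆p C (U 0)) (λ v∈ → x∈p∩q⁺ (v∈ , C⊆ v∈))

-- The table of a set composed of parts

module _ {n : ℕ} (G : BipartiteGraph n) where
  open BipartiteGraph G
  open Weighted G

  -- `Done` describes the bicliques whose choice of parts has been tried already. Only they are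
  -- bounded by the table, while every entry is attained at any time.
  record Best (S : Subset n) (Done : Subset n → Set) (R H : ℕ) (h : Heap) : Set where
    field
      best     : ℕ → ℕ
      entries  : Kept H h (Entries best R (bl S))
      sound    : ∀ t → t ≤ bl S → Attained S t (best t)
      complete : ∀ C → C ⊆ S → Biclique G C → Done C → wt C ≤ best (bl C)

  -- Makes the all-zero table sound: black vertices alone form a biclique of weight 0.
  allBlack : ∀ S t → t ≤ bl S → Attained S t 0
  allBlack S t t≤ = S ∩ B , p∩q⊆p S B ,
    (λ {u} {v} u∈ v∈ → let v∈SB , v∈W = x∈p∩q⁻ (S ∩ B) W v∈ in contradiction (p∩q⊆q S B v∈SB) (W⇒∉B v∈W)) ,
    ≤-trans t≤ (≤-reflexive (cong ∣_∣ (trans (cong (S ∩_) (sym (∩-idem B))) (sym (∩-assoc S B B))))) ,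
    noWhite (λ v∈ v∈W → W⇒∉B v∈W (p∩q⊆q S B v∈))

  emptyTable : ∀ {S R w Done} → Fresh R w → (∀ C → ¬ Done C) → Best S Done R (R + (bl S + 1)) (heap w)
  emptyTable {S} {R} f none = record
    { best     = λ _ → 0
    ; entries  = kept λ b i i≤ → trans (b (+-monoʳ-< R (≤-trans (s≤s i≤) (≤-reflexive (+-comm 1 (bl S)))))) (f (m≤m+n R i))
    ; sound    = allBlack S
    ; complete = λ C _ _ d → contradiction d (none C) }

  module Combination (d : ItemData) (Xs : List ItemData)
                (isItem   : ∀ i → i < length Xs → IsItem (nth d Xs i))
                (disjoint : ∀ i j v → i < length Xs → j < length Xs →
                            v ∈ set (nth d Xs i) → v ∈ set (nth d Xs j) → i ≡ j)
                (homogeneous : ∀ i → i < length Xs → Homogeneous (set (nth d Xs i))) where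

    open Choice d Xs isItem disjoint homogeneous public

    S : Subset n
    S = U 0

    tryMaskCost : ℕ → ℕ
    tryMaskCost E = q * 1 + (q * suc (q * 1 + 2 * E) + ((bl S + 1) * 1 + 0))

    CostBound : ℕ → Set
    CostBound E = ∀ j → j < q → (bl (U (suc j)) + 1) * (bl (P j) + 1) ≤ E

    runs-tryMask : ∀ {mask R H parts w E Done Done′} {ρ : Vec ℕ Γ} →
      Kept H (heap w) (PartFacts D parts q) → Kept H (heap w) (Powers n) → q ≤ n → Fresh H w →
      CostBound E → Best S Done R H (heap w) →
      (∀ C → Done′ C → Done C ⊎ value q (flagsOf C) ≡ mask) →
      Runs tryMask (mask ∷ R ∷ H ∷ bl S ∷ parts ∷ q ∷ ρ) w (tryMaskCost E)
        (λ { (R′ ∷ H′ ∷ []) w′ → Grow H w H′ w′ × Best S Done′ R′ H′ (heap w′) })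
    runs-tryMask {mask = mask} {R} {H} {parts} {w} {E} {Done} {Done′} facts powers q≤n f cost old split =
      runs-bind (runs-call (runs-bits powers q≤n f)) λ { (_ ∷ []) w₁ (g₁ , digits) →
      let φ = λ i → heap w₁ (H + i) in
      runs-bind (runs-call (runs-evaluate D φ q (Reaches φ) (λ j → bl (U j))
        (kept-grow g₁ facts) (kept λ b i i<q → b (+-monoʳ-< H i<q)) (fresh g₁)
        (reaches-start φ) (reaches-step φ)
        (λ j j<q → ≤-reflexive (trans (+-comm (bl (U (suc j))) _) (sym (bl-sum (U-sum j j<q)))) , cost j j<q)))
      λ { (p ∷ A ∷ H₂ ∷ []) w₂ (g₂ , ev) →
      runs-bind (runs-call (runs-maximum (kept-grow (grow-trans g₁ g₂) (Best.entries old)) (Evaluated.entries ev) (fresh g₂)))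
      λ { [] w₃ (g₃ , e) → runs-return (finished φ w₁ w₂ w₃ p A H₂ g₁ digits g₂ ev g₃ e) }}}
      where
      open Best old
      finished : ∀ φ w₁ w₂ w₃ p A H₂ → Grow H w (H + q) w₁ → Digits mask q H (heap w₁) → Grow (H + q) w₁ H₂ w₂ →
        (ev : Evaluated D (λ i → heap w₁ (H + i)) q (Reaches (λ i → heap w₁ (H + i))) (λ j → bl (U j)) 0 p A H₂ (heap w₂)) →
        Grow H₂ w₂ (H₂ + suc (bl S)) w₃ →
        Entries (λ t → improve t A (best t) (Evaluated.best ev t)) H₂ (bl S) (heap w₃) →
        Grow H w (H₂ + (bl S + 1)) w₃ × Best S Done′ H₂ (H₂ + (bl S + 1)) (heap w₃)
      finished φ w₁ w₂ w₃ p A H₂ g₁ digits g₂ ev g₃ e =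
        subst (λ z → Grow H w (H₂ + z) w₃ × Best S Done′ H₂ (H₂ + z) (heap w₃)) (+-comm 1 (bl S))
        (grow-trans g₁ (grow-trans g₂ g₃) , record
          { best     = λ t → improve t A (best t) (a t)
          ; entries  = kept λ b i i≤ → trans (b (+-monoʳ-< H₂ (s≤s i≤))) (e i i≤)
          ; sound    = λ t t≤ → [ (λ eq → subst (Attained S t) (sym eq) (sound t t≤))
                                , (λ (t≤A , eq) → subst (Attained S t) (sym eq)
                                    (reaches-attained (λ i → heap w₁ (H + i)) (Evaluated.sound ev t t≤A))) ]′
                                (improve-cases t A (best t) (a t))
          ; complete = λ C C⊆ bc d →
              [ (λ d → ≤-trans (complete C C⊆ bc d) (improve-old (bl C) A (best (bl C)) (a (bl C))))
              , (λ eq → let chosen = λ i i<q → digits (flagsOf C) (flagsOf-flags C) eq i i<q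
                            C≡ = C∩U₀ C C⊆ bc (λ i → heap w₁ (H + i)) chosen
                            r≤ , y≤ = subst (λ D → bl D ≤ A × wt D ≤ a (bl D)) C≡
                              (Evaluated.complete ev _ _ (chain C C⊆ bc (λ i → heap w₁ (H + i)) chosen))
                        in ≤-trans y≤ (improve-new (best (bl C)) (a (bl C)) r≤)) ]′ (split C d) })
        where
        a = Evaluated.best ev

    record Summary (i : ℕ) (s b rB rW : ℕ) : Set where
      field
        s≡    : s ≡ ∣ U i ∣
        b≡    : b ≡ bl (U i)
        uB uW : Fin n
        rB≡   : rB ≡ toℕ uB
        rW≡   : rW ≡ toℕ uW
        black : ∀ {v} → v ∈ U i → v ∈ B → uB ∈ U i × uB ∈ B
        white : ∀ {v} → v ∈ U i → v ∈ W → uW ∈ U i × uW ∈ W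
        -- For two parts of one vertex each, both representatives start in part 1. The vertex of
        -- part 0 then replaces exactly one of them, namely that of its own colour.
        two   : q ≡ 2 → ∣ P 0 ∣ ≡ 1 → ∣ P 1 ∣ ≡ 1 →
                (1 ≤ i × uB ∈ P 1 × uW ∈ P 1) ⊎ (i ≡ 0 × ((uB ∈ P 0 × uW ∈ P 1) ⊎ (uB ∈ P 1 × uW ∈ P 0)))

    weight≢0 : ∀ C {v} → v ∈ C → v ∈ W → wt C ≢ 0
    weight≢0 C {v} v∈C vW eq = contradiction (≤-trans (≤-trans (m^n>0 2 n) (≤-trans (m≤m+n (2 ^ n) (2 ^ toℕ v))
        (single weight (x∈p∩q⁺ (v∈C , vW))))) (≤-reflexive eq)) λ ()
      where
      single : ∀ {m} (f : Fin m → ℕ) {C v} → v ∈ C → f v ≤ μ f C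
      single f here = m≤m+n (f zero) _
      single f {true ∷ C} (there v∈) = ≤-trans (single (f ∘ suc) v∈) (m≤n+m _ (f zero))
      single f {false ∷ C} (there v∈) = single (f ∘ suc) v∈

    -- A single white vertex is a biclique of positive weight without black vertices. Hence entry 0
    -- of a table shows whether the part has a white vertex, which is how `statisticsPart` decides.
    entry≡0 : ∀ j → j < q → entry (X j) 0 ≡ 0 → ∀ {v} → v ∈ P j → v ∉ W
    entry≡0 j j<q eq {v} v∈ vW = weight≢0 ⁅ v ⁆ (x∈⁅x⁆ v) vW (n≤0⇒n≡0 (≤-trans
      (IsItem.complete (isItem j j<q) ⁅ v ⁆ (λ u∈ → subst (_∈ P j) (sym (x∈⁅y⁆⇒x≡y v u∈)) v∈)
        (λ {u} u∈ _ → let u∈v , uB = x∈p∩q⁻ ⁅ v ⁆ B u∈ in contradiction (subst (_∈ B) (x∈⁅y⁆⇒x≡y v u∈v) uB) (W⇒∉B vW)))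
      (≤-reflexive (trans (cong (entry (X j)) (noBlack {⁅ v ⁆} λ u∈ uB →
         contradiction (subst (_∈ B) (x∈⁅y⁆⇒x≡y v u∈) uB) (W⇒∉B vW))) eq))))

    entry≢0 : ∀ j → j < q → entry (X j) 0 ≢ 0 → ∃ λ v → v ∈ P j × v ∈ W
    entry≢0 j j<q ne with nonempty? (P j ∩ W)
    ... | yes (v , v∈) = v , x∈p∩q⁻ (P j) W v∈
    ... | no none with IsItem.sound (isItem j j<q) 0 z≤n
    ...   | C , C⊆ , _ , _ , eq = contradiction
      (trans (sym eq) (noWhite {C} (λ v∈ vW → none (_ , x∈p∩q⁺ (C⊆ v∈ , vW))))) ne

    bl≢0 : ∀ C → bl C ≢ 0 → ∃ λ v → v ∈ C × v ∈ B
    bl≢0 C ne with nonempty? (C ∩ B)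
    ... | yes (v , v∈) = v , x∈p∩q⁻ C B v∈
    ... | no none = contradiction (∣∣-empty (C ∩ B) none) ne

    singleton-unique : ∀ (C : Subset n) → ∣ C ∣ ≡ 1 → ∀ {u v} → u ∈ C → v ∈ C → u ≡ v
    singleton-unique C eq {u} {v} u∈ v∈ with u Fin.≟ v
    ... | yes u≡v = u≡v
    ... | no u≢v = contradiction (≤-trans (≤-trans (≤-reflexive (cong₂ _+_ (sym (∣⁅x⁆∣≡1 u)) (sym (∣⁅x⁆∣≡1 v))))
          (≤-trans (≤-reflexive (sym (∣∣-sum (∪-isSum {A = ⁅ u ⁆} {⁅ v ⁆} λ x∈u x∈v →
              u≢v (trans (sym (x∈⁅y⁆⇒x≡y u x∈u)) (x∈⁅y⁆⇒x≡y v x∈v))))))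
            (p⊆q⇒∣p∣≤∣q∣ {q = C} λ x∈ → [ (λ x∈u → subst (_∈ C) (sym (x∈⁅y⁆⇒x≡y u x∈u)) u∈)
                                        , (λ x∈v → subst (_∈ C) (sym (x∈⁅y⁆⇒x≡y v x∈v)) v∈) ]′ (x∈p∪q⁻ ⁅ u ⁆ ⁅ v ⁆ x∈))))
          (≤-reflexive eq)) λ { (s≤s ()) }

    record SizeFacts (parts : ℕ) (h : Heap) : Set where
      field
        ptr≡  : ∀ j → j < q → h (parts + j) ≡ ptr (X j)
        cells : ∀ j → j < q → ItemCells (X j) h

    runs-statistics : ∀ {parts w} {ρ : Vec ℕ Γ} → 1 ≤ q → SizeFacts parts (heap w) →
      Runs statistics (parts ∷ q ∷ ρ) w (q * 1)
        (λ { (s ∷ b ∷ rB ∷ rW ∷ []) w′ → w′ ≡ w × Summary 0 s b rB rW })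
    runs-statistics {parts = parts} {w} 1≤q facts = runs-weaken ≤-refl
      (λ { (s ∷ b ∷ rB ∷ rW ∷ []) w′ (eq , _ , r) → eq , r })
      (runs-loop-inv Inv (refl , ≤-refl , start) advance)
      where
      open SizeFacts facts
      h = heap w
      last = q ∸ 1
      last< : last < q
      last< = ∸-monoʳ-< {q} (s≤s z≤n) 1≤q
      Inv : ℕ → Post 4
      Inv i (s ∷ b ∷ rB ∷ rW ∷ []) w′ = w′ ≡ w × i ≤ q × Summary i s b rB rW
      start : Summary q 0 0 (h (h (parts + last) + 2)) (h (h (parts + last) + 3))
      start = record
        { s≡ = sym (trans (cong ∣_∣ U-end) (∣⊥∣≡0 n))
        ; b≡ = sym (noBlack (λ v∈ → contradiction (subst (_ ∈_) U-end v∈) ∉⊥))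
        ; uB = repB (X last) ; uW = repW (X last)
        ; rB≡ = trans (cong (λ z → h (z + 2)) (ptr≡ last last<)) (ItemCells.repB≡ (cells last last<))
        ; rW≡ = trans (cong (λ z → h (z + 3)) (ptr≡ last last<)) (ItemCells.repW≡ (cells last last<))
        ; black = λ v∈ → contradiction (subst (_ ∈_) U-end v∈) ∉⊥
        ; white = λ v∈ → contradiction (subst (_ ∈_) U-end v∈) ∉⊥
        ; two = λ q≡2 _ p≡1 → inj₁ (1≤q , two′ q≡2 p≡1) }
        where
        two′ : q ≡ 2 → ∣ P 1 ∣ ≡ 1 → repB (X last) ∈ P 1 × repW (X last) ∈ P 1
        two′ q≡2 p≡1 rewrite q≡2 = IsItem.small (isItem 1 (≤-reflexive (sym q≡2))) (≤-trans (≤-reflexive p≡1) (s≤s z≤n))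
      advance : ∀ {l} {σ : Vec ℕ l} i acc w₁ → Inv (suc i) acc w₁ →
        Runs statisticsPart (acc ++ i ∷ parts ∷ q ∷ σ) w₁ 0 (Inv i)
      advance i (s ∷ b ∷ rB ∷ rW ∷ []) w₁ (refl , i<q , sm) =
        runs-bind {a = 0} {R = λ { (x ∷ []) w₂ → w₂ ≡ w × ((bl (P i) ≡ 0 × x ≡ rB) ⊎ (bl (P i) ≢ 0 × x ≡ toℕ (repB (X i)))) }}
          (runs-ifz (λ z → runs-return (refl , inj₁ (trans (sym b≡′) z , refl)))
                    (λ nz → runs-return (refl , inj₂ ((λ z → nz (trans b≡′ z)) , rB≡′))))
          λ { (rB′ ∷ []) _ (refl , onB) →
        runs-bind {a = 0} {R = λ { (x ∷ []) w₂ → w₂ ≡ w × ((entry (X i) 0 ≡ 0 × x ≡ rW) ⊎ (entry (X i) 0 ≢ 0 × x ≡ toℕ (repW (X i)))) }}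
          (runs-ifz (λ z → runs-return (refl , inj₁ (trans (sym e≡′) z , refl)))
                    (λ nz → runs-return (refl , inj₂ ((λ z → nz (trans e≡′ z)) , rW≡′))))
          λ { (rW′ ∷ []) _ (refl , onW) → runs-return (refl , <⇒≤ i<q , next rB′ rW′ onB onW) }}
        where
        open Summary sm
        c = cells i i<q
        p≡ = ptr≡ i i<q
        it = isItem i i<q
        b≡′ : h (h (parts + i) + 1) ≡ bl (P i)
        b≡′ = trans (cong (λ z → h (z + 1)) p≡) (ItemCells.black≡ c)
        rB≡′ : h (h (parts + i) + 2) ≡ toℕ (repB (X i))
        rB≡′ = trans (cong (λ z → h (z + 2)) p≡) (ItemCells.repB≡ c)
        rW≡′ : h (h (parts + i) + 3) ≡ toℕ (repW (X i))
        rW≡′ = trans (cong (λ z → h (z + 3)) p≡) (ItemCells.repW≡ c)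
        e≡′ : h (h (h (parts + i) + 4)) ≡ entry (X i) 0
        e≡′ = trans (cong h (trans (trans (cong (λ z → h (z + 4)) p≡) (ItemCells.table≡ c)) (sym (+-identityʳ _))))
                (ItemCells.entry≡ c 0 z≤n)
        s-sum = U-sum i i<q
        next : ∀ rB′ rW′ → (bl (P i) ≡ 0 × rB′ ≡ rB) ⊎ (bl (P i) ≢ 0 × rB′ ≡ toℕ (repB (X i))) →
               (entry (X i) 0 ≡ 0 × rW′ ≡ rW) ⊎ (entry (X i) 0 ≢ 0 × rW′ ≡ toℕ (repW (X i))) →
               Summary i (s + h (h (parts + i))) (b + h (h (parts + i) + 1)) rB′ rW′
        next rB′ rW′ onB onW = record
          { s≡ = trans (cong₂ _+_ s≡ (trans (cong h p≡) (ItemCells.size≡ c)))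
                   (trans (+-comm ∣ U (suc i) ∣ _) (sym (∣∣-sum s-sum)))
          ; b≡ = trans (cong₂ _+_ b≡ b≡′) (trans (+-comm (bl (U (suc i))) _) (sym (bl-sum s-sum)))
          ; uB = proj₁ B′ ; uW = proj₁ W′
          ; rB≡ = proj₁ (proj₂ B′) ; rW≡ = proj₁ (proj₂ W′)
          ; black = proj₁ (proj₂ (proj₂ B′)) ; white = proj₁ (proj₂ (proj₂ W′))
          ; two = two′ }
          where
          B′ : ∃ λ u → rB′ ≡ toℕ u × (∀ {v} → v ∈ U i → v ∈ B → u ∈ U i × u ∈ B) ×
               ((bl (P i) ≡ 0 × u ≡ uB) ⊎ (bl (P i) ≢ 0 × u ≡ repB (X i)))
          B′ = go onB
            where
            go : (bl (P i) ≡ 0 × rB′ ≡ rB) ⊎ (bl (P i) ≢ 0 × rB′ ≡ toℕ (repB (X i))) →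
              ∃ λ u → rB′ ≡ toℕ u × (∀ {v} → v ∈ U i → v ∈ B → u ∈ U i × u ∈ B) ×
               ((bl (P i) ≡ 0 × u ≡ uB) ⊎ (bl (P i) ≢ 0 × u ≡ repB (X i)))
            go (inj₁ (z , eq)) = uB , trans eq rB≡ , (λ v∈ vB → [ (λ v∈P → contradiction vB (bl≡0 {P i} z v∈P))
                  , (λ v∈U → let u∈ , uB′ = black v∈U vB in right s-sum u∈ , uB′) ]′ (split s-sum v∈)) , inj₁ (z , refl)
            go (inj₂ (nz , eq)) = repB (X i) , eq , (λ _ _ → let v , v∈ , vB = bl≢0 (P i) nz ; r∈ , rB = IsItem.black it v∈ vB in left s-sum r∈ , rB) , inj₂ (nz , refl)
          W′ : ∃ λ u → rW′ ≡ toℕ u × (∀ {v} → v ∈ U i → v ∈ W → u ∈ U i × u ∈ W) ×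
               ((entry (X i) 0 ≡ 0 × u ≡ uW) ⊎ (entry (X i) 0 ≢ 0 × u ≡ repW (X i)))
          W′ = go onW
            where
            go : (entry (X i) 0 ≡ 0 × rW′ ≡ rW) ⊎ (entry (X i) 0 ≢ 0 × rW′ ≡ toℕ (repW (X i))) →
              ∃ λ u → rW′ ≡ toℕ u × (∀ {v} → v ∈ U i → v ∈ W → u ∈ U i × u ∈ W) ×
               ((entry (X i) 0 ≡ 0 × u ≡ uW) ⊎ (entry (X i) 0 ≢ 0 × u ≡ repW (X i)))
            go (inj₁ (z , eq)) = uW , trans eq rW≡ , (λ v∈ vW → [ (λ v∈P → contradiction vW (entry≡0 i i<q z v∈P))
                  , (λ v∈U → let u∈ , uW′ = white v∈U vW in right s-sum u∈ , uW′) ]′ (split s-sum v∈)) , inj₁ (z , refl)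
            go (inj₂ (nz , eq)) = repW (X i) , eq , (λ _ _ → let v , v∈ , vW = entry≢0 i i<q nz ; r∈ , rW = IsItem.white it v∈ vW in left s-sum r∈ , rW) , inj₂ (nz , refl)
          two′ : q ≡ 2 → ∣ P 0 ∣ ≡ 1 → ∣ P 1 ∣ ≡ 1 → (1 ≤ i × proj₁ B′ ∈ P 1 × proj₁ W′ ∈ P 1) ⊎
            (i ≡ 0 × ((proj₁ B′ ∈ P 0 × proj₁ W′ ∈ P 1) ⊎ (proj₁ B′ ∈ P 1 × proj₁ W′ ∈ P 0)))
          two′ q≡2 p₀ p₁ with two q≡2 p₀ p₁
          ... | inj₁ (_ , uB∈ , uW∈) = at-i i refl i<q
            where
            at-i : ∀ k → k ≡ i → k < q → (1 ≤ k × proj₁ B′ ∈ P 1 × proj₁ W′ ∈ P 1) ⊎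
              (k ≡ 0 × ((proj₁ B′ ∈ P 0 × proj₁ W′ ∈ P 1) ⊎ (proj₁ B′ ∈ P 1 × proj₁ W′ ∈ P 0)))
            at-i (suc (suc k)) _ k<q = contradiction (≤-trans k<q (≤-reflexive q≡2)) λ { (s≤s (s≤s ())) }
            at-i (suc zero) refl k<q = inj₁ (s≤s z≤n ,
                [ (λ (_ , eq) → subst (_∈ P 1) (sym eq) uB∈) , (λ (_ , eq) → subst (_∈ P 1) (sym eq) (proj₁ sml)) ]′ (proj₂ (proj₂ (proj₂ B′))) ,
                [ (λ (_ , eq) → subst (_∈ P 1) (sym eq) uW∈) , (λ (_ , eq) → subst (_∈ P 1) (sym eq) (proj₂ sml)) ]′ (proj₂ (proj₂ (proj₂ W′))))
              where sml = IsItem.small it (≤-trans (≤-reflexive p₁) (s≤s z≤n))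
            at-i zero refl k<q = inj₂ (refl , cases (proj₂ (proj₂ (proj₂ B′))) (proj₂ (proj₂ (proj₂ W′))))
              where
              sml = IsItem.small it (≤-trans (≤-reflexive p₀) (s≤s z≤n))
              cases : (bl (P 0) ≡ 0 × proj₁ B′ ≡ uB) ⊎ (bl (P 0) ≢ 0 × proj₁ B′ ≡ repB (X 0)) →
                      (entry (X 0) 0 ≡ 0 × proj₁ W′ ≡ uW) ⊎ (entry (X 0) 0 ≢ 0 × proj₁ W′ ≡ repW (X 0)) →
                      (proj₁ B′ ∈ P 0 × proj₁ W′ ∈ P 1) ⊎ (proj₁ B′ ∈ P 1 × proj₁ W′ ∈ P 0)
              cases (inj₁ (_ , eq)) (inj₂ (_ , eq′)) =
                inj₂ (subst (_∈ P 1) (sym eq) uB∈ , subst (_∈ P 0) (sym eq′) (proj₂ sml))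
              cases (inj₂ (_ , eq)) (inj₁ (_ , eq′)) =
                inj₁ (subst (_∈ P 0) (sym eq) (proj₁ sml) , subst (_∈ P 1) (sym eq′) uW∈)
              -- The only vertex of part 0 has one colour and not both, so neither none nor both of
              -- the representatives can be replaced.
              cases (inj₁ (z , _)) (inj₁ (z′ , _)) = contradiction (∉B⇒W (bl≡0 {P 0} z (proj₁ sml)))
                (entry≡0 0 i<q z′ (proj₁ sml))
              cases (inj₂ (nz , _)) (inj₂ (nz′ , _)) =
                let u , u∈ , u∈B = bl≢0 (P 0) nz ; v , v∈ , v∈W = entry≢0 0 i<q nz′
                in contradiction (subst (_∈ B) (singleton-unique (P 0) p₀ u∈ v∈) u∈B) (W⇒∉B v∈W)
          ... | inj₂ ()

-- The stack of items and the splitting of pairs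

nth-snoc : ∀ {A : Set} (d : A) xs x i → i < length (xs ++ₗ x ∷ []) →
           (i < length xs × nth d (xs ++ₗ x ∷ []) i ≡ nth d xs i) ⊎ (i ≡ length xs × nth d (xs ++ₗ x ∷ []) i ≡ x)
nth-snoc d []       x zero    _ = inj₂ (refl , refl)
nth-snoc d []       x (suc i) (s≤s ())
nth-snoc d (y ∷ xs) x zero    _ = inj₁ (s≤s z≤n , refl)
nth-snoc d (y ∷ xs) x (suc i) (s≤s i<) with nth-snoc d xs x i i<
... | inj₁ (lt , eq) = inj₁ (s≤s lt , eq)
... | inj₂ (lt , eq) = inj₂ (cong suc lt , eq)

nth-all : ∀ {A : Set} {P : A → Set} {d xs} → All P xs → ∀ i → i < length xs → P (nth d xs i)
nth-all (p ∷ ps) zero    _        = p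
nth-all (p ∷ ps) (suc i) (s≤s i<) = nth-all ps i i<

length-snoc : ∀ {A : Set} (xs : List A) x → length (xs ++ₗ x ∷ []) ≡ length xs + 1
length-snoc xs x = length-++ xs

∣≟2∣ : ∀ s → (s ∸ 2) + (2 ∸ s) ≡ 0 → s ≡ 2
∣≟2∣ s eq = ≤-antisym (m∸n≡0⇒m≤n (m+n≡0⇒m≡0 (s ∸ 2) eq)) (m∸n≡0⇒m≤n (m+n≡0⇒n≡0 (s ∸ 2) eq))

module _ {n : ℕ} (G : BipartiteGraph n) where
  open BipartiteGraph G
  open Weighted G

  leafItem : Fin n → ItemData
  leafItem v = record
    { set = ⁅ v ⁆ ; ptr = record# (toℕ v) ; table = record# (toℕ v) + 5 ; repB = v ; repW = v
    ; entry = λ b → ifZero b (wt ⁅ v ⁆) 0 }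

  record Static (H : ℕ) (h : Heap) : Set where
    field
      powers : Kept H h (Powers n)
      edges  : Kept H h EdgeCells
      single : ∀ v → Stored H h (leafItem v)

  static-grow : ∀ {H w H′ w′} → Grow H w H′ w′ → Static H (heap w) → Static H′ (heap w′)
  static-grow g s = record { powers = kept-grow g (Static.powers s) ; edges = kept-grow g (Static.edges s)
                           ; single = λ v → stored-grow g (Static.single s v) }

  -- The end of the stack needs no null address, because the numbers of children in the tokens tell
  -- how many items may be popped.
  data StackAt (H : ℕ) (h : Heap) : ℕ → List ItemData → Set where
    []   : ∀ {stk} → StackAt H h stk []
    push : ∀ {stk next X Xs} → Kept H h (λ h → h stk ≡ ptr X × h (stk + 1) ≡ next) → Stored H h X →
           StackAt H h next Xs → StackAt H h stk (X ∷ Xs)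

  stack-grow : ∀ {H w H′ w′ stk Xs} → Grow H w H′ w′ → StackAt H (heap w) stk Xs → StackAt H′ (heap w′) stk Xs
  stack-grow g []           = []
  stack-grow g (push k s t) = push (kept-grow g k) (stored-grow g s) (stack-grow g t)

  isItem-leaf : ∀ v → IsItem (leafItem v)
  isItem-leaf v = record
    { black = λ x∈ xB → x∈⁅x⁆ v , subst (_∈ B) (x∈⁅y⁆⇒x≡y v x∈) xB
    ; white = λ x∈ xW → x∈⁅x⁆ v , subst (_∈ W) (x∈⁅y⁆⇒x≡y v x∈) xW
    ; small = λ _ → x∈⁅x⁆ v , x∈⁅x⁆ v
    ; pair  = λ eq → contradiction (trans (sym (∣⁅x⁆∣≡1 v)) eq) λ ()
    ; sound = sound
    ; complete = complete }
    where
    biclique : Biclique G ⁅ v ⁆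
    biclique {x} {y} x∈ y∈ = let x∈v , xB = x∈p∩q⁻ ⁅ v ⁆ B x∈ ; y∈v , yW = x∈p∩q⁻ ⁅ v ⁆ W y∈ in
      contradiction (subst (_∈ B) (trans (x∈⁅y⁆⇒x≡y v x∈v) (sym (x∈⁅y⁆⇒x≡y v y∈v))) xB) (W⇒∉B yW)
    onlyBlack : ∀ {C} → C ⊆ ⁅ v ⁆ → bl C ≢ 0 → wt C ≡ 0
    onlyBlack {C} C⊆ ne with nonempty? (C ∩ B)
    ... | no e = contradiction (∣∣-empty (C ∩ B) e) ne
    ... | yes (x , x∈) = let x∈C , xB = x∈p∩q⁻ C B x∈ in
      noWhite {C} (λ y∈ yW → W⇒∉B yW (subst (_∈ B) (trans (x∈⁅y⁆⇒x≡y v (C⊆ x∈C)) (sym (x∈⁅y⁆⇒x≡y v (C⊆ y∈)))) xB))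
    sound : ∀ b → b ≤ bl ⁅ v ⁆ → Attained ⁅ v ⁆ b (ifZero b (wt ⁅ v ⁆) 0)
    sound zero    b≤ = ⁅ v ⁆ , id , biclique , z≤n , refl
    sound (suc b) b≤ = ⁅ v ⁆ , id , biclique , b≤ , onlyBlack id (λ eq → contradiction (≤-trans b≤ (≤-reflexive eq)) λ ())
    complete : ∀ C → C ⊆ ⁅ v ⁆ → Biclique G C → wt C ≤ ifZero (bl C) (wt ⁅ v ⁆) 0
    complete C C⊆ _ with bl C ≟ 0 | nonempty? C
    ... | no ne | _ rewrite onlyBlack C⊆ ne = z≤n
    ... | yes eq | no e rewrite noWhite {C} (λ v∈ _ → e (_ , v∈)) = z≤n
    ... | yes eq | yes (x , x∈) rewrite eq = ≤-reflexive (cong wt (⊆-antisym C⊆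
      (λ y∈ → subst (_∈ C) (trans (x∈⁅y⁆⇒x≡y v (C⊆ x∈)) (sym (x∈⁅y⁆⇒x≡y v y∈))) x∈)))

  -- An augmenting vertex may tell apart the two vertices of a part that is a
  -- pair of one colour.  With all items of size two split, every part is
  -- homogeneous, so its adjacency to other parts can be tested on representatives.

  pieces : ItemData → List ItemData
  pieces V with ∣ set V ∣ ≟ 2
  ... | yes _ = leafItem (repB V) ∷ leafItem (repW V) ∷ []
  ... | no  _ = V ∷ []

  pieces-two : ∀ V → ∣ set V ∣ ≡ 2 → pieces V ≡ leafItem (repB V) ∷ leafItem (repW V) ∷ []
  pieces-two V eq with ∣ set V ∣ ≟ 2
  ... | yes _ = refl
  ... | no ne = contradiction eq ne

  pieces-one : ∀ V → ∣ set V ∣ ≢ 2 → pieces V ≡ V ∷ []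
  pieces-one V ne with ∣ set V ∣ ≟ 2
  ... | yes eq = contradiction eq ne
  ... | no _   = refl

  refine : List ItemData → List ItemData
  refine []       = []
  refine (V ∷ Vs) = pieces V ++ₗ refine Vs

  Pointers : ItemData → ℕ → List ItemData → Heap → Set
  Pointers d parts Xs h = ∀ i → i < length Xs → h (parts + i) ≡ ptr (nth d Xs i)

  pointers-snoc : ∀ {d parts Xs X h x} → Pointers d parts Xs h → x ≡ ptr X →
                  Pointers d parts (Xs ++ₗ X ∷ []) (h [ parts + length Xs ≔ x ])
  pointers-snoc {d} {parts} {Xs} {X} {h} {x} p eq i i< with nth-snoc d Xs X i i<
  ... | inj₁ (lt , e) = trans (update-other h x (λ eq → <⇒≢ lt (sym (+-cancelˡ-≡ parts _ i eq)))) (trans (p i lt) (cong ptr (sym e)))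
  ... | inj₂ (refl , e) = trans (update-same h _ x) (trans eq (cong ptr (sym e)))

  runs-expand : ∀ d {H stk w} {ρ : Vec ℕ Γ} Vs rest → StackAt H (heap w) stk (Vs ++ₗ rest) → Fresh H w →
    Runs expand (length Vs ∷ stk ∷ H ∷ ρ) w (length Vs * 1)
      (λ { (q ∷ stk′ ∷ []) w′ → Grow H w (H + (length Vs + length Vs)) w′ × q ≡ length (refine Vs) ×
             StackAt H (heap w) stk′ rest × Pointers d H (refine Vs) (heap w′) })
  runs-expand d {H} {stk} {w} {ρ} Vs₀ rest st₀ fresh₀ =
    runs-weaken ≤-refl (λ { (_ ∷ _ ∷ []) _ r → r })
      (runs-loop (go Vs₀ [] st₀ (grow-refl fresh₀ (m≤m+n H _)) ≤-refl (λ _ ())))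
    where
    a = length Vs₀
    K = H + (a + a)
    σ = a ∷ stk ∷ H ∷ ρ
    Final : List ItemData → Post 2
    Final Zs (q ∷ stk′ ∷ []) w″ = Grow H w K w″ × q ≡ length Zs × StackAt H (heap w) stk′ rest × Pointers d H Zs (heap w″)
    go : ∀ Vs Ys {stk w′} → StackAt H (heap w) stk (Vs ++ₗ rest) → Grow H w K w′ →
         length Ys + (length Vs + length Vs) ≤ a + a → Pointers d H Ys (heap w′) →
         LoopRuns expandPart σ (length Vs) (length Ys ∷ stk ∷ []) w′ (length Vs * 1)
           (Final (Ys ++ₗ refine Vs))
    go [] Ys {w′ = w′} st g le ps = loopRuns-zero (g , cong length (sym (++ₗ-identityʳ Ys)) , st ,
      subst (λ z → Pointers d H z (heap w′)) (sym (++ₗ-identityʳ Ys)) ps)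
    go (V ∷ Vs) Ys {stk} {w′} (push {next = next} k s t) g le ps = loopRuns-suc
      {R = R}
      (runs-ifz two one)
      λ { (_ ∷ _ ∷ []) w″ (g″ , refl , refl , ps″) →
          subst (λ Zs → LoopRuns expandPart σ (length Vs) _ w″ _ (Final Zs)) (++ₗ-assoc Ys (pieces V) (refine Vs))
            (go Vs (Ys ++ₗ pieces V) t g″ (fits (length (Ys ++ₗ pieces V)) (≤-trans (≤-reflexive (length-++ Ys)) (+-monoʳ-≤ (length Ys) (pieces-length V)))) ps″) }
      where
      R : Post 2
      R (q ∷ stk′ ∷ []) w″ = Grow H w K w″ × q ≡ length (Ys ++ₗ pieces V) × stk′ ≡ next ×
                             Pointers d H (Ys ++ₗ pieces V) (heap w″)
      y = length Ys
      v = length Vs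
      pieces-length : ∀ V → length (pieces V) ≤ 2
      pieces-length V with ∣ set V ∣ ≟ 2
      ... | yes _ = ≤-refl
      ... | no  _ = s≤s z≤n
      le′ : (y + 2) + (v + v) ≤ a + a
      le′ = ≤-trans (≤-reflexive (trans (+-assoc y 2 (v + v)) (cong (λ z → y + suc z) (sym (+-suc v v))))) le
      fits : ∀ z → z ≤ y + 2 → z + (v + v) ≤ a + a
      fits z z≤ = ≤-trans (+-monoˡ-≤ (v + v) z≤) le′
      y+1< : y + 1 < a + a
      y+1< = ≤-trans (≤-reflexive (sym (+-suc y 1))) (≤-trans (m≤m+n (y + 2) (v + v)) le′)
      y< : y < a + a
      y< = ≤-trans (s≤s (m≤m+n y 1)) y+1<
      open Stored s
      size≡′ : heap w′ (heap w′ stk) ≡ ∣ set V ∣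
      size≡′ = trans (cong (heap w′) (proj₁ (kept-in g k))) (ItemCells.size≡ (kept-in g cells))
      two : (heap w′ (heap w′ stk) ∸ 2) + (2 ∸ heap w′ (heap w′ stk)) ≡ 0 →
            Runs expandTwo (y ∷ stk ∷ v ∷ σ) w′ 0 R
      two z = runs-poke (runs-poke (runs-return
              (g₂ , trans (sym (+-assoc y 1 1)) (trans (cong (_+ 1) (sym (length-snoc Ys b))) (sym len₂))
              , proj₂ (kept-in g₂ k) , subst (λ Zs → Pointers d H Zs (heap w₁ [ H + (y + 1) ≔ x₂ ])) Zs≡ ps₂)))
        where
        b = leafItem (repB V)
        c = leafItem (repW V)
        x₁ = record# (heap w′ (heap w′ stk + 2))
        x₁≡ : x₁ ≡ ptr b
        x₁≡ = cong record# (trans (cong (λ z → heap w′ (z + 2)) (proj₁ (kept-in g k))) (ItemCells.repB≡ (kept-in g cells)))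
        w₁ = pokeWorld w′ (H + y) x₁
        g₁ : Grow H w K w₁
        g₁ = grow-poke (m≤m+n H y) (+-monoʳ-< H y<) g
        x₂ = record# (heap w₁ (heap w₁ stk + 3))
        x₂≡ : x₂ ≡ ptr c
        x₂≡ = cong record# (trans (cong (λ z → heap w₁ (z + 3)) (proj₁ (kept-in g₁ k))) (ItemCells.repW≡ (kept-in g₁ cells)))
        g₂ : Grow H w K (pokeWorld w₁ (H + (y + 1)) x₂)
        g₂ = grow-poke (m≤m+n H (y + 1)) (+-monoʳ-< H y+1<) g₁
        ps₂ : Pointers d H ((Ys ++ₗ b ∷ []) ++ₗ c ∷ []) (heap w₁ [ H + (y + 1) ≔ x₂ ])
        ps₂ = subst (λ z → Pointers d H ((Ys ++ₗ b ∷ []) ++ₗ c ∷ []) (heap w₁ [ H + z ≔ x₂ ])) (length-snoc Ys b)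
                (pointers-snoc {d} {Xs = Ys ++ₗ b ∷ []} {X = c} {h = heap w₁} (pointers-snoc {d} {Xs = Ys} {X = b} {h = heap w′} ps x₁≡) x₂≡)
        Zs≡ : (Ys ++ₗ b ∷ []) ++ₗ c ∷ [] ≡ Ys ++ₗ pieces V
        Zs≡ = trans (++ₗ-assoc Ys (b ∷ []) (c ∷ []))
                (cong (Ys ++ₗ_) (sym (pieces-two V (trans (sym size≡′) (∣≟2∣ _ z)))))
        len₂ : length (Ys ++ₗ pieces V) ≡ length (Ys ++ₗ b ∷ []) + 1
        len₂ = trans (cong length (sym Zs≡)) (length-snoc (Ys ++ₗ b ∷ []) c)
      one : (heap w′ (heap w′ stk) ∸ 2) + (2 ∸ heap w′ (heap w′ stk)) ≢ 0 →
            Runs expandOne (y ∷ stk ∷ v ∷ σ) w′ 0 R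
      one nz =
        runs-poke (runs-return (g₁ , trans (sym (length-snoc Ys V)) (cong length Zs≡) , proj₂ (kept-in g₁ k) ,
          subst (λ Zs → Pointers d H Zs (heap w′ [ H + y ≔ heap w′ stk ])) Zs≡ (pointers-snoc {d} {Xs = Ys} {X = V} {h = heap w′} ps (proj₁ (kept-in g k)))))
        where
        g₁ : Grow H w K (pokeWorld w′ (H + y) (heap w′ stk))
        g₁ = grow-poke (m≤m+n H y) (+-monoʳ-< H y<) g
        Zs≡ : Ys ++ₗ V ∷ [] ≡ Ys ++ₗ pieces V
        Zs≡ = cong (Ys ++ₗ_) (sym (pieces-one V λ ≡2 → nz (cong (λ z → (z ∸ 2) + (2 ∸ z)) (trans size≡′ ≡2))))

-- Combining the children of a node

∣pair∣ : ∀ {n} {u v : Fin n} → u ≢ v → ∣ ⁅ u ⁆ ∪ ⁅ v ⁆ ∣ ≡ 2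
∣pair∣ {u = u} {v} u≢v = trans (∣∣-sum (∪-isSum {A = ⁅ u ⁆} {⁅ v ⁆} λ x∈u x∈v →
  u≢v (trans (sym (x∈⁅y⁆⇒x≡y u x∈u)) (x∈⁅y⁆⇒x≡y v x∈v)))) (cong₂ _+_ (∣⁅x⁆∣≡1 u) (∣⁅x⁆∣≡1 v))

pair⊆ : ∀ {n} {C : Subset n} {u v} → u ∈ C → v ∈ C → ⁅ u ⁆ ∪ ⁅ v ⁆ ⊆ C
pair⊆ {C = C} {u} {v} u∈ v∈ x∈ = [ (λ x∈u → subst (_∈ C) (sym (x∈⁅y⁆⇒x≡y u x∈u)) u∈)
                                 , (λ x∈v → subst (_∈ C) (sym (x∈⁅y⁆⇒x≡y v x∈v)) v∈) ]′ (x∈p∪q⁻ ⁅ u ⁆ ⁅ v ⁆ x∈)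

pair≡ : ∀ {n} (C : Subset n) {u v} → ∣ C ∣ ≡ 2 → u ≢ v → u ∈ C → v ∈ C → ⁅ u ⁆ ∪ ⁅ v ⁆ ≡ C
pair≡ C {u} {v} eq u≢v u∈ v∈ = ⊆-antisym (pair⊆ u∈ v∈) λ {x} x∈ → inside′ x x∈
  where
  inside′ : ∀ x → x ∈ C → x ∈ ⁅ u ⁆ ∪ ⁅ v ⁆
  inside′ x x∈ with x ∈? ⁅ u ⁆ ∪ ⁅ v ⁆
  ... | yes y = y
  ... | no n  = contradiction (p⊂q⇒∣p∣<∣q∣ (pair⊆ u∈ v∈ , x , x∈ , n))
                  (<-irrefl (trans (∣pair∣ u≢v) (sym eq)))

-- Loop iterations of `combine` on at most Q parts, in units of E: Q to expand, Q for the
-- statistics, and for each of the 2 ^ Q masks its Q digits, Q rounds of conflict test and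
-- convolution, and the maximum.
combineCost : ℕ → ℕ
combineCost Q = Q + (Q + 2 ^ Q * suc (Q + (Q * suc (Q + 2) + 2)))

module _ {n : ℕ} (G : BipartiteGraph n) where
  open BipartiteGraph G
  open Weighted G
  private
    leaf′ : Fin n → ItemData
    leaf′ = leafItem G
    refine′ : List ItemData → List ItemData
    refine′ = refine G
    pieces′ : ItemData → List ItemData
    pieces′ = pieces G

  Disj : ItemData → ItemData → Set
  Disj X Y = ∀ {v} → v ∈ set X → v ∉ set Y

  unionOf : List ItemData → Subset n
  unionOf Vs = ⋃ (map set Vs)

  Good : Subset n → Set
  Good M = ∣ M ∣ ≡ 2 ⊎ Homogeneous M

  record Children (Vs : List ItemData) : Set where
    field
      items    : All IsItem Vs
      disjoint : AllPairs Disj Vs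
      nonempty : All (λ V → Nonempty (set V)) Vs
      good     : All (λ V → Good (set V)) Vs
      two      : 2 ≤ length Vs

  refine-all : ∀ {P Q : ItemData → Set} → (∀ {V} → Q V → ∣ set V ∣ ≡ 2 → ∀ v → v ∈ set V → P (leaf′ v)) →
               (∀ {V} → Q V → ∣ set V ∣ ≢ 2 → P V) → ∀ {Vs} → All IsItem Vs → All Q Vs → All P (refine′ Vs)
  refine-all f g [] [] = []
  refine-all {P} f g {V ∷ Vs} (i ∷ is) (q ∷ qs) = All.++⁺ first (refine-all f g is qs)
    where
    first : All P (pieces′ V)
    first with ∣ set V ∣ ≟ 2
    ... | yes eq = let b∈ , w∈ = IsItem.small i (≤-reflexive eq) in f q eq _ b∈ ∷ f q eq _ w∈ ∷ []
    ... | no ne  = g q ne ∷ []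

  pieces-union : ∀ V Ys → IsItem V → unionOf (pieces′ V ++ₗ Ys) ≡ set V ∪ unionOf Ys
  pieces-union V Ys i with ∣ set V ∣ ≟ 2
  ... | no ne  = refl
  ... | yes eq = trans (sym (∪-assoc ⁅ repB V ⁆ ⁅ repW V ⁆ (unionOf Ys)))
    (cong (_∪ unionOf Ys) (pair≡ (set V) eq (IsItem.pair i eq) (proj₁ (IsItem.small i (≤-reflexive eq)))
                                             (proj₂ (IsItem.small i (≤-reflexive eq)))))

  refine-union : ∀ {Vs} → All IsItem Vs → unionOf (refine′ Vs) ≡ unionOf Vs
  refine-union []                  = refl
  refine-union {V ∷ Vs} (i ∷ is) = trans (pieces-union V (refine′ Vs) i) (cong (set V ∪_) (refine-union is))

  refine-disjoint : ∀ {Vs} → All IsItem Vs → AllPairs Disj Vs → AllPairs Disj (refine′ Vs)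
  refine-disjoint [] [] = []
  refine-disjoint {V ∷ Vs} (i ∷ is) (d ∷ ds) = AllPairs.++⁺ first (refine-disjoint is ds) cross
    where
    apart : ∀ M → M ⊆ set V → All (λ Y → ∀ {v} → v ∈ M → v ∉ set Y) (refine′ Vs)
    apart M M⊆ = refine-all {P = λ Y → ∀ {v} → v ∈ M → v ∉ set Y} {Q = Disj V}
      (λ d _ u u∈ v∈M v∈u → d (M⊆ v∈M) (subst (_∈ _) (sym (x∈⁅y⁆⇒x≡y u v∈u)) u∈))
      (λ d _ v∈M v∈ → d (M⊆ v∈M) v∈) is d
    singleton⊆ : ∀ u → u ∈ set V → ⁅ u ⁆ ⊆ set V
    singleton⊆ u u∈ v∈ = subst (_∈ set V) (sym (x∈⁅y⁆⇒x≡y u v∈)) u∈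
    first : AllPairs Disj (pieces′ V)
    first with ∣ set V ∣ ≟ 2
    ... | no ne  = [] ∷ []
    ... | yes eq = ((λ x∈b x∈w → IsItem.pair i eq (trans (sym (x∈⁅y⁆⇒x≡y _ x∈b)) (x∈⁅y⁆⇒x≡y _ x∈w))) ∷ []) ∷ [] ∷ []
    cross : All (λ X → All (Disj X) (refine′ Vs)) (pieces′ V)
    cross with ∣ set V ∣ ≟ 2
    ... | no ne  = apart (set V) id ∷ []
    ... | yes eq = let b∈ , w∈ = IsItem.small i (≤-reflexive eq) in
      apart _ (singleton⊆ _ b∈) ∷ apart _ (singleton⊆ _ w∈) ∷ []

  refine-length : ∀ Vs → length Vs ≤ length (refine′ Vs)
  refine-length []       = z≤n
  refine-length (V ∷ Vs) rewrite length-++ (pieces′ V) {refine′ Vs} = +-mono-≤ first (refine-length Vs)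
    where
    first : 1 ≤ length (pieces′ V)
    first with ∣ set V ∣ ≟ 2
    ... | no _  = ≤-refl
    ... | yes _ = s≤s z≤n

  refine-length′ : ∀ Vs → length (refine′ Vs) ≤ length Vs + length Vs
  refine-length′ []       = z≤n
  refine-length′ (V ∷ Vs) rewrite length-++ (pieces′ V) {refine′ Vs} =
    ≤-trans (+-mono-≤ first (refine-length′ Vs)) (≤-reflexive (cong suc (sym (+-suc (length Vs) (length Vs)))))
    where
    first : length (pieces′ V) ≤ 2
    first with ∣ set V ∣ ≟ 2
    ... | no _  = s≤s z≤n
    ... | yes _ = ≤-refl

  disjoint-nth : ∀ d {Xs} → AllPairs Disj Xs → ∀ i j v → i < length Xs → j < length Xs →
                 v ∈ set (nth d Xs i) → v ∈ set (nth d Xs j) → i ≡ j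
  disjoint-nth d (p ∷ ps) zero    zero    v _ _ _ _ = refl
  disjoint-nth d (p ∷ ps) zero    (suc j) v _ (s≤s j<) v∈ v∈′ = contradiction v∈′ (nth-all p j j< v∈)
  disjoint-nth d (p ∷ ps) (suc i) zero    v (s≤s i<) _ v∈ v∈′ = contradiction v∈ (nth-all p i i< v∈′)
  disjoint-nth d (p ∷ ps) (suc i) (suc j) v (s≤s i<) (s≤s j<) v∈ v∈′ = cong suc (disjoint-nth d ps i j v i< j< v∈ v∈′)

  homogeneous-leaf : ∀ v → Homogeneous ⁅ v ⁆
  homogeneous-leaf v {u} _ x∈ y∈ _ _ = subst (Adj u) (trans (x∈⁅y⁆⇒x≡y v x∈) (sym (x∈⁅y⁆⇒x≡y v y∈)))

  ∣∣≥1 : ∀ {C : Subset n} → Nonempty C → 1 ≤ ∣ C ∣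
  ∣∣≥1 {C} (v , v∈) = n≢0⇒n>0 λ eq → ∣∣≡0⇒empty C eq (v , v∈)

  -- The number u stands for the size of the union accumulated when M is convolved into it. Both lie
  -- disjointly in a set of size s.
  Bounded : ℕ → ℕ → Subset n → Set
  Bounded E s M = ∀ u → u + ∣ M ∣ ≤ s → (u + 1) * (∣ M ∣ + 1) ≤ E

  NewItem : (S : Subset n) (rest : List ItemData) (H : ℕ) (w : World) → Post 2
  NewItem S rest H w (stk ∷ H′ ∷ []) w′ =
    Grow H w H′ w′ × ∃ λ V → set V ≡ S × StackAt G H′ (heap w′) stk (V ∷ rest)

  module NewRecord (s b rB rW R stk H : ℕ) (w : World) where
    p₀ = pokeWorld w H s
    p₁ = pokeWorld p₀ (H + 1) b
    p₂ = pokeWorld p₁ (H + 2) rB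
    p₃ = pokeWorld p₂ (H + 3) rW
    p₄ = pokeWorld p₃ (H + 4) R
    p₅ = pokeWorld p₄ (H + 5) H
    p₆ = pokeWorld p₅ (H + 6) stk

    h₀ = heap w [ H ≔ s ]
    h₁ = h₀ [ H + 1 ≔ b ]
    h₂ = h₁ [ H + 2 ≔ rB ]
    h₃ = h₂ [ H + 3 ≔ rW ]
    h₄ = h₃ [ H + 4 ≔ R ]
    h₅ = h₄ [ H + 5 ≔ H ]
    h₆ = h₅ [ H + 6 ≔ stk ]

    growth : Fresh H w → Grow H w (H + 7) p₆
    growth f = poke′ 6 (s≤s (s≤s (s≤s (s≤s (s≤s (s≤s (s≤s z≤n)))))))
      (poke′ 5 (s≤s (s≤s (s≤s (s≤s (s≤s (s≤s z≤n))))))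
      (poke′ 4 (s≤s (s≤s (s≤s (s≤s (s≤s z≤n)))))
      (poke′ 3 (s≤s (s≤s (s≤s (s≤s z≤n))))
      (poke′ 2 (s≤s (s≤s (s≤s z≤n)))
      (poke′ 1 (s≤s (s≤s z≤n))
      (grow-poke ≤-refl (m<m+n H (s≤s z≤n)) (grow-refl f (m≤m+n H 7))))))))
      where
      poke′ : ∀ {w′ x} i → i < 7 → Grow H w (H + 7) w′ → Grow H w (H + 7) (pokeWorld w′ (H + i) x)
      poke′ i i<7 = grow-poke (m≤m+n H i) (+-monoʳ-< H i<7)

    field₀ : h₆ H ≡ s
    field₀ = skip₀ h₅ H 5 (skip₀ h₄ H 4 (skip₀ h₃ H 3 (skip₀ h₂ H 2 (skip₀ h₁ H 1 (skip₀ h₀ H 0 (update-same (heap w) H s))))))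
    field₁ : h₆ (H + 1) ≡ b
    field₁ = skip h₅ H 6 1 (λ ()) (skip h₄ H 5 1 (λ ()) (skip h₃ H 4 1 (λ ()) (skip h₂ H 3 1 (λ ()) (skip h₁ H 2 1 (λ ())
      (update-same h₀ (H + 1) b)))))
    field₂ : h₆ (H + 2) ≡ rB
    field₂ = skip h₅ H 6 2 (λ ()) (skip h₄ H 5 2 (λ ()) (skip h₃ H 4 2 (λ ()) (skip h₂ H 3 2 (λ ()) (update-same h₁ (H + 2) rB))))
    field₃ : h₆ (H + 3) ≡ rW
    field₃ = skip h₅ H 6 3 (λ ()) (skip h₄ H 5 3 (λ ()) (skip h₃ H 4 3 (λ ()) (update-same h₂ (H + 3) rW)))
    field₄ : h₆ (H + 4) ≡ R
    field₄ = skip h₅ H 6 4 (λ ()) (skip h₄ H 5 4 (λ ()) (update-same h₃ (H + 4) R))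
    field₅ : h₆ (H + 5) ≡ H
    field₅ = skip h₅ H 6 5 (λ ()) (update-same h₄ (H + 5) H)
    field₆ : h₆ (H + 6) ≡ stk
    field₆ = update-same h₅ (H + 6) stk

  module _ {V₀ : ItemData} {Vs₀ rest : List ItemData} (ch : Children (V₀ ∷ Vs₀)) where
    private
      Vs = V₀ ∷ Vs₀
      Xs = refine′ Vs
      module C = Children ch

      items : All IsItem Xs
      items = refine-all {Q = IsItem} (λ _ _ v _ → isItem-leaf G v) (λ i _ → i) C.items C.items

      nonempties : All (λ X → Nonempty (set X)) Xs
      nonempties = refine-all (λ _ _ v _ → v , x∈⁅x⁆ v) (λ ne _ → ne) C.items C.nonempty

      homogeneities : All (λ X → Homogeneous (set X)) Xs
      homogeneities = refine-all {P = λ X → Homogeneous (set X)} {Q = λ V → Good (set V)} (λ _ _ v _ → homogeneous-leaf v)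
        (λ { (inj₁ eq) ne → contradiction eq ne ; (inj₂ h) _ → h }) C.items C.good

    open Combination G V₀ Xs (nth-all items) (disjoint-nth V₀ (refine-disjoint C.items C.disjoint)) (nth-all homogeneities)

    S≡ : S ≡ unionOf Vs
    S≡ = refine-union C.items

    private
      2≤q : 2 ≤ q
      2≤q = ≤-trans C.two (refine-length Vs)

      P≥1 : ∀ i → i < q → 1 ≤ ∣ P i ∣
      P≥1 i i<q = ∣∣≥1 (nth-all nonempties i i<q)

      U≥ : ∀ k i → k + i ≡ q → k ≤ ∣ U i ∣
      U≥ zero    i eq = z≤n
      U≥ (suc k) i eq = ≤-trans (+-mono-≤ (P≥1 i i<q) (U≥ k (suc i) (trans (+-suc k i) eq)))
        (≤-reflexive (sym (∣∣-sum (U-sum i i<q))))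
        where i<q = ≤-trans (m≤n+m (suc i) k) (≤-reflexive (trans (+-suc k i) eq))

      q≤∣S∣ : q ≤ ∣ S ∣
      q≤∣S∣ = U≥ q 0 (+-identityʳ q)

      -- The number of masks is looked up, and the table of powers ends at 2 ^ n.
      q≤n : q ≤ n
      q≤n = ≤-trans q≤∣S∣ (∣p∣≤n S)

      U-mono : ∀ j → j ≤ q → ∣ U j ∣ ≤ ∣ S ∣
      U-mono zero    _   = ≤-refl
      U-mono (suc j) j<q = ≤-trans (≤-trans (m≤n+m _ ∣ P j ∣) (≤-reflexive (sym (∣∣-sum (U-sum j j<q))))) (U-mono j (<⇒≤ j<q))

      costBound : ∀ {E} → All (λ V → Bounded E ∣ S ∣ (set V)) Vs → 2 * ∣ S ∣ ≤ E → CostBound E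
      costBound {E} bs 2s≤E j j<q = ≤-trans
        (*-mono-≤ (+-monoˡ-≤ 1 (∣p∩q∣≤∣p∣ (U (suc j)) B)) (+-monoˡ-≤ 1 (∣p∩q∣≤∣p∣ (P j) B)))
        (nth-all bounds j j<q ∣ U (suc j) ∣
          (≤-trans (≤-reflexive (trans (+-comm ∣ U (suc j) ∣ _) (sym (∣∣-sum (U-sum j j<q))))) (U-mono j (<⇒≤ j<q))))
        where
        bounds : All (λ X → Bounded E ∣ S ∣ (set X)) Xs
        bounds = refine-all
          -- For a vertex split off from a pair, u + 1 is at most the size of S and the other factor
          -- is 2.
          (λ _ _ v _ u u≤ → ≤-trans (*-mono-≤ (≤-trans (≤-reflexive (cong (u +_) (sym (∣⁅x⁆∣≡1 v)))) u≤)
              (≤-reflexive (cong (_+ 1) (∣⁅x⁆∣≡1 v)))) (≤-trans (≤-reflexive (*-comm ∣ S ∣ 2)) 2s≤E))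
          (λ b _ → b) C.items bs

    newData : ∀ {s b rB rW R H h} → Summary 0 s b rB rW → Best G S (λ C → 0 ≤ value q (flagsOf C)) R H h → ℕ → ItemData
    newData {R = R} sm bst p = record
      { set = S ; ptr = p ; table = R ; repB = Summary.uB sm ; repW = Summary.uW sm ; entry = Best.best bst }

    newItem : ∀ {s b rB rW R H h} (sm : Summary 0 s b rB rW) (bst : Best G S (λ C → 0 ≤ value q (flagsOf C)) R H h) p →
              IsItem (newData sm bst p)
    newItem sm bst p = record
      { black = black ; white = white ; small = λ s≤2 → reps (sizes s≤2)
      ; pair = λ eq → pair′ eq (sizes (≤-reflexive eq))
      ; sound = sound ; complete = λ C C⊆ bc → complete C C⊆ bc z≤n }
      where
      open Summary sm
      open Best bst
      sizes : ∣ S ∣ ≤ 2 → q ≡ 2 × ∣ P 0 ∣ ≡ 1 × ∣ P 1 ∣ ≡ 1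
      sizes s≤2 = ≤-antisym (≤-trans q≤∣S∣ s≤2) 2≤q ,
        ≤-antisym (+-cancelʳ-≤ 1 _ 1 (≤-trans (+-monoʳ-≤ ∣ P 0 ∣ (≤-trans (P≥1 1 2≤q) P1≤)) total)) (P≥1 0 1≤q) ,
        ≤-antisym (≤-trans P1≤ (+-cancelˡ-≤ 1 _ 1 (≤-trans (+-monoˡ-≤ ∣ U 1 ∣ (P≥1 0 1≤q)) total))) (P≥1 1 2≤q)
        where
        1≤q = ≤-trans (s≤s z≤n) 2≤q
        total : ∣ P 0 ∣ + ∣ U 1 ∣ ≤ 2
        total = ≤-trans (≤-reflexive (sym (∣∣-sum (U-sum 0 1≤q)))) s≤2
        P1≤ : ∣ P 1 ∣ ≤ ∣ U 1 ∣
        P1≤ = ≤-trans (m≤m+n _ _) (≤-reflexive (sym (∣∣-sum (U-sum 1 2≤q))))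
      Reps : Set
      Reps = (uB ∈ P 0 × uW ∈ P 1) ⊎ (uB ∈ P 1 × uW ∈ P 0)
      reps′ : q ≡ 2 × ∣ P 0 ∣ ≡ 1 × ∣ P 1 ∣ ≡ 1 → Reps
      reps′ (q≡2 , p₀ , p₁) with two q≡2 p₀ p₁
      ... | inj₁ (() , _)
      ... | inj₂ (_ , r) = r
      in₀ : P 0 ⊆ S
      in₀ = P⊆U 0 (≤-trans (s≤s z≤n) 2≤q)
      in₁ : P 1 ⊆ S
      in₁ = P⊆U 1 2≤q
      reps : q ≡ 2 × ∣ P 0 ∣ ≡ 1 × ∣ P 1 ∣ ≡ 1 → uB ∈ S × uW ∈ S
      reps sz with reps′ sz
      ... | inj₁ (b∈ , w∈) = in₀ b∈ , in₁ w∈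
      ... | inj₂ (b∈ , w∈) = in₁ b∈ , in₀ w∈
      pair′ : ∣ S ∣ ≡ 2 → q ≡ 2 × ∣ P 0 ∣ ≡ 1 × ∣ P 1 ∣ ≡ 1 → uB ≢ uW
      pair′ eq sz same with reps′ sz
      ... | inj₁ (b∈ , w∈) = contradiction (disjoint-nth V₀ (refine-disjoint C.items C.disjoint) 0 1 uB
              (≤-trans (s≤s z≤n) 2≤q) 2≤q b∈ (subst (_∈ P 1) (sym same) w∈)) λ ()
      ... | inj₂ (b∈ , w∈) = contradiction (disjoint-nth V₀ (refine-disjoint C.items C.disjoint) 0 1 uB
              (≤-trans (s≤s z≤n) 2≤q) 2≤q (subst (_∈ P 0) (sym same) w∈) b∈) λ ()

    cost : ℕ → ℕ
    cost E = length Vs * 1 + (q * 1 + (2 ^ q * suc (tryMaskCost E) + 0))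

    cost≤ : ∀ {E Q} → ∣ S ∣ + 1 ≤ E → q ≤ Q → cost E ≤ combineCost Q * E
    cost≤ {E} {Q} s≤E q≤Q = begin
      length Vs * 1 + (q * 1 + (2 ^ q * suc (tryMaskCost E) + 0))
        ≡⟨ cong₂ _+_ (*-identityʳ (length Vs)) (cong₂ _+_ (*-identityʳ q) (+-identityʳ (2 ^ q * suc (tryMaskCost E)))) ⟩
      length Vs + (q + 2 ^ q * suc (tryMaskCost E))
        ≤⟨ +-mono-≤ (scale (≤-trans (refine-length Vs) q≤Q)) (+-mono-≤ (scale q≤Q)
             (*-mono-≤ (^-monoʳ-≤ 2 q≤Q) inner)) ⟩
      Q * E + (Q * E + 2 ^ Q * (suc (Q + (Q * suc (Q + 2) + 2)) * E))
        ≡⟨ cong (λ z → Q * E + (Q * E + z)) (*-assoc (2 ^ Q) _ E) ⟨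
      Q * E + (Q * E + 2 ^ Q * suc (Q + (Q * suc (Q + 2) + 2)) * E)
        ≡⟨ cong (Q * E +_) (*-distribʳ-+ E Q _) ⟨
      Q * E + (Q + 2 ^ Q * suc (Q + (Q * suc (Q + 2) + 2))) * E
        ≡⟨ *-distribʳ-+ E Q _ ⟨
      combineCost Q * E ∎
      where
      open ≤-Reasoning
      1≤E : 1 ≤ E
      1≤E = ≤-trans (m≤n+m 1 ∣ S ∣) s≤E
      scale : ∀ {x y} → x ≤ y → x ≤ y * E
      scale {x} {y} x≤y = ≤-trans (≤-reflexive (sym (*-identityʳ x))) (*-mono-≤ x≤y 1≤E)
      inner : suc (tryMaskCost E) ≤ suc (Q + (Q * suc (Q + 2) + 2)) * E
      inner = begin
        suc (q * 1 + (q * suc (q * 1 + 2 * E) + ((bl S + 1) * 1 + 0)))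
          ≡⟨ cong₂ (λ x y → suc (x + (q * suc (x + 2 * E) + y))) (*-identityʳ q) (trans (+-identityʳ _) (*-identityʳ _)) ⟩
        1 + (q + (q * (1 + (q + 2 * E)) + (bl S + 1)))
          ≤⟨ +-mono-≤ 1≤E (+-mono-≤ (scale q≤Q) (+-mono-≤ (*-mono-≤ q≤Q
               (+-mono-≤ 1≤E (+-monoˡ-≤ (2 * E) (scale q≤Q))))
               (≤-trans (+-monoˡ-≤ 1 (∣p∩q∣≤∣p∣ S B)) (≤-trans s≤E (m≤n*m E 2))))) ⟩
        E + (Q * E + (Q * (E + (Q * E + 2 * E)) + 2 * E))
          ≡⟨ expand′ E Q ⟩
        suc (Q + (Q * suc (Q + 2) + 2)) * E ∎
        where
        expand′ : ∀ E Q → E + (Q * E + (Q * (E + (Q * E + 2 * E)) + 2 * E)) ≡ suc (Q + (Q * suc (Q + 2) + 2)) * E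
        expand′ = solve-∀

    runs-combine : ∀ {H stk w E Q} {ρ : Vec ℕ Γ} → Static G H (heap w) → StackAt G H (heap w) stk (Vs ++ₗ rest) → Fresh H w →
      All (λ V → Bounded E ∣ S ∣ (set V)) Vs → 2 * ∣ S ∣ ≤ E → ∣ S ∣ + 1 ≤ E → q ≤ Q →
      Runs combine (length Vs ∷ stk ∷ H ∷ ρ) w (combineCost Q * E) (NewItem (unionOf Vs) rest H w)
    runs-combine {H = H} {stk} {w} {E} {Q} {ρ} st stack f bounded 2s≤E s≤E q≤Q =
      runs-weaken (cost≤ s≤E q≤Q) (λ _ _ r → r)
      (runs-bind (runs-call (runs-expand G V₀ Vs rest stack f))
      λ { (_ ∷ stk′ ∷ []) w₁ (g₁ , refl , stack′ , ptrs) →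
      runs-bind (runs-call (runs-statistics (≤-trans (s≤s z≤n) 2≤q)
        (record { ptr≡ = ptrs ; cells = λ j j<q → kept-in g₁ (Stored.cells (nth-all storedXs j j<q)) })))
      λ { (s ∷ b ∷ rB ∷ rW ∷ []) _ (refl , sm) → afterStatistics stk′ w₁ g₁ stack′ ptrs s b rB rW sm (Summary.s≡ sm) (Summary.b≡ sm) }})
      where
      a = length Vs
      H₁ = H + (a + a)
      storedVs : ∀ {stk} Vs → StackAt G H (heap w) stk (Vs ++ₗ rest) → All (Stored H (heap w)) Vs
      storedVs []       _            = []
      storedVs (V ∷ Vs) (push _ s t) = s ∷ storedVs Vs t
      storedXs : All (Stored H (heap w)) Xs
      storedXs = refine-all {Q = Stored H (heap w)} (λ _ _ v _ → Static.single st v) (λ s _ → s) C.items (storedVs Vs stack)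
      partFacts : ∀ {w₁} → Grow H w H₁ w₁ → Pointers G V₀ H Xs (heap w₁) → Kept H₁ (heap w₁) (PartFacts D H q)
      partFacts {w₁} g₁ ptrs = kept λ {h} b →
        let cell : ∀ j → j < q → ItemCells (X j) h
            cell = λ j j<q → at (kept-grow g₁ (Stored.cells (nth-all storedXs j j<q))) b
        in record
        { ptr≡    = λ j j<q → trans (b (+-monoʳ-< H (≤-trans j<q (refine-length′ Vs)))) (ptrs j j<q)
        ; blacks≡ = λ j j<q → ItemCells.black≡ (cell j j<q)
        ; repB≡   = λ j j<q → ItemCells.repB≡ (cell j j<q)
        ; repW≡   = λ j j<q → ItemCells.repW≡ (cell j j<q)
        ; table≡  = λ j j<q → ItemCells.table≡ (cell j j<q)
        ; entry≡  = λ j j<q → ItemCells.entry≡ (cell j j<q)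
        ; edges≡  = λ i j _ _ → at (kept-grow g₁ (Static.edges st)) b (repB (X i)) (repW (X j)) }
      afterStatistics : ∀ stk′ w₁ → (g₁ : Grow H w H₁ w₁) → StackAt G H (heap w) stk′ rest → Pointers G V₀ H Xs (heap w₁) →
        ∀ s b rB rW → Summary 0 s b rB rW → s ≡ ∣ S ∣ → b ≡ bl S →
        Runs combineMasks (s ∷ b ∷ rB ∷ rW ∷ q ∷ stk′ ∷ a ∷ stk ∷ H ∷ ρ) w₁ (2 ^ q * suc (tryMaskCost E) + 0) (NewItem (unionOf Vs) rest H w)
      afterStatistics stk′ w₁ g₁ stack′ ptrs .(∣ S ∣) .(bl S) rB rW sm refl refl = runs-bind {R = Inv 0}
        (runs-weaken (≤-reflexive (cong (_* suc (tryMaskCost E)) pow≡)) (λ _ _ r → r)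
          (runs-loop-inv Inv
            ( grow-refl (fresh g₁) (m≤m+n H₁ _)
            , emptyTable G {S} {w = w₁} (fresh g₁) (λ C le → contradiction (≤-trans (≤-reflexive (sym pow≡)) le)
                                    (<⇒≱ (value-< (flagsOf-flags C) q))))
            λ { i (R ∷ H₂ ∷ []) w₂ (g₂ , bst) → runs-weaken ≤-refl
                  (λ { (R′ ∷ H₃ ∷ []) w₃ (g₃ , bst′) → grow-trans g₂ g₃ , bst′ })
                  (runs-call (runs-tryMask (kept-grow g₂ (partFacts g₁ ptrs)) (kept-grow (grow-trans g₁ g₂) (Static.powers st))
                    q≤n (fresh g₂) (costBound bounded 2s≤E) bst
                    (λ C le → [ inj₁ , (λ eq → inj₂ (sym eq)) ]′ (m≤n⇒m<n∨m≡n le)))) }))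
        λ { (R ∷ H₂ ∷ []) w₂ (g₂ , bst) → runs-poke (runs-poke (runs-poke (runs-poke (runs-poke (runs-poke (runs-poke
              (runs-return (finished R H₂ w₂ g₂ bst)))))))) }
        where
        pow≡ : heap w₁ (record# q + 7) ≡ 2 ^ q
        pow≡ = kept-in g₁ (Static.powers st) q q≤n
        -- Masks are tried downwards, so with i of them to come the bicliques with a code of at
        -- least i are done. Initially i is 2 ^ q, which no code reaches.
        Inv : ℕ → Post 2
        Inv i (R ∷ H₂ ∷ []) w₂ = Grow H₁ w₁ H₂ w₂ × Best G S (λ C → i ≤ value q (flagsOf C)) R H₂ (heap w₂)
        -- The new item occupies offsets 0 to 4 from H₂; offsets 5 and 6 hold the stack cell that
        -- points to it and to the rest of the stack.
        finished : ∀ R H₂ w₂ → Grow H₁ w₁ H₂ w₂ → Best G S (λ C → 0 ≤ value q (flagsOf C)) R H₂ (heap w₂) →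
                   NewItem (unionOf Vs) rest H w (H₂ + 5 ∷ H₂ + 7 ∷ [])
                     (NewRecord.p₆ ∣ S ∣ (bl S) rB rW R stk′ H₂ w₂)
        finished R H₂ w₂ g₂ bst
          = grow-trans g₁ (grow-trans g₂ g₃) , newData sm bst H₂ , S≡ ,
            push (kept λ {h′} b → trans (b (+-monoʳ-< H₂ (s≤s (s≤s (s≤s (s≤s (s≤s (s≤s z≤n)))))))) field₅ ,
                             trans (cong h′ (+-assoc H₂ 5 1)) (trans (b (+-monoʳ-< H₂ ≤-refl)) field₆))
              (stored (newItem sm bst H₂) (kept λ b → record
                { size≡  = trans (b (m<m+n H₂ (s≤s z≤n))) field₀
                ; black≡ = trans (b (+-monoʳ-< H₂ (s≤s (s≤s z≤n)))) field₁
                ; repB≡  = trans (b (+-monoʳ-< H₂ (s≤s (s≤s (s≤s z≤n))))) (trans field₂ (Summary.rB≡ sm))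
                ; repW≡  = trans (b (+-monoʳ-< H₂ (s≤s (s≤s (s≤s (s≤s z≤n)))))) (trans field₃ (Summary.rW≡ sm))
                ; table≡ = trans (b (+-monoʳ-< H₂ (s≤s (s≤s (s≤s (s≤s (s≤s z≤n))))))) field₄
                ; entry≡ = at (kept-grow g₃ (Best.entries bst)) b }))
              (stack-grow G (grow-trans g₁ (grow-trans g₂ g₃)) stack′)
          where
          open NewRecord ∣ S ∣ (bl S) rB rW R stk′ H₂ w₂
          g₃ = growth (fresh g₂)

-- Decompositions and homogeneity

allEqual⇒∣∣≤1 : ∀ {n} (C : Subset n) → (∀ {u v} → u ∈ C → v ∈ C → u ≡ v) → ∣ C ∣ ≤ 1
allEqual⇒∣∣≤1 {n} C eq with nonempty? C
... | no e = ≤-trans (≤-reflexive (∣∣-empty C e)) z≤n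
... | yes (u , u∈) = ≤-trans (p⊆q⇒∣p∣≤∣q∣ {q = ⁅ u ⁆} (λ v∈ → subst (_∈ ⁅ u ⁆) (eq u∈ v∈) (x∈⁅x⁆ u))) (≤-reflexive (∣⁅x⁆∣≡1 u))

⋃-disjoint : ∀ {n} {V : Subset n} {Vs} → All (λ X → Empty (V ∩ X)) Vs → ∀ {v} → v ∈ V → v ∉ ⋃ Vs
⋃-disjoint [] v∈ v∈⊥ = ∉⊥ v∈⊥
⋃-disjoint {Vs = X ∷ Vs} (e ∷ es) v∈ v∈∪ = [ (λ v∈X → e (_ , x∈p∩q⁺ (v∈ , v∈X))) , ⋃-disjoint es v∈ ]′ (x∈p∪q⁻ X (⋃ Vs) v∈∪)

length≤∣⋃∣ : ∀ {n} {Vs : List (Subset n)} → All Nonempty Vs → AllPairs (λ X Y → Empty (X ∩ Y)) Vs → length Vs ≤ ∣ ⋃ Vs ∣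
length≤∣⋃∣ [] [] = z≤n
length≤∣⋃∣ {Vs = V ∷ Vs} ((v , v∈) ∷ ne) (d ∷ ds) = ≤-trans
  (+-mono-≤ (n≢0⇒n>0 {∣ V ∣} λ eq → ∣∣≡0⇒empty V eq (v , v∈)) (length≤∣⋃∣ ne ds))
  (≤-reflexive (sym (∣∣-sum (∪-isSum (⋃-disjoint d)))))

module Decompositions {n : ℕ} (G : BipartiteGraph n) (twinFree : TwinFree G) where
  open BipartiteGraph G
  open Weighted G

  Same : Fin n → Fin n → Set
  Same x y = (x ∈ B → y ∈ B) × (x ∈ W → y ∈ W)

  MonoPair : Subset n → Set
  MonoPair S = ∣ S ∣ ≡ 2 × (S ⊆ B ⊎ S ⊆ W)

  -- The invariant of the vertex sets in the tree. The exception is harmless: a pair of one colour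
  -- is split before it takes part in a Prime combination, and further down its parts are single
  -- vertices.
  Closed : Subset n → Set
  Closed S = Homogeneous S ⊎ MonoPair S

  closed⇒good : ∀ {S} → Closed S → Good G S
  closed⇒good (inj₁ h)        = inj₂ h
  closed⇒good (inj₂ (eq , _)) = inj₁ eq

  twins : ∀ {u v} → (∀ {x} → Adj u x → Adj v x) → (∀ {x} → Adj v x → Adj u x) → u ≡ v
  twins f g = twinFree (⊆-antisym f g)

  allEqual⇒homogeneous : ∀ {M} → (∀ {u v} → u ∈ M → v ∈ M → u ≡ v) → Homogeneous M
  allEqual⇒homogeneous eq _ x∈ y∈ _ _ = subst (Adj _) (eq x∈ y∈)

  -- What the Parallel, Series and K+S relations have in common: once it is known on which side of v
  -- the relation holds, the colour of a vertex decides its adjacency to v.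
  PointHomogeneous : (Fin n → Fin n → Set) → Set
  PointHomogeneous r = ∀ {u u′ v} → Same u u′ → (r u v → r u′ v → Adj v u → Adj v u′) × (r v u → r v u′ → Adj v u → Adj v u′)

  parallel series k+s : Fin n → Fin n → Set
  parallel u v = ¬ Adj u v
  series u v = (u ∈ B → v ∈ W → Adj u v) × (u ∈ W → v ∈ B → Adj u v)
  k+s u v = (u ∈ B → v ∈ W → Adj u v) × (u ∈ W → v ∈ B → ¬ Adj u v)

  parallel-homogeneous : PointHomogeneous parallel
  parallel-homogeneous _ = (λ r _ a → contradiction (symmetric a) r) , (λ r _ a → contradiction a r)

  series-homogeneous : PointHomogeneous series
  series-homogeneous {u} {u′} {v} (sB , sW) =
    (λ _ (f , g) a → symmetric ([ (λ (vB , uW) → g (sW uW) vB) , (λ (vW , uB) → f (sB uB) vW) ]′ (bipartite a))) ,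
    (λ _ (f , g) a → [ (λ (vB , uW) → f vB (sW uW)) , (λ (vW , uB) → g vW (sB uB)) ]′ (bipartite a))

  k+s-homogeneous : PointHomogeneous k+s
  k+s-homogeneous {u} {u′} {v} (sB , sW) =
    (λ (f , g) (f′ , _) a → symmetric ([ (λ (vB , uW) → contradiction (symmetric a) (g uW vB)) , (λ (vW , uB) → f′ (sB uB) vW) ]′ (bipartite a))) ,
    (λ (f , g) (f′ , _) a → [ (λ (vB , uW) → f′ vB (sW uW)) , (λ (vW , uB) → contradiction a (g vW uB)) ]′ (bipartite a))

  -- A vertex outside S is handled by the homogeneity of S, and one inside S is related to all of M
  -- from one side. If S is a pair, a proper subset has at most one vertex.
  homogeneous-part : ∀ {r} → PointHomogeneous r → ∀ {S M} → Closed S → M ⊆ S → (∃ λ z → z ∈ S × z ∉ M) →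
    (∀ {v} → v ∈ S → v ∉ M → (∀ {u} → u ∈ M → r u v) ⊎ (∀ {u} → u ∈ M → r v u)) → Homogeneous M
  homogeneous-part {r} ph {S} {M} (inj₁ hom) M⊆ _ rel {v} v∉ x∈ y∈ sB sW a with v ∈? S
  ... | no v∉S = hom v∉S (M⊆ x∈) (M⊆ y∈) sB sW a
  ... | yes v∈S with rel v∈S v∉
  ...   | inj₁ f = proj₁ (ph (sB , sW)) (f x∈) (f y∈) a
  ...   | inj₂ f = proj₂ (ph (sB , sW)) (f x∈) (f y∈) a
  homogeneous-part ph {S} {M} (inj₂ (two , _)) M⊆ (z , z∈ , z∉) _ v∉ x∈ y∈ sB sW a =
    allEqual⇒homogeneous {M} (λ {u} {v} u∈ v∈ → decidable-stable (u Fin.≟ v) λ u≢v → z∉ (pair⊆ u∈ v∈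
      (subst (z ∈_) (sym (pair≡ S two u≢v (M⊆ u∈) (M⊆ v∈))) z∈))) v∉ x∈ y∈ sB sW a

  -- `Admits` asks for a split of maximal length. Lengths are at most n, so passing from a split to
  -- a longer one comes to an end, at a maximal one.
  noSplit : ∀ {R S} → ¬ Admits G R S → ∀ {Vs} → ¬ Splits G R S Vs
  noSplit {R} {S} none {Vs} = go (suc n) Vs (m≤n+m (suc n) (length Vs))
    where
    go : ∀ k Vs → n < length Vs + k → ¬ Splits G R S Vs
    go zero    Vs lt sp = <⇒≱ lt (≤-trans (≤-reflexive (+-identityʳ _))
      (≤-trans (length≤∣⋃∣ (IsPartition.nonempty p) (IsPartition.disjoint p)) (∣p∣≤n (⋃ Vs))))
      where p = Splits.partition sp
    go (suc k) Vs lt sp = none (Vs , sp , λ Us sp′ → ≮⇒≥ λ longer →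
      go k Us (≤-trans lt (≤-trans (≤-reflexive (+-suc (length Vs) k)) (+-monoˡ-≤ k longer))) sp′)

  twoParts : ∀ {R S} → ¬ Admits G R S → ∀ A D → Nonempty A → Nonempty D → (∀ {v} → v ∈ A → v ∉ D) →
             A ∪ D ≡ S → ¬ R A D
  twoParts none A D ne ne′ dis eq r = noSplit none {A ∷ D ∷ []} record
    { partition = record
      { nonempty = ne ∷ ne′ ∷ []
      ; disjoint = ((λ (v , v∈) → let v∈A , v∈D = x∈p∩q⁻ A D v∈ in dis v∈A v∈D) ∷ []) ∷ [] ∷ []
      ; covers   = trans (cong (A ∪_) (∪-identityʳ D)) eq }
    ; p≥2 = s≤s (s≤s z≤n)
    ; related = (r ∷ []) ∷ [] ∷ [] }

  splitOff : ∀ {R S} → ¬ Admits G R S → ∀ A → A ⊆ S → Nonempty A → (∃ λ z → z ∈ S × z ∉ A) → ¬ R A (S ∩ ∁ A)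
  splitOff {S = S} none A A⊆ ne (z , z∈ , z∉) = twoParts none A (S ∩ ∁ A) ne
    (z , x∈p∩q⁺ (z∈ , x∉p⇒x∈∁p z∉)) (λ v∈A v∈ → x∈∁p⇒x∉p (p∩q⊆q S (∁ A) v∈) v∈A)
    (⊆-antisym (λ v∈ → [ A⊆ , p∩q⊆p S (∁ A) ]′ (x∈p∪q⁻ A (S ∩ ∁ A) v∈)) cover)
    where
    cover : S ⊆ A ∪ (S ∩ ∁ A)
    cover {v} v∈ with v ∈? A
    ... | yes v∈A = x∈p∪q⁺ (inj₁ v∈A)
    ... | no v∉A  = x∈p∪q⁺ (inj₂ (x∈p∩q⁺ (v∈ , x∉p⇒x∈∁p v∉A)))

  -- Between vertices of one colour left adjacency holds vacuously, so the two vertices would form a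
  -- K+S split.
  ¬monoPair : ∀ {S} → ¬ Admits G (LeftAdjacent G) S → ¬ MonoPair S
  ¬monoPair {S} none (two , mono) with nonempty? S
  ... | no e = contradiction (trans (sym two) (∣∣-empty S e)) λ ()
  ... | yes (u , u∈) with nonempty? (S ∩ ∁ ⁅ u ⁆)
  ...   | no e = contradiction (≤-trans (≤-reflexive (sym two)) (≤-trans (p⊆q⇒∣p∣≤∣q∣ {q = ⁅ u ⁆} (λ {v} v∈ →
                   decidable-stable (v ∈? ⁅ u ⁆) λ v∉ → e (v , x∈p∩q⁺ (v∈ , x∉p⇒x∈∁p v∉)))) (≤-reflexive (∣⁅x⁆∣≡1 u)))) λ { (s≤s ()) }
  ...   | yes (v , v∈) with x∈p∩q⁻ S (∁ ⁅ u ⁆) v∈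
  ...     | v∈S , v∈∁ = splitOff none ⁅ u ⁆ (λ x∈ → subst (_∈ S) (sym (x∈⁅y⁆⇒x≡y u x∈)) u∈) (u , x∈⁅x⁆ u)
      (v , v∈S , x∈∁p⇒x∉p v∈∁)
      (λ {x} {y} x∈ y∈ → let x∈S = subst (_∈ S) (sym (x∈⁅y⁆⇒x≡y u x∈)) u∈ ; y∈S = p∩q⊆p S (∁ ⁅ u ⁆) y∈ in
         (λ xB yW → contradiction mono (impossible x∈S y∈S xB yW))
       , (λ xW yB _ → impossible y∈S x∈S yB xW mono))
    where
    impossible : ∀ {x y} → x ∈ S → y ∈ S → x ∈ B → y ∈ W → ¬ (S ⊆ B ⊎ S ⊆ W)
    impossible x∈ y∈ xB yW (inj₁ S⊆B) = W⇒∉B yW (S⊆B y∈)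
    impossible x∈ y∈ xB yW (inj₂ S⊆W) = W⇒∉B (S⊆W x∈) xB

  Adj? : ∀ u v → Dec (Adj u v)
  Adj? u v = v ∈? N u

  bimodule-homogeneous : ∀ {S M} → Bimodule G S M → ∀ {v x y} → v ∈ S → v ∉ M → x ∈ M → y ∈ M → Same x y → Adj v x → Adj v y
  bimodule-homogeneous bm {v} v∈S v∉ x∈ y∈ (sB , sW) a with Bimodule.homogeneous bm v v∈S v∉
  ... | inj₁ non  = contradiction a (non (x∈⁅x⁆ v) x∈)
  ... | inj₂ full = [ (λ (vB , xW) → proj₁ (full (x∈⁅x⁆ v) y∈) vB (sW xW))
                    , (λ (vW , xB) → proj₂ (full (x∈⁅x⁆ v) y∈) vW (sB xB)) ]′ (bipartite a)

  module Primes {S : Subset n} (¬parallel : ¬ Admits G (Nonadjacent G) S) (¬series : ¬ Admits G (FullyAdjacent G) S)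
                (hom : Homogeneous S) where

    -- K and L are the two colour classes, in either order.
    module Coloured (K L : Subset n)
      (cover : ∀ v → v ∈ K ⊎ v ∈ L)
      (apart : ∀ {v} → v ∈ K → v ∉ L)
      (sameK : ∀ {x y} → x ∈ K → y ∈ K → Same x y)
      (sameL : ∀ {x y} → x ∈ L → y ∈ L → Same x y)
      (K→L   : ∀ {u v} → Adj u v → u ∈ K → v ∈ L)
      (L→K   : ∀ {u v} → Adj u v → u ∈ L → v ∈ K)
      (full  : ∀ {X Y} → (∀ {u v} → u ∈ X → v ∈ Y → u ∈ L → v ∈ K → Adj u v) →
               (∀ {u} → u ∈ X → u ∈ L) → FullyAdjacent G X Y)
      (trivial : ∀ {M} → (∀ {u v} → u ∈ M → v ∈ M → u ∈ K → v ∈ K → u ≡ v) →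
                 (∀ {u v} → u ∈ M → v ∈ M → u ∈ L → v ∈ L → u ≡ v) → Trivial G M)
      {M M′} (max : MaximalNontrivialBimodule G S M) (max′ : MaximalNontrivialBimodule G S M′) (M≢M′ : M ≢ M′)
      {v x₁ x₂} (v∈M : v ∈ M) (v∈M′ : v ∈ M′) (vK : v ∈ K)
      (x₁∈ : x₁ ∈ M) (x₁∉ : x₁ ∉ M′) (x₁L : x₁ ∈ L) (x₂∈ : x₂ ∈ M) (x₂∉ : x₂ ∉ M′) (x₂L : x₂ ∈ L)
      (adj : Adj v x₁) (nonadj : ¬ Adj v x₂) where

      bm  = proj₁ (proj₁ max)
      bm′ = proj₁ (proj₁ max′)
      ⊆S : M ⊆ S
      ⊆S = Bimodule.subset bm
      ⊆S′ : M′ ⊆ S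
      ⊆S′ = Bimodule.subset bm′

      outside-S : ∀ {u x y} → u ∉ S → x ∈ S → y ∈ S → Same x y → Adj u x → Adj u y
      outside-S u∉ x∈ y∈ (sB , sW) = hom u∉ x∈ y∈ sB sW

      -- Otherwise the edge from v to x₁ would give edges from b to x₁, from b to x₂ and from v to
      -- x₂, by replacing one endpoint at a time inside M′, M and M′ again.
      K⊆M : ∀ {b} → b ∈ M′ → b ∈ K → b ∈ M
      K⊆M {b} b∈ bK = decidable-stable (b ∈? M) λ b∉ → nonadj (symmetric
        (bimodule-homogeneous bm′ (⊆S x₂∈) x₂∉ b∈ v∈M′ (sameK bK vK) (symmetric
          (bimodule-homogeneous bm (⊆S′ b∈) b∉ x₁∈ x₂∈ (sameL x₁L x₂L) (symmetric
            (bimodule-homogeneous bm′ (⊆S x₁∈) x₁∉ v∈M′ b∈ (sameK vK bK) (symmetric adj)))))))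

      -- Otherwise M′ would be contained in M, and its maximality would make the two equal.
      extra : ∃ λ z → z ∈ M′ × z ∉ M
      extra with nonempty? (M′ ∩ ∁ M)
      ... | yes (z , z∈) = z , p∩q⊆p M′ (∁ M) z∈ , x∈∁p⇒x∉p (p∩q⊆q M′ (∁ M) z∈)
      ... | no e = contradiction (proj₂ max′ M (proj₁ max) λ {z} z∈ → decidable-stable (z ∈? M) λ z∉ →
                     e (z , x∈p∩q⁺ (z∈ , x∉p⇒x∈∁p z∉))) M≢M′

      extraL : ∀ {z} → z ∈ M′ → z ∉ M → z ∈ L
      extraL {z} z∈ z∉ = [ (λ zK → contradiction (K⊆M z∈ zK) z∉) , id ]′ (cover z)

      module Shared {w₀} (w₀∈ : w₀ ∈ M) (w₀∈′ : w₀ ∈ M′) (w₀L : w₀ ∈ L) where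
        T = M ∪ M′

        T-cases : ∀ {x} → x ∈ T → x ∈ M ⊎ x ∈ M′
        T-cases = x∈p∪q⁻ M M′

        -- M and M′ share a vertex of each colour, v and w₀. Adjacency to u is passed from x to the
        -- shared vertex of the same colour and from there to y, each time inside one of the two
        -- bimodules.
        T-homogeneous : ∀ {u x y} → u ∈ S → u ∉ T → x ∈ T → y ∈ T → Same x y → Adj u x → Adj u y
        T-homogeneous {u} {x} {y} u∈ u∉ x∈ y∈ same a = from (cover x)
          where
          u∉M : u ∉ M
          u∉M u∈M = u∉ (x∈p∪q⁺ (inj₁ u∈M))
          u∉M′ : u ∉ M′
          u∉M′ u∈M = u∉ (x∈p∪q⁺ (inj₂ u∈M))
          via : ∀ {c} → c ∈ M → c ∈ M′ → Same x c → Same c y → Adj u y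
          via {c} c∈ c∈′ xc cy = [ (λ y∈M → bimodule-homogeneous bm u∈ u∉M c∈ y∈M cy a′)
                                 , (λ y∈M′ → bimodule-homogeneous bm′ u∈ u∉M′ c∈′ y∈M′ cy a′) ]′ (T-cases y∈)
            where
            a′ : Adj u c
            a′ = [ (λ x∈M → bimodule-homogeneous bm u∈ u∉M x∈M c∈ xc a)
                 , (λ x∈M′ → bimodule-homogeneous bm′ u∈ u∉M′ x∈M′ c∈′ xc a) ]′ (T-cases x∈)
          comp : ∀ {c} → Same c x → Same c y
          comp (cB , cW) = (λ z → proj₁ same (cB z)) , (λ z → proj₂ same (cW z))
          from : x ∈ K ⊎ x ∈ L → Adj u y
          from (inj₁ xK) = via v∈M v∈M′ (sameK xK vK) (comp (sameK vK xK))
          from (inj₂ xL) = via w₀∈ w₀∈′ (sameL xL w₀L) (comp (sameL w₀L xL))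

        T-bimodule : Bimodule G S T
        T-bimodule = record
          { subset = λ x∈ → [ ⊆S , ⊆S′ ]′ (T-cases x∈)
          ; homogeneous = λ u u∈ u∉ → one u u∈ u∉ }
          where
          one : ∀ u → u ∈ S → u ∉ T → Nonadjacent G ⁅ u ⁆ T ⊎ FullyAdjacent G ⁅ u ⁆ T
          one u u∈ u∉ with nonempty? (N u ∩ T)
          ... | no e = inj₁ λ x∈ y∈ a → e (_ , x∈p∩q⁺ (subst (λ x → Adj x _) (x∈⁅y⁆⇒x≡y u x∈) a , y∈))
          ... | yes (x , x∈) = inj₂ λ {u′} {y} u′∈ y∈ → adjacent u′∈ y∈
            where
            a : Adj u x
            a = p∩q⊆p (N u) T x∈
            adjacent : ∀ {u′ y} → u′ ∈ ⁅ u ⁆ → y ∈ T → (u′ ∈ B → y ∈ W → Adj u′ y) × (u′ ∈ W → y ∈ B → Adj u′ y)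
            adjacent {u′} {y} u′∈ y∈ rewrite x∈⁅y⁆⇒x≡y u u′∈ with bipartite a
            ... | inj₁ (uB , xW) = (λ _ yW → T-homogeneous u∈ u∉ (p∩q⊆q (N u) T x∈) y∈
                    ((λ xB → contradiction xB (W⇒∉B xW)) , (λ _ → yW)) a) , (λ uW → contradiction uB (W⇒∉B uW))
            ... | inj₂ (uW , xB) = (λ uB → contradiction uB (W⇒∉B uW)) , (λ _ yB → T-homogeneous u∈ u∉ (p∩q⊆q (N u) T x∈) y∈
                    ((λ _ → yB) , (λ xW → contradiction xB (W⇒∉B xW))) a)

        bl-≤ : ∀ X {C D : Subset n} → C ⊆ D → ∣ C ∩ X ∣ ≤ ∣ D ∩ X ∣
        bl-≤ X {C} C⊆D = p⊆q⇒∣p∣≤∣q∣ (λ v∈ → let v∈C , v∈X = x∈p∩q⁻ C X v∈ in x∈p∩q⁺ (C⊆D v∈C , v∈X))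

        -- The union is a bimodule and strictly larger than M, so the maximality of M leaves only
        -- the whole of S.
        T≡S : T ≡ S
        T≡S = decidable-stable (≡-dec _≟ᵇ_ T S) λ T≢S →
          let z , z∈ , z∉ = extra
              T≡M = proj₂ max T (T-bimodule , (λ (t , t′) → proj₁ (proj₂ (proj₁ max))
                      (≤-trans (bl-≤ B {M} {T} (p⊆p∪q M′)) t , ≤-trans (bl-≤ W {M} {T} (p⊆p∪q M′)) t′)) , T≢S) (p⊆p∪q M′)
          in z∉ (subst (z ∈_) T≡M (x∈p∪q⁺ (inj₂ z∈)))

        K∩S⊆M : ∀ {b} → b ∈ S → b ∈ K → b ∈ M
        K∩S⊆M b∈ bK = [ id , (λ b∈′ → K⊆M b∈′ bK) ]′ (T-cases (subst (_ ∈_) (sym T≡S) b∈))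

        -- If all K-vertices of M lie in M′, then so do all of S; x₁, which lies outside M′ and is
        -- adjacent to v, is adjacent to all of them and splits off in Series. Otherwise take such a
        -- vertex b₁ outside M′. It sees the L-vertices of M′ all alike, and each vertex of M′
        -- outside M sees all K-vertices of S as it sees b₁. So the part of M′ outside M splits off,
        -- in Series or in Parallel.
        impossible : ∃ (λ b → b ∈ M × b ∉ M′ × b ∈ K) ⊎ (∀ {b} → b ∈ M → b ∈ K → b ∈ M′) → ⊥
        impossible (inj₂ K⊆M′) =
          splitOff ¬series ⁅ x₁ ⁆ (λ u∈ → subst (_∈ S) (sym (x∈⁅y⁆⇒x≡y x₁ u∈)) (⊆S x₁∈)) (x₁ , x∈⁅x⁆ x₁)
            (v , ⊆S v∈M , λ v∈ → apart vK (subst (_∈ L) (sym (x∈⁅y⁆⇒x≡y x₁ v∈)) x₁L))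
            (full {⁅ x₁ ⁆} {S ∩ ∁ ⁅ x₁ ⁆}
              (λ {u} {b} u∈ b∈ _ bK → let b∈S = p∩q⊆p S (∁ ⁅ x₁ ⁆) b∈ in
                subst (λ z → Adj z b) (sym (x∈⁅y⁆⇒x≡y x₁ u∈))
                  (bimodule-homogeneous bm′ (⊆S x₁∈) x₁∉ v∈M′ (K⊆M′ (K∩S⊆M b∈S bK) bK) (sameK vK bK) (symmetric adj)))
              (λ u∈ → subst (_∈ L) (sym (x∈⁅y⁆⇒x≡y x₁ u∈)) x₁L))
        impossible (inj₁ (b₁ , b₁∈ , b₁∉ , b₁K)) = decide (Adj? b₁ w₀)
          where
          V = M′ ∩ ∁ M
          in-V : ∀ {y} → y ∈ V → y ∈ M′ × y ∉ M
          in-V y∈ = let y∈M′ , y∈∁ = x∈p∩q⁻ M′ (∁ M) y∈ in y∈M′ , x∈∁p⇒x∉p y∈∁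
          V⊆ : V ⊆ S
          V⊆ y∈ = ⊆S′ (proj₁ (in-V y∈))
          V-L : ∀ {y} → y ∈ V → y ∈ L
          V-L y∈ = let y∈′ , y∉ = in-V y∈ in extraL y∈′ y∉
          neV : Nonempty V
          neV = let z , z∈ , z∉ = extra in z , x∈p∩q⁺ (z∈ , x∉p⇒x∈∁p z∉)
          rest : ∃ λ z → z ∈ S × z ∉ V
          rest = v , ⊆S v∈M , λ v∈ → proj₂ (in-V v∈) v∈M
          same-b₁ : ∀ {y y′} → y ∈ M′ → y′ ∈ M′ → y ∈ L → y′ ∈ L → Adj b₁ y → Adj b₁ y′
          same-b₁ y∈ y′∈ yL y′L = bimodule-homogeneous bm′ (⊆S b₁∈) b₁∉ y∈ y′∈ (sameL yL y′L)
          decide : Dec (Adj b₁ w₀) → ⊥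
          decide (yes a) = splitOff ¬series V V⊆ neV rest
            (full {V} {S ∩ ∁ V} (λ {y} {b} y∈ b∈ yL bK → let y∈′ , y∉ = in-V y∈ in
               bimodule-homogeneous bm (⊆S′ y∈′) y∉ b₁∈ (K∩S⊆M (p∩q⊆p S (∁ V) b∈) bK) (sameK b₁K bK)
                 (symmetric (same-b₁ w₀∈′ y∈′ w₀L yL a))) V-L)
          decide (no na) = splitOff ¬parallel V V⊆ neV rest
            (λ {y} {b} y∈ b∈ a → let y∈′ , y∉ = in-V y∈ ; yL = V-L y∈ ; bK = L→K a yL in
               na (same-b₁ y∈′ w₀∈′ yL w₀L (symmetric
                 (bimodule-homogeneous bm (⊆S′ y∈′) y∉ (K∩S⊆M (p∩q⊆p S (∁ V) b∈) bK) b₁∈ (sameK bK b₁K) a))))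

      privateK : ∃ (λ b → b ∈ M × b ∉ M′ × b ∈ K) ⊎ (∀ {b} → b ∈ M → b ∈ K → b ∈ M′)
      privateK with nonempty? ((M ∩ ∁ M′) ∩ K)
      ... | yes (b , b∈) = let b∈′ , bK = x∈p∩q⁻ (M ∩ ∁ M′) K b∈ ; b∈M , b∈∁ = x∈p∩q⁻ M (∁ M′) b∈′ in
              inj₁ (b , b∈M , x∈∁p⇒x∉p b∈∁ , bK)
      ... | no e = inj₂ λ {b} b∈ bK → decidable-stable (b ∈? M′) λ b∉ → e (b , x∈p∩q⁺ (x∈p∩q⁺ (b∈ , x∉p⇒x∈∁p b∉) , bK))

      unshared : ∀ {w} → w ∈ M → w ∈ M′ → w ∉ L
      unshared w∈ w∈′ wL = Shared.impossible w∈ w∈′ wL privateK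

      -- They are twins: a vertex that told them apart would have to be an L-vertex in both M and
      -- M′, and there is none.
      sharedK : ∀ {b b′} → b ∈ M → b ∈ M′ → b′ ∈ M → b′ ∈ M′ → b ∈ K → b′ ∈ K → b ≡ b′
      sharedK b∈ b∈′ b′∈ b′∈′ bK b′K = twins (one b∈ b∈′ b′∈ b′∈′ bK b′K) (one b′∈ b′∈′ b∈ b∈′ b′K bK)
        where
        one : ∀ {b b′} → b ∈ M → b ∈ M′ → b′ ∈ M → b′ ∈ M′ → b ∈ K → b′ ∈ K → ∀ {y} → Adj b y → Adj b′ y
        one {b} {b′} b∈ b∈′ b′∈ b′∈′ bK b′K {y} a with y ∈? S | y ∈? M | y ∈? M′
        ... | no y∉ | _ | _ = symmetric (outside-S y∉ (⊆S b∈) (⊆S b′∈) (sameK bK b′K) (symmetric a))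
        ... | yes y∈ | no y∉ | _ = symmetric (bimodule-homogeneous bm y∈ y∉ b∈ b′∈ (sameK bK b′K) (symmetric a))
        ... | yes y∈ | yes _ | no y∉ = symmetric (bimodule-homogeneous bm′ y∈ y∉ b∈′ b′∈′ (sameK bK b′K) (symmetric a))
        ... | yes y∈ | yes y∈M | yes y∈M′ = contradiction (K→L a bK) (unshared y∈M y∈M′)

      -- A K-vertex b₁ of M outside M′ would make M′ trivial. All K-vertices of M′ are shared, hence
      -- equal. Its L-vertices lie outside M and see every K-vertex of M′ as they see b₁, which in
      -- turn sees them all alike, so they are twins.
      K⊆M′ : ∀ {b} → b ∈ M → b ∈ K → b ∈ M′
      K⊆M′ = [ (λ (b₁ , b₁∈ , b₁∉ , b₁K) → contradiction
                 (trivial (λ u∈ w∈ uK wK → sharedK (K⊆M u∈ uK) u∈ (K⊆M w∈ wK) w∈ uK wK)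
                          (λ u∈ w∈ uL wL → twins (L-twin b₁∈ b₁∉ b₁K u∈ w∈ uL wL) (L-twin b₁∈ b₁∉ b₁K w∈ u∈ wL uL)))
                 (proj₁ (proj₂ (proj₁ max′)))) , (λ f → f) ]′ privateK
        where
        L-twin : ∀ {b₁} → b₁ ∈ M → b₁ ∉ M′ → b₁ ∈ K → ∀ {y y′} → y ∈ M′ → y′ ∈ M′ → y ∈ L → y′ ∈ L → ∀ {b} → Adj y b → Adj y′ b
        L-twin {b₁} b₁∈ b₁∉ b₁K {y} {y′} y∈ y′∈ yL y′L {b} a with b ∈? S | b ∈? M′
        ... | no b∉ | _ = symmetric (outside-S b∉ (⊆S′ y∈) (⊆S′ y′∈) (sameL yL y′L) (symmetric a))
        ... | yes b∈ | no b∉ = symmetric (bimodule-homogeneous bm′ b∈ b∉ y∈ y′∈ (sameL yL y′L) (symmetric a))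
        ... | yes _ | yes b∈ =
          let bK = L→K a yL ; b∈M = K⊆M b∈ bK in
          bimodule-homogeneous bm (⊆S′ y′∈) (λ y′∈M → unshared y′∈M y′∈ y′L) b₁∈ b∈M (sameK b₁K bK)
            (symmetric (bimodule-homogeneous bm′ (⊆S b₁∈) b₁∉ y∈ y′∈ (sameL yL y′L)
              (symmetric (bimodule-homogeneous bm (⊆S′ y∈) (λ y∈M → unshared y∈M y∈ yL) b∈M b₁∈ (sameK bK b₁K) a))))

      onlyK : ∀ {b} → b ∈ M → b ∈ K → b ≡ v
      onlyK b∈ bK = sharedK b∈ (K⊆M′ b∈ bK) v∈M v∈M′ bK vK

      -- As v is the only K-vertex of M, nothing but adjacency to v can distinguish L-vertices of M.
      -- Twin-freeness then leaves one L-vertex adjacent to v and one that is not.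
      L-class : ∀ {x y} → x ∈ M → y ∈ M → x ∈ L → y ∈ L → (Adj v x → Adj v y) → ∀ {c} → Adj x c → Adj y c
      L-class {x} {y} x∈ y∈ xL yL f {c} a with c ∈? S | c ∈? M
      ... | no c∉ | _ = symmetric (outside-S c∉ (⊆S x∈) (⊆S y∈) (sameL xL yL) (symmetric a))
      ... | yes c∈ | no c∉ = symmetric (bimodule-homogeneous bm c∈ c∉ x∈ y∈ (sameL xL yL) (symmetric a))
      ... | yes _ | yes c∈ = let c≡v = onlyK c∈ (L→K a xL) in
        subst (Adj y) (sym c≡v) (symmetric (f (symmetric (subst (Adj x) c≡v a))))

      L-members : ∀ {x} → x ∈ M → x ∈ L → x ≡ x₁ ⊎ x ≡ x₂
      L-members {x} x∈ xL with Adj? v x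
      ... | yes a = inj₁ (twins (L-class x∈ x₁∈ xL x₁L (λ _ → adj)) (L-class x₁∈ x∈ x₁L xL (λ _ → a)))
      ... | no na = inj₂ (twins (L-class x∈ x₂∈ xL x₂L (λ a → contradiction a na))
                                (L-class x₂∈ x∈ x₂L xL (λ a → contradiction a nonadj)))

      remaining : ∀ {P} → (∀ {x} → x ∈ P → x ∈ M × x ∉ M′) → x₁ ∈ P → x₂ ∈ P → ∣ P ∣ ≡ 2 × P ⊆ L
      remaining {P} P⊆ x₁∈P x₂∈P = trans (sym (cong ∣_∣ P≡)) (∣pair∣ x₁≢x₂) , P⊆L
        where
        x₁≢x₂ : x₁ ≢ x₂
        x₁≢x₂ eq = nonadj (subst (Adj v) eq adj)
        P⊆L : P ⊆ L
        P⊆L {x} x∈ = [ (λ xK → contradiction (K⊆M′ (proj₁ (P⊆ x∈)) xK) (proj₂ (P⊆ x∈))) , id ]′ (cover x)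
        P≡ : ⁅ x₁ ⁆ ∪ ⁅ x₂ ⁆ ≡ P
        P≡ = ⊆-antisym (pair⊆ x₁∈P x₂∈P) λ {x} x∈ → x∈p∪q⁺
          ([ (λ { refl → inj₁ (x∈⁅x⁆ x) }) , (λ { refl → inj₂ (x∈⁅x⁆ x) }) ]′ (L-members (proj₁ (P⊆ x∈)) (P⊆L x∈)))

    B-or-W : ∀ v → v ∈ B ⊎ v ∈ W
    B-or-W v with v ∈? B
    ... | yes vB = inj₁ vB
    ... | no v∉B = inj₂ (∉B⇒W v∉B)

    sameB : ∀ {x y} → x ∈ B → y ∈ B → Same x y
    sameB xB yB = (λ _ → yB) , (λ xW → contradiction xB (W⇒∉B xW))

    sameW : ∀ {x y} → x ∈ W → y ∈ W → Same x y
    sameW xW yW = (λ xB → contradiction xB (W⇒∉B xW)) , (λ _ → yW)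

    B→W : ∀ {u v} → Adj u v → u ∈ B → v ∈ W
    B→W a uB = [ proj₂ , (λ (uW , _) → contradiction uB (W⇒∉B uW)) ]′ (bipartite a)

    W→B : ∀ {u v} → Adj u v → u ∈ W → v ∈ B
    W→B a uW = [ (λ (uB , _) → contradiction uB (W⇒∉B uW)) , proj₂ ]′ (bipartite a)

    few : ∀ {M : Subset n} X → (∀ {u v} → u ∈ M → v ∈ M → u ∈ X → v ∈ X → u ≡ v) → ∣ M ∩ X ∣ ≤ 1
    few {M} X eq = allEqual⇒∣∣≤1 (M ∩ X) λ u∈ v∈ →
      let u∈M , uX = x∈p∩q⁻ M X u∈ ; v∈M , vX = x∈p∩q⁻ M X v∈ in eq u∈M v∈M uX vX

    -- Let v augment M, say v black and lying in M′ too, and let v tell apart two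
    -- white vertices x₁, x₂ of M ∖ M′.  No black vertex of M′ lies outside M.  If M
    -- and M′ share a white vertex, their union is S, which splits; otherwise
    -- twin-freeness leaves v as the only black vertex of M and x₁, x₂ as the only
    -- white ones.
    canonical-closed : ∀ {P} → MaximalCanonicalBimodule G S P → Closed P
    canonical-closed {P} (M , max , members , _) = decide (∣ P ∣ ≟ 2) (P ⊆? B) (P ⊆? W)
      where
      homogeneous : ¬ MonoPair P → Homogeneous P
      homogeneous notPair {v} {x} {y} v∉ x∈ y∈ sB sW a with v ∈? S | v ∈? M
      ... | no v∉S | _ = hom v∉S (inS x∈) (inS y∈) sB sW a
        where
        inS : P ⊆ S
        inS z∈ = Bimodule.subset (proj₁ (proj₁ max)) (proj₁ (Equivalence.to (members _) z∈))
      ... | yes v∈S | no v∉M = bimodule-homogeneous (proj₁ (proj₁ max)) v∈S v∉M (inM x∈) (inM y∈) (sB , sW) a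
        where
        inM : P ⊆ M
        inM z∈ = proj₁ (Equivalence.to (members _) z∈)
      -- A vertex of M that is missing in P must be augmenting. Assuming the edge away refutes all
      -- witnesses of that, which would put v into P.
      ... | yes _ | yes v∈M = decidable-stable (Adj? v y) λ na → v∉ (Equivalence.from (members v)
              (v∈M , λ { (M₀ , M₁ , max₀ , max₁ , ne , v∈₀ , v∈₁) → other na M₀ M₁ max₀ max₁ ne v∈₀ v∈₁ (≡-dec _≟ᵇ_ M M₀) }))
        where
        with-M′ : ¬ Adj v y → ∀ M′ → MaximalNontrivialBimodule G S M′ → M ≢ M′ → v ∈ M′ → ⊥
        with-M′ na M′ max′ ne v∈M′ =
          [ (λ (vB , xW) → notPair (blackCase vB xW)) , (λ (vW , xB) → notPair (whiteCase vW xB)) ]′ (bipartite a)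
          where
          member : ∀ {z} → z ∈ P → z ∈ M × z ∉ M′
          member z∈ = let z∈M , notAug = Equivalence.to (members _) z∈ in
            z∈M , λ z∈M′ → notAug (M , M′ , max , max′ , ne , z∈M , z∈M′)
          blackCase : v ∈ B → x ∈ W → MonoPair P
          blackCase vB xW
            with eq , P⊆W ← Coloured.remaining B W B-or-W (λ b w → W⇒∉B w b) sameB sameW B→W W→B
              (λ {X} {Y} f X⊆W u∈ w∈ → (λ uB _ → contradiction uB (W⇒∉B (X⊆W u∈))) , (λ uW wB → f u∈ w∈ uW wB))
              (λ f g → few B f , few W g) max max′ ne v∈M v∈M′ vB
              (proj₁ (member x∈)) (proj₂ (member x∈)) xW (proj₁ (member y∈)) (proj₂ (member y∈)) (sW xW) a na
              {P} member x∈ y∈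
            = eq , inj₂ P⊆W
          whiteCase : v ∈ W → x ∈ B → MonoPair P
          whiteCase vW xB
            with eq , P⊆B ← Coloured.remaining W B (λ u → [ inj₂ , inj₁ ]′ (B-or-W u)) W⇒∉B sameW sameB W→B B→W
              (λ {X} {Y} f X⊆B u∈ w∈ → (λ uB wW → f u∈ w∈ uB wW) , (λ uW _ → contradiction (X⊆B u∈) (W⇒∉B uW)))
              (λ f g → few B g , few W f) max max′ ne v∈M v∈M′ vW
              (proj₁ (member x∈)) (proj₂ (member x∈)) xB (proj₁ (member y∈)) (proj₂ (member y∈)) (sB xB) a na
              {P} member x∈ y∈
            = eq , inj₁ P⊆B
        -- The two bimodules that witness the augmenting vertex are distinct, so one of them differs
        -- from M and can play the role of M′.
        other : ¬ Adj v y → ∀ M₀ M₁ → MaximalNontrivialBimodule G S M₀ → MaximalNontrivialBimodule G S M₁ →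
                M₀ ≢ M₁ → v ∈ M₀ → v ∈ M₁ → Dec (M ≡ M₀) → ⊥
        other na M₀ M₁ max₀ max₁ ne v∈₀ v∈₁ (yes refl) = with-M′ na M₁ max₁ ne v∈₁
        other na M₀ M₁ max₀ max₁ ne v∈₀ v∈₁ (no M≢)   = with-M′ na M₀ max₀ M≢ v∈₀
      decide : Dec (∣ P ∣ ≡ 2) → Dec (P ⊆ B) → Dec (P ⊆ W) → Closed P
      decide (yes two) (yes P⊆B) _         = inj₂ (two , inj₁ P⊆B)
      decide (yes two) (no _)    (yes P⊆W) = inj₂ (two , inj₂ P⊆W)
      decide (yes _)   (no P⊈B)  (no P⊈W)  = inj₁ (homogeneous λ { (_ , inj₁ P⊆B) → P⊈B P⊆B ; (_ , inj₂ P⊆W) → P⊈W P⊆W })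
      decide (no ne)   _         _         = inj₁ (homogeneous λ (two , _) → ne two)

  prime-closed : ∀ {S Vs} → Closed S → PrimeDecomposition G S Vs → ∀ {V} → V ∈ₗ Vs → Closed V
  prime-closed {S} closed prime {V} V∈ with closed | Equivalence.to (PrimeDecomposition.parts prime V) V∈
  ... | inj₂ mono | _ = contradiction mono (¬monoPair (PrimeDecomposition.¬k+s prime))
  ... | inj₁ hom | inj₁ canonical =
    Primes.canonical-closed (PrimeDecomposition.¬parallel prime) (PrimeDecomposition.¬series prime) hom canonical
  ... | inj₁ hom | inj₂ (v , _ , _ , refl) =
    inj₁ (allEqual⇒homogeneous λ x∈ y∈ → trans (x∈⁅y⁆⇒x≡y v x∈) (sym (x∈⁅y⁆⇒x≡y v y∈)))

-- Sums of squares

total squares : List ℕ → ℕ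
total []         = 0
total (x ∷ xs)   = x + total xs
squares []       = 0
squares (x ∷ xs) = x * x + squares xs

-- Sum of the products x y over all pairs of an entry of the list, or the
-- initial x, and a later entry, collected in the order in which a left fold
-- meets them.
cross : ℕ → List ℕ → ℕ
cross x []       = 0
cross x (y ∷ ys) = x * y + cross (x + y) ys

square-of-total : ∀ x ys → (x + total ys) * (x + total ys) ≡ x * x + squares ys + 2 * cross x ys
square-of-total x [] = lemma x
  where
  lemma : ∀ x → (x + 0) * (x + 0) ≡ x * x + 0 + 2 * 0
  lemma = solve-∀
square-of-total x (y ∷ ys) rewrite sym (+-assoc x y (total ys)) | square-of-total (x + y) ys =
  lemma x y (squares ys) (cross (x + y) ys)
  where
  lemma : ∀ x y s c → (x + y) * (x + y) + s + 2 * c ≡ x * x + (y * y + s) + 2 * (x * y + c)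
  lemma = solve-∀

squares≤ : ∀ xs → squares xs ≤ total xs * total xs
squares≤ []       = z≤n
squares≤ (x ∷ xs) = ≤-trans (+-monoʳ-≤ (x * x) (squares≤ xs))
  (≤-trans (m≤m+n _ (2 * (x * total xs))) (≤-reflexive (lemma x (total xs))))
  where
  lemma : ∀ x t → x * x + t * t + 2 * (x * t) ≡ (x + t) * (x + t)
  lemma = solve-∀

-- Here y is the total of the other entries, and its square is at least the sum of their squares.
Complement : List ℕ → ℕ → Set
Complement xs x = ∃ λ y → x + y ≡ total xs × squares xs ≤ x * x + y * y

complements : ∀ xs → All (Complement xs) xs
complements []       = []
complements (x ∷ xs) = (total xs , refl , +-monoʳ-≤ (x * x) (squares≤ xs)) ∷
  All.map (λ {z} (y , eq , le) → x + y , trans (shuffle z x y) (cong (x +_) eq) ,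
    ≤-trans (+-monoʳ-≤ (x * x) le) (≤-trans (m≤m+n _ (2 * (x * y))) (≤-reflexive (lemma x y z)))) (complements xs)
  where
  shuffle : ∀ z x y → z + (x + y) ≡ x + (z + y)
  shuffle = solve-∀
  lemma : ∀ x y z → x * x + (z * z + y * y) + 2 * (x * y) ≡ z * z + (x + y) * (x + y)
  lemma = solve-∀

-- The square of the total is the sum of the squares plus twice the cross products, and also z² + y²
-- + 2zy. As z² + y² is at least the sum of the squares, 2zy is at most twice the cross products.
product≤cross : ∀ {x xs z y} → z + y ≡ total (x ∷ xs) → squares (x ∷ xs) ≤ z * z + y * y → z * y ≤ cross x xs
product≤cross {x} {xs} {z} {y} eq le = *-cancelˡ-≤ 2 (+-cancelˡ-≤ (squares (x ∷ xs)) _ _ (begin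
  squares (x ∷ xs) + 2 * (z * y) ≤⟨ +-monoˡ-≤ _ le ⟩
  z * z + y * y + 2 * (z * y) ≡⟨ lemma z y ⟩
  (z + y) * (z + y) ≡⟨ cong (λ t → t * t) eq ⟩
  (x + total xs) * (x + total xs) ≡⟨ square-of-total x xs ⟩
  squares (x ∷ xs) + 2 * cross x xs ∎))
  where
  open ≤-Reasoning
  lemma : ∀ z y → z * z + y * y + 2 * (z * y) ≡ (z + y) * (z + y)
  lemma = solve-∀

-- The origin of the factor 4 in the costs: for positive numbers x + 1 is at most 2x, y + 1 at most
-- 2y, and x and y are each at most xy.
sum≤4product : ∀ {x y} → 1 ≤ x → 1 ≤ y → (x + 1) * (y + 1) ≤ 4 * (x * y) × 2 * (x + y) ≤ 4 * (x * y)
sum≤4product {suc x} {suc y} _ _ = ≤-trans (m≤m+n _ (3 * x * y + 2 * x + 2 * y)) (≤-reflexive (first x y)) ,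
                                   ≤-trans (m≤m+n _ (4 * x * y + 2 * x + 2 * y)) (≤-reflexive (second x y))
  where
  first : ∀ x y → (suc x + 1) * (suc y + 1) + (3 * x * y + 2 * x + 2 * y) ≡ 4 * (suc x * suc y)
  first = solve-∀
  second : ∀ x y → 2 * (suc x + suc y) + (4 * x * y + 2 * x + 2 * y) ≡ 4 * (suc x * suc y)
  second = solve-∀

complements⁺ : ∀ {x xs} → 1 ≤ x → 1 ≤ total xs →
  All (λ z → ∃ λ y → 1 ≤ y × z + y ≡ total (x ∷ xs) × squares (x ∷ xs) ≤ z * z + y * y) (x ∷ xs)
complements⁺ {x} {xs} 1≤x 1≤t = (total xs , 1≤t , refl , +-monoʳ-≤ (x * x) (squares≤ xs)) ∷
  All.map (λ {z} (y , eq , le) → x + y , ≤-trans 1≤x (m≤m+n x y) , trans (shuffle z x y) (cong (x +_) eq) ,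
    ≤-trans (+-monoʳ-≤ (x * x) le) (≤-trans (m≤m+n _ (2 * (x * y))) (≤-reflexive (lemma x y z)))) (complements xs)
  where
  shuffle : ∀ z x y → z + (x + y) ≡ x + (z + y)
  shuffle = solve-∀
  lemma : ∀ x y z → x * x + (z * z + y * y) + 2 * (x * y) ≡ z * z + (x + y) * (x + y)
  lemma = solve-∀

-- Provides the E of `runs-combine`. In whatever order the parts are convolved, a part of size z
-- meets a union of size at most s minus z, and z (s minus z) is at most the sum of the cross
-- products.
cross-bounds : ∀ {x y ys} → All (1 ≤_) (x ∷ y ∷ ys) → let s = total (x ∷ y ∷ ys) ; E = 4 * cross x (y ∷ ys) in
  All (λ z → ∀ u → u + z ≤ s → (u + 1) * (z + 1) ≤ E) (x ∷ y ∷ ys) × 2 * s ≤ E × s + 1 ≤ E × 1 ≤ cross x (y ∷ ys)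
cross-bounds {x} {y} {ys} pos@(1≤x ∷ 1≤y ∷ _) =
  All.zipWith bound (complements⁺ {x} {y ∷ ys} 1≤x 1≤t , pos) , twice ,
  ≤-trans (+-monoʳ-≤ s 1≤s) (≤-trans (≤-reflexive (cong (s +_) (sym (+-identityʳ s)))) twice) ,
  n≢0⇒n>0 (λ c≡0 → contradiction (≤-trans (≤-trans (*-monoʳ-≤ 2 1≤s) twice) (≤-reflexive (trans (cong (4 *_) c≡0) refl))) λ ())
  where
  s = total (x ∷ y ∷ ys)
  E = 4 * cross x (y ∷ ys)
  1≤t : 1 ≤ total (y ∷ ys)
  1≤t = ≤-trans 1≤y (m≤m+n y (total ys))
  1≤s : 1 ≤ s
  1≤s = ≤-trans 1≤x (m≤m+n x _)
  twice : 2 * s ≤ E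
  twice = ≤-trans (proj₂ (sum≤4product {x} {total (y ∷ ys)} 1≤x 1≤t))
    (*-monoʳ-≤ 4 (product≤cross {x} {y ∷ ys} {x} {total (y ∷ ys)} refl (+-monoʳ-≤ (x * x) (squares≤ (y ∷ ys)))))
  bound : ∀ {z} → (∃ λ y′ → 1 ≤ y′ × z + y′ ≡ s × squares (x ∷ y ∷ ys) ≤ z * z + y′ * y′) × 1 ≤ z →
          ∀ u → u + z ≤ s → (u + 1) * (z + 1) ≤ E
  bound {z} ((y′ , 1≤y′ , eq , le) , 1≤z) u u+z≤s = ≤-trans
    (≤-trans (*-monoˡ-≤ (z + 1) (+-monoˡ-≤ 1 u≤y′)) (≤-reflexive (*-comm (y′ + 1) (z + 1))))
    (≤-trans (proj₁ (sum≤4product {z} {y′} 1≤z 1≤y′)) (*-monoʳ-≤ 4 (product≤cross {x} {y ∷ ys} {z} {y′} eq le)))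
    where
    u≤y′ : u ≤ y′
    u≤y′ = +-cancelʳ-≤ z u y′ (≤-trans u+z≤s (≤-reflexive (trans (sym eq) (+-comm z y′))))

-- Evaluation of the whole tree

two-costs : ∀ k s v b → k * s + (k * v + b) ≡ k * (v + s) + b
two-costs = solve-∀

-- The reverse of the preorder sequence: a node comes after its subtrees, as a stack machine needs
-- it, and the last subtree comes first, so that the item of the first child ends on top.
revTokens : ∀ {n} → Tree n → List (ℕ × ℕ)
revTokensAll : ∀ {n} → List (Tree n) → List (ℕ × ℕ)
revTokens (leaf v)    = (0 , toℕ v) ∷ []
revTokens (node ℓ ts) = revTokensAll ts ++ₗ (encodeLabel ℓ , length ts) ∷ []
revTokensAll []       = []
revTokensAll (t ∷ ts) = revTokensAll ts ++ₗ revTokens t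

data TokensAt (H : ℕ) (h : Heap) : ℕ → List (ℕ × ℕ) → Set where
  []  : ∀ {tok} → TokensAt H h tok []
  _∷_ : ∀ {tok next a b xs} → Kept H h (λ h → h tok ≡ a × h (tok + 1) ≡ b × h (tok + 2) ≡ next) →
        TokensAt H h next xs → TokensAt H h tok ((a , b) ∷ xs)

tokens-grow : ∀ {H w H′ w′ tok xs} → Grow H w H′ w′ → TokensAt H (heap w) tok xs → TokensAt H′ (heap w′) tok xs
tokens-grow g []       = []
tokens-grow g (k ∷ ts) = kept-grow g k ∷ tokens-grow g ts

opaque
  -- Room for the parts after splitting pairs: 4 for two items that are merged, and 2k for the
  -- children of a Prime node.
  nodeFactor : ℕ → ℕ
  nodeFactor k = combineCost (4 + (k + k))

  nodeFactor≡ : ∀ k → nodeFactor k ≡ combineCost (4 + (k + k))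
  nodeFactor≡ k = refl

module Evaluation {n : ℕ} (G : BipartiteGraph n) (twinFree : TwinFree G) (k : ℕ) where
  open BipartiteGraph G
  open Weighted G
  open Decompositions G twinFree

  CC : ℕ
  CC = nodeFactor k

  -- Chosen to make the costs telescope. With cross products c, a node costs at most 4 CC c + 2 c =
  -- K 2c, and K times the squares of the parts plus K 2c is K times the square of the size of S.
  K : ℕ
  K = 2 * CC + 1

  sq : Subset n → ℕ
  sq S = ∣ S ∣ * ∣ S ∣

  sizes : List ItemData → List ℕ
  sizes = map (λ V → ∣ set V ∣)

  size-union : ∀ {Vs} → AllPairs (Disj G) Vs → ∣ unionOf G Vs ∣ ≡ total (sizes Vs)
  size-union [] = ∣⊥∣≡0 n
  size-union {V ∷ Vs} (d ∷ ds) = trans (∣∣-sum (∪-isSum (outside-all d))) (cong (∣ set V ∣ +_) (size-union ds))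
    where
    outside-all : ∀ {Vs} → All (Disj G V) Vs → ∀ {v} → v ∈ set V → v ∉ unionOf G Vs
    outside-all [] v∈ v∈⊥ = ∉⊥ v∈⊥
    outside-all {Vs = X ∷ Vs} (d ∷ ds) v∈ v∈∪ = [ d v∈ , outside-all ds v∈ ]′ (x∈p∪q⁻ (set X) (unionOf G Vs) v∈∪)

  items-of-stack : ∀ {H h stk Vs rest} → StackAt G H h stk (Vs ++ₗ rest) → All IsItem Vs
  items-of-stack {Vs = []}     _            = []
  items-of-stack {Vs = V ∷ Vs} (push _ s t) = Stored.isItem s ∷ items-of-stack t

  combineItems : ∀ {V V′ Vs rest H stk w} {ρ : Vec ℕ Γ} → Children G (V ∷ V′ ∷ Vs) → Static G H (heap w) →
    StackAt G H (heap w) stk (V ∷ V′ ∷ Vs ++ₗ rest) → Fresh H w →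
    length (V ∷ V′ ∷ Vs) + length (V ∷ V′ ∷ Vs) ≤ 4 + (k + k) →
    Runs combine (length (V ∷ V′ ∷ Vs) ∷ stk ∷ H ∷ ρ) w (CC * (4 * cross ∣ set V ∣ (sizes (V′ ∷ Vs))))
      (NewItem G (unionOf G (V ∷ V′ ∷ Vs)) rest H w)
  combineItems {V = V} {V′} {Vs} ch st stack f le = runs-weaken (≤-reflexive (cong (_* E) (sym (nodeFactor≡ k)))) (λ _ _ r → r)
    (runs-combine G ch st stack f
      (subst (λ z → All (λ X → Bounded G E z (set X)) (V ∷ V′ ∷ Vs)) (sym s≡) (All.map⁻ (proj₁ bounds)))
      (subst (λ z → 2 * z ≤ E) (sym s≡) (proj₁ (proj₂ bounds)))
      (subst (λ z → z + 1 ≤ E) (sym s≡) (proj₁ (proj₂ (proj₂ bounds))))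
      (≤-trans (refine-length′ G (V ∷ V′ ∷ Vs)) le))
    where
    E = 4 * cross ∣ set V ∣ (sizes (V′ ∷ Vs))
    bounds = cross-bounds {∣ set V ∣} {∣ set V′ ∣} {sizes Vs} (All.map⁺ (All.map (∣∣≥1 G) (Children.nonempty ch)))
    s≡ = trans (cong ∣_∣ (S≡ G {rest = []} ch)) (size-union (Children.disjoint ch))

  rel : (Fin n → Fin n → Set) → Subset n → Subset n → Set
  rel r X Y = ∀ {u v} → u ∈ X → v ∈ Y → r u v

  relItems : (Fin n → Fin n → Set) → ItemData → ItemData → Set
  relItems r X Y = rel r (set X) (set Y)

  ∈unionOf : ∀ {Vs v} → v ∈ unionOf G Vs → ∃ λ V → V ∈ₗ Vs × v ∈ set V
  ∈unionOf {[]} v∈ = contradiction v∈ ∉⊥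
  ∈unionOf {V ∷ Vs} v∈ = [ (λ v∈V → V , here refl , v∈V) , (λ v∈Vs → let X , X∈ , v∈X = ∈unionOf v∈Vs in X , there X∈ , v∈X) ]′
    (x∈p∪q⁻ (set V) (unionOf G Vs) v∈)

  mergeCost : ℕ → List ℕ → ℕ
  mergeCost x []       = 0
  mergeCost x (y ∷ ys) = suc (CC * (4 * cross x (y ∷ [])) + mergeCost (x + y) ys)

  mergeCost≤ : ∀ {x ys} → 1 ≤ x → All (1 ≤_) ys → mergeCost x ys ≤ (CC * 4 + 1) * cross x ys
  mergeCost≤ {ys = []} _ _ = z≤n
  mergeCost≤ {x} {y ∷ ys} 1≤x (1≤y ∷ pos) = ≤-trans
    (+-mono-≤ {1} {x * y} (*-mono-≤ 1≤x 1≤y) (+-monoʳ-≤ _ (mergeCost≤ (≤-trans 1≤x (m≤m+n x y)) pos)))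
    (≤-reflexive (lemma (x * y) CC (cross (x + y) ys)))
    where
    lemma : ∀ p c r → p + (c * (4 * (p + 0)) + (c * 4 + 1) * r) ≡ (c * 4 + 1) * (p + r)
    lemma = solve-∀

  -- X is the union of the children merged so far.
  record Merging (r : Fin n → Fin n → Set) (S : Subset n) (X : ItemData) (Vs : List ItemData) : Set where
    field
      nonempty : Nonempty (set X) × All (λ V → Nonempty (set V)) Vs
      disjoint : AllPairs (Disj G) (X ∷ Vs)
      related  : AllPairs (relItems r) (X ∷ Vs)
      union    : unionOf G (X ∷ Vs) ≡ S

  -- The union of the children merged so far is again homogeneous, because each later child is
  -- related to all of it in the same direction. Merging in the given order preserves this for K+S
  -- too, where the direction matters.
  merging-children : ∀ {r S X V Vs} → PointHomogeneous r → Closed S → IsItem X → IsItem V → Merging r S X (V ∷ Vs) →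
                     Children G (X ∷ V ∷ [])
  merging-children {r} {S} {X} {V} {Vs} ph closed iX iV m
    with (neX , neV ∷ _) ← Merging.nonempty m | ((XV ∷ _) ∷ (dV ∷ _)) ← Merging.disjoint m
       | ((rXV ∷ rX) ∷ (rV ∷ _)) ← Merging.related m = record
    { items    = iX ∷ iV ∷ []
    ; disjoint = (XV ∷ []) ∷ [] ∷ []
    ; nonempty = neX ∷ neV ∷ []
    ; good     = inj₂ (homogeneous-part ph closed X⊆ (proj₁ neV , V⊆ (proj₂ neV) , λ v∈ → XV v∈ (proj₂ neV)) relX)
               ∷ inj₂ (homogeneous-part ph closed V⊆ (proj₁ neX , X⊆ (proj₂ neX) , λ v∈ → XV (proj₂ neX) v∈) relV) ∷ []
    ; two      = ≤-refl }
    where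
    in-S : ∀ {v} → v ∈ unionOf G (X ∷ V ∷ Vs) → v ∈ S
    in-S = subst (_ ∈_) (Merging.union m)
    X⊆ : set X ⊆ S
    X⊆ v∈ = in-S (x∈p∪q⁺ (inj₁ v∈))
    V⊆ : set V ⊆ S
    V⊆ v∈ = in-S (x∈p∪q⁺ {p = set X} (inj₂ (x∈p∪q⁺ (inj₁ v∈))))
    cases : ∀ {v} → v ∈ S → v ∈ set X ⊎ v ∈ set V ⊎ v ∈ unionOf G Vs
    cases {v} v∈ = [ inj₁ , (λ v∈′ → inj₂ (x∈p∪q⁻ (set V) (unionOf G Vs) v∈′)) ]′
      (x∈p∪q⁻ (set X) (unionOf G (V ∷ Vs)) (subst (v ∈_) (sym (Merging.union m)) v∈))
    later : ∀ {Z v} → All (relItems r Z) Vs → v ∈ unionOf G Vs → ∀ {u} → u ∈ set Z → r u v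
    later rs v∈ u∈ = let Y , Y∈ , v∈Y = ∈unionOf v∈ in All.lookup rs Y∈ u∈ v∈Y
    relX : ∀ {v} → v ∈ S → v ∉ set X → (∀ {u} → u ∈ set X → r u v) ⊎ (∀ {u} → u ∈ set X → r v u)
    relX v∈ v∉ with cases v∈
    ... | inj₁ v∈X = contradiction v∈X v∉
    ... | inj₂ (inj₁ v∈V) = inj₁ λ u∈ → rXV u∈ v∈V
    ... | inj₂ (inj₂ v∈′) = inj₁ (later {X} rX v∈′)
    relV : ∀ {v} → v ∈ S → v ∉ set V → (∀ {u} → u ∈ set V → r u v) ⊎ (∀ {u} → u ∈ set V → r v u)
    relV v∈ v∉ with cases v∈
    ... | inj₁ v∈X = inj₂ λ u∈ → rXV v∈X u∈
    ... | inj₂ (inj₁ v∈V) = contradiction v∈V v∉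
    ... | inj₂ (inj₂ v∈′) = inj₁ (later {V} rV v∈′)

  merging-next : ∀ {r S X V Vs Y} → set Y ≡ unionOf G (X ∷ V ∷ []) → Merging r S X (V ∷ Vs) → Merging r S Y Vs
  merging-next {r} {S} {X} {V} {Vs} {Y} eq m
    with ((x , x∈) , _ ∷ neVs) ← Merging.nonempty m | ((_ ∷ dX) ∷ (dV ∷ ds)) ← Merging.disjoint m
       | ((_ ∷ rX) ∷ (rV ∷ rs)) ← Merging.related m = record
    { nonempty = (x , subst (x ∈_) (sym Y≡) (x∈p∪q⁺ (inj₁ x∈))) , neVs
    ; disjoint = All.zipWith {P = Disj G X} {Q = Disj G V} {R = Disj G Y} (λ (dX , dV) v∈ → [ dX , dV ]′ (cases v∈)) (dX , dV) ∷ ds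
    ; related  = All.zipWith {P = relItems r X} {Q = relItems r V} {R = relItems r Y} (λ (rX , rV) u∈ v∈ → [ (λ u∈X → rX u∈X v∈) , (λ u∈V → rV u∈V v∈) ]′ (cases u∈)) (rX , rV) ∷ rs
    ; union    = trans (cong (_∪ unionOf G Vs) Y≡) (trans (∪-assoc (set X) (set V) _) (Merging.union m)) }
    where
    Y≡ : set Y ≡ set X ∪ set V
    Y≡ = trans eq (cong (set X ∪_) (∪-identityʳ (set V)))
    cases : ∀ {v} → v ∈ set Y → v ∈ set X ⊎ v ∈ set V
    cases v∈ = x∈p∪q⁻ (set X) (set V) (subst (_ ∈_) Y≡ v∈)

  merge : ∀ {r S} → PointHomogeneous r → Closed S → ∀ Vs {X rest H stk w} {ρ : Vec ℕ Γ} → Merging r S X Vs →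
    Static G H (heap w) → StackAt G H (heap w) stk (X ∷ Vs ++ₗ rest) → Fresh H w →
    LoopRuns mergeTwo ρ (length Vs) (stk ∷ H ∷ []) w (mergeCost ∣ set X ∣ (sizes Vs)) (NewItem G S rest H w)
  merge ph closed [] {X} m st stack f = loopRuns-zero
    (grow-refl f ≤-refl , X , trans (sym (∪-identityʳ (set X))) (Merging.union m) , stack)
  merge {S = S} ph closed (V ∷ Vs) {X} {rest} {H} {w = w} m st stack@(push _ sX (push _ sV _)) f = loopRuns-suc
    (runs-call (combineItems children st stack f (m≤m+n 4 (k + k))))
    λ { (stk′ ∷ H′ ∷ []) w′ (g , Y , Y≡ , stack′) →
        loopRuns-weaken (≤-reflexive (cong (λ z → mergeCost z (sizes Vs)) (trans (cong ∣_∣ Y≡)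
            (trans (size-union (Children.disjoint children)) (cong (∣ set X ∣ +_) (+-identityʳ ∣ set V ∣))))))
          (λ { (stk″ ∷ H″ ∷ []) w″ (g′ , Z , Z≡ , stack″) → grow-trans g g′ , Z , Z≡ , stack″ })
          (merge ph closed Vs {Y} (merging-next Y≡ m) (static-grow G g st) stack′ (fresh g)) }
    where
    children : Children G (X ∷ V ∷ [])
    children = merging-children ph closed (Stored.isItem sX) (Stored.isItem sV) m

  nonPrime : ∀ ℓ {S Vs} → ℓ ≢ Prime → DecomposesInto G ℓ S Vs → ∃ λ r → PointHomogeneous r × Splits G (rel r) S Vs
  nonPrime Parallel _ ((sp , _) , _) = parallel , parallel-homogeneous , sp
  nonPrime Series   _ ((sp , _) , _) = series , series-homogeneous , sp
  nonPrime K+S      _ (sp , _)       = k+s , k+s-homogeneous , sp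
  nonPrime Prime    ≢ _              = contradiction refl ≢

  prime? : ∀ ℓ → (ℓ ≡ Prime) ⊎ (ℓ ≢ Prime × encodeLabel ℓ ∸ 3 ≡ 0)
  prime? Parallel = inj₂ ((λ ()) , refl)
  prime? Series   = inj₂ ((λ ()) , refl)
  prime? K+S      = inj₂ ((λ ()) , refl)
  prime? Prime    = inj₁ refl

  label≢0 : ∀ ℓ → encodeLabel ℓ ≢ 0
  label≢0 Parallel ()
  label≢0 Series   ()
  label≢0 K+S      ()
  label≢0 Prime    ()

  partition : ∀ ℓ {S Vs} → DecomposesInto G ℓ S Vs → IsPartition G S Vs
  partition Parallel ((sp , _) , _) = Splits.partition sp
  partition Series   ((sp , _) , _) = Splits.partition sp
  partition K+S      (sp , _)       = Splits.partition sp
  partition Prime    pd             = PrimeDecomposition.partition pd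

  disjoint-either : ∀ {R : Subset n → Subset n → Set} {Vs X Y} → AllPairs R Vs → X ∈ₗ Vs → Y ∈ₗ Vs → X ≢ Y → R X Y ⊎ R Y X
  disjoint-either (r ∷ rs) (here refl) (here refl) ne = contradiction refl ne
  disjoint-either (r ∷ rs) (here refl) (there Y∈)  ne = inj₁ (All.lookup r Y∈)
  disjoint-either (r ∷ rs) (there X∈)  (here refl) ne = inj₂ (All.lookup r X∈)
  disjoint-either (r ∷ rs) (there X∈)  (there Y∈)  ne = disjoint-either rs X∈ Y∈ ne

  ∈⋃⁻ : ∀ {Vs : List (Subset n)} {v} → v ∈ ⋃ Vs → ∃ λ V → V ∈ₗ Vs × v ∈ V
  ∈⋃⁻ {[]} v∈ = contradiction v∈ ∉⊥
  ∈⋃⁻ {V ∷ Vs} v∈ = [ (λ v∈V → V , here refl , v∈V) , (λ v∈Vs → let X , X∈ , v∈X = ∈⋃⁻ v∈Vs in X , there X∈ , v∈X) ]′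
    (x∈p∪q⁻ V (⋃ Vs) v∈)

  ∈⋃⁺ : ∀ {Vs : List (Subset n)} {V v} → V ∈ₗ Vs → v ∈ V → v ∈ ⋃ Vs
  ∈⋃⁺ {V ∷ Vs} (here refl) v∈ = x∈p∪q⁺ (inj₁ v∈)
  ∈⋃⁺ {X ∷ Vs} (there V∈)  v∈ = x∈p∪q⁺ {p = X} (inj₂ (∈⋃⁺ V∈ v∈))

  children-closed : ∀ ℓ {S Vs} → DecomposesInto G ℓ S Vs → Closed S → ∀ {V} → V ∈ₗ Vs → Closed V
  children-closed ℓ {S} {Vs} dec closed {V} V∈ with prime? ℓ
  ... | inj₁ refl = prime-closed closed dec V∈
  ... | inj₂ (≢P , _) with r , ph , sp ← nonPrime ℓ ≢P dec =
    inj₁ (homogeneous-part ph closed (λ v∈ → in-S V∈ v∈) (other (Splits.p≥2 sp) (IsPartition.nonempty part) (IsPartition.disjoint part) V∈ id) related)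
    where
    part = Splits.partition sp
    covers = IsPartition.covers part
    in-S : ∀ {X v} → X ∈ₗ Vs → v ∈ X → v ∈ S
    in-S X∈ v∈ = subst (_ ∈_) covers (∈⋃⁺ X∈ v∈)
    other : ∀ {Us} → 2 ≤ length Us → All Nonempty Us → AllPairs (λ X Y → Empty (X ∩ Y)) Us → V ∈ₗ Us →
            (∀ {X} → X ∈ₗ Us → X ∈ₗ Vs) → ∃ λ z → z ∈ S × z ∉ V
    other {_ ∷ []} (s≤s ()) _ _ _ _
    other {_ ∷ _ ∷ _} _ (_ ∷ (z , z∈) ∷ _) ((d ∷ _) ∷ _) (here refl) ⊆Vs =
      z , in-S (⊆Vs (there (here refl))) z∈ , λ z∈V → d (z , x∈p∩q⁺ (z∈V , z∈))
    other {_ ∷ _ ∷ _} _ ((z , z∈) ∷ _) (d ∷ _) (there V∈) ⊆Vs =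
      z , in-S (⊆Vs (here refl)) z∈ , λ z∈V → All.lookup d V∈ (z , x∈p∩q⁺ (z∈ , z∈V))
    related : ∀ {v} → v ∈ S → v ∉ V → (∀ {u} → u ∈ V → r u v) ⊎ (∀ {u} → u ∈ V → r v u)
    related {v} v∈ v∉ with Y , Y∈ , v∈Y ← ∈⋃⁻ (subst (v ∈_) (sym covers) v∈)
      with disjoint-either (Splits.related sp) V∈ Y∈ (λ { refl → v∉ v∈Y })
    ... | inj₁ VY = inj₁ λ u∈ → VY u∈ v∈Y
    ... | inj₂ YV = inj₂ λ u∈ → YV v∈Y u∈

  size-⋃ : ∀ {Vs : List (Subset n)} → AllPairs (λ X Y → Empty (X ∩ Y)) Vs → ∣ ⋃ Vs ∣ ≡ total (map ∣_∣ Vs)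
  size-⋃ [] = ∣⊥∣≡0 n
  size-⋃ {V ∷ Vs} (d ∷ ds) = trans (∣∣-sum (∪-isSum (⋃-disjoint d))) (cong (∣ V ∣ +_) (size-⋃ ds))

  -- The only part of a Prime node would be either a canonical bimodule, hence contained in a
  -- bimodule other than S, or a singleton, while S has at least two vertices.
  length≥2 : ∀ ℓ {S Vs} → DecomposesInto G ℓ S Vs → 2 ≤ length Vs
  length≥2 ℓ dec with prime? ℓ
  length≥2 ℓ dec | inj₂ (≢P , _) = let _ , _ , sp = nonPrime ℓ ≢P dec in Splits.p≥2 sp
  length≥2 .Prime {S} {[]} dec | inj₁ refl = contradiction (≤-trans (PrimeDecomposition.size≥2 dec)
    (≤-reflexive (trans (cong ∣_∣ (sym (IsPartition.covers (PrimeDecomposition.partition dec)))) (∣⊥∣≡0 n)))) λ ()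
  length≥2 .Prime {S} {V ∷ []} dec | inj₁ refl with Equivalence.to (PrimeDecomposition.parts dec V) (here refl)
  ... | inj₁ (M , max , members , _) = contradiction
      (⊆-antisym (Bimodule.subset (proj₁ (proj₁ max)))
        (λ v∈ → proj₁ (Equivalence.to (members _) (subst (_ ∈_) (sym V≡S) v∈))))
      (proj₂ (proj₂ (proj₁ max)))
    where
    V≡S : V ≡ S
    V≡S = trans (sym (∪-identityʳ V)) (IsPartition.covers (PrimeDecomposition.partition dec))
  ... | inj₂ (v , _ , _ , refl) = contradiction (≤-trans (PrimeDecomposition.size≥2 dec)
      (≤-reflexive (trans (cong ∣_∣ (sym V≡S)) (∣⁅x⁆∣≡1 v)))) λ { (s≤s ()) }
    where
    V≡S : ⁅ v ⁆ ≡ S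
    V≡S = trans (sym (∪-identityʳ ⁅ v ⁆)) (IsPartition.covers (PrimeDecomposition.partition dec))
  length≥2 .Prime {S} {_ ∷ _ ∷ _} dec | inj₁ refl = s≤s (s≤s z≤n)

  arities-node : ∀ ℓ ts → All (_≤ k) (primeArities (node ℓ ts)) →
                 All (_≤ k) (primeAritiesAll {n} ts) × (ℓ ≡ Prime → length ts ≤ k)
  arities-node Parallel ts as       = as , λ ()
  arities-node Series   ts as       = as , λ ()
  arities-node K+S      ts as       = as , λ ()
  arities-node Prime    ts (a ∷ as) = as , λ _ → a

  disjoint-items : ∀ Is → AllPairs (λ X Y → Empty (X ∩ Y)) (map set Is) → AllPairs (Disj G) Is
  disjoint-items []       []       = []
  disjoint-items (I ∷ Is) (e ∷ es) = go Is e ∷ disjoint-items Is es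
    where
    go : ∀ Js → All (λ Y → Empty (set I ∩ Y)) (map set Js) → All (Disj G I) Js
    go []       []       = []
    go (J ∷ Js) (e ∷ es) = (λ v∈ v∈′ → e (_ , x∈p∩q⁺ (v∈ , v∈′))) ∷ go Js es

  AfterNode : Subset n → List ItemData → List (ℕ × ℕ) → ℕ → World → Post 3
  AfterNode S rest toks H w (tok ∷ stk ∷ H′ ∷ []) w′ =
    Grow H w H′ w′ × (∃ λ V → set V ≡ S × StackAt G H′ (heap w′) stk (V ∷ rest)) × TokensAt H′ (heap w′) tok toks

  nodeCost : ℕ → ℕ
  nodeCost c = CC * (4 * c) + c

  -- The inequality is the amortised form of the cost: the potential K times squared size, released
  -- when the parts are united, pays for the node.
  runs-node : ∀ ℓ {S Is rest toks tok stk H w} {ρ : Vec ℕ Γ} → DecomposesInto G ℓ S (map set Is) → Closed S →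
    (ℓ ≡ Prime → length Is ≤ k) → Static G H (heap w) → StackAt G H (heap w) stk (Is ++ₗ rest) → Fresh H w →
    TokensAt H (heap w) tok ((encodeLabel ℓ , length Is) ∷ toks) →
    ∃ λ a → Runs tokenStep (tok ∷ stk ∷ H ∷ ρ) w a (AfterNode S rest toks H w) ×
            suc a + K * squares (map ∣_∣ (map set Is)) ≤ K * sq S
  runs-node ℓ {Is = []} dec = contradiction (length≥2 ℓ dec) λ ()
  runs-node ℓ {Is = _ ∷ []} dec = contradiction (length≥2 ℓ dec) λ { (s≤s ()) }
  runs-node ℓ {S} {Is = V₀ ∷ V₁ ∷ Vs} {rest} {toks} {tok} {stk} {H} {w} {ρ} dec closed arity st stack f (_∷_ {next = next} kt ts) =
    nodeCost c ,
    runs-call (runs-ifz (λ z → contradiction (trans (sym tag) z) (label≢0 ℓ)) λ _ →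
      runs-ifz (λ z → runs-weaken (mergeBound z) (λ _ _ r → r) (runs-bind (runs-loop (merged z)) after))
               (λ nz → runs-weaken (≤-trans (≤-reflexive (+-identityʳ _)) (m≤m+n _ c)) (λ _ _ r → r)
                  (runs-bind (runs-call (combined nz)) after))) ,
    bound
    where
    Is = V₀ ∷ V₁ ∷ Vs
    c = cross ∣ set V₀ ∣ (sizes (V₁ ∷ Vs))
    part = partition ℓ dec
    tag : heap w tok ≡ encodeLabel ℓ
    tag = proj₁ (now kt)
    count : heap w (tok + 1) ≡ length Is
    count = proj₁ (proj₂ (now kt))
    nonempties : All (λ V → Nonempty (set V)) Is
    nonempties = All.map⁻ (IsPartition.nonempty part)
    disjoints : AllPairs (Disj G) Is
    disjoints = disjoint-items Is (IsPartition.disjoint part)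
    after : ∀ xs w′ → NewItem G S rest H w xs w′ →
            Runs (return (field′ 2 v2 ∷ v0 ∷ v1 ∷ [])) (xs ++ tok ∷ stk ∷ H ∷ tok ∷ stk ∷ H ∷ ρ) w′ 0 (AfterNode S rest toks H w)
    after (stk′ ∷ H′ ∷ []) w′ (g , new) = runs-return (g , new ,
      subst (λ z → TokensAt H′ (heap w′) z toks) (sym (proj₂ (proj₂ (kept-in g kt)))) (tokens-grow g ts))
    merged : heap w tok ∸ 3 ≡ 0 → LoopRuns mergeTwo (tok ∷ stk ∷ H ∷ tok ∷ stk ∷ H ∷ ρ) (heap w (tok + 1) ∸ 1) (stk ∷ H ∷ []) w
               (mergeCost ∣ set V₀ ∣ (sizes (V₁ ∷ Vs))) (NewItem G S rest H w)
    merged z with prime? ℓ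
    ... | inj₁ refl = contradiction (trans (sym (cong (_∸ 3) tag)) z) λ ()
    ... | inj₂ (≢P , _) with r , ph , sp ← nonPrime ℓ ≢P dec =
      subst (λ z → LoopRuns mergeTwo (tok ∷ stk ∷ H ∷ tok ∷ stk ∷ H ∷ ρ) z (stk ∷ H ∷ []) w
                 (mergeCost ∣ set V₀ ∣ (sizes (V₁ ∷ Vs))) (NewItem G S rest H w)) (sym (cong (_∸ 1) count)) (merge ph closed (V₁ ∷ Vs) (record
        { nonempty = All.head nonempties , All.tail nonempties
        ; disjoint = disjoints
        ; related  = AllPairs.map⁻ (Splits.related sp)
        ; union    = IsPartition.covers part }) st stack f)
    positive : All (1 ≤_) (sizes Is)
    positive = All.map⁺ (All.map (∣∣≥1 G) nonempties)
    mergeBound : ∀ (z : heap w tok ∸ 3 ≡ 0) → mergeCost ∣ set V₀ ∣ (sizes (V₁ ∷ Vs)) + 0 ≤ nodeCost c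
    mergeBound _ = ≤-trans (≤-reflexive (+-identityʳ _)) (≤-trans (mergeCost≤ (All.head positive) (All.tail positive))
      (≤-reflexive (lemma CC c)))
      where
      lemma : ∀ a c → (a * 4 + 1) * c ≡ a * (4 * c) + c
      lemma = solve-∀
    combined : heap w tok ∸ 3 ≢ 0 → Runs combine (heap w (tok + 1) ∷ stk ∷ H ∷ tok ∷ stk ∷ H ∷ tok ∷ stk ∷ H ∷ ρ) w (CC * (4 * c)) (NewItem G S rest H w)
    combined nz with prime? ℓ
    ... | inj₂ (_ , z) = contradiction (trans (cong (_∸ 3) tag) z) nz
    ... | inj₁ refl = subst₂ (λ z T → Runs combine (z ∷ stk ∷ H ∷ tok ∷ stk ∷ H ∷ tok ∷ stk ∷ H ∷ ρ) w (CC * (4 * c)) (NewItem G T rest H w)) (sym count) (IsPartition.covers part)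
      (combineItems record
        { items    = items-of-stack {Vs = Is} stack
        ; disjoint = disjoints
        ; nonempty = nonempties
        ; good     = All.map⁻ (All.tabulate λ V∈ → closed⇒good (children-closed Prime dec closed V∈))
        ; two      = s≤s (s≤s z≤n) } st stack f
        (≤-trans (+-mono-≤ (arity refl) (arity refl)) (m≤n+m (k + k) 4)))
    bound : suc (nodeCost c) + K * squares (map ∣_∣ (map set Is)) ≤ K * sq S
    bound = begin
      suc (nodeCost c) + K * squares (map ∣_∣ (map set Is))
        ≡⟨ cong (λ z → suc (nodeCost c) + K * squares z) (sym (map-∘ {g = ∣_∣} {f = set} Is)) ⟩
      suc (nodeCost c) + K * squares (sizes Is)
        ≤⟨ +-monoˡ-≤ _ (s≤s (≤-refl {nodeCost c})) ⟩
      1 + (CC * (4 * c) + c) + K * squares (sizes Is)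
        ≤⟨ +-monoˡ-≤ _ (+-monoˡ-≤ _ 1≤c) ⟩
      c + (CC * (4 * c) + c) + K * squares (sizes Is)
        ≡⟨ lemma CC c (squares (sizes Is)) ⟩
      K * (squares (sizes Is) + 2 * c)
        ≡⟨ cong (K *_) (sym (square-of-total ∣ set V₀ ∣ (sizes (V₁ ∷ Vs)))) ⟩
      K * (total (sizes Is) * total (sizes Is))
        ≡⟨ cong (λ z → K * (z * z)) (trans (sym (size-union disjoints)) (cong ∣_∣ (IsPartition.covers part))) ⟩
      K * sq S ∎
      where
      open ≤-Reasoning
      1≤c : 1 ≤ c
      1≤c = proj₂ (proj₂ (proj₂ (cross-bounds positive)))
      lemma : ∀ a c s → c + (a * (4 * c) + c) + (2 * a + 1) * s ≡ (2 * a + 1) * (s + 2 * c)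
      lemma = solve-∀

  -- One loop consumes the tokens of the whole tree, and a subtree accounts for a prefix of its
  -- iterations only. The remaining iterations therefore enter as a continuation with cost b.
  process : ∀ {S t} → CanonicalTreeOf G S t → Closed S → All (_≤ k) (primeArities t) →
    ∀ {rest toks tok stk H w b m} {ρ : Vec ℕ m} {Q : Post 3} →
    Static G H (heap w) → StackAt G H (heap w) stk rest → Fresh H w → TokensAt H (heap w) tok (revTokens t ++ₗ toks) →
    (∀ {tok′ stk′ H′ w′} → AfterNode S rest toks H w (tok′ ∷ stk′ ∷ H′ ∷ []) w′ →
       LoopRuns tokenStep ρ (length toks) (tok′ ∷ stk′ ∷ H′ ∷ []) w′ b Q) →
    LoopRuns tokenStep ρ (length (revTokens t ++ₗ toks)) (tok ∷ stk ∷ H ∷ []) w (K * sq S + b) Q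

  processAll : ∀ {Vs ts} → Pointwise (CanonicalTreeOf G) Vs ts → All Closed Vs → All (_≤ k) (primeAritiesAll ts) →
    ∀ {rest toks tok stk H w b m} {ρ : Vec ℕ m} {Q : Post 3} →
    Static G H (heap w) → StackAt G H (heap w) stk rest → Fresh H w → TokensAt H (heap w) tok (revTokensAll ts ++ₗ toks) →
    (∀ {tok′ stk′ H′ w′ Is} → Grow H w H′ w′ → map set Is ≡ Vs → StackAt G H′ (heap w′) stk′ (Is ++ₗ rest) →
       TokensAt H′ (heap w′) tok′ toks →
       LoopRuns tokenStep ρ (length toks) (tok′ ∷ stk′ ∷ H′ ∷ []) w′ b Q) →
    LoopRuns tokenStep ρ (length (revTokensAll ts ++ₗ toks)) (tok ∷ stk ∷ H ∷ []) w (K * squares (map ∣_∣ Vs) + b) Q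

  process (leaf v) closed as {rest} {toks} {tok} {stk} {H} {w} {b} {Q = Q} st stack f (_∷_ {next = next} kt ts) cont =
    loopRuns-weaken bound (λ _ _ q → q) (loopRuns-suc {R = AfterNode ⁅ v ⁆ rest toks H w}
      (runs-call (runs-ifz (λ _ → runs-poke (runs-poke (runs-return pushed)))
        (λ nz → contradiction (proj₁ (now kt)) nz)))
      λ { (tok′ ∷ stk′ ∷ H′ ∷ []) w′ after → cont after })
    where
    bound : suc (0 + b) ≤ K * sq ⁅ v ⁆ + b
    bound rewrite ∣⁅x⁆∣≡1 v = +-monoˡ-≤ b (≤-trans (m≤n+m 1 (2 * CC)) (≤-reflexive (sym (*-identityʳ K))))
    x = record# (heap w (tok + 1))
    w₁ = pokeWorld w H x
    w₂ = pokeWorld w₁ (H + 1) stk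
    g : Grow H w (H + 2) w₂
    g = grow-poke (m≤m+n H 1) (+-monoʳ-< H (s≤s (s≤s z≤n))) (grow-poke ≤-refl (m<m+n H (s≤s z≤n)) (grow-refl f (m≤m+n H 2)))
    pushed : AfterNode ⁅ v ⁆ rest toks H w (heap w₂ (tok + 2) ∷ H ∷ H + 2 ∷ []) w₂
    pushed = g , (leafItem G v , refl , push (kept λ b →
        trans (b (m<m+n H (s≤s z≤n))) (trans (update-other (heap w₁) stk (λ eq → <⇒≢ (m<m+n H (s≤s z≤n)) (sym eq)))
          (trans (update-same (heap w) H x) (cong record# (proj₁ (proj₂ (now kt)))))) ,
        trans (b (+-monoʳ-< H (s≤s (s≤s z≤n)))) (update-same (heap w₁) (H + 1) stk))
        (stored-grow g (Static.single st v)) (stack-grow G g stack)) ,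
      subst (λ z → TokensAt (H + 2) (heap w₂) z toks) (sym (proj₂ (proj₂ (kept-in g kt)))) (tokens-grow g ts)
  process (node {S} {ℓ} {Vs} {ts} dec pw) closed as {rest} {toks} {tok} {stk} {H} {w} {b} {ρ = ρ} {Q} st stack f tokens cont =
    subst (λ xs → LoopRuns tokenStep ρ (length xs) (tok ∷ stk ∷ H ∷ []) w (K * sq S + b) Q) (sym reassoc)
      (processChildren (subst (TokensAt H (heap w) tok) reassoc tokens))
    where
    tk = (encodeLabel ℓ , length ts)
    reassoc : (revTokensAll ts ++ₗ tk ∷ []) ++ₗ toks ≡ revTokensAll ts ++ₗ tk ∷ toks
    reassoc = ++ₗ-assoc (revTokensAll ts) (tk ∷ []) toks
    arity = arities-node ℓ ts as
    nodeBound : ℕ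
    nodeBound = K * sq S ∸ K * squares (map ∣_∣ Vs)
    processChildren : TokensAt H (heap w) tok (revTokensAll ts ++ₗ tk ∷ toks) →
      LoopRuns tokenStep ρ (length (revTokensAll ts ++ₗ tk ∷ toks)) (tok ∷ stk ∷ H ∷ []) w (K * sq S + b) Q
    processChildren tokens = loopRuns-weaken total≤ (λ _ _ q → q)
      (processAll pw (All.tabulate (children-closed ℓ dec closed)) (proj₁ arity) st stack f tokens step′)
      where
      squares≤sq : K * squares (map ∣_∣ Vs) ≤ K * sq S
      squares≤sq = *-monoʳ-≤ K (≤-trans (squares≤ (map ∣_∣ Vs)) (≤-reflexive (cong (λ z → z * z)
        (trans (sym (size-⋃ (IsPartition.disjoint (partition ℓ dec)))) (cong ∣_∣ (IsPartition.covers (partition ℓ dec)))))))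
      total≤ : K * squares (map ∣_∣ Vs) + (nodeBound + b) ≤ K * sq S + b
      total≤ = ≤-reflexive (trans (sym (+-assoc (K * squares (map ∣_∣ Vs)) nodeBound b)) (cong (_+ b) (m+[n∸m]≡n squares≤sq)))
      step′ : ∀ {tok′ stk′ H′ w′ Is} → Grow H w H′ w′ → map set Is ≡ Vs → StackAt G H′ (heap w′) stk′ (Is ++ₗ rest) →
        TokensAt H′ (heap w′) tok′ (tk ∷ toks) → LoopRuns tokenStep ρ (suc (length toks)) (tok′ ∷ stk′ ∷ H′ ∷ []) w′ (nodeBound + b) Q
      step′ {tok′} {stk′} {H′} {w′} {Is} g refl stack′ tokens′ = finished (runs-node ℓ {Is = Is} {ρ = length toks ∷ ρ} dec closed
          (λ p → ≤-trans (≤-reflexive (sym length≡)) (proj₂ arity p)) (static-grow G g st) stack′ (fresh g)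
          (subst (λ z → TokensAt H′ (heap w′) tok′ ((encodeLabel ℓ , z) ∷ toks)) length≡ tokens′))
        where
        length≡ : length ts ≡ length Is
        length≡ = trans (sym (Pointwise-length pw)) (length-map set Is)
        finished : (∃ λ a → Runs tokenStep (tok′ ∷ stk′ ∷ H′ ∷ length toks ∷ ρ) w′ a (AfterNode S rest toks H′ w′) ×
                     suc a + K * squares (map ∣_∣ Vs) ≤ K * sq S) →
                   LoopRuns tokenStep ρ (suc (length toks)) (tok′ ∷ stk′ ∷ H′ ∷ []) w′ (nodeBound + b) Q
        finished (a , run , le) = loopRuns-weaken (+-monoˡ-≤ b (m+n≤o⇒m≤o∸n (suc a) le)) (λ _ _ q → q) (loopRuns-suc run
            λ { (tok″ ∷ stk″ ∷ H″ ∷ []) w″ (g′ , new , tokens″) → cont (grow-trans g g′ , new , tokens″) })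

  processAll [] [] as {b = b} st stack f tokens cont =
    loopRuns-weaken (m≤n+m b (K * 0)) (λ _ _ q → q) (cont {Is = []} (grow-refl f ≤-refl) refl stack tokens)
  processAll {V ∷ Vs} {t ∷ ts} (c ∷ pw) (cl ∷ cls) as {rest} {toks} {tok} {stk} {H} {w} {b} {ρ = ρ} {Q} st stack f tokens cont
    = subst (λ xs → LoopRuns tokenStep ρ (length xs) (tok ∷ stk ∷ H ∷ []) w (K * (sq V + squares (map ∣_∣ Vs)) + b) Q)
      (sym (++ₗ-assoc (revTokensAll ts) (revTokens t) toks))
      (loopRuns-weaken (≤-reflexive (two-costs K (squares (map ∣_∣ Vs)) (sq V) b)) (λ _ _ q → q)
        (processAll pw cls (All.++⁻ʳ (primeArities t) as) st stack f
          (subst (TokensAt H (heap w) tok) (++ₗ-assoc (revTokensAll ts) (revTokens t) toks) tokens)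
          λ {tok′} {stk′} {H′} {w′} {Is} g eq stack′ tokens′ →
            process c cl (All.++⁻ˡ (primeArities t) as) (static-grow G g st) stack′ (fresh g) tokens′
              λ { (g′ , (I , I≡ , stack″) , tokens″) → cont {Is = I ∷ Is} (grow-trans g g′) (cong₂ _∷_ I≡ eq) stack″ tokens″ }))

-- weight, colour, vertex, its record, power, 2^n, row, remaining, 2^n, n
writeHead : Cmd (10 + Γ) 0
writeHead = poke v3 (lit 1) (poke (v3 ⊕ lit 1) v1 (poke (v3 ⊕ lit 2) v2 (poke (v3 ⊕ lit 3) v2 (return []))))

writeRecord : Cmd (10 + Γ) 5
writeRecord = bind writeHead (
  poke (v3 ⊕ lit 4) (v3 ⊕ lit 5) (
  poke (v3 ⊕ lit 5) v0 (
  poke (v3 ⊕ lit 7) v4 (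
  poke (v3 ⊕ lit 8) v6 (
  return ((v2 ⊕ lit 1) ∷ (v3 ⊕ lit 16) ∷ (v4 ⊕ v4) ∷ v5 ∷ (v6 ⊕ v9) ∷ []))))))

-- vertex, its record, power, 2^n, row, remaining, 2^n, n
readVertex : Cmd (8 + Γ) 5
readVertex = input (
  bind (ifz v0 (return ((v4 ⊕ v3) ∷ [])) (return (lit 0 ∷ []))) writeRecord)

-- n
readVertices : Cmd (1 + Γ) 5
readVertices =
  bind (loop v0 (lit 1 ∷ []) (return ((v0 ⊕ v0) ∷ [])))
  (loop v1 (lit 0 ∷ lit 16 ∷ lit 1 ∷ v0 ∷ recordOf (v1 ⊕ lit 1) ∷ []) readVertex)

readNumber : Cmd (2 + Γ) 1
readNumber = input (poke v1 v0 (return ((v1 ⊕ lit 1) ∷ [])))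

-- H n
readMatrix : Cmd (2 + Γ) 1
readMatrix = loop v1 (v0 ∷ []) (loop v3 (v0 ∷ []) readNumber)

-- leaves tokens token H remaining _ n
readToken : Cmd (7 + Γ) 4
readToken = ifz (v6 ⊖ v0) (return (v0 ∷ v1 ∷ v2 ∷ v3 ∷ [])) (
  input (input (
  poke v5 v1 (poke (v5 ⊕ lit 1) v0 (poke (v5 ⊕ lit 2) v4 (
  bind (ifz v1 (return ((v2 ⊕ lit 1) ∷ [])) (return (v2 ∷ []))) (
  return (v0 ∷ (v4 ⊕ lit 1) ∷ v6 ∷ (v6 ⊕ lit 3) ∷ []))))))))

-- H n;  results: leaves, tokens, last token, H
readTokens : Cmd (2 + Γ) 4
readTokens = loop (v1 ⊕ v1) (lit 0 ∷ lit 0 ∷ lit 0 ∷ v0 ∷ []) readToken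

record Objective : Set where
  field
    score : ∀ {Γ} → Cmd (2 + Γ) 1
    limit : ∀ {Γ} → Cmd (2 + Γ) 1

-- code n power;  results: number of whites, remainder
divide : Cmd (3 + Γ) 2
divide = loop v1 (lit 0 ∷ v0 ∷ []) (ifz (v5 ⊖ v1)
  (return ((v0 ⊕ lit 1) ∷ (v1 ⊖ v5) ∷ []))
  (return (v0 ∷ v1 ∷ [])))

-- vertex, remaining blacks and whites, _, whites n limit
printVertex : Cmd (7 + Γ) 3
printVertex = ifz (field′ 1 (recordOf v0))
  (bind (return ((! (v4 ⊕ v0) ⊖ (! (v4 ⊕ v0) ⊖ v2)) ∷ []))
    (output v0 (return ((v1 ⊕ lit 1) ∷ v2 ∷ (v3 ⊖ v0) ∷ []))))
  (bind (loop v5 (lit 0 ∷ []) (return ((v0 ⊕ (! (v6 ⊕ v1) ⊖ edge v2 v1)) ∷ [])))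
    (bind (return (((lit 1 ⊖ v0) ⊖ ((lit 1 ⊖ v0) ⊖ v2)) ∷ []))
      (output v0 (return ((v2 ⊕ lit 1) ∷ (v3 ⊖ v0) ∷ v4 ∷ [])))))

-- whites n limit
printSet : Cmd (3 + Γ) 0
printSet = bind (loop v1 (lit 0 ∷ v2 ∷ v2 ∷ []) printVertex) (return [])

module _ (O : Objective) where
  open Objective O

  -- score whites _ table b n power
  chooseStep : Cmd (7 + Γ) 2
  chooseStep =
    bind (call (! (v3 ⊕ v2) ∷ v5 ∷ v6 ∷ []) divide) (
    bind (call (v4 ∷ v0 ∷ []) score) (
    ifz (v3 ⊖ v0) (return (v0 ∷ v2 ∷ [])) (return (v3 ∷ v4 ∷ []))))

  -- table b n power;  results: best score, white set
  choose : Cmd (4 + Γ) 2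
  choose = loop (v1 ⊕ lit 1) (lit 0 ∷ lit 0 ∷ []) chooseStep

  -- best score, white set, _ H n
  finishRest : Cmd (5 + Γ) 0
  finishRest =
    bind (call (v1 ∷ v4 ∷ v3 ∷ []) bits) (
    bind (call (v1 ∷ v5 ∷ []) limit) (
    call (v5 ∷ v6 ∷ v0 ∷ []) printSet))

  -- item H n
  finish : Cmd (3 + Γ) 0
  finish = bind (call (field′ 4 v0 ∷ field′ 1 v0 ∷ v2 ∷ powerOf v2 ∷ []) choose) finishRest

  -- _ tokens token H … n
  evaluateTree : Cmd 11 0
  evaluateTree = bind (loop v1 (v2 ∷ lit 0 ∷ v3 ∷ []) tokenStep) (call (! v1 ∷ v2 ∷ var (# 13) ∷ []) finish)

  -- H … n
  loadTree : Cmd 7 0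
  loadTree = bind (call (v0 ∷ v6 ∷ []) readTokens) evaluateTree

  -- _ record n, its power … n
  loadMatrix : Cmd 6 0
  loadMatrix = poke (v1 ⊕ lit 7) v2 (bind (call ((v1 ⊕ lit 16) ∷ v5 ∷ []) readMatrix) loadTree)

  main : Cmd 0 0
  main = input (bind (call (v0 ∷ []) readVertices) loadMatrix)

-- Reading the graph

record#≡ : ∀ v → 16 + v * 16 ≡ record# v
record#≡ v = lemma v
  where
  lemma : ∀ v → 16 + v * 16 ≡ 16 + ((((v + v) + (v + v)) + ((v + v) + (v + v))) + (((v + v) + (v + v)) + ((v + v) + (v + v))))
  lemma = solve-∀

encodeBits : ∀ {m} → Vec Bool m → List ℕ
encodeBits bs = map bit (toList bs)

record RecordCells (P p v : ℕ) (b : Bool) (row : ℕ) (h : Heap) : Set where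
  field
    field₀ : h p ≡ 1
    field₁ : h (p + 1) ≡ bit b
    field₂ : h (p + 2) ≡ v
    field₃ : h (p + 3) ≡ v
    field₄ : h (p + 4) ≡ p + 5
    field₅ : h (p + 5) ≡ (if b then 0 else P + 2 ^ v)
    field₆ : h (p + 6) ≡ 0
    field₇ : h (p + 7) ≡ 2 ^ v
    field₈ : h (p + 8) ≡ row

module WriteRecord (P p v : ℕ) (b : Bool) (row : ℕ) (w : World) where
  wt = if b then 0 else P + 2 ^ v
  w₀ = pokeWorld w p 1
  w₁ = pokeWorld w₀ (p + 1) (bit b)
  w₂ = pokeWorld w₁ (p + 2) v
  w₃ = pokeWorld w₂ (p + 3) v
  w₄ = pokeWorld w₃ (p + 4) (p + 5)
  w₅ = pokeWorld w₄ (p + 5) wt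
  w₇ = pokeWorld w₅ (p + 7) (2 ^ v)
  w₈ = pokeWorld w₇ (p + 8) row
  h₀ = heap w₀
  h₁ = heap w₁
  h₂ = heap w₂
  h₃ = heap w₃
  h₄ = heap w₄
  h₅ = heap w₅
  h₇ = heap w₇

  growth : Fresh p w → Grow p w (p + 16) w₈
  growth f =
    poke′ 8 (m≤m+n 9 _) (poke′ 7 (m≤m+n 8 _) (poke′ 5 (m≤m+n 6 _) (poke′ 4 (m≤m+n 5 _) (poke′ 3 (m≤m+n 4 _)
      (poke′ 2 (m≤m+n 3 _) (poke′ 1 (m≤m+n 2 _) (grow-poke ≤-refl (m<m+n p (s≤s z≤n)) (grow-refl f (m≤m+n p 16)))))))))
    where
    poke′ : ∀ {w′ x} i → i < 16 → Grow p w (p + 16) w′ → Grow p w (p + 16) (pokeWorld w′ (p + i) x)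
    poke′ i i< = grow-poke (m≤m+n p i) (+-monoʳ-< p i<)

  cells : Fresh p w → RecordCells P p v b row (heap w₈)
  cells f = record
    { field₀ = skip₀ h₇ p 7 (skip₀ h₅ p 6 (skip₀ h₄ p 4 (skip₀ h₃ p 3 (skip₀ h₂ p 2 (skip₀ h₁ p 1 (skip₀ h₀ p 0
                 (update-same (heap w) p 1)))))))
    ; field₁ = skip h₇ p 8 1 (λ ()) (skip h₅ p 7 1 (λ ()) (skip h₄ p 5 1 (λ ()) (skip h₃ p 4 1 (λ ()) (skip h₂ p 3 1 (λ ())
                 (skip h₁ p 2 1 (λ ()) (update-same h₀ (p + 1) (bit b)))))))
    ; field₂ = skip h₇ p 8 2 (λ ()) (skip h₅ p 7 2 (λ ()) (skip h₄ p 5 2 (λ ()) (skip h₃ p 4 2 (λ ()) (skip h₂ p 3 2 (λ ())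
                 (update-same h₁ (p + 2) v)))))
    ; field₃ = skip h₇ p 8 3 (λ ()) (skip h₅ p 7 3 (λ ()) (skip h₄ p 5 3 (λ ()) (skip h₃ p 4 3 (λ ())
                 (update-same h₂ (p + 3) v))))
    ; field₄ = skip h₇ p 8 4 (λ ()) (skip h₅ p 7 4 (λ ()) (skip h₄ p 5 4 (λ ()) (update-same h₃ (p + 4) (p + 5))))
    ; field₅ = skip h₇ p 8 5 (λ ()) (skip h₅ p 7 5 (λ ()) (update-same h₄ (p + 5) wt))
    ; field₆ = skip h₇ p 8 6 (λ ()) (skip h₅ p 7 6 (λ ()) (skip h₄ p 5 6 (λ ()) (skip h₃ p 4 6 (λ ()) (skip h₂ p 3 6 (λ ())
                 (skip h₁ p 2 6 (λ ()) (skip h₀ p 1 6 (λ ()) (skip₁ (heap w) p 5 (f (m≤m+n p 6)))))))))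
    ; field₇ = skip h₇ p 8 7 (λ ()) (update-same h₅ (p + 7) (2 ^ v))
    ; field₈ = update-same h₇ (p + 8) row }

kept-cells : ∀ {P p v b row w} → RecordCells P p v b row (heap w) → Kept (p + 16) (heap w) (RecordCells P p v b row)
kept-cells {p = p} c = kept λ {h} e → let at′ = λ i i< → e {p + i} (+-monoʳ-< p i<) in record
  { field₀ = trans (e (m<m+n p (s≤s z≤n))) field₀
  ; field₁ = trans (at′ 1 (m≤m+n 2 _)) field₁
  ; field₂ = trans (at′ 2 (m≤m+n 3 _)) field₂
  ; field₃ = trans (at′ 3 (m≤m+n 4 _)) field₃
  ; field₄ = trans (at′ 4 (m≤m+n 5 _)) field₄
  ; field₅ = trans (at′ 5 (m≤m+n 6 _)) field₅
  ; field₆ = trans (at′ 6 (m≤m+n 7 _)) field₆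
  ; field₇ = trans (at′ 7 (m≤m+n 8 _)) field₇
  ; field₈ = trans (at′ 8 (m≤m+n 9 _)) field₈ }
  where open RecordCells c

Records : ∀ {m} → (P n p v row : ℕ) → Vec Bool m → Heap → Set
Records P n p v row []       h = ⊤
Records P n p v row (b ∷ bs) h = RecordCells P p v b row h × Records P n (p + 16) (suc v) (row + n) bs h

VerticesRead : ∀ {m} → (P n p v row : ℕ) → Vec Bool m → World → Post 5
VerticesRead {m} P n p v row bs w (v′ ∷ p′ ∷ pw′ ∷ P′ ∷ row′ ∷ []) w′ =
  p′ ≡ p + m * 16 × pw′ ≡ 2 ^ (v + m) × Grow p w p′ w′ × Kept p′ (heap w′) (Records P n p v row bs)

runs-writeRecord : ∀ {P p v b row w i Q n} {ρ : Vec ℕ Γ} {R : Post 5} → let open WriteRecord P p v b row w in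
  R (v + 1 ∷ p + 16 ∷ 2 ^ v + 2 ^ v ∷ P ∷ row + n ∷ []) w₈ →
  Runs writeRecord (wt ∷ bit b ∷ v ∷ p ∷ 2 ^ v ∷ P ∷ row ∷ i ∷ Q ∷ n ∷ ρ) w 0 R
runs-writeRecord {P = P} {p} {v} {b} {row} {w} r = runs-bind {R = λ _ w′ → w′ ≡ w₃}
  (runs-poke (runs-poke (runs-poke (runs-poke (runs-return refl)))))
  λ { [] _ refl → runs-poke (runs-poke (runs-poke (runs-poke (runs-return r)))) }
  where open WriteRecord P p v b row w

readVertices-loop : ∀ {m} (bs : Vec Bool m) {P n p v row h rest os Q} {ρ : Vec ℕ Γ} → Fresh p (world h rest os) →
  LoopRuns readVertex (Q ∷ n ∷ ρ) m (v ∷ p ∷ 2 ^ v ∷ P ∷ row ∷ []) (world h (encodeBits bs ++ₗ rest) os) (m * 1)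
    (VerticesRead P n p v row bs (world h rest os))
readVertices-loop [] {p = p} {v} f = loopRuns-zero
  (sym (+-identityʳ p) , cong (2 ^_) (sym (+-identityʳ v)) , grow-refl f ≤-refl , kept λ _ → tt)
readVertices-loop {m = suc m} (b ∷ bs) {P} {n} {p} {v} {row} {h} {rest} {os} {Q} {ρ} f = loopRuns-suc
  {R = λ xs w′ → xs ≡ suc v ∷ p + 16 ∷ 2 ^ suc v ∷ P ∷ row + n ∷ [] × w′ ≡ world (heap w₈) (encodeBits bs ++ₗ rest) os}
  (runs-input (runs-bind {a = 0} {R = λ xs w′ → xs ≡ wt ∷ [] × w′ ≡ world h (encodeBits bs ++ₗ rest) os}
    (runs-ifz (λ z → runs-return (cong (_∷ []) (white b z) , refl)) (λ nz → runs-return (cong (_∷ []) (black b nz) , refl)))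
    λ { _ _ (refl , refl) → runs-writeRecord (next , refl) }))
  λ { _ _ (refl , refl) → loopRuns-weaken ≤-refl continue
        (readVertices-loop bs {P = P} {n} {p + 16} {suc v} {row + n} {heap w₈} {rest} {os} (fresh (growth f))) }
  where
  open WriteRecord P p v b row (world h rest os)
  white : ∀ b → bit b ≡ 0 → P + 2 ^ v ≡ (if b then 0 else P + 2 ^ v)
  white false _ = refl
  black : ∀ b → bit b ≢ 0 → 0 ≡ (if b then 0 else P + 2 ^ v)
  black true  _  = refl
  black false nz = contradiction refl nz
  next : _≡_ {A = Vec ℕ 5} (v + 1 ∷ p + 16 ∷ 2 ^ v + 2 ^ v ∷ P ∷ row + n ∷ []) (suc v ∷ p + 16 ∷ 2 ^ suc v ∷ P ∷ row + n ∷ [])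
  next = cong₂ (λ x y → x ∷ p + 16 ∷ y ∷ P ∷ row + n ∷ []) (+-comm v 1) (cong (2 ^ v +_) (sym (+-identityʳ _)))
  continue : ∀ xs w′ → VerticesRead P n (p + 16) (suc v) (row + n) bs (world (heap w₈) rest os) xs w′ →
             VerticesRead P n p v row (b ∷ bs) (world h rest os) xs w′
  continue (v′ ∷ p′ ∷ pw′ ∷ P′ ∷ row′ ∷ []) w′ (e₁ , e₂ , g , k) =
    trans e₁ (+-assoc p 16 (m * 16)) , trans e₂ (cong (2 ^_) (sym (+-suc v m))) , grow-trans (growth f) g ,
    kept λ e → at (kept-grow g (kept-cells {w = w₈} (cells f))) e , at k e

records-lookup : ∀ {m P n p v row h} (bs : Vec Bool m) → Records P n p v row bs h →
                 ∀ x → RecordCells P (p + toℕ x * 16) (v + toℕ x) (lookup bs x) (row + toℕ x * n) h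
records-lookup {p = p} {v} {row} (b ∷ bs) (c , _) zero rewrite +-identityʳ p | +-identityʳ v | +-identityʳ row = c
records-lookup {n = n} {p} {v} {row} (b ∷ bs) (_ , r) (suc x)
  rewrite +-suc v (toℕ x) | sym (+-assoc row n (toℕ x * n)) | sym (+-assoc p 16 (toℕ x * 16)) = records-lookup bs r x

-- The first n iterations double 1 up to 2 ^ n, which is needed before any white vertex can be given
-- its weight.
runs-readVertices : ∀ {n} (bs : Vec Bool n) {h rest os} {ρ : Vec ℕ Γ} → Fresh 16 (world h rest os) →
  Runs readVertices (n ∷ ρ) (world h (encodeBits bs ++ₗ rest) os) (n * 1 + n * 1)
    (VerticesRead (2 ^ n) n 16 0 (record# (n + 1)) bs (world h rest os))
runs-readVertices {n = n} bs {h} {rest} {os} f = runs-bind {R = λ xs w′ → xs ≡ 2 ^ n ∷ [] × w′ ≡ world h (encodeBits bs ++ₗ rest) os}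
  (runs-weaken ≤-refl (λ { (x ∷ []) _ (eq , refl) → cong (_∷ []) (trans (sym (*-identityʳ x)) eq) , refl })
    (runs-loop-inv Inv (+-identityʳ (2 ^ n) , refl)
      λ { i (x ∷ []) _ (eq , refl) → runs-return (trans (double x (2 ^ i)) eq , refl) }))
  λ { _ _ (refl , refl) → runs-loop (readVertices-loop bs f) }
  where
  Inv : ℕ → Post 1
  Inv i (x ∷ []) w′ = x * 2 ^ i ≡ 2 ^ n × w′ ≡ world h (encodeBits bs ++ₗ rest) os
  double : ∀ x p → (x + x) * p ≡ x * (2 * p)
  double = solve-∀

Row : ∀ {m} → ℕ → Vec Bool m → Heap → Set
Row H bs h = ∀ x → h (H + toℕ x) ≡ bit (lookup bs x)

RowRead : ∀ {m} → ℕ → Vec Bool m → World → Post 1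
RowRead {m} H bs w (H′ ∷ []) w′ = H′ ≡ H + m × Grow H w H′ w′ × Kept H′ (heap w′) (Row H bs)

readRow : ∀ {m} (bs : Vec Bool m) {H h rest os} {ρ : Vec ℕ Γ} → Fresh H (world h rest os) →
  LoopRuns readNumber ρ m (H ∷ []) (world h (encodeBits bs ++ₗ rest) os) (m * 1) (RowRead H bs (world h rest os))
readRow [] {H} f = loopRuns-zero (sym (+-identityʳ H) , grow-refl f ≤-refl , kept λ _ ())
readRow {m = suc m} (b ∷ bs) {H} {h} {rest} {os} f = loopRuns-suc
  {R = λ xs w′ → xs ≡ suc H ∷ [] × w′ ≡ world h₁ (encodeBits bs ++ₗ rest) os}
  (runs-input (runs-poke (runs-return (cong (_∷ []) (+-comm H 1) , refl))))
  λ { _ _ (refl , refl) → loopRuns-weaken ≤-refl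
        (λ { (H′ ∷ []) w′ (eq , g′ , k) → trans eq (sym (+-suc H m)) , grow-trans g g′ ,
               kept λ {h′} e → λ { zero → trans (cong h′ (+-identityʳ H)) (trans (e (≤-trans ≤-refl (H≤ g′)))
                                     (trans (below g′ ≤-refl) (update-same h H (bit b))))
                                 ; (suc x) → trans (cong h′ (+-suc H (toℕ x))) (at k e x) } })
        (readRow bs {suc H} {h₁} {rest} {os} (fresh g)) }
  where
  h₁ = h [ H ≔ bit b ]
  g : Grow H (world h rest os) (suc H) (world h₁ rest os)
  g = grow-poke ≤-refl ≤-refl (grow-refl f (n≤1+n H))

module _ {n : ℕ} (N : Fin n → Vec Bool n) where

  Rows : ℕ → List (Fin n) → Heap → Set
  Rows H []       h = ⊤
  Rows H (v ∷ vs) h = Row H (N v) h × Rows (H + n) vs h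

  RowsRead : ℕ → List (Fin n) → World → Post 1
  RowsRead H vs w (H′ ∷ []) w′ = Grow H w H′ w′ × Kept H′ (heap w′) (Rows H vs)

  readRows : ∀ vs {H H₀ h rest os} {ρ : Vec ℕ Γ} → Fresh H (world h rest os) →
    LoopRuns (loop v3 (v0 ∷ []) readNumber) (H₀ ∷ n ∷ ρ) (length vs) (H ∷ [])
      (world h (concatMap (λ v → encodeBits (N v)) vs ++ₗ rest) os) (length vs * suc (n * 1)) (RowsRead H vs (world h rest os))
  readRows [] f = loopRuns-zero (grow-refl f ≤-refl , kept λ _ → tt)
  readRows (v ∷ vs) {H} {H₀} {h} {rest} {os} {ρ} f
    rewrite ++ₗ-assoc (encodeBits (N v)) (concatMap (λ v → encodeBits (N v)) vs) rest = loopRuns-suc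
    (runs-loop (readRow (N v) {H} {h} {concatMap (λ v → encodeBits (N v)) vs ++ₗ rest} {os} f))
    λ { (_ ∷ []) (world h₁ _ _) (refl , grow refl refl H≤ b f₁ , k) → let g = grow refl refl H≤ b f₁ in
        loopRuns-weaken ≤-refl (λ { (H′ ∷ []) w′ (g′ , k′) → grow-trans g g′ , kept λ e → at (kept-grow g′ k) e , at k′ e })
          (readRows vs {H + n} {H₀} {h₁} {rest} {os} f₁) }

  rows-tabulate : ∀ {m H h} (f : Fin m → Fin n) → Rows H (tabulateₗ f) h → ∀ v x → h (H + toℕ v * n + toℕ x) ≡ bit (lookup (N (f v)) x)
  rows-tabulate {suc m} {H} f (r , _) zero x rewrite +-identityʳ H = r x
  rows-tabulate {suc m} {H} f (_ , r) (suc v) x rewrite sym (+-assoc H n (toℕ v * n)) = rows-tabulate (f ∘ suc) r v x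

-- Reading the tree

leafCount : ∀ {n} → Tree n → ℕ
leafCountAll : ∀ {n} → List (Tree n) → ℕ
leafCount (leaf _)    = 1
leafCount (node _ ts) = leafCountAll ts
leafCountAll []       = 0
leafCountAll (t ∷ ts) = leafCount t + leafCountAll ts

module _ {n : ℕ} where

  AfterTree : (leaves count : ℕ) → List (ℕ × ℕ) → ℕ → World → Post 4
  AfterTree lv cnt toks H w (lv′ ∷ cnt′ ∷ tok ∷ H′ ∷ []) w′ =
    lv′ ≡ lv × cnt′ ≡ cnt × Grow H w H′ w′ × TokensAt H′ (heap w′) tok toks

  readOne : ∀ {a b toks lv cnt tok H h rest os} {ρ : Vec ℕ Γ} {i H₀} → lv < n → Fresh H (world h rest os) → TokensAt H h tok toks →
    Runs readToken (lv ∷ cnt ∷ tok ∷ H ∷ i ∷ H₀ ∷ n ∷ ρ) (world h (a ∷ b ∷ rest) os) 0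
      (AfterTree (ifZero a (lv + 1) lv) (cnt + 1) ((a , b) ∷ toks) H (world h rest os))
  readOne {a = a} {b} {toks} {lv} {cnt} {tok} {H} {h} {rest} {os} lv<n f ts =
    runs-ifz (λ z → contradiction (m∸n≡0⇒m≤n z) (<⇒≱ lv<n)) λ _ →
    runs-input (runs-input (runs-poke (runs-poke (runs-poke
      (runs-bind {a = 0} {R = λ xs w′ → xs ≡ ifZero a (lv + 1) lv ∷ [] × w′ ≡ w₃}
        (runs-ifz (λ z → runs-return (cong (_∷ []) (sym (ifZero-0 z)) , refl))
                  (λ nz → runs-return (cong (_∷ []) (sym (ifZero-≢0 nz)) , refl)))
        λ { _ _ (refl , refl) → runs-return (refl , refl , g , (kept λ e →
              trans (e (m<m+n H (s≤s z≤n))) (skip₀ h₂ H 1 (skip₀ h₁ H 0 (update-same h H a))) ,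
              trans (e (+-monoʳ-< H (s≤s (s≤s z≤n)))) (skip h₂ H 2 1 (λ ()) (update-same h₁ (H + 1) b)) ,
              trans (e (+-monoʳ-< H (s≤s (s≤s (s≤s z≤n))))) (update-same h₂ (H + 2) tok)) ∷ tokens-grow g ts) })))))
    where
    h₁ = h [ H ≔ a ]
    h₂ = h₁ [ H + 1 ≔ b ]
    w₃ = world (h₂ [ H + 2 ≔ tok ]) rest os
    g : Grow H (world h rest os) (H + 3) w₃
    g = grow-poke (m≤m+n H 2) (+-monoʳ-< H (s≤s (s≤s (s≤s z≤n)))) (grow-poke (m≤m+n H 1) (+-monoʳ-< H (s≤s (s≤s z≤n)))
          (grow-poke ≤-refl (m<m+n H (s≤s z≤n)) (grow-refl f (m≤m+n H 3))))

  data Branching : Tree n → Set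
  data BranchingAll : List (Tree n) → Set
  data Branching where
    leaf : ∀ {v} → Branching (leaf v)
    node : ∀ {ℓ ts} → 2 ≤ length ts → BranchingAll ts → Branching (node ℓ ts)
  data BranchingAll where
    []  : BranchingAll []
    _∷_ : ∀ {t ts} → Branching t → BranchingAll ts → BranchingAll (t ∷ ts)

  -- Every inner node has at least two children, so there are fewer than twice
  -- as many nodes as leaves.
  tokens< : ∀ {t} → Branching t → length (revTokens t) < leafCount t + leafCount t
  tokensAll : ∀ {ts} → BranchingAll ts → length (revTokensAll ts) + length ts ≤ leafCountAll ts + leafCountAll ts
  tokens< leaf = ≤-refl
  tokens< (node {ℓ} {ts} 2≤ bs) = ≤-trans (≤-reflexive (cong suc (length-++ (revTokensAll ts))))
    (≤-trans (≤-reflexive (sym (+-suc (length (revTokensAll ts)) 1))) (≤-trans (+-monoʳ-≤ (length (revTokensAll ts)) 2≤) (tokensAll bs)))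
  tokensAll [] = z≤n
  tokensAll (_∷_ {t} {ts} b bs) rewrite length-++ (revTokensAll ts) {revTokens t} =
    ≤-trans (≤-reflexive (shuffle (length (revTokensAll ts)) (length (revTokens t)) (length ts)))
      (≤-trans (+-mono-≤ (tokens< b) (tokensAll bs)) (≤-reflexive (shuffle′ (leafCount t) (leafCountAll ts))))
    where
    shuffle : ∀ a b c → a + b + suc c ≡ suc b + (a + c)
    shuffle = solve-∀
    shuffle′ : ∀ a b → a + a + (b + b) ≡ a + b + (a + b)
    shuffle′ = solve-∀

  leafCount>0 : ∀ {t} → Branching t → 1 ≤ leafCount t
  leafCountAll>0 : ∀ {ts} → 1 ≤ length ts → BranchingAll ts → 1 ≤ leafCountAll ts
  leafCount>0 leaf = ≤-refl
  leafCount>0 (node 2≤ bs) = leafCountAll>0 (≤-trans (s≤s z≤n) 2≤) bs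
  leafCountAll>0 _ (b ∷ bs) = ≤-trans (leafCount>0 b) (m≤m+n _ _)

  -- The reader goes on as long as fewer than n leaves have been seen. This holds before each token
  -- of the tree, since every subtree still has a leaf to come.
  readTree : ∀ {t} → Branching t → ∀ {toks lv cnt tok H h rest os i b H₀} {ρ : Vec ℕ Γ} {Q : Post 4} → lv + leafCount t ≤ n →
    Fresh H (world h rest os) → TokensAt H h tok toks →
    (∀ xs w′ → AfterTree (lv + leafCount t) (cnt + length (revTokens t)) (revTokens t ++ₗ toks) H (world h rest os) xs w′ →
       LoopRuns readToken (H₀ ∷ n ∷ ρ) i xs w′ b Q) →
    LoopRuns readToken (H₀ ∷ n ∷ ρ) (length (revTokens t) + i) (lv ∷ cnt ∷ tok ∷ H ∷ []) (world h (encodeTree t ++ₗ rest) os)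
      (length (revTokens t) + b) Q

  readTrees : ∀ {ts} → BranchingAll ts → ∀ {toks lv cnt tok H h rest os i b H₀} {ρ : Vec ℕ Γ} {Q : Post 4} → lv + leafCountAll ts ≤ n →
    Fresh H (world h rest os) → TokensAt H h tok toks →
    (∀ xs w′ → AfterTree (lv + leafCountAll ts) (cnt + length (revTokensAll ts)) (revTokensAll ts ++ₗ toks) H (world h rest os) xs w′ →
       LoopRuns readToken (H₀ ∷ n ∷ ρ) i xs w′ b Q) →
    LoopRuns readToken (H₀ ∷ n ∷ ρ) (length (revTokensAll ts) + i) (lv ∷ cnt ∷ tok ∷ H ∷ []) (world h (encodeTrees ts ++ₗ rest) os)
      (length (revTokensAll ts) + b) Q

  label-step : ∀ ℓ {lv} → ifZero (encodeLabel ℓ) (lv + 1) lv ≡ lv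
  label-step Parallel = refl
  label-step Series   = refl
  label-step K+S      = refl
  label-step Prime    = refl

  readTree (leaf {v}) {lv = lv} le f ts cont = loopRuns-suc
    (readOne (≤-trans (≤-reflexive (+-comm 1 lv)) le) f ts)
    λ { xs w′ after → cont xs w′ after }
  readTree (node {ℓ} {trees} 2≤ bs) {toks} {lv} {cnt} {tok} {H} {h} {rest} {os} {i} {b} {H₀} {ρ} {Q} le f ts cont =
    subst (λ z → LoopRuns readToken (H₀ ∷ n ∷ ρ) (z + i) _ (world h (encodeTree (node ℓ trees) ++ₗ rest) os) (z + b) Q) (sym count≡)
      (loopRuns-suc (readOne (≤-trans (s≤s (m≤m+n lv 0)) (≤-trans (≤-reflexive (sym (+-suc lv 0)))
          (≤-trans (+-monoʳ-≤ lv (leafCountAll>0 (≤-trans (s≤s z≤n) 2≤) bs)) le))) f ts)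
        λ { (lv′ ∷ cnt′ ∷ tok′ ∷ H′ ∷ []) (world h₁ _ _) (refl , refl , grow refl refl H≤ bel f₁ , ts₁) →
            subst (λ z → LoopRuns readToken (H₀ ∷ n ∷ ρ) (c + i) (z ∷ cnt + 1 ∷ tok′ ∷ H′ ∷ []) (world h₁ (encodeTrees trees ++ₗ rest) os) (c + b) Q)
              (sym (label-step ℓ))
              (readTrees bs {i = i} {b} {H₀} {ρ} le f₁ ts₁
                λ { (_ ∷ _ ∷ tok″ ∷ H″ ∷ []) w″ (refl , refl , g″ , ts″) → cont _ w″
                      (refl , trans (+-assoc cnt 1 c) (cong (cnt +_) (sym count≡)) , grow-trans {w′ = world h₁ rest os} (grow refl refl H≤ bel f₁) g″ ,
                       subst (TokensAt H″ (heap w″) tok″) (sym (++ₗ-assoc (revTokensAll trees) _ toks)) ts″) }) })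
    where
    c = length (revTokensAll trees)
    count≡ : length (revTokensAll trees ++ₗ (encodeLabel ℓ , length trees) ∷ []) ≡ suc c
    count≡ = trans (length-++ (revTokensAll trees)) (+-comm c 1)

  readTrees [] {lv = lv} {cnt} f le ts cont = cont _ _ (sym (+-identityʳ lv) , sym (+-identityʳ cnt) , grow-refl le ≤-refl , ts)
  readTrees (_∷_ {t} {trees} b bs) {toks} {lv} {cnt} {tok} {H} {h} {rest} {os} {i} {bd} {H₀} {ρ} {Q} le f ts cont
    rewrite ++ₗ-assoc (encodeTree t) (encodeTrees trees) rest =
    subst (λ z → LoopRuns readToken (H₀ ∷ n ∷ ρ) (z + i) (lv ∷ cnt ∷ tok ∷ H ∷ []) (world h (encodeTree t ++ₗ encodeTrees trees ++ₗ rest) os) (z + bd) Q) (sym count≡)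
      (subst₂ (λ x y → LoopRuns readToken (H₀ ∷ n ∷ ρ) x (lv ∷ cnt ∷ tok ∷ H ∷ []) (world h (encodeTree t ++ₗ encodeTrees trees ++ₗ rest) os) y Q)
        (sym (+-assoc c₁ c₂ i)) (sym (+-assoc c₁ c₂ bd))
        (readTree b {i = c₂ + i} {c₂ + bd} {H₀} {ρ} (≤-trans (+-monoʳ-≤ lv (m≤m+n (leafCount t) _)) le) f ts
          λ { (_ ∷ _ ∷ tok′ ∷ H′ ∷ []) (world h₁ _ _) (refl , refl , grow refl refl H≤ bel f₁ , ts₁) →
              readTrees bs {i = i} {bd} {H₀} {ρ} (≤-trans (≤-reflexive (+-assoc lv (leafCount t) _)) le) f₁ ts₁
                λ { (_ ∷ _ ∷ tok″ ∷ H″ ∷ []) w″ (refl , refl , g″ , ts″) → cont _ w″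
                      ( +-assoc lv (leafCount t) _ , trans (+-assoc cnt c₁ c₂) (cong (cnt +_) (sym count≡))
                      , grow-trans {w′ = world h₁ rest os} (grow refl refl H≤ bel f₁) g″
                      , subst (TokensAt H″ (heap w″) tok″) (sym (++ₗ-assoc (revTokensAll trees) (revTokens t) toks)) ts″) } }))
    where
    c₁ = length (revTokens t)
    c₂ = length (revTokensAll trees)
    count≡ : length (revTokensAll trees ++ₗ revTokens t) ≡ c₁ + c₂
    count≡ = trans (length-++ (revTokensAll trees)) (+-comm c₂ c₁)

  -- The number of tokens is not part of the input, so the loop runs 2n times, more often than there
  -- are tokens. After the n-th leaf it idles.
  runs-readTokens : ∀ {t H h os} {ρ : Vec ℕ Γ} → Branching t → leafCount t ≡ n → Fresh H (world h [] os) →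
    Runs readTokens (H ∷ n ∷ ρ) (world h (encodeTree t ++ₗ []) os) (n + n)
      (AfterTree n (length (revTokens t)) (revTokens t ++ₗ []) H (world h [] os))
  runs-readTokens {Γ} {t} {H} {h} {os} {ρ} b leaves≡ f = runs-weaken (≤-reflexive (m+[n∸m]≡n short)) (λ _ _ r → r)
    (runs-loop (subst (λ z → LoopRuns readToken (H ∷ n ∷ ρ) z (0 ∷ 0 ∷ 0 ∷ H ∷ []) (world h (encodeTree t ++ₗ []) os) (c + idle) Final)
      (m+[n∸m]≡n short)
      (readTree b {i = idle} {idle} {H} {ρ} (≤-reflexive leaves≡) f [] λ { (lv ∷ cnt ∷ tok ∷ H′ ∷ []) w′ (e , after) →
        loopRuns-weaken (≤-reflexive (*-identityʳ idle)) (λ _ _ r → r)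
        (loopRuns-inv (λ _ → Final) (λ { i (lv ∷ cnt ∷ tok ∷ H′ ∷ []) w (e , after) →
            runs-ifz (λ _ → runs-return (e , after)) (λ nz → contradiction (m≤n⇒m∸n≡0 (≤-reflexive (sym e))) nz) })
          idle _ w′ (trans e leaves≡ , after)) })))
    where
    c = length (revTokens t)
    short : c ≤ n + n
    short = ≤-trans (<⇒≤ (tokens< b)) (≤-reflexive (cong₂ _+_ leaves≡ leaves≡))
    idle = n + n ∸ c
    Final : Post 4
    Final = AfterTree n c (revTokens t ++ₗ []) H (world h [] os)

-- Decoding weights, correctness of objectives, trimming

digit : ∀ {m} → Subset m → ℕ → ℕ
digit []      j       = 0
digit (b ∷ D) zero    = bit b
digit (b ∷ D) (suc j) = digit D j

digit-flags : ∀ {m} (D : Subset m) → Flags (digit D)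
digit-flags []          j       = z≤n
digit-flags (true ∷ D)  zero    = ≤-refl
digit-flags (false ∷ D) zero    = z≤n
digit-flags (b ∷ D)     (suc j) = digit-flags D j

digit-lookup : ∀ {m} (D : Subset m) v → digit D (toℕ v) ≡ bit (lookup D v)
digit-lookup (b ∷ D) zero    = refl
digit-lookup (b ∷ D) (suc v) = digit-lookup D v

value-suc : ∀ φ m → value (suc m) φ ≡ φ 0 + 2 * value m (φ ∘ suc)
value-suc φ zero    = lemma (φ 0)
  where
  lemma : ∀ x → x * 1 ≡ x + 0
  lemma = solve-∀
value-suc φ (suc m) rewrite value-suc φ m = lemma (φ 0) (value m (φ ∘ suc)) (φ (suc m)) (2 ^ m)
  where
  lemma : ∀ x v y p → x + 2 * v + y * (2 * p) ≡ x + 2 * (v + y * p)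
  lemma = solve-∀

μ-scale : ∀ {m} c (f : Fin m → ℕ) D → μ (λ v → c * f v) D ≡ c * μ f D
μ-scale c f []          = sym (*-zeroʳ c)
μ-scale c f (true ∷ D)  = trans (cong (c * f zero +_) (μ-scale c (f ∘ suc) D)) (sym (*-distribˡ-+ c (f zero) _))
μ-scale c f (false ∷ D) = μ-scale c (f ∘ suc) D

μ-constant : ∀ {m} c (f : Fin m → ℕ) D → μ (λ v → c + f v) D ≡ ∣ D ∣ * c + μ f D
μ-constant c f []          = refl
μ-constant c f (true ∷ D)  rewrite μ-constant c (f ∘ suc) D = lemma c (f zero) (∣ D ∣ * c) (μ (f ∘ suc) D)
  where
  lemma : ∀ c f x y → c + f + (x + y) ≡ c + x + (f + y)
  lemma = solve-∀
μ-constant c f (false ∷ D) = μ-constant c (f ∘ suc) D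

binary : ∀ {m} (D : Subset m) → μ (λ v → 2 ^ toℕ v) D ≡ value m (digit D)
binary [] = refl
binary {suc m} (true ∷ D)  rewrite value-suc (digit (true ∷ D)) m | μ-scale 2 (λ v → 2 ^ toℕ v) D | binary D = refl
binary {suc m} (false ∷ D) rewrite value-suc (digit (false ∷ D)) m | μ-scale 2 (λ v → 2 ^ toℕ v) D | binary D = refl

-- Division by repeated subtraction. The quotient will be a number of white vertices, so n rounds
-- suffice.
runs-divide : ∀ {q P r n w} {ρ : Vec ℕ Γ} → q ≤ n → r < P →
  Runs divide (q * P + r ∷ n ∷ P ∷ ρ) w (n * 1) (λ xs w′ → xs ≡ q ∷ r ∷ [] × w′ ≡ w)
runs-divide {q = q} {P} {r} {n} {w} q≤n r<P = runs-weaken ≤-refl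
  (λ { (a ∷ y ∷ []) _ (refl , zero , a≡ , y≡ , _) → cong₂ (λ x z → x ∷ z ∷ []) (trans (sym (+-identityʳ a)) a≡) y≡ , refl })
  (runs-loop-inv Inv (refl , q , refl , refl , q≤n)
    λ { i (a ∷ y ∷ []) _ (refl , j , a≡ , y≡ , j≤) → runs-ifz
        (λ z → runs-return (subtract i a y j a≡ y≡ j≤ (m∸n≡0⇒m≤n z)))
        (λ nz → runs-return (stay i a y j a≡ y≡ (λ P≤y → nz (m≤n⇒m∸n≡0 P≤y)))) })
  where
  Inv : ℕ → Post 2
  Inv i (a ∷ y ∷ []) w′ = w′ ≡ w × ∃ λ j → a + j ≡ q × y ≡ j * P + r × j ≤ i
  subtract : ∀ i a y j → a + j ≡ q → y ≡ j * P + r → j ≤ suc i → P ≤ y → Inv i (a + 1 ∷ y ∸ P ∷ []) w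
  subtract i a y zero    a≡ refl _  P≤y = contradiction P≤y (<⇒≱ r<P)
  subtract i a y (suc j) a≡ refl j≤ _   = refl , j , trans (+-assoc a 1 j) a≡ ,
    trans (cong (_∸ P) (+-assoc P (j * P) r)) (m+n∸m≡n P (j * P + r)) , s≤s⁻¹ j≤
  stay : ∀ i a y j → a + j ≡ q → y ≡ j * P + r → ¬ P ≤ y → Inv i (a ∷ y ∷ []) w
  stay i a y zero    a≡ y≡   _   = refl , 0 , a≡ , y≡ , z≤n
  stay i a y (suc j) a≡ refl P≰y = contradiction (≤-trans (m≤m+n P (j * P)) (m≤m+n (P + j * P) r)) P≰y

module _ {n : ℕ} (G : BipartiteGraph n) where
  open BipartiteGraph G
  wh : Subset n → ℕ
  wh C = ∣ C ∩ W ∣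

-- f is the quantity maximised by O as a function of the numbers of blacks and
-- whites; at most bound s n vertices of each colour are printed if its maximum is s.
record Correct (O : Objective) (Goal : ∀ {n} → BipartiteGraph n → Subset n → Set) : Set where
  field
    f     : ℕ → ℕ → ℕ
    bound : ℕ → ℕ → ℕ
    f-mono : ∀ b {w w′} → w ≤ w′ → f b w ≤ f b w′
    runs-score : ∀ {Γ} b w {world} {ρ : Vec ℕ Γ} →
      Runs (Objective.score O) (b ∷ w ∷ ρ) world b (λ xs world′ → xs ≡ f b w ∷ [] × world′ ≡ world)
    runs-limit : ∀ {Γ} s n {world} {ρ : Vec ℕ Γ} →
      Runs (Objective.limit O) (s ∷ n ∷ ρ) world 0 (λ xs world′ → xs ≡ bound s n ∷ [] × world′ ≡ world)
    goal : ∀ {n} (G : BipartiteGraph n) C {s c b w} → Biclique G C → c ≤ b → b ≤ n → w ≤ n → f c w ≡ s →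
      Weighted.bl G C ≡ b ⊓ bound s n → wh G C ≡ w ⊓ bound s n →
      (∀ D → Biclique G D → f (Weighted.bl G D) (wh G D) ≤ s) → Goal G C

-- Mirrors the printing loop, which takes vertices in their order until the limit of their colour is
-- exhausted. Subsets of bicliques are bicliques, so cutting is always allowed.
trim : ∀ {m} → Vec Bool m → Vec Bool m → ℕ → ℕ → Vec Bool m
trim []          []      lb lw = []
trim (_ ∷ B)     (false ∷ F) lb lw = false ∷ trim B F lb lw
trim (true ∷ B)  (true ∷ F)  zero lw = false ∷ trim B F zero lw
trim (true ∷ B)  (true ∷ F)  (suc lb) lw = true ∷ trim B F lb lw
trim (false ∷ B) (true ∷ F)  lb zero = false ∷ trim B F lb zero
trim (false ∷ B) (true ∷ F)  lb (suc lw) = true ∷ trim B F lb lw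

trim-⊆ : ∀ {m} (B F : Vec Bool m) lb lw → trim B F lb lw ⊆ F
trim-⊆ (_ ∷ B)     (false ∷ F) lb lw (there v∈) = there (trim-⊆ B F lb lw v∈)
trim-⊆ (true ∷ B)  (true ∷ F)  zero lw (there v∈) = there (trim-⊆ B F zero lw v∈)
trim-⊆ (true ∷ B)  (true ∷ F)  (suc lb) lw here = here
trim-⊆ (true ∷ B)  (true ∷ F)  (suc lb) lw (there v∈) = there (trim-⊆ B F lb lw v∈)
trim-⊆ (false ∷ B) (true ∷ F)  lb zero (there v∈) = there (trim-⊆ B F lb zero v∈)
trim-⊆ (false ∷ B) (true ∷ F)  lb (suc lw) here = here
trim-⊆ (false ∷ B) (true ∷ F)  lb (suc lw) (there v∈) = there (trim-⊆ B F lb lw v∈)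

trim-black : ∀ {m} (B F : Vec Bool m) lb lw → ∣ trim B F lb lw ∩ B ∣ ≡ ∣ F ∩ B ∣ ⊓ lb
trim-black []          []          lb lw = refl
trim-black (true ∷ B)  (false ∷ F) lb lw = trim-black B F lb lw
trim-black (false ∷ B) (false ∷ F) lb lw = trim-black B F lb lw
trim-black (true ∷ B)  (true ∷ F)  zero lw = trans (trim-black B F zero lw) (⊓-zeroʳ ∣ F ∩ B ∣)
trim-black (true ∷ B)  (true ∷ F)  (suc lb) lw = cong suc (trim-black B F lb lw)
trim-black (false ∷ B) (true ∷ F)  lb zero = trim-black B F lb zero
trim-black (false ∷ B) (true ∷ F)  lb (suc lw) = trim-black B F lb lw

trim-white : ∀ {m} (B F : Vec Bool m) lb lw → ∣ trim B F lb lw ∩ ∁ B ∣ ≡ ∣ F ∩ ∁ B ∣ ⊓ lw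
trim-white []          []          lb lw = refl
trim-white (true ∷ B)  (false ∷ F) lb lw = trim-white B F lb lw
trim-white (false ∷ B) (false ∷ F) lb lw = trim-white B F lb lw
trim-white (true ∷ B)  (true ∷ F)  zero lw = trim-white B F zero lw
trim-white (true ∷ B)  (true ∷ F)  (suc lb) lw = trim-white B F lb lw
trim-white (false ∷ B) (true ∷ F)  lb zero = trans (trim-white B F lb zero) (⊓-zeroʳ ∣ F ∩ ∁ B ∣)
trim-white (false ∷ B) (true ∷ F)  lb (suc lw) = cong suc (trim-white B F lb lw)

sumBelow : ℕ → (ℕ → ℕ) → ℕ
sumBelow zero    g = 0
sumBelow (suc i) g = g i + sumBelow i g

sumBelow≡0⁻ : ∀ k {g} → sumBelow k g ≡ 0 → ∀ i → i < k → g i ≡ 0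
sumBelow≡0⁻ (suc k) {g} eq i i< with m≤n⇒m<n∨m≡n (s≤s⁻¹ i<)
... | inj₁ i<k  = sumBelow≡0⁻ k (m+n≡0⇒n≡0 (g k) eq) i i<k
... | inj₂ refl = m+n≡0⇒m≡0 (g k) eq

sumBelow≡0⁺ : ∀ k {g} → (∀ i → i < k → g i ≡ 0) → sumBelow k g ≡ 0
sumBelow≡0⁺ zero    _ = refl
sumBelow≡0⁺ (suc k) z rewrite z k ≤-refl = sumBelow≡0⁺ k (λ i i<k → z i (m<n⇒m<1+n i<k))

isZero : ℕ → Bool
isZero zero    = true
isZero (suc _) = false

bit-isZero : ∀ x → 1 ∸ x ≡ bit (isZero x)
bit-isZero zero    = refl
bit-isZero (suc x) = 0∸n≡0 x

-- Printing

module _ {n whites : ℕ} (h : Heap) where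

  -- Counts the chosen white vertices that are not adjacent to v, so it is 0 exactly for their
  -- common neighbours.
  missing : ℕ → ℕ
  missing v = sumBelow n (λ j → h (whites + j) ∸ edgeValue h v j)

  record Candidate (v : ℕ) (black chosen : Bool) : Set where
    field
      colour  : h (record# v + 1) ≡ bit black
      ifBlack : black ≡ true → 1 ∸ missing v ≡ bit chosen
      ifWhite : black ≡ false → h (whites + v) ≡ bit chosen

  Printed : ∀ {m} → Vec Bool m → Vec Bool m → ℕ → ℕ → List ℕ → List ℕ → Post 3
  Printed B F lb lw is os _ w′ = w′ ≡ world h is (os ++ₗ encodeSet (trim B F lb lw))

  next-out : ∀ (os : List ℕ) o xs → (os ∷ʳ o) ++ₗ xs ≡ os ++ₗ o ∷ xs
  next-out os o xs = ++ₗ-assoc os (o ∷ []) xs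

  printLoop : ∀ {m} (B F : Vec Bool m) {v lb lw lim is os} {ρ : Vec ℕ Γ} → (∀ x → Candidate (v + toℕ x) (lookup B x) (lookup F x)) →
    LoopRuns printVertex (whites ∷ n ∷ lim ∷ ρ) m (v ∷ lb ∷ lw ∷ []) (world h is os) (m * suc (n * 1)) (Printed B F lb lw is os)
  printLoop [] [] {is = is} {os} c = loopRuns-zero (cong (world h is) (sym (++ₗ-identityʳ os)))
  printLoop {Γ} {suc m} (true ∷ B) (f ∷ F) {v} {lb} {lw} {lim} {is} {os} {ρ} c = loopRuns-suc
    {R = λ xs w′ → xs ≡ v + 1 ∷ lb ∸ o ∷ lw ∷ [] × w′ ≡ world h is (os ∷ʳ o)}
    (runs-ifz (λ z → contradiction (trans (sym z) colour′) λ ())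
      (λ _ → runs-weaken (≤-reflexive (+-identityʳ (n * 1))) (λ _ _ r → r)
        (runs-bind (runs-loop-inv Inv (refl , ≤-refl , refl)
            λ { i (x ∷ []) _ (refl , i<n , eq) → runs-return (refl , <⇒≤ i<n , trans (+-assoc x _ _) eq) })
          λ { (x ∷ []) _ (refl , _ , eq) → runs-bind (runs-return {Q = λ xs w′ → xs ≡ o ∷ [] × w′ ≡ world h is os}
                  (cong (λ z → z ∸ (z ∸ lb) ∷ []) (trans (cong (1 ∸_) (trans (sym (+-identityʳ x)) eq)) chosen) , refl))
                λ { _ _ (refl , refl) → runs-output (runs-return (refl , refl)) } })))
    λ { _ _ (refl , refl) → loopRuns-weaken ≤-refl (λ { xs w′ refl → cong (world h is) (output≡ f lb) })
          (printLoop B F {v + 1} {lb ∸ o} {lw} {lim} {is} {os ∷ʳ o} {ρ} c′) }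
    where
    o = bit f ∸ (bit f ∸ lb)
    c₀ : Candidate v true f
    c₀ = subst (λ z → Candidate z true f) (+-identityʳ v) (c zero)
    colour′ : h (record# v + 1) ≡ 1
    colour′ = Candidate.colour c₀
    chosen : 1 ∸ missing v ≡ bit f
    chosen = Candidate.ifBlack c₀ refl
    c′ : ∀ x → Candidate (v + 1 + toℕ x) (lookup B x) (lookup F x)
    c′ x = subst (λ z → Candidate z (lookup B x) (lookup F x)) (sym (+-assoc v 1 (toℕ x))) (c (suc x))
    Inv : ℕ → Post 1
    Inv i (x ∷ []) w′ = w′ ≡ world h is os × i ≤ n × x + sumBelow i (λ j → h (whites + j) ∸ edgeValue h v j) ≡ missing v
    output≡ : ∀ f lb → let o = bit f ∸ (bit f ∸ lb) in
      (os ∷ʳ o) ++ₗ encodeSet (trim B F (lb ∸ o) lw) ≡ os ++ₗ encodeSet (trim (true ∷ B) (f ∷ F) lb lw)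
    output≡ false zero     = next-out os 0 _
    output≡ false (suc lb) = next-out os 0 _
    output≡ true  zero     = next-out os 0 _
    output≡ true  (suc lb) rewrite 0∸n≡0 lb = next-out os 1 _
  printLoop {Γ} {suc m} (false ∷ B) (f ∷ F) {v} {lb} {lw} {lim} {is} {os} {ρ} c = loopRuns-suc
    {R = λ xs w′ → xs ≡ v + 1 ∷ lb ∷ lw ∸ o ∷ [] × w′ ≡ world h is (os ∷ʳ o)}
    (runs-ifz (λ z → runs-weaken z≤n (λ _ _ r → r) (runs-bind (runs-return {Q = λ xs w′ → xs ≡ o ∷ [] × w′ ≡ world h is os}
                (cong (λ z → z ∸ (z ∸ lw) ∷ []) chosen , refl))
              λ { _ _ (refl , refl) → runs-output (runs-return (refl , refl)) }))
      (λ nz → contradiction colour′ nz))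
    λ { _ _ (refl , refl) → loopRuns-weaken ≤-refl (λ { xs w′ refl → cong (world h is) (output≡ f lw) })
          (printLoop B F {v + 1} {lb} {lw ∸ o} {lim} {is} {os ∷ʳ o} {ρ} c′) }
    where
    o = bit f ∸ (bit f ∸ lw)
    c₀ : Candidate v false f
    c₀ = subst (λ z → Candidate z false f) (+-identityʳ v) (c zero)
    colour′ : h (record# v + 1) ≡ 0
    colour′ = Candidate.colour c₀
    chosen : h (whites + v) ≡ bit f
    chosen = Candidate.ifWhite c₀ refl
    c′ : ∀ x → Candidate (v + 1 + toℕ x) (lookup B x) (lookup F x)
    c′ x = subst (λ z → Candidate z (lookup B x) (lookup F x)) (sym (+-assoc v 1 (toℕ x))) (c (suc x))
    output≡ : ∀ f lw → let o = bit f ∸ (bit f ∸ lw) in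
      (os ∷ʳ o) ++ₗ encodeSet (trim B F lb (lw ∸ o)) ≡ os ++ₗ encodeSet (trim (false ∷ B) (f ∷ F) lb lw)
    output≡ false zero     = next-out os 0 _
    output≡ false (suc lw) = next-out os 0 _
    output≡ true  zero     = next-out os 0 _
    output≡ true  (suc lw) rewrite 0∸n≡0 lw = next-out os 1 _

-- Choosing the best number of black vertices

module _ {O : Objective} {Goal : ∀ {n} → BipartiteGraph n → Subset n → Set} (correct : Correct O Goal) where
  open Correct correct

  record Chosen (D : ℕ → ℕ → ℕ → Set) (i b s low : ℕ) : Set where
    field
      -- Before the first candidate the score is 0, so this candidate cannot lose and the initial
      -- white set is never returned.
      start : i ≡ suc b → s ≡ 0
      best  : i ≤ b → ∃₂ λ c q → c ≤ b × D c q low × s ≡ f c q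
      upper : ∀ c → i ≤ c → c ≤ b → ∃₂ λ q r → D c q r × f c q ≤ s

  runs-choose : ∀ {entry table b n P w} {ρ : Vec ℕ Γ} (D : ℕ → ℕ → ℕ → Set) →
    Entries entry table b (heap w) → (∀ c → c ≤ b → ∃₂ λ q r → D c q r) →
    (∀ {c q r} → c ≤ b → D c q r → entry c ≡ q * P + r × q ≤ n × r < P) →
    Runs (choose O) (table ∷ b ∷ n ∷ P ∷ ρ) w ((b + 1) * suc (n * 1 + (b + 0)))
      (λ { (s ∷ low ∷ []) w′ → w′ ≡ w × Chosen D 0 b s low })
  runs-choose {Γ} {entry} {table} {b} {n} {P} {w} {ρ} D entries exists decode = runs-weaken ≤-refl
    (λ { (s ∷ low ∷ []) w′ (eq , _ , ch) → eq , ch })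
    (runs-loop-inv Inv
      (refl , ≤-reflexive (+-comm b 1) , record
        { start = λ _ → refl
        ; best  = λ lt → contradiction (≤-trans (≤-reflexive (+-comm 1 b)) lt) 1+n≰n
        ; upper = λ c lt c≤b → contradiction (≤-trans (≤-reflexive (+-comm 1 b)) lt) (<⇒≱ (s≤s c≤b)) })
      λ { i (s ∷ low ∷ []) _ (refl , i< , ch) → iteration i s low (s≤s⁻¹ i<) ch (exists i (s≤s⁻¹ i<)) })
    where
    Inv : ℕ → Post 2
    Inv i (s ∷ low ∷ []) w′ = w′ ≡ w × i ≤ suc b × Chosen D i b s low
    σ = table ∷ b ∷ n ∷ P ∷ ρ
    iteration : ∀ i s low → i ≤ b → Chosen D (suc i) b s low → (∃₂ λ q r → D i q r) →
                Runs (chooseStep O) (s ∷ low ∷ i ∷ σ) w (n * 1 + (b + 0)) (Inv i)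
    iteration i s low i≤b ch (q , r , d) with e≡ , q≤n , r<P ← decode i≤b d =
      runs-bind (runs-call (subst (λ z → Runs divide (z ∷ n ∷ P ∷ s ∷ low ∷ i ∷ σ) w (n * 1) (λ xs w′ → xs ≡ q ∷ r ∷ [] × w′ ≡ w))
          (sym (trans (entries i i≤b) e≡)) (runs-divide q≤n r<P)))
        λ { _ _ (refl , refl) →
      runs-bind (runs-weaken i≤b (λ _ _ e → e) (runs-call (runs-score i q)))
        λ { _ _ (refl , refl) → runs-ifz
          (λ z → runs-return (refl , m≤n⇒m≤1+n i≤b , take (m∸n≡0⇒m≤n z)))
          (λ nz → runs-return (refl , m≤n⇒m≤1+n i≤b , keep (λ le → nz (m≤n⇒m∸n≡0 le)))) }}
      where
      open Chosen ch
      take : s ≤ f i q → Chosen D i b (f i q) r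
      take le = record
        { start = λ eq → contradiction (≤-trans (≤-reflexive (sym eq)) i≤b) 1+n≰n
        ; best  = λ _ → i , q , i≤b , d , refl
        ; upper = λ c i≤c c≤b → [ (λ i<c → let q′ , r′ , d′ , le′ = upper c i<c c≤b in q′ , r′ , d′ , ≤-trans le′ le)
                                , (λ { refl → q , r , d , ≤-refl }) ]′ (m≤n⇒m<n∨m≡n i≤c) }
      keep : ¬ s ≤ f i q → Chosen D i b s low
      keep ≰ = record
        { start = λ eq → contradiction (≤-trans (≤-reflexive (sym eq)) i≤b) 1+n≰n
        ; best  = λ _ → [ best , (λ { refl → contradiction (≤-trans (≤-reflexive (start refl)) z≤n) ≰ }) ]′ (m≤n⇒m<n∨m≡n i≤b)
        ; upper = λ c i≤c c≤b → [ (λ i<c → upper c i<c c≤b) , (λ { refl → q , r , d , ≰⇒≥ ≰ }) ]′ (m≤n⇒m<n∨m≡n i≤c) }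

  module _ {n : ℕ} (G : BipartiteGraph n) where
    open BipartiteGraph G
    open Weighted G

    low : Subset n → ℕ
    low C = value n (digit (C ∩ W))

    wt≡ : ∀ C → wt C ≡ wh G C * 2 ^ n + low C
    wt≡ C = trans (μ-constant (2 ^ n) (λ v → 2 ^ toℕ v) (C ∩ W)) (cong (wh G C * 2 ^ n +_) (binary (C ∩ W)))

    low< : ∀ C → low C < 2 ^ n
    low< C = value-< (digit-flags (C ∩ W)) n

    -- One white vertex more in C would raise its weight by at least 2 ^ n over the high part of C′,
    -- and the low digits of C′ stay below 2 ^ n.
    whites≤ : ∀ C C′ → wt C ≤ wt C′ → wh G C ≤ wh G C′
    whites≤ C C′ le = ≮⇒≥ λ lt → <⇒≱ (≤-trans (+-monoʳ-< (wh G C′ * 2 ^ n) (low< C′))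
      (≤-trans (≤-trans (≤-reflexive (+-comm (wh G C′ * 2 ^ n) (2 ^ n))) (*-monoˡ-≤ (2 ^ n) lt))
        (≤-trans (m≤m+n _ (low C)) (≤-reflexive (sym (wt≡ C)))))) (≤-trans le (≤-reflexive (wt≡ C′)))

    bl-singleton : ∀ v → bl ⁅ v ⁆ ≡ bit (lookup B v)
    bl-singleton v = go B v
      where
      go : ∀ {m} (B : Subset m) v → ∣ ⁅ v ⁆ ∩ B ∣ ≡ bit (lookup B v)
      go {suc m} (true ∷ B)  zero    = cong suc (trans (cong ∣_∣ (∩-zeroˡ B)) (∣⊥∣≡0 m))
      go {suc m} (false ∷ B) zero    = trans (cong ∣_∣ (∩-zeroˡ B)) (∣⊥∣≡0 m)
      go (b ∷ B)     (suc v) = go B v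

    -- The program knows C only through its weight. The low digits give the white set D, and D
    -- together with all its common black neighbours is a biclique that has the white vertices of C
    -- and at least as many black ones.
    module Completion (C : Subset n) (bc : Biclique G C) {H h} (digits : Digits (low C) n H h) (edges : EdgeCells h) where
      D = C ∩ W

      missing′ : Fin n → ℕ
      missing′ v = missing {n} {H} h (toℕ v)

      F : Subset n
      F = tabulate λ v → if lookup B v then isZero (missing′ v) else lookup D v

      flag : ∀ v → h (H + toℕ v) ≡ bit (lookup D v)
      flag v = trans (digits (digit D) (digit-flags D) refl (toℕ v) (toℕ<n v)) (digit-lookup D v)

      lookup-F : ∀ v → lookup F v ≡ (if lookup B v then isZero (missing′ v) else lookup D v)
      lookup-F v = lookup∘tabulate _ v

      term : ∀ u v → h (H + toℕ v) ∸ edgeValue h (toℕ u) (toℕ v) ≡ bit (lookup D v) ∸ adjacency u v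
      term u v = cong₂ _∸_ (flag v) (edges u v)

      full : ∀ {u} → missing′ u ≡ 0 → ∀ {v} → v ∈ D → Adj u v
      full {u} eq {v} v∈ = adjacency⁻ λ a≡0 → contradiction
        (trans (sym (trans (term u v) (cong₂ _∸_ (cong bit ([]=⇒lookup v∈)) a≡0))) (sumBelow≡0⁻ n eq (toℕ v) (toℕ<n v))) λ ()

      complete : ∀ {u} → (∀ {v} → v ∈ D → Adj u v) → missing′ u ≡ 0
      complete {u} adj = sumBelow≡0⁺ n λ j j<n → subst (λ j → h (H + j) ∸ edgeValue h (toℕ u) j ≡ 0) (toℕ-fromℕ< j<n)
        (trans (term u (fromℕ< j<n)) (zero-term (fromℕ< j<n)))
        where
        zero-term : ∀ v → bit (lookup D v) ∸ adjacency u v ≡ 0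
        zero-term v with lookup D v in eq
        ... | false = 0∸n≡0 (adjacency u v)
        ... | true  = cong (1 ∸_) (adjacency⁺ (adj (lookup⇒[]= v D eq)))

      black-F : ∀ {u} → u ∈ F → u ∈ B → missing′ u ≡ 0
      black-F {u} u∈ uB = zero? (missing′ u) (trans (sym (cong (λ b → if b then isZero (missing′ u) else lookup D u) ([]=⇒lookup uB)))
          (trans (sym (lookup-F u)) ([]=⇒lookup u∈)))
        where
        zero? : ∀ x → isZero x ≡ true → x ≡ 0
        zero? zero _ = refl

      lookup-W : ∀ {v} → v ∈ W → lookup B v ≡ false
      lookup-W {v} vW with lookup B v in eq
      ... | false = refl
      ... | true  = contradiction (lookup⇒[]= v B eq) (W⇒∉B vW)

      white-F : ∀ {v} → v ∈ F → v ∈ W → v ∈ D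
      white-F {v} v∈ vW = lookup⇒[]= v D (trans (sym (cong (λ b → if b then isZero (missing′ v) else lookup D v) (lookup-W vW)))
          (trans (sym (lookup-F v)) ([]=⇒lookup v∈)))

      biclique-F : Biclique G F
      biclique-F u∈ v∈ = let u∈F , uB = x∈p∩q⁻ F B u∈ ; v∈F , vW = x∈p∩q⁻ F W v∈ in full (black-F u∈F uB) (white-F v∈F vW)

      whites-F : wh G F ≡ wh G C
      whites-F = cong ∣_∣ (⊆-antisym (λ v∈ → let v∈F , vW = x∈p∩q⁻ F W v∈ in white-F v∈F vW)
        (λ {v} v∈ → let vW = p∩q⊆q C W v∈ in x∈p∩q⁺ (lookup⇒[]= v F (trans (lookup-F v)
          (trans (cong (λ b → if b then isZero (missing′ v) else lookup D v) (lookup-W vW)) ([]=⇒lookup v∈))) , vW)))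

      blacks-F : bl C ≤ bl F
      blacks-F = p⊆q⇒∣p∣≤∣q∣ λ {u} u∈ → let u∈C , uB = x∈p∩q⁻ C B u∈ in
        x∈p∩q⁺ (lookup⇒[]= u F (trans (lookup-F u)
          (trans (cong (λ b → if b then isZero (missing′ u) else lookup D u) ([]=⇒lookup uB))
            (cong isZero (complete (λ v∈ → bc u∈ v∈))))) , uB)

      candidate : (∀ v → h (record# (toℕ v) + 1) ≡ bl ⁅ v ⁆) → ∀ v → Candidate {n} {H} h (toℕ v) (lookup B v) (lookup F v)
      candidate colours v = record
        { colour  = trans (colours v) (bl-singleton v)
        ; ifBlack = λ eq → trans (bit-isZero (missing′ v)) (cong bit (sym (trans (lookup-F v) (cong (λ b → if b then isZero (missing′ v) else lookup D v) eq))))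
        ; ifWhite = λ eq → trans (flag v) (cong bit (sym (trans (lookup-F v) (cong (λ b → if b then isZero (missing′ v) else lookup D v) eq)))) }

    finishCost : ℕ → ℕ
    finishCost b = (b + 1) * suc (n * 1 + (b + 0)) + (n * 1 + (0 + (n * suc (n * 1) + 0)))

    runs-finish : ∀ {X H w} {ρ : Vec ℕ Γ} → Stored H (heap w) X → set X ≡ ⊤ˢ → Static G H (heap w) → Fresh H w →
      Runs (finish O) (ptr X ∷ H ∷ n ∷ ρ) w (finishCost (bl (set X)))
        (λ _ w′ → ∃ λ C → Goal G C × out w′ ≡ out w ++ₗ encodeSet C)
    runs-finish {Γ} {X} {H} {w} {ρ} (stored item cells) ⊤≡ st fresh₀ =
      runs-bind (runs-call (chooseFrom _ _ _ (ItemCells.table≡ c) (ItemCells.black≡ c) (kept-now (Static.powers st) n ≤-refl)))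
      λ { (s ∷ low′ ∷ []) _ (refl , ch) → afterChoice s low′ ch (Chosen.best ch z≤n) }
      where
      kept-now : ∀ {P} → Kept H (heap w) P → P (heap w)
      kept-now = now
      c = now cells
      b = bl (set X)
      E : ℕ → ℕ → ℕ → Set
      E c q r = ∃ λ C → Biclique G C × c ≤ bl C × q ≡ wh G C × r ≡ low C × wt C ≡ entry X c
      σ = ptr X ∷ H ∷ n ∷ ρ
      chooseFrom : ∀ t b′ P → t ≡ table X → b′ ≡ b → P ≡ 2 ^ n →
        Runs (choose O) (t ∷ b′ ∷ n ∷ P ∷ σ) w ((b + 1) * suc (n * 1 + (b + 0)))
          (λ { (s ∷ low′ ∷ []) w′ → w′ ≡ w × Chosen E 0 b s low′ })
      chooseFrom _ _ _ refl refl refl = runs-weaken ≤-refl (λ { (_ ∷ _ ∷ []) _ r → r }) (runs-choose E (ItemCells.entry≡ c)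
        (λ c c≤ → let C , _ , bc , c≤C , eq = IsItem.sound item c c≤ in wh G C , low C , C , bc , c≤C , refl , refl , eq)
        (λ { _ (C , _ , _ , refl , refl , eq) → trans (sym eq) (wt≡ C) , ∣p∣≤n (C ∩ W) , low< C }))
      -- D weighs at most the entry at `bl D`, so the biclique behind that entry has at least as
      -- many white vertices, and f is monotone in them.
      optimal : ∀ {s low′} → Chosen E 0 b s low′ → ∀ D → Biclique G D → f (bl D) (wh G D) ≤ s
      optimal ch D bcD =
        let D⊆ : D ⊆ set X
            D⊆ = subst (D ⊆_) (sym ⊤≡) ⊆⊤
            q , r , (C , _ , _ , q≡ , _ , eq) , le = Chosen.upper ch (bl D) z≤n (bl-mono D⊆)
        in ≤-trans (f-mono (bl D) (≤-trans (whites≤ D C (≤-trans (IsItem.complete item D D⊆ bcD) (≤-reflexive (sym eq))))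
             (≤-reflexive (sym q≡)))) le
      Result : Post 0
      Result _ w′ = ∃ λ C → Goal G C × out w′ ≡ out w ++ₗ encodeSet C
      afterChoice : ∀ s low′ → Chosen E 0 b s low′ → (∃₂ λ c q → c ≤ b × E c q low′ × s ≡ f c q) →
        Runs (finishRest O) (s ∷ low′ ∷ σ) w (n * 1 + (0 + (n * suc (n * 1) + 0))) Result
      afterChoice s _ ch (c , _ , c≤b , (C , bc , c≤C , refl , refl , eq) , s≡) =
        runs-bind (runs-call (runs-bits (Static.powers st) ≤-refl fresh₀)) λ { (_ ∷ []) w₁ (g , digits) →
        runs-bind (runs-call (runs-limit s n)) λ { _ _ (refl , refl) →
        runs-call (runs-bind (runs-loop (printLoop {n} {H} (heap w₁) B (F g digits) (candidates g digits)))
          λ { xs w₂ refl → runs-return (trim B (F g digits) lim lim , solution g digits , cong (_++ₗ _) (out≡ g)) }) }}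
        where
        lim = bound s n
        module Cm {w₁} (g : Grow H w (H + n) w₁) (digits : Digits (low C) n H (heap w₁)) =
          Completion C bc {H} {heap w₁} digits (kept-in g (Static.edges st))
        F : ∀ {w₁} → Grow H w (H + n) w₁ → Digits (low C) n H (heap w₁) → Subset n
        F g digits = Cm.F g digits
        candidates : ∀ {w₁} (g : Grow H w (H + n) w₁) (digits : Digits (low C) n H (heap w₁)) v →
                     Candidate {n} {H} (heap w₁) (toℕ v) (lookup B v) (lookup (F g digits) v)
        candidates g digits = Cm.candidate g digits λ v → ItemCells.black≡ (kept-in g (Stored.cells (Static.single st v)))
        solution : ∀ {w₁} (g : Grow H w (H + n) w₁) (digits : Digits (low C) n H (heap w₁)) → Goal G (trim B (F g digits) lim lim)
        solution g digits = goal G (trim B (F g digits) lim lim)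
          (biclique-⊆ (trim-⊆ B (F g digits) lim lim) (Cm.biclique-F g digits))
          (≤-trans c≤C (Cm.blacks-F g digits)) (∣p∣≤n (F g digits ∩ B)) (∣p∣≤n (C ∩ W)) (sym s≡)
          (trim-black B (F g digits) lim lim)
          (trans (trim-white B (F g digits) lim lim) (cong (_⊓ lim) (Cm.whites-F g digits)))
          (optimal ch)

-- The whole program and its running time

arities-bounded : ∀ {n} (T : Tree n) k → bimodularwidth T ≤ k → All (_≤ k) (primeArities T)
arities-bounded T k le with primeArities T
... | []     = []
... | a ∷ as = go a as le
  where
  go : ∀ a as → foldr _⊔_ a as ≤ k → All (_≤ k) (a ∷ as)
  go a []       le = le ∷ []
  go a (b ∷ as) le with a≤ ∷ as≤ ← go a as (≤-trans (m≤n⊔m b _) le) = a≤ ∷ ≤-trans (m≤m⊔n b (foldr _⊔_ a as)) le ∷ as≤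

factor : ℕ → ℕ
factor k = 2 * nodeFactor k + 1

module Correctness {O : Objective} {Goal : ∀ {n} → BipartiteGraph n → Subset n → Set} (correct : Correct O Goal)
                   (k : ℕ) {n : ℕ} (G : BipartiteGraph n) (twinFree : TwinFree G) where
  open BipartiteGraph G
  open Weighted G
  open Decompositions G twinFree
  open Evaluation G twinFree k

  shape : ∀ {S t} → CanonicalTreeOf G S t → Branching t × leafCount t ≡ ∣ S ∣
  shapes : ∀ {Vs ts} → Pointwise (CanonicalTreeOf G) Vs ts → BranchingAll ts × leafCountAll ts ≡ total (map ∣_∣ Vs)
  shape (leaf v) = leaf , sym (∣⁅x⁆∣≡1 v)
  shape (node {ℓ = ℓ} dec pw) with bs , eq ← shapes pw =
    node (≤-trans (length≥2 ℓ dec) (≤-reflexive (Pointwise-length pw))) bs ,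
    trans eq (trans (sym (size-⋃ (IsPartition.disjoint (partition ℓ dec)))) (cong ∣_∣ (IsPartition.covers (partition ℓ dec))))
  shapes [] = [] , refl
  shapes (c ∷ pw) with b , eq ← shape c | bs , eqs ← shapes pw = b ∷ bs , cong₂ _+_ eq eqs

  wt-singleton : ∀ v → wt ⁅ v ⁆ ≡ (if lookup B v then 0 else 2 ^ n + 2 ^ toℕ v)
  wt-singleton v = go weight B v
    where
    zero-μ : ∀ {m} (f : Fin m → ℕ) B → μ f (∅ ∩ B) ≡ 0
    zero-μ f B = μ-empty f _ λ { (v , v∈) → ∉⊥ (p∩q⊆p _ B v∈) }
    go : ∀ {m} (f : Fin m → ℕ) (B : Subset m) v → μ f (⁅ v ⁆ ∩ ∁ B) ≡ (if lookup B v then 0 else f v)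
    go f (true ∷ B)  zero    = zero-μ (f ∘ suc) (∁ B)
    go f (false ∷ B) zero    = trans (cong (f zero +_) (zero-μ (f ∘ suc) (∁ B))) (+-identityʳ (f zero))
    go f (b ∷ B)     (suc v) = go (f ∘ suc) B v

  record Loaded (h : Heap) : Set where
    field
      records : ∀ v → RecordCells (2 ^ n) (record# (toℕ v)) (toℕ v) (lookup B v) (record# (n + 1) + toℕ v * n) h
      power   : h (record# n + 7) ≡ 2 ^ n
      matrix  : ∀ u v → h (record# (n + 1) + toℕ u * n + toℕ v) ≡ bit (lookup (N u) v)

  loaded⇒static : ∀ {H h} → Kept H h Loaded → Static G H h
  loaded⇒static {H} {h} l = record
    { powers = kept-map powers l
    ; edges  = kept-map (λ {h} l u v → trans (cong (λ z → h (z + toℕ v)) (RecordCells.field₈ (Loaded.records l u))) (Loaded.matrix l u v)) l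
    ; single = λ v → stored (isItem-leaf G v) (kept-map (cells v) l) }
    where
    powers : ∀ {h} → Loaded h → Powers n h
    powers {h} l i i≤n with m≤n⇒m<n∨m≡n i≤n
    ... | inj₂ refl = Loaded.power l
    ... | inj₁ i<n  = subst (λ i → h (record# i + 7) ≡ 2 ^ i) (toℕ-fromℕ< i<n) (RecordCells.field₇ (Loaded.records l (fromℕ< i<n)))
    cells : ∀ v {h} → Loaded h → ItemCells (leafItem G v) h
    cells v {h} l = record
      { size≡  = trans field₀ (sym (∣⁅x⁆∣≡1 v))
      ; black≡ = trans field₁ (sym (bl-singleton correct G v))
      ; repB≡  = field₂
      ; repW≡  = field₃
      ; table≡ = field₄
      ; entry≡ = entries }
      where
      open RecordCells (Loaded.records l v)
      p = record# (toℕ v)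
      entries : Entries (entry (leafItem G v)) (p + 5) (bl ⁅ v ⁆) h
      entries zero          _  = trans (cong h (+-identityʳ (p + 5))) (trans field₅ (sym (wt-singleton v)))
      entries (suc zero)    _  = trans (cong h (+-assoc p 5 1)) field₆
      entries (suc (suc i)) le = contradiction (≤-trans le (≤-trans (∣p∩q∣≤∣p∣ ⁅ v ⁆ B) (≤-reflexive (∣⁅x⁆∣≡1 v)))) λ { (s≤s ()) }

  row-start : 16 + n * 16 + 16 ≡ record# (n + 1)
  row-start = trans (lemma n) (record#≡ (n + 1))
    where
    lemma : ∀ n → 16 + n * 16 + 16 ≡ 16 + (n + 1) * 16
    lemma = solve-∀

  loaded : ∀ {h} → Records (2 ^ n) n 16 0 (record# (n + 1)) B h → h (record# n + 7) ≡ 2 ^ n →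
           (∀ u v → h (record# (n + 1) + toℕ u * n + toℕ v) ≡ bit (lookup (N u) v)) → Loaded h
  loaded {h} r pow matrix = record
    { records = λ v → subst (λ z → RecordCells (2 ^ n) z (toℕ v) (lookup B v) (record# (n + 1) + toℕ v * n) h)
                  (record#≡ (toℕ v)) (records-lookup B r v)
    ; power = pow ; matrix = matrix }

  module _ {T : Tree n} (canonical : CanonicalTree G T) (arity : bimodularwidth T ≤ k) where

    branching : Branching T
    branching = proj₁ (shape canonical)

    leaves : leafCount T ≡ n
    leaves = trans (proj₂ (shape canonical)) (∣⊤∣≡n n)

    closed : Closed ⊤ˢ
    closed = inj₁ λ v∉ → contradiction ∈⊤ v∉

    matrixInput treeInput : List ℕ
    treeInput   = encodeTree T ++ₗ []
    matrixInput = concatMap (λ v → encodeBits (N v)) (allFin n) ++ₗ treeInput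

    Result : Post 0
    Result _ w = ∃ λ C → Goal G C × out w ≡ encodeSet C

    c₁ c₂ c₃ c₄ c₅ : ℕ
    c₁ = n * 1 + n * 1
    c₂ = n * suc (n * 1)
    c₃ = n + n
    c₄ = K * (n * n) + 0
    c₅ = finishCost correct G (bl ⊤ˢ)

    runs-evaluateTree : ∀ {lv tok H w} {σ : Vec ℕ 6} → Static G H (heap w) → Fresh H w → out w ≡ [] →
      TokensAt H (heap w) tok (revTokens T ++ₗ []) →
      Runs (evaluateTree O) (lv ∷ length (revTokens T) ∷ tok ∷ H ∷ (σ ++ n ∷ [])) w (c₄ + c₅) Result
    runs-evaluateTree {lv} {tok} {H} {w} {a ∷ b ∷ c ∷ d ∷ e ∷ f ∷ []} st fr out≡[] tokens = runs-bind
      (runs-loop (subst₂ (λ i s → LoopRuns tokenStep σ i (tok ∷ 0 ∷ H ∷ []) w (K * (s * s) + 0) (AfterNode ⊤ˢ [] [] H w))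
        (cong length (++ₗ-identityʳ (revTokens T))) (∣⊤∣≡n n)
        (process canonical closed (arities-bounded T k arity) st [] fr tokens
          λ { {tok′} {stk′} {H′} {w′} after → loopRuns-zero after })))
      λ { (tok′ ∷ stk′ ∷ H′ ∷ []) w′ (g , (V , V≡ , push kk s _) , _) →
          finished tok′ stk′ H′ w′ g V V≡ (proj₁ (now kk)) s }
      where
      σ = lv ∷ length (revTokens T) ∷ tok ∷ H ∷ a ∷ b ∷ c ∷ d ∷ e ∷ f ∷ n ∷ []
      finished : ∀ tok′ stk′ H′ w′ → Grow H w H′ w′ → ∀ V → set V ≡ ⊤ˢ → heap w′ stk′ ≡ ptr V → Stored H′ (heap w′) V →
        Runs (call (! v1 ∷ v2 ∷ var (# 13) ∷ []) (finish O)) (tok′ ∷ stk′ ∷ H′ ∷ σ) w′ c₅ Result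
      finished tok′ stk′ H′ w′ g V V≡ ptr≡ s = runs-call (runs-weaken
        (≤-reflexive (cong (λ S → finishCost correct G (bl S)) V≡))
        (λ { _ w″ (C , goal , out≡) → C , goal , trans out≡ (cong (_++ₗ encodeSet C) (trans (Grow.out≡ g) out≡[])) })
        (subst (λ z → Runs (finish O) (z ∷ H′ ∷ n ∷ tok′ ∷ stk′ ∷ H′ ∷ σ) w′ _ _) (sym ptr≡)
          (runs-finish correct G s V≡ (static-grow G g st) (fresh g))))

    runs-loadTree : ∀ {H h} {σ : Vec ℕ 5} → Static G H h → Fresh H (world h [] []) →
      Runs (loadTree O) (H ∷ (σ ++ n ∷ [])) (world h treeInput []) (c₃ + (c₄ + c₅)) Result
    runs-loadTree {H} {h} {a ∷ b ∷ c ∷ d ∷ e ∷ []} st f = runs-bind (runs-call (runs-readTokens branching leaves f))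
      λ { (_ ∷ _ ∷ tok ∷ H′ ∷ []) w′ (refl , refl , g , tokens) →
          runs-evaluateTree {σ = H ∷ a ∷ b ∷ c ∷ d ∷ e ∷ []} (static-grow G {w = world h [] []} g st) (fresh g) (out≡ g) tokens }

    runs-loadMatrix : ∀ {a d e p} h₁ → p ≡ 16 + n * 16 → Fresh p (world h₁ matrixInput []) →
      Kept p h₁ (Records (2 ^ n) n 16 0 (record# (n + 1)) B) →
      Runs (loadMatrix O) (a ∷ p ∷ 2 ^ n ∷ d ∷ e ∷ n ∷ []) (world h₁ matrixInput []) (c₂ + (c₃ + (c₄ + c₅))) Result
    runs-loadMatrix {a} {d} {e} {p} h₁ p≡ f records = runs-poke (runs-bind (runs-call
        (runs-loop (subst (λ i → LoopRuns (loop v3 (v0 ∷ []) readNumber) (p + 16 ∷ n ∷ σ) i (p + 16 ∷ []) (world h₂ matrixInput [])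
             (i * suc (n * 1)) (RowsRead N (p + 16) (allFin n) (world h₂ treeInput []))) (length-tabulate id)
          (readRows N (allFin n) {p + 16} {p + 16} {h₂} {treeInput} {[]} {σ} (fresh g₂)))))
      λ { (H ∷ []) (world h₃ _ _) (grow refl refl H≤ b f₃ , rows) → runs-loadTree {σ = a ∷ p ∷ 2 ^ n ∷ d ∷ e ∷ []}
          (loaded⇒static (kept λ e → inMemory (at (kept-grow {w′ = world h₃ treeInput []} (grow refl refl H≤ b f₃) kept₂) e) (at rows e))) f₃ })
      where
      σ = a ∷ p ∷ 2 ^ n ∷ d ∷ e ∷ n ∷ []
      -- Record n belongs to no vertex and exists to hold the last power 2 ^ n.
      h₂ = h₁ [ p + 7 ≔ 2 ^ n ]
      g₂ : Grow p (world h₁ treeInput []) (p + 16) (world h₂ treeInput [])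
      g₂ = grow-poke (m≤m+n p 7) (+-monoʳ-< p (m≤m+n 8 _)) (grow-refl f (m≤m+n p 16))
      Before : Heap → Set
      Before h = Records (2 ^ n) n 16 0 (record# (n + 1)) B h × h (p + 7) ≡ 2 ^ n
      kept₂ : Kept (p + 16) h₂ Before
      kept₂ = kept λ e → at (kept-grow g₂ records) e , trans (e (+-monoʳ-< p (m≤m+n 8 _))) (update-same h₁ (p + 7) (2 ^ n))
      inMemory : ∀ {h} → Before h → Rows N (p + 16) (allFin n) h → Loaded h
      inMemory {h} (r , pow) rows = loaded {h} r (subst (λ z → h (z + 7) ≡ 2 ^ n) (trans p≡ (record#≡ n)) pow)
        (λ u v → subst (λ z → h (z + toℕ u * n + toℕ v) ≡ bit (lookup (N u) v)) (trans (cong (_+ 16) p≡) row-start)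
                   (rows-tabulate N {H = p + 16} id rows u v))

    runs-main : Runs (main O) [] (world (λ _ → 0) (encodeGraph G ++ₗ encodeTree T) []) (c₁ + (c₂ + (c₃ + (c₄ + c₅)))) Result
    runs-main = subst (λ is → Runs (main O) [] (world (λ _ → 0) (n ∷ is) []) (c₁ + (c₂ + (c₃ + (c₄ + c₅)))) Result) (sym inputs)
      (runs-input (runs-bind (runs-call (runs-readVertices B {rest = matrixInput} (λ _ → refl)))
        λ { (_ ∷ p ∷ pw ∷ _ ∷ _ ∷ []) (world h₁ _ _) (p≡ , refl , grow refl refl H≤ b f , records) →
            runs-loadMatrix h₁ p≡ f records }))
      where
      inputs : (encodeSet B ++ₗ concatMap (λ v → encodeSet (N v)) (allFin n)) ++ₗ encodeTree T ≡ encodeBits B ++ₗ matrixInput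
      inputs = trans (++ₗ-assoc (encodeSet B) _ (encodeTree T))
        (cong (λ z → encodeBits B ++ₗ concatMap (λ v → encodeBits (N v)) (allFin n) ++ₗ z) (sym (++ₗ-identityʳ (encodeTree T))))

    n≥1 : 1 ≤ n
    n≥1 = ≤-trans (leafCount>0 {n} branching) (≤-reflexive leaves)

    -- All phases but the evaluation of the tree add up to 1 + 10 n + 4 n². Since n is positive,
    -- this is at most 15 n².
    bounded : c₁ + (c₂ + (c₃ + (c₄ + c₅))) ≤ (15 + K) * (n * n)
    bounded = begin
      c₁ + (c₂ + (c₃ + (c₄ + c₅)))
        ≤⟨ +-monoʳ-≤ c₁ (+-monoʳ-≤ c₂ (+-monoʳ-≤ c₃ (+-monoʳ-≤ c₄
             (+-monoˡ-≤ _ (*-mono-≤ (+-monoˡ-≤ 1 b≤n) (s≤s (+-monoʳ-≤ (n * 1) (+-monoˡ-≤ 0 b≤n)))))))) ⟩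
      c₁ + (c₂ + (c₃ + (c₄ + finishCost correct G n)))
        ≡⟨ first n K ⟩
      1 + 10 * n + (4 * n * n + K * (n * n))
        ≤⟨ +-monoˡ-≤ _ (+-mono-≤ (*-mono-≤ n≥1 n≥1) (≤-trans (*-monoʳ-≤ 10 (≤-trans (≤-reflexive (sym (*-identityʳ n))) (*-monoʳ-≤ n n≥1))) ≤-refl)) ⟩
      n * n + 10 * (n * n) + (4 * n * n + K * (n * n))
        ≡⟨ last n K ⟩
      (15 + K) * (n * n) ∎
      where
      open ≤-Reasoning
      b≤n : bl ⊤ˢ ≤ n
      b≤n = ∣p∣≤n (⊤ˢ ∩ B)
      first : ∀ n K → (n * 1 + n * 1) + (n * suc (n * 1) + ((n + n) + ((K * (n * n) + 0) +
              ((n + 1) * suc (n * 1 + (n + 0)) + (n * 1 + (0 + (n * suc (n * 1) + 0))))))) ≡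
              1 + 10 * n + (4 * n * n + K * (n * n))
      first = solve-∀
      last : ∀ n K → n * n + 10 * (n * n) + (4 * n * n + K * (n * n)) ≡ (15 + K) * (n * n)
      last = solve-∀

quadratic : ∀ s F {n τ} → 1 ≤ n → τ ≤ (15 + F) * (n * n) → s * suc τ ≤ s * (16 + F) * n ^ 2
quadratic s F {n} {τ} 1≤n le = begin
  s * suc τ ≤⟨ *-monoʳ-≤ s (+-mono-≤ (*-mono-≤ 1≤n 1≤n) le) ⟩
  s * (n * n + (15 + F) * (n * n)) ≡⟨ *-assoc s (16 + F) (n * n) ⟨
  s * (16 + F) * (n * n) ≡⟨ cong (λ z → s * (16 + F) * (n * z)) (*-identityʳ n) ⟨
  s * (16 + F) * n ^ 2 ∎
  where open ≤-Reasoning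

package : ∀ {n P is b b′} {Q : Subset n → Set} → b ≤ b′ →
          (∃ λ os → (∃ λ C → Q C × os ≡ encodeSet C) × Computes P from is to os within b) →
          ∃ λ C → Q C × (Computes P from is to encodeSet C within b′)
package b≤b′ (_ , (C , q , refl) , t , t≤b , halts) = C , q , t , ≤-trans t≤b b≤b′ , halts

computable : ∀ {O : Objective} {Goal : ∀ {n} → BipartiteGraph n → Subset n → Set} → Correct O Goal →
             ∀ k → ComputableInQuadraticTime k Goal
computable {O} {Goal} correct k = code 0 (main O) , size (main O) * (16 + factor k) ,
  λ G T twinFree canonical arity → let open Correctness correct k G twinFree in
    package (quadratic (size (main O)) (factor k) (n≥1 canonical arity) (bounded canonical arity))
      (runs-computes (runs-main canonical arity))

-- The three objectives

vertexObjective edgeObjective balancedObjective : Objective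
vertexObjective = record
  { score = return ((v0 ⊕ v1) ∷ [])
  ; limit = return (v1 ∷ []) }
edgeObjective = record
  -- The product is computed by adding the number of white vertices once for each black one, as the
  -- machine cannot multiply.
  { score = loop v0 (lit 0 ∷ []) (return ((v0 ⊕ v3) ∷ []))
  ; limit = return (v1 ∷ []) }
balancedObjective = record
  { score = return ((v1 ⊖ (v1 ⊖ v0)) ∷ [])
  ; limit = return (v0 ∷ []) }

vertex-correct : Correct vertexObjective IsVertexMaximumBiclique
vertex-correct = record
  { f = _+_
  ; bound = λ s n → n
  ; f-mono = λ b → +-monoʳ-≤ b
  ; runs-score = λ b w → runs-weaken z≤n (λ _ _ r → r) (runs-return (refl , refl))
  ; runs-limit = λ s n → runs-return (refl , refl)
  ; goal = λ G C bc c≤b b≤n w≤n s≡ b≡ w≡ opt → bc , λ D bcD → ≤-trans (opt D bcD) (≤-trans (≤-reflexive (sym s≡))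
      (≤-trans (+-monoˡ-≤ _ c≤b) (≤-reflexive (sym (cong₂ _+_ (trans b≡ (m≤n⇒m⊓n≡m b≤n)) (trans w≡ (m≤n⇒m⊓n≡m w≤n))))))) }

edge-correct : Correct edgeObjective IsEdgeMaximumBiclique
edge-correct = record
  { f = _*_
  ; bound = λ s n → n
  ; f-mono = λ b → *-monoʳ-≤ b
  ; runs-score = score-runs
  ; runs-limit = λ s n → runs-return (refl , refl)
  ; goal = λ G C bc c≤b b≤n w≤n s≡ b≡ w≡ opt → bc , λ D bcD → ≤-trans (opt D bcD) (≤-trans (≤-reflexive (sym s≡))
      (≤-trans (*-monoˡ-≤ _ c≤b) (≤-reflexive (sym (cong₂ _*_ (trans b≡ (m≤n⇒m⊓n≡m b≤n)) (trans w≡ (m≤n⇒m⊓n≡m w≤n))))))) }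
  where
  score-runs : ∀ {Γ} b w {w₀} {ρ : Vec ℕ Γ} → Runs (Objective.score edgeObjective) (b ∷ w ∷ ρ) w₀ b
    (λ xs w₁ → xs ≡ b * w ∷ [] × w₁ ≡ w₀)
  score-runs b w {w₀} = runs-weaken (≤-reflexive (*-identityʳ b))
    (λ { (x ∷ []) _ (eq , refl) → cong (_∷ []) (trans (sym (+-identityʳ x)) eq) , refl })
    (runs-loop-inv Inv (refl , refl) λ { i (x ∷ []) _ (eq , refl) → runs-return (trans (+-assoc x w (i * w)) eq , refl) })
    where
    Inv : ℕ → Post 1
    Inv i (x ∷ []) w₁ = x + i * w ≡ b * w × w₁ ≡ w₀

-- The score is the minimum of the two numbers. Cutting both colours down to the maximal score s
-- yields a balanced biclique, and each balanced biclique has its own half size as score.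
balanced-correct : Correct balancedObjective IsMaximumBalancedBiclique
balanced-correct = record
  { f = λ b w → w ∸ (w ∸ b)
  ; bound = λ s n → s
  ; f-mono = λ b {w} {w′} le → subst₂ _≤_ (sym (minimum w b)) (sym (minimum w′ b)) (⊓-monoˡ-≤ b le)
  ; runs-score = λ b w → runs-weaken z≤n (λ _ _ r → r) (runs-return (refl , refl))
  ; runs-limit = λ s n → runs-return (refl , refl)
  ; goal = goal }
  where
  minimum : ∀ w b → w ∸ (w ∸ b) ≡ w ⊓ b
  minimum w b with ≤-total b w
  ... | inj₁ b≤w = trans (m∸[m∸n]≡n b≤w) (sym (m≥n⇒m⊓n≡n b≤w))
  ... | inj₂ w≤b = trans (cong (w ∸_) (m≤n⇒m∸n≡0 w≤b)) (sym (m≤n⇒m⊓n≡m w≤b))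
  goal : ∀ {n} (G : BipartiteGraph n) C {s c b w} → Biclique G C → c ≤ b → b ≤ n → w ≤ n → w ∸ (w ∸ c) ≡ s →
         Weighted.bl G C ≡ b ⊓ s → wh G C ≡ w ⊓ s →
         (∀ D → Biclique G D → wh G D ∸ (wh G D ∸ Weighted.bl G D) ≤ s) → IsMaximumBalancedBiclique G C
  goal {n} G C {s} {c} {b} {w} bc c≤b _ _ s≡ b≡ w≡ opt = (bc , trans bl≡s (sym wh≡s)) , λ D (bcD , eq) →
    subst₂ _≤_ (sym (size≡ D)) (sym (size≡ C)) (+-mono-≤
      (subst (_≤ bl C) (sym eq) (≤-trans (half D eq bcD) (≤-reflexive (sym bl≡s))))
      (≤-trans (half D eq bcD) (≤-reflexive (sym wh≡s))))
    where
    open BipartiteGraph G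
    open Weighted G
    s≡′ : w ⊓ c ≡ s
    s≡′ = trans (sym (minimum w c)) s≡
    bl≡s : bl C ≡ s
    bl≡s = trans b≡ (m≥n⇒m⊓n≡n (≤-trans (≤-reflexive (sym s≡′)) (≤-trans (m⊓n≤n w c) c≤b)))
    wh≡s : wh G C ≡ s
    wh≡s = trans w≡ (m≥n⇒m⊓n≡n (≤-trans (≤-reflexive (sym s≡′)) (m⊓n≤m w c)))
    half : ∀ D → bl D ≡ wh G D → Biclique G D → wh G D ≤ s
    half D eq bcD = ≤-trans (≤-reflexive (sym (trans (cong (λ z → wh G D ∸ (wh G D ∸ z)) eq)
      (cong (wh G D ∸_) (n∸n≡0 (wh G D)))))) (opt D bcD)
    size≡ : ∀ D → ∣ D ∣ ≡ bl D + wh G D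
    size≡ D = ∣∣-sum record
      { split = λ {v} v∈ → [ (λ vB → inj₁ (x∈p∩q⁺ (v∈ , vB))) , (λ vW → inj₂ (x∈p∩q⁺ (v∈ , vW))) ]′ (colour v)
      ; left  = p∩q⊆p D B
      ; right = p∩q⊆p D W
      ; disjoint = λ v∈B v∈W → W⇒∉B (p∩q⊆q D W v∈W) (p∩q⊆q D B v∈B) }
      where
      colour : ∀ v → v ∈ B ⊎ v ∈ W
      colour v with v ∈? B
      ... | yes vB = inj₁ vB
      ... | no v∉B = inj₂ (∉B⇒W v∉B)

corollary2 : (k : ℕ) →
    ComputableInQuadraticTime k IsVertexMaximumBiclique ×
    ComputableInQuadraticTime k IsEdgeMaximumBiclique ×
    ComputableInQuadraticTime k IsMaximumBalancedBiclique
corollary2 k = computable vertex-correct k , computable edge-correct k , computable balanced-correct k
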